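{- Let $k$ be a positive integer and let $f:\mathbb{Z}_{\ge 1}\to\mathbb{C}$ be a multiplicative function such that $f(p)=k$ for every prime $p$, and $f(p^{\alpha})=\alpha^{O(1)}$ for all primes $p$ and all integers $\alpha\ge 2$, with the constant implied by the $O$ uniform in $p$; that is, there is a constant $K>0$, independent of $p$ and $\alpha$, such that $|f(p^{\alpha})|\le \alpha^{K}$ for all primes $p$ and all integers $\alpha\ge 2$. Then, for real $x\ge 2$, $$ \sum_{n\le x} f(n)=C_{f}\, x(\log x)^{k-1}+O\big(x(\log x)^{k-2}\big), $$ where $$ C_{f}=\frac{1}{(k-1)!}\prod_{p}\left(\left(1-\frac{1}{p}\right)^{k}\sum_{\alpha\ge 0}\frac{f(p^{\alpha})}{p^{\alpha}}\right), $$ the product being over all primes $p$. The implied constant in the conclusion may depend on $f$ (and hence on $k$) but not on $x$.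
   Context: A function $f$ on the positive integers is multiplicative if $f(1)=1$ and $f(mn)=f(m)f(n)$ whenever $\gcd(m,n)=1$. Sums over $n\le x$ are over positive integers $n\le x$. -}

module Defs where

open import Data.Nat as ℕ using (ℕ; zero; suc)
import Data.Nat.Properties as ℕₚ
open import Data.Nat.Properties using (_!≢0)
open import Data.Nat.Coprimality using (Coprime)
open import Data.Nat.Primality using (Prime; prime?; prime⇒nonZero)
open import Data.Integer as ℤ using (ℤ; +_; -[1+_])
import Data.Integer.Properties as ℤₚ
open import Data.Rational as ℚ using (ℚ; 0ℚ; 1ℚ; ½) hiding (module ℚ)
import Data.Rational.Properties as ℚₚ
import Data.Rational.Unnormalised as ℚᵘ
import Data.Rational.Unnormalised.Properties as ℚᵘₚ
open import Data.Rational.Solver using (module +-*-Solver)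
open import Data.Product using (Σ; ∃; _×_; _,_)
open import Data.Sum using (inj₁; inj₂)
open import Relation.Nullary using (yes; no)
open import Relation.Nullary.Negation using (contradiction)
open import Relation.Binary.PropositionalEquality
  using (_≡_; refl; sym; trans; cong; cong₂; subst)

module Rational-lemmas where
  open ℚ
  open ℚₚ
  open ≤-Reasoning

  half>0 : ∀ {ε} → 0ℚ < ε → 0ℚ < ε * ½
  half>0 {ε} ε>0 = positive⁻¹ (ε * ½) {{pos*pos⇒pos ε {{positive ε>0}} ½}}

  halves : ∀ ε → ε * ½ + ε * ½ ≡ ε
  halves ε = trans (sym (*-distribˡ-+ ε ½ ½)) (*-identityʳ ε)

  split : ∀ {ε p q} → p ≤ ε * ½ → q ≤ ε * ½ → p + q ≤ ε
  split {ε} p≤ q≤ = subst (_ ≤_) (halves ε) (+-mono-≤ p≤ q≤)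

  *-mono-≤₀ : ∀ {p q r s} → 0ℚ ≤ p → 0ℚ ≤ s → p ≤ q → r ≤ s → p * r ≤ q * s
  *-mono-≤₀ {p} {q} {r} {s} 0≤p 0≤s p≤q r≤s =
    ≤-trans (*-monoˡ-≤-nonNeg p {{nonNegative 0≤p}} r≤s)
            (*-monoʳ-≤-nonNeg s {{nonNegative 0≤s}} p≤q)

  0≤* : ∀ {p q} → 0ℚ ≤ p → 0ℚ ≤ q → 0ℚ ≤ p * q
  0≤* {p} {q} 0≤p 0≤q =
    nonNegative⁻¹ _ {{nonNeg*nonNeg⇒nonNeg p {{nonNegative 0≤p}} q {{nonNegative 0≤q}}}}

  0≤square : ∀ p → 0ℚ ≤ p * p
  0≤square p with ∣p∣≡p∨∣p∣≡-p p
  ... | inj₁ e = let 0≤p = subst (0ℚ ≤_) e (0≤∣p∣ p) in 0≤* 0≤p 0≤p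
  ... | inj₂ e = let 0≤-p = subst (0ℚ ≤_) e (0≤∣p∣ p) in
    subst (0ℚ ≤_) (+-*-Solver.solve 1 (λ x → (:- x) :* (:- x) := x :* x) refl p) (0≤* 0≤-p 0≤-p)
    where open +-*-Solver using (_:*_; :-_; _:=_)

  p≤∣p∣ : ∀ p → p ≤ ∣ p ∣
  p≤∣p∣ p with ∣p∣≡p∨∣p∣≡-p p
  ... | inj₁ e = ≤-reflexive (sym e)
  ... | inj₂ e = ≤-trans p≤0 (0≤∣p∣ p)
    where
    p≤0 : p ≤ 0ℚ
    p≤0 = subst (_≤ 0ℚ) (+-*-Solver.solve 1 (λ x → +-*-Solver.:-_ (+-*-Solver.:-_ x) +-*-Solver.:= x) refl p)
      (neg-antimono-≤ (subst (0ℚ ≤_) e (0≤∣p∣ p)))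

  ∣∣≤ : ∀ {p b} → p ≤ b → - p ≤ b → ∣ p ∣ ≤ b
  ∣∣≤ {p} p≤b -p≤b with ∣p∣≡p∨∣p∣≡-p p
  ... | inj₁ e = subst (_≤ _) (sym e) p≤b
  ... | inj₂ e = subst (_≤ _) (sym e) -p≤b

  ∣-∣-sym : ∀ p q → ∣ p - q ∣ ≡ ∣ q - p ∣
  ∣-∣-sym p q = trans (sym (∣-p∣≡∣p∣ (p - q))) (cong ∣_∣ (+-*-Solver.solve 2 (λ p q → :- (p :- q) := q :- p) refl p q))
    where open +-*-Solver using (_:-_; :-_; _:=_)

  ∣-∣≤ : ∀ {p q b} → p ≤ q + b → q ≤ p + b → ∣ p - q ∣ ≤ b
  ∣-∣≤ {p} {q} {b} h₁ h₂ = ∣∣≤ (shift h₁)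
    (subst (_≤ b) (+-*-Solver.solve 2 (λ p q → q :- p := :- (p :- q)) refl p q) (shift h₂))
    where
    open +-*-Solver using (_:+_; _:-_; :-_; _:=_)
    shift : ∀ {p q} → p ≤ q + b → p - q ≤ b
    shift {p} {q} h = subst (p - q ≤_)
      (+-*-Solver.solve 2 (λ q b → (q :+ b) :- q := b) refl q b) (+-monoˡ-≤ (- q) h)

  ≤-from-∣-∣ : ∀ {p q b} → ∣ p - q ∣ ≤ b → p ≤ q + b
  ≤-from-∣-∣ {p} {q} {b} h = begin
    p              ≡⟨ +-*-Solver.solve 2 (λ p q → p := q :+ (p :- q)) refl p q ⟩
    q + (p - q)    ≤⟨ +-monoʳ-≤ q (≤-trans (p≤∣p∣ (p - q)) h) ⟩
    q + b          ∎
    where open +-*-Solver using (_:+_; _:-_; _:=_)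

  ∣∣-lipschitz : ∀ p q → ∣ ∣ p ∣ - ∣ q ∣ ∣ ≤ ∣ p - q ∣
  ∣∣-lipschitz p q = ∣-∣≤ (half-lip p q)
    (subst (λ t → ∣ q ∣ ≤ ∣ p ∣ + t) (∣-∣-sym q p) (half-lip q p))
    where
    open +-*-Solver using (_:+_; _:-_; _:=_)
    half-lip : ∀ p q → ∣ p ∣ ≤ ∣ q ∣ + ∣ p - q ∣
    half-lip p q = ≤-trans
      (≤-reflexive (cong ∣_∣ (+-*-Solver.solve 2 (λ p q → p := q :+ (p :- q)) refl p q)))
      (∣p+q∣≤∣p∣+∣q∣ q (p - q))

  1≤⇒0< : ∀ {p} → 1ℚ ≤ p → 0ℚ < p
  1≤⇒0< = <-≤-trans (positive⁻¹ 1ℚ)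

  reciprocal : ∀ {p} → 0ℚ < p → ℚ
  reciprocal {p} p>0 = (1/ p) {{>-nonZero p>0}}

  reciprocal>0 : ∀ {p} (p>0 : 0ℚ < p) → 0ℚ < reciprocal p>0
  reciprocal>0 {p} p>0 = positive⁻¹ _ {{1/pos⇒pos p {{positive p>0}}}}

  *-reciprocal : ∀ {p} (p>0 : 0ℚ < p) → p * reciprocal p>0 ≡ 1ℚ
  *-reciprocal {p} p>0 = *-inverseʳ p {{>-nonZero p>0}}

  reciprocal-anti : ∀ {p q} (p>0 : 0ℚ < p) (q>0 : 0ℚ < q) → p ≤ q → reciprocal q>0 ≤ reciprocal p>0
  reciprocal-anti {p} {q} p>0 q>0 p≤q = begin
    Q            ≡⟨ sym (*-identityʳ Q) ⟩
    Q * 1ℚ       ≡⟨ cong (Q *_) (sym (*-reciprocal p>0)) ⟩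
    Q * (p * P)  ≤⟨ *-monoˡ-≤-nonNeg Q {{nonNegative (<⇒≤ (reciprocal>0 q>0))}}
                     (*-monoʳ-≤-nonNeg P {{nonNegative (<⇒≤ (reciprocal>0 p>0))}} p≤q) ⟩
    Q * (q * P)  ≡⟨ +-*-Solver.solve 3 (λ Q q P → Q :* (q :* P) := (q :* Q) :* P) refl Q q P ⟩
    (q * Q) * P  ≡⟨ cong (_* P) (*-reciprocal q>0) ⟩
    1ℚ * P       ≡⟨ *-identityˡ P ⟩
    P            ∎
    where
    open +-*-Solver using (_:*_; _:=_)
    P = reciprocal p>0
    Q = reciprocal q>0

open Rational-lemmas

-- Real numbers: Cauchy sequences of rationals up to the setoid equality
-- _≃_. Arithmetic is pointwise.

Cauchy : (ℕ → ℚ) → Set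
Cauchy s = ∀ ε → 0ℚ ℚ.< ε → ∃ λ N → ∀ m n → N ℕ.≤ m → N ℕ.≤ n → ℚ.∣ s m ℚ.- s n ∣ ℚ.≤ ε

record ℝ : Set where
  constructor mkℝ
  field
    seq    : ℕ → ℚ
    cauchy : Cauchy seq

open ℝ public

infix  4 _≃_ _≤_ _<_
infixl 6 _+_ _-_
infixl 7 _*_
infix  8 -_
infixr 9 _^_

_≃_ : ℝ → ℝ → Set
x ≃ y = ∀ ε → 0ℚ ℚ.< ε → ∃ λ N → ∀ n → N ℕ.≤ n → ℚ.∣ seq x n ℚ.- seq y n ∣ ℚ.≤ ε

_≤_ : ℝ → ℝ → Set
x ≤ y = ∀ ε → 0ℚ ℚ.< ε → ∃ λ N → ∀ n → N ℕ.≤ n → seq x n ℚ.≤ seq y n ℚ.+ ε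

_<_ : ℝ → ℝ → Set
x < y = ∃ λ ε → 0ℚ ℚ.< ε × ∃ λ N → ∀ n → N ℕ.≤ n → seq x n ℚ.+ ε ℚ.≤ seq y n

ℚ⇒ℝ : ℚ → ℝ
ℚ⇒ℝ q = mkℝ (λ _ → q) λ ε ε>0 → 0 , λ _ _ _ _ →
  subst (λ t → ℚ.∣ t ∣ ℚ.≤ ε) (sym (ℚₚ.+-inverseʳ q)) (ℚₚ.<⇒≤ ε>0)

ℕ⇒ℝ : ℕ → ℝ
ℕ⇒ℝ n = ℚ⇒ℝ (+ n ℚ./ 1)

0ℝ 1ℝ : ℝ
0ℝ = ℚ⇒ℝ 0ℚ
1ℝ = ℚ⇒ℝ 1ℚ

module Cauchy-lemmas where
  open ℚ using () renaming (_+_ to _+'_; _-_ to _-'_; _*_ to _*'_; -_ to -'_; _≤_ to _≤'_; _<_ to _<'_)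

  ⊔-left : ∀ {M N n} → M ℕ.⊔ N ℕ.≤ n → M ℕ.≤ n
  ⊔-left {M} {N} = ℕₚ.≤-trans (ℕₚ.m≤m⊔n M N)

  ⊔-right : ∀ {M N n} → M ℕ.⊔ N ℕ.≤ n → N ℕ.≤ n
  ⊔-right {M} {N} = ℕₚ.≤-trans (ℕₚ.m≤n⊔m M N)

  +-cauchy : ∀ {s t} → Cauchy s → Cauchy t → Cauchy (λ n → s n +' t n)
  +-cauchy {s} {t} cs ct ε ε>0 =
    let M , hs = cs (ε *' ½) (half>0 ε>0)
        N , ht = ct (ε *' ½) (half>0 ε>0)
    in M ℕ.⊔ N , λ m n m≥ n≥ → begin
      ℚ.∣ (s m +' t m) -' (s n +' t n) ∣
        ≡⟨ cong ℚ.∣_∣ (solve 4 (λ a b c d → (a :+ b) :- (c :+ d) := (a :- c) :+ (b :- d)) refl (s m) (t m) (s n) (t n)) ⟩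
      ℚ.∣ (s m -' s n) +' (t m -' t n) ∣
        ≤⟨ ℚₚ.∣p+q∣≤∣p∣+∣q∣ (s m -' s n) (t m -' t n) ⟩
      ℚ.∣ s m -' s n ∣ +' ℚ.∣ t m -' t n ∣
        ≤⟨ split (hs m n (⊔-left {M} {N} m≥) (⊔-left {M} {N} n≥)) (ht m n (⊔-right {M} {N} m≥) (⊔-right {M} {N} n≥)) ⟩
      ε ∎
    where
    open ℚₚ.≤-Reasoning
    open +-*-Solver

  neg-cauchy : ∀ {s} → Cauchy s → Cauchy (λ n → -' s n)
  neg-cauchy {s} cs ε ε>0 =
    let N , h = cs ε ε>0 in N , λ m n m≥ n≥ →
      subst (_≤' ε) (trans (∣-∣-sym (s m) (s n)) (cong ℚ.∣_∣
        (solve 2 (λ a b → b :- a := (:- a) :- (:- b)) refl (s m) (s n)))) (h m n m≥ n≥)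
    where open +-*-Solver

  eventually-bounded : ∀ {s} → Cauchy s → ∃ λ B → 1ℚ ≤' B × ∃ λ N → ∀ n → N ℕ.≤ n → ℚ.∣ s n ∣ ≤' B
  eventually-bounded {s} cs =
    let N , h = cs 1ℚ (ℚₚ.positive⁻¹ 1ℚ)
    in ℚ.∣ s N ∣ +' 1ℚ
     , subst (_≤' ℚ.∣ s N ∣ +' 1ℚ) (ℚₚ.+-identityˡ 1ℚ) (ℚₚ.+-monoˡ-≤ 1ℚ (ℚₚ.0≤∣p∣ (s N)))
     , N , λ n n≥ → ≤-from-∣-∣ (ℚₚ.≤-trans (∣∣-lipschitz (s n) (s N)) (h n N n≥ ℕₚ.≤-refl))

  pos* : ∀ {p q} → 0ℚ <' p → 0ℚ <' q → 0ℚ <' p *' q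
  pos* {p} {q} p>0 q>0 = ℚₚ.positive⁻¹ _ {{ℚₚ.pos*pos⇒pos p {{ℚ.positive p>0}} q {{ℚ.positive q>0}}}}

  cancel : ∀ {A} (A>0 : 0ℚ <' A) e → A *' (e *' reciprocal A>0) ≡ e
  cancel {A} A>0 e = trans
    (solve 3 (λ A e R → A :* (e :* R) := e :* (A :* R)) refl A e (reciprocal A>0))
    (trans (cong (e *'_) (*-reciprocal A>0)) (ℚₚ.*-identityʳ e))
    where open +-*-Solver

  product-estimate : ∀ {A B e} (A>0 : 0ℚ <' A) (B>0 : 0ℚ <' B) → 0ℚ <' e → ∀ a b c d →
    ℚ.∣ a ∣ ≤' A → ℚ.∣ d ∣ ≤' B →
    ℚ.∣ a -' c ∣ ≤' e *' reciprocal B>0 → ℚ.∣ b -' d ∣ ≤' e *' reciprocal A>0 →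
    ℚ.∣ a *' b -' c *' d ∣ ≤' e +' e
  product-estimate {A} {B} {e} A>0 B>0 e>0 a b c d a≤A d≤B ac bd = begin
    ℚ.∣ a *' b -' c *' d ∣
      ≡⟨ cong ℚ.∣_∣ (solve 4 (λ a b c d → a :* b :- c :* d := a :* (b :- d) :+ (a :- c) :* d) refl a b c d) ⟩
    ℚ.∣ a *' (b -' d) +' (a -' c) *' d ∣
      ≤⟨ ℚₚ.∣p+q∣≤∣p∣+∣q∣ (a *' (b -' d)) ((a -' c) *' d) ⟩
    ℚ.∣ a *' (b -' d) ∣ +' ℚ.∣ (a -' c) *' d ∣
      ≡⟨ cong₂ _+'_ (ℚₚ.∣p*q∣≡∣p∣*∣q∣ a (b -' d)) (ℚₚ.∣p*q∣≡∣p∣*∣q∣ (a -' c) d) ⟩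
    ℚ.∣ a ∣ *' ℚ.∣ b -' d ∣ +' ℚ.∣ a -' c ∣ *' ℚ.∣ d ∣
      ≤⟨ ℚₚ.+-mono-≤
           (*-mono-≤₀ (ℚₚ.0≤∣p∣ a) (ℚₚ.<⇒≤ (pos* e>0 (reciprocal>0 A>0))) a≤A bd)
           (*-mono-≤₀ (ℚₚ.0≤∣p∣ (a -' c)) (ℚₚ.<⇒≤ B>0) ac d≤B) ⟩
    A *' (e *' reciprocal A>0) +' (e *' reciprocal B>0) *' B
      ≡⟨ cong₂ _+'_ (cancel A>0 e) (trans (ℚₚ.*-comm _ B) (cancel B>0 e)) ⟩
    e +' e ∎
    where
    open ℚₚ.≤-Reasoning
    open +-*-Solver

  *-cauchy : ∀ {s t} → Cauchy s → Cauchy t → Cauchy (λ n → s n *' t n)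
  *-cauchy {s} {t} cs ct ε ε>0 =
    let e>0 = half>0 ε>0
        A , 1≤A , K , hA = eventually-bounded {s} cs
        B , 1≤B , L , hB = eventually-bounded {t} ct
        A>0 = 1≤⇒0< 1≤A
        B>0 = 1≤⇒0< 1≤B
        M , hs = cs ((ε *' ½) *' reciprocal B>0) (pos* e>0 (reciprocal>0 B>0))
        N , ht = ct ((ε *' ½) *' reciprocal A>0) (pos* e>0 (reciprocal>0 A>0))
    in (K ℕ.⊔ L) ℕ.⊔ (M ℕ.⊔ N) , λ m n m≥ n≥ →
      subst (ℚ.∣ s m *' t m -' s n *' t n ∣ ≤'_) (halves ε)
        (product-estimate A>0 B>0 e>0 (s m) (t m) (s n) (t n)
          (hA m (⊔-left {K} {L} (⊔-left {K ℕ.⊔ L} {M ℕ.⊔ N} m≥)))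
          (hB n (⊔-right {K} {L} (⊔-left {K ℕ.⊔ L} {M ℕ.⊔ N} n≥)))
          (hs m n (⊔-left {M} {N} (⊔-right {K ℕ.⊔ L} {M ℕ.⊔ N} m≥)) (⊔-left {M} {N} (⊔-right {K ℕ.⊔ L} {M ℕ.⊔ N} n≥)))
          (ht m n (⊔-right {M} {N} (⊔-right {K ℕ.⊔ L} {M ℕ.⊔ N} m≥)) (⊔-right {M} {N} (⊔-right {K ℕ.⊔ L} {M ℕ.⊔ N} n≥))))

open Cauchy-lemmas

_+_ : ℝ → ℝ → ℝ
x + y = mkℝ (λ n → seq x n ℚ.+ seq y n) (+-cauchy {seq x} {seq y} (cauchy x) (cauchy y))

-_ : ℝ → ℝ
- x = mkℝ (λ n → ℚ.- seq x n) (neg-cauchy {seq x} (cauchy x))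

_-_ : ℝ → ℝ → ℝ
x - y = x + (- y)

_*_ : ℝ → ℝ → ℝ
x * y = mkℝ (λ n → seq x n ℚ.* seq y n) (*-cauchy {seq x} {seq y} (cauchy x) (cauchy y))

∣_∣ : ℝ → ℝ
∣ x ∣ = mkℝ (λ n → ℚ.∣ seq x n ∣) λ ε ε>0 →
  let N , h = cauchy x ε ε>0
  in N , λ m n m≥ n≥ → ℚₚ.≤-trans (∣∣-lipschitz (seq x m) (seq x n)) (h m n m≥ n≥)

_^_ : ℝ → ℕ → ℝ
x ^ zero  = 1ℝ
x ^ suc n = x * x ^ n

module Reciprocal-lemmas where
  open ℚ using () renaming (_+_ to _+'_; _-_ to _-'_; _*_ to _*'_; _≤_ to _≤'_; _<_ to _<'_)

  reciprocal-estimate : ∀ {ε η} (ε>0 : 0ℚ <' ε) {a b} (a>0 : 0ℚ <' a) (b>0 : 0ℚ <' b) →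
    ε ≤' a → ε ≤' b → ℚ.∣ b -' a ∣ ≤' ε *' (ε *' η) →
    ℚ.∣ reciprocal a>0 -' reciprocal b>0 ∣ ≤' η
  reciprocal-estimate {ε} {η} ε>0 {a} {b} a>0 b>0 ε≤a ε≤b h = begin
    ℚ.∣ P -' Q ∣
      ≡⟨ cong ℚ.∣_∣ factor ⟩
    ℚ.∣ (P *' Q) *' (b -' a) ∣
      ≡⟨ ℚₚ.∣p*q∣≡∣p∣*∣q∣ (P *' Q) (b -' a) ⟩
    ℚ.∣ P *' Q ∣ *' ℚ.∣ b -' a ∣
      ≡⟨ cong (_*' ℚ.∣ b -' a ∣) (ℚₚ.0≤p⇒∣p∣≡p 0≤PQ) ⟩
    (P *' Q) *' ℚ.∣ b -' a ∣
      ≤⟨ ℚₚ.*-monoˡ-≤-nonNeg (P *' Q) {{ℚ.nonNegative 0≤PQ}} h ⟩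
    (P *' Q) *' (ε *' (ε *' η))
      ≤⟨ ℚₚ.*-monoʳ-≤-nonNeg (ε *' (ε *' η)) {{ℚ.nonNegative (ℚₚ.≤-trans (ℚₚ.0≤∣p∣ (b -' a)) h)}}
           (*-mono-≤₀ (ℚₚ.<⇒≤ P>0) (ℚₚ.<⇒≤ R>0) (reciprocal-anti ε>0 a>0 ε≤a) (reciprocal-anti ε>0 b>0 ε≤b)) ⟩
    (R *' R) *' (ε *' (ε *' η))
      ≡⟨ solve 3 (λ R e h → (R :* R) :* (e :* (e :* h)) := (e :* R) :* ((e :* R) :* h)) refl R ε η ⟩
    (ε *' R) *' ((ε *' R) *' η)
      ≡⟨ cong (λ u → u *' (u *' η)) (*-reciprocal ε>0) ⟩
    1ℚ *' (1ℚ *' η)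
      ≡⟨ trans (ℚₚ.*-identityˡ _) (ℚₚ.*-identityˡ η) ⟩
    η ∎
    where
    open ℚₚ.≤-Reasoning
    open +-*-Solver
    P = reciprocal a>0
    Q = reciprocal b>0
    R = reciprocal ε>0
    P>0 = reciprocal>0 a>0
    R>0 = reciprocal>0 ε>0
    0≤PQ : 0ℚ ≤' P *' Q
    0≤PQ = 0≤* (ℚₚ.<⇒≤ P>0) (ℚₚ.<⇒≤ (reciprocal>0 b>0))
    factor : P -' Q ≡ (P *' Q) *' (b -' a)
    factor = begin-equality
      P -' Q
        ≡⟨ cong₂ _-'_ (sym (ℚₚ.*-identityʳ P)) (sym (ℚₚ.*-identityʳ Q)) ⟩
      P *' 1ℚ -' Q *' 1ℚ
        ≡⟨ cong₂ (λ u v → P *' u -' Q *' v) (sym (*-reciprocal b>0)) (sym (*-reciprocal a>0)) ⟩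
      P *' (b *' Q) -' Q *' (a *' P)
        ≡⟨ solve 4 (λ P Q a b → P :* (b :* Q) :- Q :* (a :* P) := (P :* Q) :* (b :- a)) refl P Q a b ⟩
      (P *' Q) *' (b -' a) ∎

open Reciprocal-lemmas

-- The index shift past N makes every term of the sequence invertible.
inv : (x : ℝ) → 0ℝ < x → ℝ
inv x (ε , ε>0 , N , x≥ε) = mkℝ (λ n → reciprocal (x>0 n)) λ η η>0 →
  let M , h = cauchy x (ε ℚ.* (ε ℚ.* η)) (pos* ε>0 (pos* ε>0 η>0))
  in M , λ m n m≥ n≥ → reciprocal-estimate ε>0 (x>0 m) (x>0 n) (ε≤ m) (ε≤ n)
           (h (N ℕ.+ n) (N ℕ.+ m) (ℕₚ.≤-trans n≥ (ℕₚ.m≤n+m n N)) (ℕₚ.≤-trans m≥ (ℕₚ.m≤n+m m N)))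
  where
  ε≤ : ∀ n → ε ℚ.≤ seq x (N ℕ.+ n)
  ε≤ n = subst (ℚ._≤ seq x (N ℕ.+ n)) (ℚₚ.+-identityˡ ε) (x≥ε (N ℕ.+ n) (ℕₚ.m≤m+n N n))
  x>0 : ∀ n → 0ℚ ℚ.< seq x (N ℕ.+ n)
  x>0 n = ℚₚ.<-≤-trans ε>0 (ε≤ n)

zpow : (x : ℝ) → 0ℝ < x → ℤ → ℝ
zpow x x>0 (+ n)    = x ^ n
zpow x x>0 -[1+ n ] = inv x x>0 ^ suc n

-- root q n is the lower end of the n-th interval in the bisection of
-- [0 , 1 + q] for √q, and width q n is the length of that interval.

width : ℚ → ℕ → ℚ
width q zero    = 1ℚ ℚ.+ q
width q (suc n) = width q n ℚ.* ½

root : ℚ → ℕ → ℚ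
root q zero = 0ℚ
root q (suc n) with (root q n ℚ.+ width q (suc n)) ℚ.* (root q n ℚ.+ width q (suc n)) ℚₚ.≤? q
... | yes _ = root q n ℚ.+ width q (suc n)
... | no  _ = root q n

module Root-lemmas where
  open ℚ using () renaming (_+_ to _+'_; _-_ to _-'_; _*_ to _*'_; _≤_ to _≤'_; _<_ to _<'_)

  0≤+ : ∀ {p q} → 0ℚ ≤' p → 0ℚ ≤' q → 0ℚ ≤' p +' q
  0≤+ {p} {q} 0≤p 0≤q = subst (_≤' p +' q) (ℚₚ.+-identityˡ 0ℚ) (ℚₚ.+-mono-≤ 0≤p 0≤q)

  square-mono : ∀ {p q} → 0ℚ ≤' p → p ≤' q → p *' p ≤' q *' q
  square-mono 0≤p p≤q = *-mono-≤₀ 0≤p (ℚₚ.≤-trans 0≤p p≤q) p≤q p≤q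

  module _ {q : ℚ} (0≤q : 0ℚ ≤' q) where

    0≤width : ∀ n → 0ℚ ≤' width q n
    0≤width zero    = 0≤+ (ℚₚ.<⇒≤ (ℚₚ.positive⁻¹ 1ℚ)) 0≤q
    0≤width (suc n) = 0≤* (0≤width n) (ℚₚ.<⇒≤ (ℚₚ.positive⁻¹ ½))

    0≤root : ∀ n → 0ℚ ≤' root q n
    0≤root zero = ℚₚ.≤-refl
    0≤root (suc n) with (root q n +' width q (suc n)) *' (root q n +' width q (suc n)) ℚₚ.≤? q
    ... | yes _ = 0≤+ (0≤root n) (0≤width (suc n))
    ... | no  _ = 0≤root n

    root-lower : ∀ n → root q n *' root q n ≤' q
    root-lower zero = subst (_≤' q) (sym (ℚₚ.*-zeroˡ 0ℚ)) 0≤q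
    root-lower (suc n) with (root q n +' width q (suc n)) *' (root q n +' width q (suc n)) ℚₚ.≤? q
    ... | yes h = h
    ... | no  _ = root-lower n

    root-upper : ∀ n → q ≤' (root q n +' width q n) *' (root q n +' width q n)
    root-upper zero = begin
      q                                            ≡⟨ sym (ℚₚ.+-identityˡ q) ⟩
      0ℚ +' q                                      ≤⟨ ℚₚ.+-monoˡ-≤ q (0≤+ (ℚₚ.<⇒≤ (ℚₚ.positive⁻¹ 1ℚ)) (0≤+ 0≤q (0≤square q))) ⟩
      (1ℚ +' (q +' q *' q)) +' q                   ≡⟨ solve 1 (λ x → (con 1ℚ :+ (x :+ x :* x)) :+ x := (con 0ℚ :+ (con 1ℚ :+ x)) :* (con 0ℚ :+ (con 1ℚ :+ x))) refl q ⟩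
      (0ℚ +' (1ℚ +' q)) *' (0ℚ +' (1ℚ +' q))       ∎
      where
      open ℚₚ.≤-Reasoning
      open +-*-Solver
    root-upper (suc n) with (root q n +' width q (suc n)) *' (root q n +' width q (suc n)) ℚₚ.≤? q
    ... | yes _ = subst (λ t → q ≤' t *' t)
      (trans (cong (root q n +'_) (sym (halves (width q n)))) (sym (ℚₚ.+-assoc (root q n) _ _))) (root-upper n)
    ... | no ¬h = ℚₚ.<⇒≤ (ℚₚ.≰⇒> ¬h)

  -- r² ≤ p, q ≤ (s + v)² and p ≤ q + e² give r ≤ s + v + e.
  root-estimate : ∀ {p q r s v e} → 0ℚ ≤' s → 0ℚ ≤' v → 0ℚ <' e →
    r *' r ≤' p → q ≤' (s +' v) *' (s +' v) → p ≤' q +' e *' e → r ≤' (s +' v) +' e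
  root-estimate {p} {q} {r} {s} {v} {e} 0≤s 0≤v e>0 r²≤p q≤ p≤ with r ℚₚ.≤? (s +' v) +' e
  ... | yes h = h
  ... | no ¬h = contradiction (ℚₚ.<-≤-trans strict bound) (ℚₚ.<-irrefl refl)
    where
    open +-*-Solver
    t = s +' v
    0≤t : 0ℚ ≤' t
    0≤t = 0≤+ 0≤s 0≤v
    0<t+e : 0ℚ <' t +' e
    0<t+e = subst (_<' t +' e) (ℚₚ.+-identityˡ 0ℚ) (ℚₚ.+-mono-≤-< 0≤t e>0)
    t+e<r : t +' e <' r
    t+e<r = ℚₚ.≰⇒> ¬h
    strict : (t +' e) *' (t +' e) <' r *' r
    strict = ℚₚ.<-trans
      (ℚₚ.*-monoʳ-<-pos (t +' e) {{ℚ.positive 0<t+e}} t+e<r)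
      (ℚₚ.*-monoˡ-<-pos r {{ℚ.positive (ℚₚ.<-trans 0<t+e t+e<r)}} t+e<r)
    bound : r *' r ≤' (t +' e) *' (t +' e)
    bound = begin
      r *' r                              ≤⟨ r²≤p ⟩
      p                                   ≤⟨ p≤ ⟩
      q +' e *' e                         ≤⟨ ℚₚ.+-monoˡ-≤ (e *' e) q≤ ⟩
      t *' t +' e *' e                    ≡⟨ sym (ℚₚ.+-identityʳ _) ⟩
      (t *' t +' e *' e) +' 0ℚ            ≤⟨ ℚₚ.+-monoʳ-≤ (t *' t +' e *' e) (0≤+ 0≤te 0≤te) ⟩
      (t *' t +' e *' e) +' (t *' e +' t *' e)
        ≡⟨ solve 2 (λ t e → (t :* t :+ e :* e) :+ (t :* e :+ t :* e) := (t :+ e) :* (t :+ e)) refl t e ⟩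
      (t +' e) *' (t +' e)                ∎
      where
      open ℚₚ.≤-Reasoning
      0≤te : 0ℚ ≤' t *' e
      0≤te = 0≤* 0≤t (ℚₚ.<⇒≤ e>0)

  halved : ℚ → ℕ → ℚ
  halved w zero    = w
  halved w (suc n) = halved w n *' ½

  halved-mono : ∀ {v w} → v ≤' w → ∀ n → halved v n ≤' halved w n
  halved-mono v≤w zero    = v≤w
  halved-mono v≤w (suc n) = ℚₚ.*-monoʳ-≤-nonNeg ½ (halved-mono v≤w n)

  0≤halved : ∀ {w} → 0ℚ ≤' w → ∀ n → 0ℚ ≤' halved w n
  0≤halved 0≤w zero    = 0≤w
  0≤halved 0≤w (suc n) = 0≤* (0≤halved 0≤w n) (ℚₚ.<⇒≤ (ℚₚ.positive⁻¹ ½))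

  width≡halved : ∀ q n → width q n ≡ halved (1ℚ +' q) n
  width≡halved q zero    = refl
  width≡halved q (suc n) = cong (_*' ½) (width≡halved q n)

  halved-anti : ∀ {w} → 0ℚ ≤' w → ∀ {m n} → m ℕ.≤ n → halved w n ≤' halved w m
  halved-anti {w} 0≤w {m} m≤n = go (ℕₚ.≤⇒≤′ m≤n)
    where
    go : ∀ {n} → m ℕ.≤′ n → halved w n ≤' halved w m
    go ℕ.≤′-refl = ℚₚ.≤-refl
    go {suc n} (ℕ.≤′-step h) = ℚₚ.≤-trans
      (subst (halved w n *' ½ ≤'_) (ℚₚ.*-identityʳ (halved w n))
        (ℚₚ.*-monoˡ-≤-nonNeg (halved w n) {{ℚ.nonNegative (0≤halved 0≤w n)}} (ℚ.*≤* (ℤ.+≤+ (ℕ.s≤s ℕ.z≤n)))))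
      (go h)

  halved-scale : ∀ c w n → halved (c *' w) n ≡ c *' halved w n
  halved-scale c w zero    = refl
  halved-scale c w (suc n) = trans (cong (_*' ½) (halved-scale c w n)) (ℚₚ.*-assoc c (halved w n) ½)

  ones : ℕ → ℚ
  ones zero    = 0ℚ
  ones (suc n) = 1ℚ +' ones n

  halved-ones : ∀ n → halved (ones n) n ≤' 1ℚ
  halved-ones n = ℚₚ.≤-trans (halved-mono (ones≤doubled n) n) (ℚₚ.≤-reflexive (halved-doubled n))
    where
    open +-*-Solver
    doubled : ℕ → ℚ
    doubled zero    = 1ℚ
    doubled (suc n) = doubled n +' doubled n
    1≤doubled : ∀ n → 1ℚ ≤' doubled n
    1≤doubled zero    = ℚₚ.≤-refl
    1≤doubled (suc n) = ℚₚ.≤-trans (1≤doubled n)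
      (subst (_≤' doubled n +' doubled n) (ℚₚ.+-identityʳ (doubled n))
        (ℚₚ.+-monoʳ-≤ (doubled n) (ℚₚ.≤-trans (ℚₚ.<⇒≤ (ℚₚ.positive⁻¹ 1ℚ)) (1≤doubled n))))
    ones≤doubled : ∀ n → ones n ≤' doubled n
    ones≤doubled zero    = ℚₚ.<⇒≤ (ℚₚ.positive⁻¹ 1ℚ)
    ones≤doubled (suc n) = ℚₚ.+-mono-≤ (1≤doubled n) (ones≤doubled n)
    halved-shift : ∀ w n → halved w (suc n) ≡ halved (w *' ½) n
    halved-shift w zero    = refl
    halved-shift w (suc n) = cong (_*' ½) (halved-shift w n)
    halved-doubled : ∀ n → halved (doubled n) n ≡ 1ℚ
    halved-doubled zero    = refl
    halved-doubled (suc n) = trans (halved-shift (doubled n +' doubled n) n)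
      (trans (cong (λ t → halved t n) (trans (ℚₚ.*-distribʳ-+ ½ (doubled n) (doubled n)) (halves (doubled n))))
             (halved-doubled n))

  archimedean : ∀ q → ∃ λ n → q ≤' ones n
  archimedean q@record{} = ℤ.∣ ℚ.↥ q ∣ , ℚₚ.toℚᵘ-cancel-≤
    (ℚᵘₚ.≤-trans (ℚᵘ.*≤* ↥≤) (ℚᵘₚ.≤-reflexive (ℚᵘₚ.≃-sym (ones≃ ℤ.∣ ℚ.↥ q ∣))))
    where
    ones≃ : ∀ n → ℚ.toℚᵘ (ones n) ℚᵘ.≃ ℚᵘ.mkℚᵘ (+ n) 0
    ones≃ zero    = ℚᵘₚ.≃-refl
    ones≃ (suc n) = ℚᵘₚ.≃-trans (ℚₚ.toℚᵘ-homo-+ 1ℚ (ones n))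
      (ℚᵘₚ.≃-trans (ℚᵘₚ.+-congʳ ℚᵘ.1ℚᵘ (ones≃ n))
        (ℚᵘ.*≡* (cong (λ i → (+ 1 ℤ.+ i) ℤ.* + 1) (ℤₚ.*-identityʳ (+ n)))))
    i≤∣i∣ : ∀ i → i ℤ.≤ + ℤ.∣ i ∣
    i≤∣i∣ (+ n)    = ℤₚ.≤-refl
    i≤∣i∣ -[1+ n ] = ℤ.-≤+
    ↥≤ : ℚ.↥ q ℤ.* + 1 ℤ.≤ + ℤ.∣ ℚ.↥ q ∣ ℤ.* ℚ.↧ q
    ↥≤ = ℤₚ.≤-trans (ℤₚ.≤-reflexive (ℤₚ.*-identityʳ (ℚ.↥ q)))
      (ℤₚ.≤-trans (i≤∣i∣ (ℚ.↥ q))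
        (subst (+ ℤ.∣ ℚ.↥ q ∣ ℤ.≤_) (ℤₚ.pos-* ℤ.∣ ℚ.↥ q ∣ (ℚ.↧ₙ q))
          (ℤ.+≤+ (ℕₚ.m≤m*n ℤ.∣ ℚ.↥ q ∣ (ℚ.↧ₙ q)))))

  halved-small : ∀ w ε → 0ℚ <' ε → ∃ λ n → halved w n ≤' ε
  halved-small w ε ε>0 =
    let n , h = archimedean (w *' reciprocal ε>0)
    in n , (begin
      halved w n                                ≡⟨ cong (λ t → halved t n) (sym (trans (cong (ε *'_) (ℚₚ.*-comm w _)) (trans (sym (ℚₚ.*-assoc ε _ w)) (trans (cong (_*' w) (*-reciprocal ε>0)) (ℚₚ.*-identityˡ w))))) ⟩
      halved (ε *' (w *' reciprocal ε>0)) n     ≡⟨ halved-scale ε _ n ⟩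
      ε *' halved (w *' reciprocal ε>0) n       ≤⟨ ℚₚ.*-monoˡ-≤-nonNeg ε {{ℚ.nonNegative (ℚₚ.<⇒≤ ε>0)}} (ℚₚ.≤-trans (halved-mono h n) (halved-ones n)) ⟩
      ε *' 1ℚ                                   ≡⟨ ℚₚ.*-identityʳ ε ⟩
      ε                                         ∎)
    where open ℚₚ.≤-Reasoning

  root-cauchy : ∀ {s} → (∀ n → 0ℚ ≤' s n) → Cauchy s → Cauchy (λ n → root (s n) n)
  root-cauchy {s} 0≤s cs ε ε>0 =
    let e       = ε *' ½
        e>0     = half>0 ε>0
        B , _ , K , hB = eventually-bounded {s} cs
        L , hL  = halved-small (1ℚ +' B) e e>0
        M , hM  = cs (e *' e) (pos* e>0 e>0)
        small : ∀ n → K ℕ.≤ n → L ℕ.≤ n → width (s n) n ≤' e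
        small n K≤n L≤n = ℚₚ.≤-trans (ℚₚ.≤-reflexive (width≡halved (s n) n))
          (ℚₚ.≤-trans (halved-anti (0≤width (0≤s n) 0) L≤n)
            (ℚₚ.≤-trans (halved-mono (ℚₚ.+-monoʳ-≤ 1ℚ (ℚₚ.≤-trans (p≤∣p∣ (s n)) (hB n K≤n))) L) hL))
        one-sided : ∀ m n → K ℕ.≤ n → L ℕ.≤ n → M ℕ.≤ m → M ℕ.≤ n → root (s m) m ≤' root (s n) n +' ε
        one-sided m n K≤n L≤n M≤m M≤n = ℚₚ.≤-trans
          (root-estimate (0≤root (0≤s n) n) (0≤width (0≤s n) n) e>0
            (root-lower (0≤s m) m) (root-upper (0≤s n) n) (≤-from-∣-∣ (hM m n M≤m M≤n)))
          (ℚₚ.≤-trans (ℚₚ.≤-reflexive (ℚₚ.+-assoc (root (s n) n) (width (s n) n) e))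
            (ℚₚ.+-monoʳ-≤ (root (s n) n) (split (small n K≤n L≤n) ℚₚ.≤-refl)))
    in (K ℕ.⊔ L) ℕ.⊔ M , λ m n m≥ n≥ →
      let K≤ = λ {i} (h : (K ℕ.⊔ L) ℕ.⊔ M ℕ.≤ i) → ⊔-left {K} {L} (⊔-left {K ℕ.⊔ L} {M} h)
          L≤ = λ {i} (h : (K ℕ.⊔ L) ℕ.⊔ M ℕ.≤ i) → ⊔-right {K} {L} (⊔-left {K ℕ.⊔ L} {M} h)
          M≤ = λ {i} (h : (K ℕ.⊔ L) ℕ.⊔ M ℕ.≤ i) → ⊔-right {K ℕ.⊔ L} {M} h
      in ∣-∣≤ (one-sided m n (K≤ n≥) (L≤ n≥) (M≤ m≥) (M≤ n≥))
              (one-sided n m (K≤ m≥) (L≤ m≥) (M≤ n≥) (M≤ m≥))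

open Root-lemmas

sqrt : (x : ℝ) → (∀ n → 0ℚ ℚ.≤ seq x n) → ℝ
sqrt x 0≤x = mkℝ (λ n → root (seq x n) n) (root-cauchy 0≤x (cauchy x))

record ℂ : Set where
  constructor _+i_
  field
    re im : ℝ

open ℂ public

infix  4 _≃ᶜ_
infixl 6 _+ᶜ_ _-ᶜ_
infixl 7 _*ᶜ_
infixr 9 _^ᶜ_

_≃ᶜ_ : ℂ → ℂ → Set
z ≃ᶜ w = (re z ≃ re w) × (im z ≃ im w)

ℝ⇒ℂ : ℝ → ℂ
ℝ⇒ℂ x = x +i 0ℝ

ℚ⇒ℂ : ℚ → ℂ
ℚ⇒ℂ q = ℝ⇒ℂ (ℚ⇒ℝ q)

ℕ⇒ℂ : ℕ → ℂ
ℕ⇒ℂ n = ℝ⇒ℂ (ℕ⇒ℝ n)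

0ℂ 1ℂ : ℂ
0ℂ = ℝ⇒ℂ 0ℝ
1ℂ = ℝ⇒ℂ 1ℝ

_+ᶜ_ _-ᶜ_ _*ᶜ_ : ℂ → ℂ → ℂ
z +ᶜ w = (re z + re w) +i (im z + im w)
z -ᶜ w = (re z - re w) +i (im z - im w)
z *ᶜ w = (re z * re w - im z * im w) +i (re z * im w + im z * re w)

_^ᶜ_ : ℂ → ℕ → ℂ
z ^ᶜ zero  = 1ℂ
z ^ᶜ suc n = z *ᶜ z ^ᶜ n

∣_∣ᶜ : ℂ → ℝ
∣ z ∣ᶜ = sqrt (re z * re z + im z * im z)
  λ n → 0≤+ (0≤square (seq (re z) n)) (0≤square (seq (im z) n))

∑ : (ℕ → ℝ) → ℕ → ℝ
∑ a zero    = 0ℝ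
∑ a (suc n) = ∑ a n + a n

∑ᶜ : (ℕ → ℂ) → ℕ → ℂ
∑ᶜ a zero    = 0ℂ
∑ᶜ a (suc n) = ∑ᶜ a n +ᶜ a n

infix 4 _⟶_ _⟶ᶜ_

_⟶_ : (ℕ → ℝ) → ℝ → Set
a ⟶ x = ∀ ε → 0ℝ < ε → ∃ λ N → ∀ n → N ℕ.≤ n → ∣ a n - x ∣ < ε

_⟶ᶜ_ : (ℕ → ℂ) → ℂ → Set
a ⟶ᶜ z = ∀ ε → 0ℝ < ε → ∃ λ N → ∀ n → N ℕ.≤ n → ∣ a n -ᶜ z ∣ᶜ < ε

HasSum : (ℕ → ℝ) → ℝ → Set
HasSum a s = ∑ a ⟶ s

HasSumᶜ : (ℕ → ℂ) → ℂ → Set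
HasSumᶜ a s = ∑ᶜ a ⟶ᶜ s

-- The exponential, the logarithm (its inverse) and real powers are functional
-- relations: IsExp x y says y = eˣ and IsLog x ℓ says ℓ = log x.

IsExp : ℝ → ℝ → Set
IsExp x y = HasSum (λ n → x ^ n * ℚ⇒ℝ ((+ 1 ℚ./ n ℕ.!) {{n !≢0}})) y

IsLog : ℝ → ℝ → Set
IsLog x ℓ = IsExp ℓ x

-- v = a ^ K = exp (K log a)
IsPower : ℝ → ℝ → ℝ → Set
IsPower a K v = ∃ λ ℓ → IsLog a ℓ × IsExp (K * ℓ) v

-- A function on the positive integers is represented
-- by a function on ℕ whose value at 0 is never used.

record Multiplicative (f : ℕ → ℂ) : Set where
  field
    at-1 : f 1 ≃ᶜ 1ℂ
    at-* : ∀ m n → .{{ℕ.NonZero m}} → .{{ℕ.NonZero n}} → Coprime m n → f (m ℕ.* n) ≃ᶜ f m *ᶜ f n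

-- f(1) + … + f(N)
summatory : (ℕ → ℂ) → ℕ → ℂ
summatory f = ∑ᶜ (λ i → f (suc i))

-- N = ⌊ x ⌋.  No function ℝ → ℕ computes this, as x is only known through
-- approximations, so sums over n ≤ x are taken up to an N in this relation to x.
IsFloor : ℕ → ℝ → Set
IsFloor N x = (ℕ⇒ℝ N ≤ x) × (x < ℕ⇒ℝ (suc N))

primeProduct : (∀ p → Prime p → ℂ) → ℕ → ℂ
primeProduct F zero = 1ℂ
primeProduct F (suc n) with prime? (suc n)
... | yes pr = primeProduct F n *ᶜ F (suc n) pr
... | no  _  = primeProduct F n

module _ (f : ℕ → ℂ) where

  localTerm : ∀ p → Prime p → ℕ → ℂ
  localTerm p pr α = f (p ℕ.^ α) *ᶜ ℚ⇒ℂ (+ 1 ℚ./ (p ℕ.^ α))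
    where instance
      _ = prime⇒nonZero pr
      _ = ℕₚ.m^n≢0 p α

  eulerFactor : ℕ → (∀ p → Prime p → ℂ) → ∀ p → Prime p → ℂ
  eulerFactor k localSum p pr = ℚ⇒ℂ (1ℚ ℚ.- + 1 ℚ./ p) ^ᶜ k *ᶜ localSum p pr
    where instance _ = prime⇒nonZero pr

  -- C is C_f. The infinite product is the limit of its partial products over
  -- p ≤ N; the two infinite processes are part of the data, so the relation
  -- asserts their convergence.
  IsLeadingConstant : ℕ → ℂ → Set
  IsLeadingConstant k C =
    Σ (∀ p → Prime p → ℂ) λ localSum →
      (∀ p pr → HasSumᶜ (localTerm p pr) (localSum p pr)) ×
      ∃ λ product →
        (primeProduct (eulerFactor k localSum) ⟶ᶜ product) ×
        (C ≃ᶜ ℚ⇒ℂ ((+ 1 ℚ./ (k ℕ.∸ 1) ℕ.!) {{(k ℕ.∸ 1) !≢0}}) *ᶜ product)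

{-
Write V_p F(x) = F(⌊x/p⌋) and T_p F(x) = Σ_α f(p^α) F(⌊x/p^α⌋), and let U_N F(x) be the
sum of F(⌊x/n⌋) over the n ≥ 1 without prime factors ≤ N.  These operators commute,
(1 - V_p) U_{p-1} = U_p for prime p, and U_N does nothing to functions on [0, M) when
N ≥ M.  Sorting integers by their powers of each prime p ≤ N therefore gives, for x < M ≤ N,

  Σ_{n ≤ x} f(n) = Π_{p ≤ N} T_p (1 - V_p)^k D_k(x),   D_k(x) = Σ_{n ≤ x} d_k(n) = U_0^k δ(x).

The factor T_p (1 - V_p)^k has coefficients h(α) with h(0) = 1 and, because f(p) = k,
h(1) = 0.  Hence each factor multiplies the main term of an asymptotic formula by
the Euler factor at p and enlarges its error only by 1 + O((log p)/p²), and the product of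
these enlargements over all p converges.  It remains to insert the elementary asymptotics
of D_k.  All estimates are made with L(n) = 1 + H_n, H_n the harmonic numbers,
in place of log n, so that everything but the coefficients f is rational; the values f only
enter through a norm on an abstract complete algebra, which is ℂ with |re| + |im| in
the end.  The logarithm is obtained by inverting the partial sums of the exponential
series on finer and finer grids, and e^(H_N - 1) ≤ N < N + 1 ≤ e^(H_N) gives log x = L(x) + O(1).
-}

module Submission where

-- All functions in the sieve identity vanish at 0 and are compared only below a bound `M`, so every
-- operator is a finite sum of the common length `M`. Each of the N factors multiplies the error
-- constant, so no prime may cost more than 1 + O((log p)/p^2), and no constant may depend on `M` or
-- N: in the end x is fixed while N tends to infinity. Two losses need care. The factor 1/log(x/p^α)
-- in the error can be far larger than 1/log x; it is at most 2 L(p^α)/L(x), which puts an extra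
-- L(p^α) into the local series. And the local series must converge even at p = 2, so the hypothesis
-- on f(p^α) is turned once and for all into a bound C (3/2)^α. The order of the constructive reals
-- is not decidable, so the norm appears as a relation with rational right-hand sides that is closed
-- under limits; the approximations of x and log x enter only in the last comparison.

module Rationals where
  open import Data.Nat as ℕ using (ℕ; zero; suc)
  import Data.Nat.Properties as ℕₚ
  open import Data.Integer as ℤ using (ℤ; +_)
  import Data.Integer.Properties as ℤₚ
  open import Data.Rational
  open import Data.Rational.Properties
  import Data.Rational.Unnormalised as ℚᵘ
  import Data.Rational.Unnormalised.Properties as ℚᵘₚ
  open import Data.Product using (∃; _,_)
  open import Relation.Nullary using (¬_; yes; no)
  open import Relation.Nullary.Negation using (contradiction)
  open import Relation.Binary.PropositionalEquality using (_≡_; refl; sym; trans; cong; cong₂; subst)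
  open import Data.Rational.Solver using (module +-*-Solver)
  open import Defs using (module Rational-lemmas; module Cauchy-lemmas; module Root-lemmas)
  open Rational-lemmas public using (half>0; halves; split; *-mono-≤₀; 0≤*; 0≤square; p≤∣p∣; ∣∣≤; ∣-∣-sym; ∣-∣≤; ≤-from-∣-∣; ∣∣-lipschitz; reciprocal; reciprocal>0; *-reciprocal; reciprocal-anti)
  open Cauchy-lemmas public using (pos*; cancel)
  open Root-lemmas public using (0≤+; ones; archimedean)

  open +-*-Solver using (solve; _:=_; _:+_; _:*_; _:-_; :-_; con)

  -- Rational arithmetic: order, reciprocals of integers, powers.

  0≤1 : 0ℚ ≤ 1ℚ
  0≤1 = nonNegative⁻¹ 1ℚ

  0<1 : 0ℚ < 1ℚ
  0<1 = positive⁻¹ 1ℚ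

  0≤½ : 0ℚ ≤ ½
  0≤½ = nonNegative⁻¹ ½

  ≤-by : ∀ {p q} d → 0ℚ ≤ d → p + d ≡ q → p ≤ q
  ≤-by {p} d 0≤d eq = subst (p ≤_) eq (subst (_≤ p + d) (+-identityʳ p) (+-monoʳ-≤ p 0≤d))

  0≤difference : ∀ {p q} → p ≤ q → 0ℚ ≤ q - p
  0≤difference {p} {q} p≤q = subst (_≤ q - p) (+-inverseʳ p) (+-monoˡ-≤ (- p) p≤q)

  p≤p+q : ∀ {p q} → 0ℚ ≤ q → p ≤ p + q
  p≤p+q {p} {q} 0≤q = ≤-by q 0≤q refl

  p≤q+p : ∀ {p q} → 0ℚ ≤ q → p ≤ q + p
  p≤q+p {p} {q} 0≤q = ≤-by q 0≤q (+-comm p q)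

  *-monoˡ : ∀ {p q r} → 0ℚ ≤ p → q ≤ r → p * q ≤ p * r
  *-monoˡ {p} 0≤p = *-monoˡ-≤-nonNeg p {{nonNegative 0≤p}}

  *-monoʳ : ∀ {p q r} → 0ℚ ≤ p → q ≤ r → q * p ≤ r * p
  *-monoʳ {p} 0≤p = *-monoʳ-≤-nonNeg p {{nonNegative 0≤p}}

  *-mono : ∀ {p q r s} → 0ℚ ≤ p → 0ℚ ≤ r → p ≤ q → r ≤ s → p * r ≤ q * s
  *-mono 0≤p 0≤r p≤q r≤s = *-mono-≤₀ 0≤p (≤-trans 0≤r r≤s) p≤q r≤s

  *-cancel-≤ : ∀ {p q r} → 0ℚ < r → p * r ≤ q * r → p ≤ q
  *-cancel-≤ {r = r} 0<r = *-cancelʳ-≤-pos r {{positive 0<r}}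

  ≤-by-contradiction : ∀ {p q} → ¬ (q < p) → p ≤ q
  ≤-by-contradiction {p} {q} h with p ≤? q
  ... | yes p≤q = p≤q
  ... | no  p≰q = contradiction (≰⇒> p≰q) h

  ≤-of-ε : ∀ {p q} → (∀ ε → 0ℚ < ε → p ≤ q + ε) → p ≤ q
  ≤-of-ε {p} {q} h with p ≤? q
  ... | yes p≤q = p≤q
  ... | no  p≰q = contradiction (<-≤-trans (+-monoʳ-< q e<d) q+d≤q+e) (<-irrefl refl)
    where
    d = p - q
    e = d * ½
    0<d : 0ℚ < d
    0<d = subst (_< d) (+-inverseʳ q) (+-monoˡ-< (- q) (≰⇒> p≰q))
    e<d : e < d
    e<d = subst (e <_) (halves d) (subst (_< e + e) (+-identityʳ e) (+-monoʳ-< e (half>0 0<d)))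
    q+d≤q+e : q + d ≤ q + e
    q+d≤q+e = subst (_≤ q + e) (solve 2 (λ p q → p := q :+ (p :- q)) refl p q) (h e (half>0 0<d))

  fromℕ : ℕ → ℚ
  fromℕ n = + n / 1

  -- The value 0 at 0 keeps `recip` multiplicative on all of ℕ, so that `recip-*` and `recip-^` need
  -- no side conditions.
  recip : ℕ → ℚ
  recip zero    = 0ℚ
  recip (suc n) = + 1 / suc n

  private
    toℚᵘ-/ : ∀ i n → toℚᵘ (i / suc n) ℚᵘ.≃ ℚᵘ.mkℚᵘ i n
    toℚᵘ-/ i n = toℚᵘ-fromℚᵘ (ℚᵘ.mkℚᵘ i n)

  fromℕ-+ : ∀ m n → fromℕ (m ℕ.+ n) ≡ fromℕ m + fromℕ n
  fromℕ-+ m n = toℚᵘ-injective (ℚᵘₚ.≃-trans (toℚᵘ-/ (+ (m ℕ.+ n)) 0)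
    (ℚᵘₚ.≃-trans (ℚᵘ.*≡* (cong (ℤ._* + 1) (cong₂ ℤ._+_ (sym (ℤₚ.*-identityʳ (+ m))) (sym (ℤₚ.*-identityʳ (+ n))))))
    (ℚᵘₚ.≃-sym (ℚᵘₚ.≃-trans (toℚᵘ-homo-+ (fromℕ m) (fromℕ n)) (ℚᵘₚ.+-cong (toℚᵘ-/ (+ m) 0) (toℚᵘ-/ (+ n) 0))))))

  fromℕ-* : ∀ m n → fromℕ (m ℕ.* n) ≡ fromℕ m * fromℕ n
  fromℕ-* m n = toℚᵘ-injective (ℚᵘₚ.≃-trans (toℚᵘ-/ (+ (m ℕ.* n)) 0)
    (ℚᵘₚ.≃-trans (ℚᵘ.*≡* (cong (ℤ._* + 1) (ℤₚ.pos-* m n)))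
    (ℚᵘₚ.≃-sym (ℚᵘₚ.≃-trans (toℚᵘ-homo-* (fromℕ m) (fromℕ n)) (ℚᵘₚ.*-cong (toℚᵘ-/ (+ m) 0) (toℚᵘ-/ (+ n) 0))))))

  fromℕ-suc : ∀ n → fromℕ (suc n) ≡ 1ℚ + fromℕ n
  fromℕ-suc n = fromℕ-+ 1 n

  fromℕ-recip : ∀ n → fromℕ (suc n) * recip (suc n) ≡ 1ℚ
  fromℕ-recip n = toℚᵘ-injective (ℚᵘₚ.≃-trans (toℚᵘ-homo-* (fromℕ (suc n)) (recip (suc n)))
    (ℚᵘₚ.≃-trans (ℚᵘₚ.*-cong (toℚᵘ-/ (+ suc n) 0) (toℚᵘ-/ (+ 1) n))
    (ℚᵘ.*≡* (trans (ℤₚ.*-identityʳ _) (trans (ℤₚ.*-identityʳ (+ suc n)) (sym (trans (ℤₚ.*-identityˡ _) (cong (λ t → + suc t) (ℕₚ.+-identityʳ n)))))))))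

  0≤fromℕ : ∀ n → 0ℚ ≤ fromℕ n
  0≤fromℕ zero    = ≤-refl
  0≤fromℕ (suc n) = subst (0ℚ ≤_) (sym (fromℕ-suc n)) (0≤+ 0≤1 (0≤fromℕ n))

  0<fromℕ : ∀ n → 0ℚ < fromℕ (suc n)
  0<fromℕ n = subst (0ℚ <_) (sym (fromℕ-suc n)) (<-≤-trans 0<1 (p≤p+q (0≤fromℕ n)))

  fromℕ-mono : ∀ {m n} → m ℕ.≤ n → fromℕ m ≤ fromℕ n
  fromℕ-mono {m} {n} m≤n = subst (fromℕ m ≤_) (trans (sym (fromℕ-+ m (n ℕ.∸ m))) (cong fromℕ (ℕₚ.m+[n∸m]≡n m≤n)))
    (p≤p+q (0≤fromℕ (n ℕ.∸ m)))

  1≤fromℕ : ∀ n → 1ℚ ≤ fromℕ (suc n)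
  1≤fromℕ n = fromℕ-mono {1} {suc n} (ℕ.s≤s ℕ.z≤n)

  recip>0 : ∀ n → 0ℚ < recip (suc n)
  recip>0 n = positive⁻¹ (recip (suc n)) {{normalize-pos 1 (suc n)}}

  0≤recip : ∀ n → 0ℚ ≤ recip n
  0≤recip zero    = ≤-refl
  0≤recip (suc n) = <⇒≤ (recip>0 n)

  recip-anti : ∀ {m n} → m ℕ.≤ n → recip (suc n) ≤ recip (suc m)
  recip-anti {m} {n} m≤n = begin
    b                ≡⟨ sym (*-identityˡ b) ⟩
    1ℚ * b           ≡⟨ cong (_* b) (sym (fromℕ-recip m)) ⟩
    (x * a) * b      ≤⟨ *-monoʳ (0≤recip (suc n)) (*-monoʳ (0≤recip (suc m)) (fromℕ-mono (ℕ.s≤s m≤n))) ⟩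
    (y * a) * b      ≡⟨ solve 3 (λ y a b → (y :* a) :* b := (y :* b) :* a) refl y a b ⟩
    (y * b) * a      ≡⟨ trans (cong (_* a) (fromℕ-recip n)) (*-identityˡ a) ⟩
    a                ∎
    where
    open ≤-Reasoning
    x = fromℕ (suc m)
    y = fromℕ (suc n)
    a = recip (suc m)
    b = recip (suc n)

  recip≤1 : ∀ n → recip n ≤ 1ℚ
  recip≤1 zero    = 0≤1
  recip≤1 (suc n) = recip-anti {0} {n} ℕ.z≤n

  recip-* : ∀ m n → recip (m ℕ.* n) ≡ recip m * recip n
  recip-* zero    n       = sym (*-zeroˡ (recip n))
  recip-* (suc m) zero    = trans (cong recip (ℕₚ.*-zeroʳ m)) (sym (*-zeroʳ (recip (suc m))))
  recip-* (suc m) (suc n) = begin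
    c                          ≡⟨ solve 1 (λ c → c := (con 1ℚ :* con 1ℚ) :* c) refl c ⟩
    (1ℚ * 1ℚ) * c              ≡⟨ cong (_* c) (cong₂ _*_ (sym (fromℕ-recip m)) (sym (fromℕ-recip n))) ⟩
    ((x * a) * (y * b)) * c    ≡⟨ solve 5 (λ x a y b c → ((x :* a) :* (y :* b)) :* c := (a :* b) :* ((x :* y) :* c)) refl x a y b c ⟩
    (a * b) * ((x * y) * c)    ≡⟨ cong (λ t → (a * b) * (t * c)) (sym (fromℕ-* (suc m) (suc n))) ⟩
    (a * b) * (fromℕ (suc m ℕ.* suc n) * c) ≡⟨ cong ((a * b) *_) (fromℕ-recip (n ℕ.+ m ℕ.* suc n)) ⟩
    (a * b) * 1ℚ               ≡⟨ *-identityʳ (a * b) ⟩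
    a * b                      ∎
    where
    open Relation.Binary.PropositionalEquality.≡-Reasoning
    x = fromℕ (suc m)
    y = fromℕ (suc n)
    a = recip (suc m)
    b = recip (suc n)
    c = recip (suc m ℕ.* suc n)

  ones≡fromℕ : ∀ n → ones n ≡ fromℕ n
  ones≡fromℕ zero    = refl
  ones≡fromℕ (suc n) = trans (cong (λ t → 1ℚ + t) (ones≡fromℕ n)) (sym (fromℕ-suc n))

  above : ∀ q → ∃ λ n → q ≤ fromℕ n
  above q = let n , h = archimedean q in n , subst (q ≤_) (ones≡fromℕ n) h

  recip-small : ∀ ε → 0ℚ < ε → ∃ λ n → recip (suc n) ≤ ε
  recip-small ε ε>0 = let n , h = above (reciprocal ε>0) in n , *-cancel-≤ (0<fromℕ n) (begin
    recip (suc n) * fromℕ (suc n)  ≡⟨ trans (*-comm (recip (suc n)) (fromℕ (suc n))) (fromℕ-recip n) ⟩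
    1ℚ                             ≡⟨ sym (*-reciprocal ε>0) ⟩
    ε * reciprocal ε>0             ≤⟨ *-monoˡ (<⇒≤ ε>0) (≤-trans h (fromℕ-mono (ℕₚ.n≤1+n n))) ⟩
    ε * fromℕ (suc n)              ∎)
    where open ≤-Reasoning

  infixr 9 _^_

  _^_ : ℚ → ℕ → ℚ
  q ^ zero  = 1ℚ
  q ^ suc n = q * q ^ n

  0≤^ : ∀ {q} → 0ℚ ≤ q → ∀ n → 0ℚ ≤ q ^ n
  0≤^ 0≤q zero    = 0≤1
  0≤^ 0≤q (suc n) = 0≤* 0≤q (0≤^ 0≤q n)

  ^-mono : ∀ {p q} → 0ℚ ≤ p → p ≤ q → ∀ n → p ^ n ≤ q ^ n
  ^-mono 0≤p p≤q zero    = ≤-refl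
  ^-mono 0≤p p≤q (suc n) = *-mono 0≤p (0≤^ 0≤p n) p≤q (^-mono 0≤p p≤q n)

  1≤^ : ∀ {q} → 1ℚ ≤ q → ∀ n → 1ℚ ≤ q ^ n
  1≤^ 1≤q zero    = ≤-refl
  1≤^ {q} 1≤q (suc n) = subst (_≤ q * q ^ n) (*-identityˡ 1ℚ) (*-mono 0≤1 0≤1 1≤q (1≤^ 1≤q n))

  ^-distrib-* : ∀ p q n → (p * q) ^ n ≡ p ^ n * q ^ n
  ^-distrib-* p q zero    = refl
  ^-distrib-* p q (suc n) = trans (cong ((p * q) *_) (^-distrib-* p q n))
    (solve 4 (λ p q x y → (p :* q) :* (x :* y) := (p :* x) :* (q :* y)) refl p q (p ^ n) (q ^ n))

  recip-^ : ∀ m n → recip (m ℕ.^ n) ≡ recip m ^ n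
  recip-^ m zero    = refl
  recip-^ m (suc n) = trans (recip-* m (m ℕ.^ n)) (cong (recip m *_) (recip-^ m n))

  ∣^∣ : ∀ q n → ∣ q ^ n ∣ ≡ ∣ q ∣ ^ n
  ∣^∣ q zero    = refl
  ∣^∣ q (suc n) = trans (∣p*q∣≡∣p∣*∣q∣ q (q ^ n)) (cong (∣ q ∣ *_) (∣^∣ q n))

  bernoulli : ∀ {q} → 0ℚ ≤ q → ∀ n → 1ℚ + fromℕ n * q ≤ (1ℚ + q) ^ n
  bernoulli {q} 0≤q zero = ≤-reflexive (solve 1 (λ q → con 1ℚ :+ con 0ℚ :* q := con 1ℚ) refl q)
  bernoulli {q} 0≤q (suc n) = begin
    1ℚ + fromℕ (suc n) * q       ≡⟨ cong (λ t → 1ℚ + t * q) (fromℕ-suc n) ⟩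
    1ℚ + (1ℚ + x) * q            ≤⟨ ≤-by (x * (q * q)) (0≤* (0≤fromℕ n) (0≤* 0≤q 0≤q))
       (solve 2 (λ x q → (con 1ℚ :+ (con 1ℚ :+ x) :* q) :+ x :* (q :* q) := (con 1ℚ :+ q) :* (con 1ℚ :+ x :* q)) refl x q) ⟩
    (1ℚ + q) * (1ℚ + x * q)      ≤⟨ *-monoˡ (0≤+ 0≤1 0≤q) (bernoulli 0≤q n) ⟩
    (1ℚ + q) * (1ℚ + q) ^ n      ∎
    where
    open ≤-Reasoning
    x = fromℕ n

  -- A mean value inequality: the derivative (n + 1) t^n is largest at the upper end p.
  -- `^-difference-lower` is the counterpart at the lower end.
  ^-difference : ∀ {p q} → 0ℚ ≤ q → q ≤ p → ∀ n → p ^ suc n - q ^ suc n ≤ fromℕ (suc n) * p ^ n * (p - q)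
  ^-difference {p} {q} 0≤q q≤p zero = ≤-reflexive (solve 2 (λ p q → p :* con 1ℚ :- q :* con 1ℚ := con 1ℚ :* con 1ℚ :* (p :- q)) refl p q)
  ^-difference {p} {q} 0≤q q≤p (suc n) = begin
    p * x - q * y                              ≡⟨ solve 4 (λ p q x y → p :* x :- q :* y := x :* (p :- q) :+ q :* (x :- y)) refl p q x y ⟩
    x * (p - q) + q * (x - y)                  ≤⟨ +-monoʳ-≤ (x * (p - q)) (*-monoˡ 0≤q (^-difference 0≤q q≤p n)) ⟩
    x * (p - q) + q * (c * p ^ n * (p - q))    ≤⟨ +-monoʳ-≤ (x * (p - q)) (*-monoʳ (0≤* (0≤* (0≤fromℕ (suc n)) (0≤^ 0≤p n)) (0≤difference q≤p)) q≤p) ⟩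
    x * (p - q) + p * (c * p ^ n * (p - q))    ≡⟨ solve 4 (λ p q c y → (p :* y) :* (p :- q) :+ p :* (c :* y :* (p :- q)) := (con 1ℚ :+ c) :* (p :* y) :* (p :- q)) refl p q c (p ^ n) ⟩
    (1ℚ + c) * x * (p - q)                     ≡⟨ cong (λ t → t * x * (p - q)) (sym (fromℕ-suc (suc n))) ⟩
    fromℕ (suc (suc n)) * x * (p - q)          ∎
    where
    open ≤-Reasoning
    0≤p = ≤-trans 0≤q q≤p
    x = p ^ suc n
    y = q ^ suc n
    c = fromℕ (suc n)

-- Integer parts of quotients.

module Quotients where
  open import Data.Nat
  open import Data.Nat.Properties
  open import Data.Nat.DivMod
  open import Data.Nat.Divisibility using (_∣_; divides)
  open import Relation.Nullary using (¬_)
  open import Relation.Binary.PropositionalEquality using (_≡_; refl; sym; trans; cong; subst)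

  infixl 7 _÷_

  -- ⌊ x / m ⌋, with the value 0 for m = 0.
  _÷_ : ℕ → ℕ → ℕ
  x ÷ zero  = 0
  x ÷ suc m = x / suc m

  0÷ : ∀ m → 0 ÷ m ≡ 0
  0÷ zero    = refl
  0÷ (suc m) = 0/n≡0 (suc m)

  ÷1 : ∀ x → x ÷ 1 ≡ x
  ÷1 = n/1≡n

  -- Holds for zero divisors too, thanks to the value 0 chosen there. With `÷-comm` it is the source
  -- of all commutation rules between the operators.
  ÷-* : ∀ x m n → x ÷ m ÷ n ≡ x ÷ (m * n)
  ÷-* x zero    n       = 0÷ n
  ÷-* x (suc m) zero    = sym (cong (x ÷_) (*-zeroʳ m))
  ÷-* x (suc m) (suc n) = m/n/o≡m/[n*o] x (suc m) (suc n)

  ÷-comm : ∀ x m n → x ÷ m ÷ n ≡ x ÷ n ÷ m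
  ÷-comm x m n = trans (÷-* x m n) (trans (cong (x ÷_) (*-comm m n)) (sym (÷-* x n m)))

  ÷-≤ : ∀ x m → x ÷ m ≤ x
  ÷-≤ x zero    = z≤n
  ÷-≤ x (suc m) = m/n≤m x (suc m)

  ÷-small : ∀ {x m} → x < m → x ÷ m ≡ 0
  ÷-small {m = suc m} x<m = m<n⇒m/n≡0 x<m

  ÷-lower : ∀ x m → m * (x ÷ m) ≤ x
  ÷-lower x zero    = z≤n
  ÷-lower x (suc m) = subst (_≤ x) (*-comm (x / suc m) (suc m)) (m/n*n≤m x (suc m))

  ÷-upper : ∀ x m → .{{NonZero m}} → x < m * suc (x ÷ m)
  ÷-upper x (suc m) = subst (x <_) (*-comm (suc (x / suc m)) (suc m))
    (subst (_< suc (x / suc m) * suc m) (sym (m≡m%n+[m/n]*n x (suc m))) (+-monoˡ-< (x / suc m * suc m) (m%n<n x (suc m))))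

  ÷-unique : ∀ x m q → .{{_ : NonZero m}} → m * q ≤ x → x < m * suc q → x ÷ m ≡ q
  ÷-unique x m q l u = ≤-antisym
    (s≤s⁻¹ (*-cancelˡ-< m (x ÷ m) (suc q) (≤-<-trans (÷-lower x m) u)))
    (s≤s⁻¹ (*-cancelˡ-< m q (suc (x ÷ m)) (≤-<-trans l (÷-upper x m))))

  ÷-suc-∣ : ∀ x m → .{{_ : NonZero m}} → m ∣ suc x → suc x ≡ m * suc (x ÷ m)
  ÷-suc-∣ x m (divides zero ())
  ÷-suc-∣ x m@(suc m-1) (divides (suc q) eq) = trans (trans eq (*-comm (suc q) m)) (cong (λ t → m * suc t) (sym (÷-unique x m q
    (s≤s⁻¹ (subst (m * q <_) (sym sx) (subst (m * q <_) (sym (*-suc m q)) (m<n+m (m * q) {m} (s≤s z≤n)))))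
    (≤-reflexive sx))))
    where
    sx : suc x ≡ m * suc q
    sx = trans eq (*-comm (suc q) m)

  ÷-suc-∤ : ∀ x m → .{{_ : NonZero m}} → ¬ (m ∣ suc x) → suc x ÷ m ≡ x ÷ m
  ÷-suc-∤ x m m∤ = ÷-unique (suc x) m (x ÷ m) (≤-trans (÷-lower x m) (n≤1+n x))
    (≤∧≢⇒< (÷-upper x m) (λ eq → m∤ (divides (suc (x ÷ m)) (trans eq (*-comm m (suc (x ÷ m)))))))

  n<m^n : ∀ {m} → 2 ≤ m → ∀ n → n < m ^ n
  n<m^n 2≤m zero = s≤s z≤n
  n<m^n {m} 2≤m (suc n) = ≤-trans (+-mono-≤ (≤-trans (s≤s z≤n) (n<m^n 2≤m n)) (n<m^n 2≤m n))
    (≤-trans (≤-reflexive (cong (m ^ n +_) (sym (+-identityʳ (m ^ n))))) (*-monoˡ-≤ (m ^ n) 2≤m))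

-- Finite sums in a commutative ring and in ℚ.

module Sums where
  open import Algebra.Bundles using (CommutativeRing)
  open import Data.Nat as ℕ using (ℕ; zero; suc)
  import Data.Nat.Properties as ℕₚ
  open import Data.Sum using (inj₁; inj₂)
  open import Level using (0ℓ)
  import Relation.Binary.PropositionalEquality as ≡

  module Sum (R : CommutativeRing 0ℓ 0ℓ) where
    open CommutativeRing R hiding (zero)
    open import Relation.Binary.Reasoning.Setoid setoid
    open import Algebra.Properties.AbelianGroup +-abelianGroup using (⁻¹-∙-comm; ε⁻¹≈ε)
    open import Algebra.Properties.CommutativeSemigroup +-commutativeSemigroup using (interchange)

    sum : (ℕ → Carrier) → ℕ → Carrier
    sum a zero    = 0#
    sum a (suc n) = sum a n + a n

    sum-cong : ∀ {a b} n → (∀ i → i ℕ.< n → a i ≈ b i) → sum a n ≈ sum b n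
    sum-cong zero    h = refl
    sum-cong (suc n) h = +-cong (sum-cong n (λ i i<n → h i (ℕₚ.m<n⇒m<1+n i<n))) (h n (ℕₚ.n<1+n n))

    sum-zero : ∀ {a} n → (∀ i → i ℕ.< n → a i ≈ 0#) → sum a n ≈ 0#
    sum-zero zero    h = refl
    sum-zero (suc n) h = trans (+-cong (sum-zero n (λ i i<n → h i (ℕₚ.m<n⇒m<1+n i<n))) (h n (ℕₚ.n<1+n n))) (+-identityʳ 0#)

    sum-+ : ∀ a b n → sum (λ i → a i + b i) n ≈ sum a n + sum b n
    sum-+ a b zero    = sym (+-identityʳ 0#)
    sum-+ a b (suc n) = trans (+-congʳ (sum-+ a b n)) (interchange (sum a n) (sum b n) (a n) (b n))

    sum-neg : ∀ a n → sum (λ i → - a i) n ≈ - sum a n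
    sum-neg a zero    = sym ε⁻¹≈ε
    sum-neg a (suc n) = trans (+-congʳ (sum-neg a n)) (⁻¹-∙-comm (sum a n) (a n))

    sum-− : ∀ a b n → sum (λ i → a i - b i) n ≈ sum a n - sum b n
    sum-− a b n = trans (sum-+ a (λ i → - b i) n) (+-congˡ (sum-neg b n))

    sum-*ˡ : ∀ c a n → sum (λ i → c * a i) n ≈ c * sum a n
    sum-*ˡ c a zero    = sym (zeroʳ c)
    sum-*ˡ c a (suc n) = trans (+-congʳ (sum-*ˡ c a n)) (sym (distribˡ c (sum a n) (a n)))

    sum-*ʳ : ∀ a c n → sum (λ i → a i * c) n ≈ sum a n * c
    sum-*ʳ a c zero    = sym (zeroˡ c)
    sum-*ʳ a c (suc n) = trans (+-congʳ (sum-*ʳ a c n)) (sym (distribʳ c (sum a n) (a n)))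

    sum-shift : ∀ a n → sum a (suc n) ≈ a 0 + sum (λ i → a (suc i)) n
    sum-shift a zero    = +-comm 0# (a 0)
    sum-shift a (suc n) = trans (+-congʳ (sum-shift a n)) (+-assoc (a 0) _ _)

    sum-swap : ∀ (a : ℕ → ℕ → Carrier) m n → sum (λ i → sum (a i) n) m ≈ sum (λ j → sum (λ i → a i j) m) n
    sum-swap a zero    n = sym (sum-zero n (λ _ _ → refl))
    sum-swap a (suc m) n = trans (+-congʳ (sum-swap a m n)) (sym (sum-+ (λ j → sum (λ i → a i j) m) (a m) n))

    sum-extend : ∀ {a m n} → m ℕ.≤ n → (∀ i → m ℕ.≤ i → a i ≈ 0#) → sum a n ≈ sum a m
    sum-extend {a} {m} {zero} m≤n h = reflexive (≡.cong (sum a) (≡.sym (ℕₚ.n≤0⇒n≡0 m≤n)))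
    sum-extend {a} {m} {suc n} m≤n h with ℕₚ.m≤n⇒m<n∨m≡n m≤n
    ... | inj₂ ≡.refl = refl
    ... | inj₁ m<1+n  = trans (+-cong (sum-extend (ℕ.s≤s⁻¹ m<1+n) h) (h n (ℕ.s≤s⁻¹ m<1+n))) (+-identityʳ _)

  module ℚ-sums where
    open import Data.Rational
    open import Data.Rational.Properties
    open Rationals
    open Sum +-*-commutativeRing public

    sum-mono : ∀ {a b} n → (∀ i → i ℕ.< n → a i ≤ b i) → sum a n ≤ sum b n
    sum-mono zero    h = ≤-refl
    sum-mono (suc n) h = +-mono-≤ (sum-mono n (λ i i<n → h i (ℕₚ.m<n⇒m<1+n i<n))) (h n (ℕₚ.n<1+n n))

    0≤sum : ∀ {a} n → (∀ i → 0ℚ ≤ a i) → 0ℚ ≤ sum a n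
    0≤sum zero    h = ≤-refl
    0≤sum (suc n) h = 0≤+ (0≤sum n h) (h n)

-- Harmonic numbers as a substitute for the logarithm.

module Harmonic where
  open import Data.Nat as ℕ using (ℕ; zero; suc)
  import Data.Nat.Properties as ℕₚ
  open import Data.Rational hiding (_÷_)
  open import Data.Rational.Properties
  open import Data.Rational.Solver using (module +-*-Solver)
  open import Data.Product using (∃; _,_)
  open import Data.Sum using (inj₁; inj₂)
  open import Relation.Binary.PropositionalEquality using (_≡_; refl; sym; trans; cong; subst)
  open Rationals
  open Quotients
  open Sums
  open ℚ-sums using (sum)
  open +-*-Solver using (solve; _:=_; _:+_; _:*_; _:-_; :-_; con)
  open ≤-Reasoning

  H : ℕ → ℚ
  H = sum (λ i → recip (suc i))

  -- The rational substitute for log n, kept away from 0.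
  L : ℕ → ℚ
  L n = 1ℚ + H n

  0≤H : ∀ n → 0ℚ ≤ H n
  0≤H n = ℚ-sums.0≤sum n (λ i → 0≤recip (suc i))

  H-increment-upper : ∀ {s t} → s ℕ.≤ t → ∀ j → H (t ℕ.+ j) ≤ H t + fromℕ j * recip (suc s)
  H-increment-upper {s} {t} s≤t zero = ≤-reflexive (trans (cong H (ℕₚ.+-identityʳ t))
    (solve 2 (λ h r → h := h :+ con 0ℚ :* r) refl (H t) (recip (suc s))))
  H-increment-upper {s} {t} s≤t (suc j) = begin
    H (t ℕ.+ suc j)                             ≡⟨ cong H (ℕₚ.+-suc t j) ⟩
    H (t ℕ.+ j) + recip (suc (t ℕ.+ j))         ≤⟨ +-mono-≤ (H-increment-upper s≤t j) (recip-anti (ℕₚ.≤-trans s≤t (ℕₚ.m≤m+n t j))) ⟩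
    H t + fromℕ j * r + r                       ≡⟨ solve 3 (λ h x r → h :+ x :* r :+ r := h :+ (con 1ℚ :+ x) :* r) refl (H t) (fromℕ j) r ⟩
    H t + (1ℚ + fromℕ j) * r                    ≡⟨ cong (λ x → H t + x * r) (sym (fromℕ-suc j)) ⟩
    H t + fromℕ (suc j) * r                     ∎
    where r = recip (suc s)

  H-increment-lower : ∀ {s t} j → t ℕ.+ j ℕ.≤ suc s → H t + fromℕ j * recip (suc s) ≤ H (t ℕ.+ j)
  H-increment-lower {s} {t} zero h = ≤-reflexive (sym (trans (cong H (ℕₚ.+-identityʳ t))
    (solve 2 (λ h r → h := h :+ con 0ℚ :* r) refl (H t) (recip (suc s)))))
  H-increment-lower {s} {t} (suc j) h = begin
    H t + fromℕ (suc j) * r                     ≡⟨ cong (λ x → H t + x * r) (fromℕ-suc j) ⟩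
    H t + (1ℚ + fromℕ j) * r                    ≡⟨ solve 3 (λ h x r → h :+ (con 1ℚ :+ x) :* r := h :+ x :* r :+ r) refl (H t) (fromℕ j) r ⟩
    H t + fromℕ j * r + r                       ≤⟨ +-mono-≤ (H-increment-lower j (ℕₚ.≤-trans (ℕₚ.n≤1+n _) h′)) (recip-anti (ℕ.s≤s⁻¹ h′)) ⟩
    H (t ℕ.+ j) + recip (suc (t ℕ.+ j))         ≡⟨ cong H (sym (ℕₚ.+-suc t j)) ⟩
    H (t ℕ.+ suc j)                             ∎
    where
    r = recip (suc s)
    h′ = subst (ℕ._≤ suc s) (ℕₚ.+-suc t j) h

  fromℕ*recip : ∀ m n → fromℕ (suc m) * recip (suc m ℕ.* n) ≡ recip n
  fromℕ*recip m n = begin-equality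
    fromℕ (suc m) * recip (suc m ℕ.* n)          ≡⟨ cong (fromℕ (suc m) *_) (recip-* (suc m) n) ⟩
    fromℕ (suc m) * (recip (suc m) * recip n)    ≡⟨ sym (*-assoc (fromℕ (suc m)) (recip (suc m)) (recip n)) ⟩
    fromℕ (suc m) * recip (suc m) * recip n      ≡⟨ trans (cong (_* recip n) (fromℕ-recip m)) (*-identityˡ (recip n)) ⟩
    recip n                                      ∎

  H-≤ : ∀ n → H n ≤ fromℕ n
  H-≤ n = ≤-trans (H-increment-upper {0} {0} ℕ.z≤n n)
    (≤-reflexive (solve 1 (λ x → con 0ℚ :+ x :* con 1ℚ := x) refl (fromℕ n)))

  H-mono : ∀ {m n} → m ℕ.≤ n → H m ≤ H n
  H-mono {m} {n} m≤n = subst (λ t → H m ≤ H t) (ℕₚ.m+[n∸m]≡n m≤n)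
    (≤-trans (p≤p+q (0≤* (0≤fromℕ j) (0≤recip (suc (m ℕ.+ j))))) (H-increment-lower j (ℕₚ.n≤1+n (m ℕ.+ j))))
    where j = n ℕ.∸ m

  private
    block : ∀ m n → suc m ℕ.* suc n ℕ.+ suc m ≡ suc m ℕ.* suc (suc n)
    block m n = trans (ℕₚ.+-comm (suc m ℕ.* suc n) (suc m)) (sym (ℕₚ.*-suc (suc m) (suc n)))

  -- Cut the sum into blocks of length m. Every term after index m (n + 1) is at most 1/(m (n + 1)),
  -- so the block that starts there adds at most 1/(n + 1).
  H-*-upper : ∀ m n → H (m ℕ.* suc n) ≤ H m + H n
  H-*-upper m zero = ≤-reflexive (trans (cong H (ℕₚ.*-identityʳ m)) (sym (+-identityʳ (H m))))
  H-*-upper zero (suc n) = 0≤+ ≤-refl (0≤H (suc n))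
  H-*-upper m@(suc m-1) (suc n) = begin
    H (m ℕ.* suc (suc n))                         ≡⟨ cong H (sym (block m-1 n)) ⟩
    H (m ℕ.* suc n ℕ.+ m)                         ≤⟨ H-increment-upper {n ℕ.+ m-1 ℕ.* suc n} {m ℕ.* suc n} (ℕₚ.n≤1+n _) m ⟩
    H (m ℕ.* suc n) + fromℕ m * recip (m ℕ.* suc n) ≡⟨ cong (H (m ℕ.* suc n) +_) (fromℕ*recip m-1 (suc n)) ⟩
    H (m ℕ.* suc n) + recip (suc n)               ≤⟨ +-monoˡ-≤ (recip (suc n)) (H-*-upper m n) ⟩
    H m + H n + recip (suc n)                     ≡⟨ +-assoc (H m) (H n) _ ⟩
    H m + H (suc n)                               ∎

  -- The same blocks, bounded below by their last terms. The 1 on the right pays for H 1, which the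
  -- first block cannot supply.
  H-*-lower : ∀ m n → H (suc m) + H (suc n) ≤ H (suc m ℕ.* suc n) + 1ℚ
  H-*-lower m zero = ≤-reflexive (cong (λ t → H t + 1ℚ) (sym (ℕₚ.*-identityʳ (suc m))))
  H-*-lower m-1 (suc n) = begin
    H m + H (suc (suc n))                                        ≡⟨ sym (+-assoc (H m) (H (suc n)) _) ⟩
    H m + H (suc n) + recip (suc (suc n))                        ≤⟨ +-monoˡ-≤ (recip (suc (suc n))) (H-*-lower m-1 n) ⟩
    H (m ℕ.* suc n) + 1ℚ + recip (suc (suc n))                   ≡⟨ solve 2 (λ h r → h :+ con 1ℚ :+ r := h :+ r :+ con 1ℚ) refl (H (m ℕ.* suc n)) (recip (suc (suc n))) ⟩
    H (m ℕ.* suc n) + recip (suc (suc n)) + 1ℚ                   ≡⟨ cong (λ r → H (m ℕ.* suc n) + r + 1ℚ) (sym (fromℕ*recip m-1 (suc (suc n)))) ⟩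
    H (m ℕ.* suc n) + fromℕ m * recip (m ℕ.* suc (suc n)) + 1ℚ   ≤⟨ +-monoˡ-≤ 1ℚ (H-increment-lower {t = m ℕ.* suc n} m (ℕₚ.≤-reflexive (block m-1 n))) ⟩
    H (m ℕ.* suc n ℕ.+ m) + 1ℚ                                   ≡⟨ cong (λ t → H t + 1ℚ) (block m-1 n) ⟩
    H (m ℕ.* suc (suc n)) + 1ℚ                                   ∎
    where m = suc m-1

  1≤L : ∀ n → 1ℚ ≤ L n
  1≤L n = p≤p+q (0≤H n)

  0<L : ∀ n → 0ℚ < L n
  0<L n = <-≤-trans 0<1 (1≤L n)

  0≤L : ∀ n → 0ℚ ≤ L n
  0≤L n = <⇒≤ (0<L n)

  L-mono : ∀ {m n} → m ℕ.≤ n → L m ≤ L n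
  L-mono m≤n = +-monoʳ-≤ 1ℚ (H-mono m≤n)

  H≤L : ∀ n → H n ≤ L n
  H≤L n = p≤q+p 0≤1

  L-≤ : ∀ n → L n ≤ 1ℚ + fromℕ n
  L-≤ n = +-monoʳ-≤ 1ℚ (H-≤ n)

  -- With `L-÷-lower`, the harmonic form of log(x/m) = log x - log m up to 1. The lower bound needs
  -- a nonzero quotient, hence its hypothesis.
  L-÷-upper : ∀ x m → .{{_ : ℕ.NonZero m}} → L x ≤ H m + L (x ÷ m)
  L-÷-upper x m = begin
    1ℚ + H x                          ≤⟨ +-monoʳ-≤ 1ℚ (H-mono (ℕₚ.<⇒≤ (÷-upper x m))) ⟩
    1ℚ + H (m ℕ.* suc (x ÷ m))        ≤⟨ +-monoʳ-≤ 1ℚ (H-*-upper m (x ÷ m)) ⟩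
    1ℚ + (H m + H (x ÷ m))            ≡⟨ solve 2 (λ a b → con 1ℚ :+ (a :+ b) := a :+ (con 1ℚ :+ b)) refl (H m) (H (x ÷ m)) ⟩
    H m + L (x ÷ m)                   ∎

  L-÷-lower : ∀ {x m} → m ℕ.< x → L (x ÷ suc m) ≤ L x - H (suc m) + 1ℚ
  L-÷-lower {x} {m} m<x with x ÷ suc m | ÷-lower x (suc m) | ÷-upper x (suc m)
  ... | zero  | _ | u = contradiction (subst (x ℕ.<_) (ℕₚ.*-identityʳ (suc m)) u) (ℕₚ.<⇒≱ (ℕ.s≤s m<x))
    where open import Relation.Nullary.Negation using (contradiction)
  ... | suc q | l | _ = begin
    1ℚ + H (suc q)                                ≡⟨ solve 2 (λ a b → con 1ℚ :+ b := con 1ℚ :+ (a :+ b) :- a) refl (H (suc m)) (H (suc q)) ⟩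
    1ℚ + (H (suc m) + H (suc q)) - H (suc m)      ≤⟨ +-monoˡ-≤ (- H (suc m)) (+-monoʳ-≤ 1ℚ (≤-trans (H-*-lower m q) (+-monoˡ-≤ 1ℚ (H-mono l)))) ⟩
    1ℚ + (H x + 1ℚ) - H (suc m)                   ≡⟨ solve 2 (λ x a → con 1ℚ :+ (x :+ con 1ℚ) :- a := con 1ℚ :+ x :- a :+ con 1ℚ) refl (H x) (H (suc m)) ⟩
    L x - H (suc m) + 1ℚ                          ∎

  L-^ : ∀ m n → L (suc m ℕ.^ n) ≤ fromℕ (suc n) * L (suc m)
  L-^ m zero = ≤-trans (L-mono {1} {suc m} (ℕ.s≤s ℕ.z≤n)) (≤-reflexive (sym (*-identityˡ (L (suc m)))))
  L-^ m (suc n) = begin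
    L (suc m ℕ.* suc m ℕ.^ n)               ≤⟨ L-mono (ℕₚ.*-monoʳ-≤ (suc m) (ℕₚ.n≤1+n (suc m ℕ.^ n))) ⟩
    L (suc m ℕ.* suc (suc m ℕ.^ n))         ≤⟨ +-monoʳ-≤ 1ℚ (H-*-upper (suc m) (suc m ℕ.^ n)) ⟩
    1ℚ + (H (suc m) + H (suc m ℕ.^ n))      ≤⟨ ≤-by 1ℚ 0≤1 (solve 2 (λ a b → con 1ℚ :+ (a :+ b) :+ con 1ℚ := (con 1ℚ :+ a) :+ (con 1ℚ :+ b)) refl (H (suc m)) (H (suc m ℕ.^ n))) ⟩
    L (suc m) + L (suc m ℕ.^ n)             ≤⟨ +-monoʳ-≤ (L (suc m)) (L-^ m n) ⟩
    L (suc m) + fromℕ (suc n) * L (suc m)   ≡⟨ solve 2 (λ l x → l :+ x :* l := (con 1ℚ :+ x) :* l) refl (L (suc m)) (fromℕ (suc n)) ⟩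
    (1ℚ + fromℕ (suc n)) * L (suc m)        ≡⟨ cong (_* L (suc m)) (sym (fromℕ-suc (suc n))) ⟩
    fromℕ (suc (suc n)) * L (suc m)         ∎

  -- Controls the sums of L(n)/n^2: by `u-telescopes` the decrements of `u` from index 1 on dominate
  -- these terms. Up to constants it is (log t)/t, as in the antiderivative -(1 + log t)/t of (log
  -- t)/t^2.
  u : ℕ → ℚ
  u n = (L n + fromℕ 2) * recip n

  0≤u : ∀ n → 0ℚ ≤ u n
  0≤u n = 0≤* (0≤+ (0≤L n) (0≤fromℕ 2)) (0≤recip n)

  u-telescopes : ∀ n → L (suc (suc n)) * (recip (suc (suc n)) * recip (suc (suc n))) ≤ u (suc n) - u (suc (suc n))
  u-telescopes n = begin
    (1ℚ + (h + b)) * (b * b)                ≤⟨ *-monoʳ (0≤* 0≤b 0≤b) (≤-by {1ℚ + (h + b)} (1ℚ - b) (0≤difference (recip≤1 (suc (suc n))))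
        (solve 2 (λ h b → (con 1ℚ :+ (h :+ b)) :+ (con 1ℚ :- b) := con 1ℚ :+ h :+ con 1ℚ) refl h b)) ⟩
    (1ℚ + h + 1ℚ) * (b * b)                 ≡⟨ solve 2 (λ h b → (con 1ℚ :+ h :+ con 1ℚ) :* (b :* b) := (con 1ℚ :+ h :+ con (fromℕ 2)) :* b :* b :- b :* b) refl h b ⟩
    (1ℚ + h + fromℕ 2) * b * b - b * b      ≤⟨ +-monoˡ-≤ (- (b * b)) (*-monoˡ (0≤* (0≤+ (0≤L (suc n)) (0≤fromℕ 2)) 0≤b) b≤a) ⟩
    (1ℚ + h + fromℕ 2) * b * a - b * b      ≡⟨ solve 3 (λ h a b → (con 1ℚ :+ h :+ con (fromℕ 2)) :* b :* a :- b :* b :=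
                                                   (con 1ℚ :+ h :+ con (fromℕ 2)) :* (b :+ a :* b) :- (con 1ℚ :+ (h :+ b) :+ con (fromℕ 2)) :* b) refl h a b ⟩
    (1ℚ + h + fromℕ 2) * (b + a * b) - (1ℚ + (h + b) + fromℕ 2) * b ≡⟨ cong (λ t → (1ℚ + h + fromℕ 2) * t - (1ℚ + (h + b) + fromℕ 2) * b) (sym a-split) ⟩
    u (suc n) - u (suc (suc n))             ∎
    where
    a = recip (suc n)
    b = recip (suc (suc n))
    h = H (suc n)
    0≤b = 0≤recip (suc (suc n))
    b≤a : b ≤ a
    b≤a = recip-anti (ℕₚ.n≤1+n n)
    x = fromℕ (suc n)
    a-split : a ≡ b + a * b
    a-split = begin-equality
      a                            ≡⟨ sym (*-identityʳ a) ⟩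
      a * 1ℚ                       ≡⟨ cong (a *_) (sym (fromℕ-recip (suc n))) ⟩
      a * (fromℕ (suc (suc n)) * b) ≡⟨ cong (λ t → a * (t * b)) (fromℕ-suc (suc n)) ⟩
      a * ((1ℚ + x) * b)           ≡⟨ solve 3 (λ a b x → a :* ((con 1ℚ :+ x) :* b) := (x :* a) :* b :+ a :* b) refl a b x ⟩
      (x * a) * b + a * b          ≡⟨ cong (λ t → t * b + a * b) (fromℕ-recip n) ⟩
      1ℚ * b + a * b               ≡⟨ cong (_+ a * b) (*-identityˡ b) ⟩
      b + a * b                    ∎

  -- The first m + 1 terms are at most 1, the later ones at most 1/(m + 1). Since m is free, H n =
  -- o(n), which makes `u` tend to 0.
  H-sublinear : ∀ m n → H n ≤ fromℕ (suc m) + fromℕ n * recip (suc m)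
  H-sublinear m n with ℕₚ.≤-total n (suc m)
  ... | inj₁ n≤m = ≤-trans (H-≤ n) (≤-trans (fromℕ-mono n≤m) (p≤p+q (0≤* (0≤fromℕ n) (0≤recip (suc m)))))
  ... | inj₂ m≤n = begin
    H n                                       ≡⟨ cong H (sym (ℕₚ.m+[n∸m]≡n m≤n)) ⟩
    H (suc m ℕ.+ j)                           ≤⟨ H-increment-upper (ℕₚ.n≤1+n m) j ⟩
    H (suc m) + fromℕ j * recip (suc m)       ≤⟨ +-mono-≤ (H-≤ (suc m)) (*-monoʳ (0≤recip (suc m)) (fromℕ-mono (ℕₚ.m∸n≤m n (suc m)))) ⟩
    fromℕ (suc m) + fromℕ n * recip (suc m)   ∎
    where j = n ℕ.∸ suc m

  u-small : ∀ ε → 0ℚ < ε → ∃ λ N → ∀ n → N ℕ.≤ n → u (suc n) ≤ ε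
  u-small ε ε>0 =
    let e>0   = half>0 ε>0
        m , m-small = recip-small (ε * ½) e>0
        c     = fromℕ 3 + fromℕ (suc m)
        c>0   = <-≤-trans (0<fromℕ m) (p≤q+p (0≤fromℕ 3))
        N , N-small = recip-small (ε * ½ * reciprocal c>0) (pos* e>0 (reciprocal>0 c>0))
    in N , λ n N≤n → let r = recip (suc n) in begin
      (1ℚ + H (suc n) + fromℕ 2) * r
        ≤⟨ *-monoʳ (0≤recip (suc n)) (+-monoˡ-≤ (fromℕ 2) (+-monoʳ-≤ 1ℚ (H-sublinear m (suc n)))) ⟩
      (1ℚ + (fromℕ (suc m) + fromℕ (suc n) * recip (suc m)) + fromℕ 2) * r
        ≡⟨ solve 4 (λ a x s r → (con 1ℚ :+ (a :+ x :* s) :+ con (fromℕ 2)) :* r := (con (fromℕ 3) :+ a) :* r :+ s :* (x :* r))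
             refl (fromℕ (suc m)) (fromℕ (suc n)) (recip (suc m)) r ⟩
      c * r + recip (suc m) * (fromℕ (suc n) * r)
        ≡⟨ cong (λ t → c * r + recip (suc m) * t) (fromℕ-recip n) ⟩
      c * r + recip (suc m) * 1ℚ
        ≤⟨ split (≤-trans (*-monoˡ (<⇒≤ c>0) (≤-trans (recip-anti N≤n) N-small)) (≤-reflexive (cancel c>0 (ε * ½))))
                 (≤-trans (≤-reflexive (*-identityʳ _)) m-small) ⟩
      ε ∎

-- Main and error terms under x -> x/m, and sums of the main term.

module Growth where
  open import Data.Nat as ℕ using (ℕ; zero; suc)
  import Data.Nat.Properties as ℕₚ
  open import Data.Rational hiding (_÷_)
  open import Data.Rational.Properties
  open import Data.Rational.Solver using (module +-*-Solver)
  open import Relation.Binary.PropositionalEquality using (_≡_; refl; sym; trans; cong; cong₂; subst; subst₂)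
  open Rationals
  open Quotients
  open Sums
  open Harmonic
  open ℚ-sums using (sum; sum-mono; sum-*ˡ; sum-+)
  open +-*-Solver using (solve; _:=_; _:+_; _:*_; _:-_; :-_; con)
  open ≤-Reasoning

  -- Multiplying by this reciprocal, instead of lowering an exponent of `L`, treats k = 1 like all
  -- other k: there the error has the size x / log x.
  Λ : ℕ → ℚ
  Λ x = reciprocal (0<L x)

  0≤Λ : ∀ x → 0ℚ ≤ Λ x
  0≤Λ x = <⇒≤ (reciprocal>0 (0<L x))

  L*Λ : ∀ x → L x * Λ x ≡ 1ℚ
  L*Λ x = *-reciprocal (0<L x)

  -- With L x in place of log x: the size x (log x)ʲ of the main term for
  -- k = j + 1, and the size x (log x)ʲ⁻¹ of the error term.
  G : ℕ → ℕ → ℚ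
  G j x = fromℕ x * L x ^ j

  W : ℕ → ℕ → ℚ
  W j x = G j x * Λ x

  0≤L^ : ∀ x j → 0ℚ ≤ L x ^ j
  0≤L^ x j = 0≤^ (0≤L x) j

  0≤G : ∀ j x → 0ℚ ≤ G j x
  0≤G j x = 0≤* (0≤fromℕ x) (0≤L^ x j)

  0≤W : ∀ j x → 0ℚ ≤ W j x
  0≤W j x = 0≤* (0≤G j x) (0≤Λ x)

  L^suc*Λ : ∀ x j → L x ^ suc j * Λ x ≡ L x ^ j
  L^suc*Λ x j = trans (solve 3 (λ l p r → (l :* p) :* r := (l :* r) :* p) refl (L x) (L x ^ j) (Λ x))
    (trans (cong (_* L x ^ j) (L*Λ x)) (*-identityˡ _))

  W-suc : ∀ j x → W (suc j) x ≡ G j x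
  W-suc j x = trans (*-assoc (fromℕ x) (L x ^ suc j) (Λ x)) (cong (fromℕ x *_) (L^suc*Λ x j))

  fromℕ-÷-≤ : ∀ x m → fromℕ (x ÷ suc m) ≤ fromℕ x * recip (suc m)
  fromℕ-÷-≤ x m = *-cancel-≤ (0<fromℕ m) (begin
    fromℕ y * n                  ≡⟨ trans (*-comm (fromℕ y) n) (sym (fromℕ-* (suc m) y)) ⟩
    fromℕ (suc m ℕ.* y)          ≤⟨ fromℕ-mono (÷-lower x (suc m)) ⟩
    fromℕ x                      ≡⟨ sym (*-identityʳ _) ⟩
    fromℕ x * 1ℚ                 ≡⟨ cong (fromℕ x *_) (sym (fromℕ-recip m)) ⟩
    fromℕ x * (n * recip (suc m)) ≡⟨ solve 3 (λ x n r → x :* (n :* r) := (x :* r) :* n) refl (fromℕ x) n (recip (suc m)) ⟩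
    (fromℕ x * recip (suc m)) * n ∎)
    where
    y = x ÷ suc m
    n = fromℕ (suc m)

  fromℕ-÷-≥ : ∀ x m → fromℕ x * recip (suc m) - fromℕ (x ÷ suc m) ≤ 1ℚ
  fromℕ-÷-≥ x m = *-cancel-≤ (0<fromℕ m) (begin
    (fromℕ x * r - fromℕ y) * n          ≡⟨ solve 4 (λ x n r y → (x :* r :- y) :* n := x :* (n :* r) :- n :* y) refl (fromℕ x) n r (fromℕ y) ⟩
    fromℕ x * (n * r) - n * fromℕ y      ≡⟨ cong (λ t → fromℕ x * t - n * fromℕ y) (fromℕ-recip m) ⟩
    fromℕ x * 1ℚ - n * fromℕ y           ≤⟨ +-monoˡ-≤ (- (n * fromℕ y)) (≤-trans (≤-reflexive (*-identityʳ _)) (fromℕ-mono (ℕₚ.<⇒≤ (÷-upper x (suc m))))) ⟩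
    fromℕ (suc m ℕ.* suc y) - n * fromℕ y ≡⟨ cong (_- n * fromℕ y) (trans (fromℕ-* (suc m) (suc y)) (cong (n *_) (fromℕ-suc y))) ⟩
    n * (1ℚ + fromℕ y) - n * fromℕ y     ≡⟨ solve 2 (λ n y → n :* (con 1ℚ :+ y) :- n :* y := con 1ℚ :* n) refl n (fromℕ y) ⟩
    1ℚ * n                               ∎)
    where
    y = x ÷ suc m
    n = fromℕ (suc m)
    r = recip (suc m)

  -- L(x) is at most L(m) + L(x/m), hence at most 2 L(m) L(x/m), since both factors are at least 1.
  Λ-÷ : ∀ x m → Λ (x ÷ suc m) ≤ (1ℚ + 1ℚ) * (L (suc m) * Λ x)
  Λ-÷ x m = begin
    Λ y                                      ≡⟨ sym (trans (cong (Λ y *_) (L*Λ x)) (*-identityʳ (Λ y))) ⟩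
    Λ y * (L x * Λ x)                        ≤⟨ *-monoˡ (0≤Λ y) (*-monoʳ (0≤Λ x) (≤-trans (L-÷-upper x (suc m)) (+-mono-≤ (H≤L (suc m)) (≤-reflexive (sym (*-identityˡ (L y))))))) ⟩
    Λ y * ((Lm + 1ℚ * L y) * Λ x)            ≤⟨ *-monoˡ (0≤Λ y) (*-monoʳ (0≤Λ x) (+-mono-≤ (≤-trans (≤-reflexive (sym (*-identityʳ Lm))) (*-monoˡ (0≤L (suc m)) (1≤L y))) (*-monoʳ (0≤L y) (1≤L (suc m))))) ⟩
    Λ y * ((Lm * L y + Lm * L y) * Λ x)      ≡⟨ solve 4 (λ a m l b → a :* ((m :* l :+ m :* l) :* b) := (l :* a) :* ((con 1ℚ :+ con 1ℚ) :* (m :* b))) refl (Λ y) Lm (L y) (Λ x) ⟩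
    (L y * Λ y) * ((1ℚ + 1ℚ) * (Lm * Λ x))   ≡⟨ trans (cong (_* ((1ℚ + 1ℚ) * (Lm * Λ x))) (L*Λ y)) (*-identityˡ _) ⟩
    (1ℚ + 1ℚ) * (Lm * Λ x)                   ∎
    where
    y = x ÷ suc m
    Lm = L (suc m)

  G-÷-≤ : ∀ j x m → G j (x ÷ suc m) ≤ G j x * recip (suc m)
  G-÷-≤ j x m = ≤-trans (*-mono (0≤fromℕ (x ÷ suc m)) (0≤L^ (x ÷ suc m) j) (fromℕ-÷-≤ x m) (^-mono (0≤L (x ÷ suc m)) (L-mono (÷-≤ x (suc m))) j))
    (≤-reflexive (solve 3 (λ x r l → (x :* r) :* l := (x :* l) :* r) refl (fromℕ x) (recip (suc m)) (L x ^ j)))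

  W-÷ : ∀ j x m → W j (x ÷ suc m) ≤ (1ℚ + 1ℚ) * (L (suc m) * recip (suc m)) * W j x
  W-÷ j x m = ≤-trans (*-mono (0≤G j (x ÷ suc m)) (0≤Λ (x ÷ suc m)) (G-÷-≤ j x m) (Λ-÷ x m))
    (≤-reflexive (solve 4 (λ g r m l → (g :* r) :* ((con 1ℚ :+ con 1ℚ) :* (m :* l)) := (con 1ℚ :+ con 1ℚ) :* (m :* r) :* (g :* l)) refl
      (G j x) (recip (suc m)) (L (suc m)) (Λ x)))

  ^-difference-Λ : ∀ {p q} x j → 0ℚ ≤ q → q ≤ p → p ≤ L x → p ^ j - q ^ j ≤ fromℕ j * (L x ^ j * Λ x) * (p - q)
  ^-difference-Λ {p} {q} x zero 0≤q q≤p p≤L = ≤-reflexive (solve 3 (λ a p q → con 1ℚ :- con 1ℚ := con 0ℚ :* a :* (p :- q)) refl (1ℚ * Λ x) p q)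
  ^-difference-Λ {p} {q} x (suc j) 0≤q q≤p p≤L = ≤-trans (^-difference 0≤q q≤p j) (*-monoʳ (0≤difference q≤p)
    (*-monoˡ (0≤fromℕ (suc j)) (≤-trans (^-mono (≤-trans 0≤q q≤p) p≤L j) (≤-reflexive (sym (L^suc*Λ x j))))))

  -- Two changes are separated: rounding x/m to an integer (`first`), and replacing log x by
  -- log(x/m) in the power (`second`).
  G-÷ : ∀ j x m → ∣ G j (x ÷ suc m) - G j x * recip (suc m) ∣ ≤ fromℕ (suc j) * (L (suc m) * recip (suc m)) * W j x
  G-÷ j x m = subst (_≤ fromℕ (suc j) * (Lm * r) * W j x) (∣-∣-sym (G j x * r) (G j y))
    (≤-trans (≤-reflexive (0≤p⇒∣p∣≡p (0≤difference (G-÷-≤ j x m)))) (begin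
      X * l * r - Y * L y ^ j                           ≡⟨ solve 5 (λ x l r y m → x :* l :* r :- y :* m := (x :* r :- y) :* l :+ y :* (l :- m)) refl X l r Y (L y ^ j) ⟩
      (X * r - Y) * l + Y * (l - L y ^ j)               ≤⟨ +-mono-≤ first second ⟩
      (Lm * r) * W j x + fromℕ j * (Lm * r) * W j x     ≡⟨ solve 3 (λ a n w → a :* w :+ n :* a :* w := (con 1ℚ :+ n) :* a :* w) refl (Lm * r) (fromℕ j) (W j x) ⟩
      (1ℚ + fromℕ j) * (Lm * r) * W j x                 ≡⟨ cong (λ n → n * (Lm * r) * W j x) (sym (fromℕ-suc j)) ⟩
      fromℕ (suc j) * (Lm * r) * W j x                  ∎))
    where
    y = x ÷ suc m
    Lm = L (suc m)
    r = recip (suc m)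
    X = fromℕ x
    Y = fromℕ y
    l = L x ^ j
    t = X * r - Y
    0≤t : 0ℚ ≤ t
    0≤t = 0≤difference (fromℕ-÷-≤ x m)
    -- The bound t ≤ 1 alone would not save a logarithm. Write L(x) ≤ H(m) + 1 + Y and bound t by X
    -- r in front of H(m) but by 1 in front of Y; the remaining t + Y is X r.
    t*L : t * L x ≤ X * r * Lm
    t*L = begin
      t * L x                             ≤⟨ *-monoˡ 0≤t (≤-trans (L-÷-upper x (suc m)) (+-monoʳ-≤ (H (suc m)) (L-≤ y))) ⟩
      t * (H (suc m) + (1ℚ + Y))          ≡⟨ solve 3 (λ t h y → t :* (h :+ (con 1ℚ :+ y)) := t :* h :+ t :+ t :* y) refl t (H (suc m)) Y ⟩
      t * H (suc m) + t + t * Y           ≤⟨ +-mono-≤ (+-monoˡ-≤ t (*-monoʳ (0≤H (suc m)) t≤)) (*-monoʳ (0≤fromℕ y) (fromℕ-÷-≥ x m)) ⟩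
      X * r * H (suc m) + t + 1ℚ * Y      ≡⟨ solve 4 (λ x r h y → x :* r :* h :+ (x :* r :- y) :+ con 1ℚ :* y := x :* r :* (con 1ℚ :+ h)) refl X r (H (suc m)) Y ⟩
      X * r * Lm                          ∎
      where
      t≤ : t ≤ X * r
      t≤ = ≤-by Y (0≤fromℕ y) (solve 2 (λ a y → a :- y :+ y := a) refl (X * r) Y)
    first : t * l ≤ (Lm * r) * W j x
    first = begin
      t * l                       ≡⟨ sym (trans (cong (t * l *_) (L*Λ x)) (*-identityʳ (t * l))) ⟩
      t * l * (L x * Λ x)         ≡⟨ solve 4 (λ t l a b → t :* l :* (a :* b) := t :* a :* (l :* b)) refl t l (L x) (Λ x) ⟩
      t * L x * (l * Λ x)         ≤⟨ *-monoʳ (0≤* (0≤L^ x j) (0≤Λ x)) t*L ⟩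
      X * r * Lm * (l * Λ x)      ≡⟨ solve 5 (λ x r m l a → x :* r :* m :* (l :* a) := (m :* r) :* ((x :* l) :* a)) refl X r Lm l (Λ x) ⟩
      (Lm * r) * W j x            ∎
    second : Y * (l - L y ^ j) ≤ fromℕ j * (Lm * r) * W j x
    second = begin
      Y * (l - L y ^ j)                          ≤⟨ *-monoˡ (0≤fromℕ y) (^-difference-Λ x j (0≤L y) (L-mono (÷-≤ x (suc m))) ≤-refl) ⟩
      Y * (fromℕ j * (l * Λ x) * (L x - L y))    ≤⟨ *-mono (0≤fromℕ y) (0≤* 0≤c (0≤difference (L-mono (÷-≤ x (suc m))))) (fromℕ-÷-≤ x m) (*-monoˡ 0≤c LL) ⟩
      X * r * (fromℕ j * (l * Λ x) * Lm)         ≡⟨ solve 6 (λ x r n l a m → x :* r :* (n :* (l :* a) :* m) := n :* (m :* r) :* ((x :* l) :* a)) refl X r (fromℕ j) l (Λ x) Lm ⟩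
      fromℕ j * (Lm * r) * W j x                 ∎
      where
      0≤c : 0ℚ ≤ fromℕ j * (l * Λ x)
      0≤c = 0≤* (0≤fromℕ j) (0≤* (0≤L^ x j) (0≤Λ x))
      LL : L x - L y ≤ Lm
      LL = ≤-trans (+-monoˡ-≤ (- L y) (≤-trans (L-÷-upper x (suc m)) (+-monoˡ-≤ (L y) (H≤L (suc m)))))
        (≤-reflexive (solve 2 (λ m y → m :+ y :- y := m) refl Lm (L y)))

  ^-difference-lower : ∀ {p q} → 0ℚ ≤ q → q ≤ p → ∀ n → fromℕ (suc n) * q ^ n * (p - q) ≤ p ^ suc n - q ^ suc n
  ^-difference-lower {p} {q} 0≤q q≤p zero = ≤-reflexive (solve 2 (λ p q → con 1ℚ :* con 1ℚ :* (p :- q) := p :* con 1ℚ :- q :* con 1ℚ) refl p q)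
  ^-difference-lower {p} {q} 0≤q q≤p (suc n) = begin
    fromℕ (suc (suc n)) * y * (p - q)          ≡⟨ cong (λ t → t * y * (p - q)) (fromℕ-suc (suc n)) ⟩
    (1ℚ + c) * y * (p - q)                     ≡⟨ solve 4 (λ p q c z → (con 1ℚ :+ c) :* (q :* z) :* (p :- q) := (q :* z) :* (p :- q) :+ q :* (c :* z :* (p :- q))) refl p q c (q ^ n) ⟩
    y * (p - q) + q * (c * q ^ n * (p - q))    ≤⟨ +-mono-≤ (*-monoʳ (0≤difference q≤p) (^-mono 0≤q q≤p (suc n))) (*-monoˡ 0≤q (^-difference-lower 0≤q q≤p n)) ⟩
    x * (p - q) + q * (x - y)                  ≡⟨ solve 4 (λ p q x y → x :* (p :- q) :+ q :* (x :- y) := p :* x :- q :* y) refl p q x y ⟩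
    p * x - q * y                              ∎
    where
    x = p ^ suc n
    y = q ^ suc n
    c = fromℕ (suc n)

  ∣sum∣ : ∀ {a b} n → (∀ i → i ℕ.< n → ∣ a i ∣ ≤ b i) → ∣ sum a n ∣ ≤ sum b n
  ∣sum∣ zero    h = ≤-refl
  ∣sum∣ {a} (suc n) h = ≤-trans (∣p+q∣≤∣p∣+∣q∣ (sum a n) (a n)) (+-mono-≤ (∣sum∣ n (λ i i<n → h i (ℕₚ.m<n⇒m<1+n i<n))) (h n (ℕₚ.n<1+n n)))

  sum-const : ∀ c n → sum (λ _ → c) n ≡ fromℕ n * c
  sum-const c zero    = sym (*-zeroˡ c)
  sum-const c (suc n) = trans (cong (_+ c) (sum-const c n)) (trans (solve 2 (λ n c → n :* c :+ c := (con 1ℚ :+ n) :* c) refl (fromℕ n) c)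
    (cong (_* c) (sym (fromℕ-suc n))))

  ∣-∣-triangle : ∀ p q r → ∣ p - r ∣ ≤ ∣ p - q ∣ + ∣ q - r ∣
  ∣-∣-triangle p q r = subst (λ t → ∣ t ∣ ≤ ∣ p - q ∣ + ∣ q - r ∣) (solve 3 (λ p q r → (p :- q) :+ (q :- r) := p :- r) refl p q r) (∣p+q∣≤∣p∣+∣q∣ (p - q) (q - r))

  between : ∀ {a b c d} → a ≤ c → c ≤ b → a ≤ d → d ≤ b → ∣ c - d ∣ ≤ b - a
  between {a} {b} {c} {d} ac cb ad db = ∣-∣≤ (pointwise cb ad) (pointwise db ac)
    where
    pointwise : ∀ {c d} → c ≤ b → a ≤ d → c ≤ d + (b - a)
    pointwise {c} {d} cb ad = ≤-trans cb (≤-trans (≤-by (d - a) (0≤difference ad) refl)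
      (≤-reflexive (solve 3 (λ a b d → b :+ (d :- a) := d :+ (b :- a)) refl a b d)))

  -- The implied constant of `G-sum`. Its summands come from rounding, from knowing log(x/i) only up
  -- to 1, and from the end of the telescoping sum.
  K : ℕ → ℚ
  K j = fromℕ (suc j) + fromℕ (suc j) * (fromℕ j * (1ℚ + 1ℚ) ^ j) + 1ℚ

  0≤K : ∀ j → 0ℚ ≤ K j
  0≤K j = 0≤+ (0≤+ (0≤fromℕ (suc j)) (0≤* (0≤fromℕ (suc j)) (0≤* (0≤fromℕ j) (0≤^ (0≤+ 0≤1 0≤1) j)))) 0≤1

  module _ (j x : ℕ) where
    private
      n = fromℕ (suc j)
      X = fromℕ x
      l = L x ^ j
      -- Stands for log(x/i). Unlike `L (x ÷ i)` it decreases by exactly 1/(i + 1) per step, which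
      -- makes differences of its powers computable.
      w : ℕ → ℚ
      w i = L x - H i
      2^j = (1ℚ + 1ℚ) ^ j
      β = fromℕ j * (2^j * (l * Λ x))

      shifted : ∀ {v} → 0ℚ ≤ v → v ≤ L x → (v + 1ℚ) ^ j - v ^ j ≤ β
      shifted {v} 0≤v v≤L = go j
        where
        go : ∀ j → (v + 1ℚ) ^ j - v ^ j ≤ fromℕ j * ((1ℚ + 1ℚ) ^ j * (L x ^ j * Λ x))
        go zero = ≤-reflexive (solve 1 (λ a → con 1ℚ :- con 1ℚ := con 0ℚ :* (con 1ℚ :* (con 1ℚ :* a))) refl (Λ x))
        go (suc j) = begin
          (v + 1ℚ) ^ suc j - v ^ suc j               ≤⟨ ^-difference 0≤v (p≤p+q 0≤1) j ⟩
          fromℕ (suc j) * (v + 1ℚ) ^ j * (v + 1ℚ - v) ≡⟨ solve 3 (λ n p v → n :* p :* (v :+ con 1ℚ :- v) := n :* p) refl (fromℕ (suc j)) ((v + 1ℚ) ^ j) v ⟩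
          fromℕ (suc j) * (v + 1ℚ) ^ j               ≤⟨ *-monoˡ (0≤fromℕ (suc j)) (^-mono (0≤+ 0≤v 0≤1) (≤-trans (+-mono-≤ v≤L (1≤L x)) (≤-reflexive (solve 1 (λ l → l :+ l := (con 1ℚ :+ con 1ℚ) :* l) refl (L x)))) j) ⟩
          fromℕ (suc j) * ((1ℚ + 1ℚ) * L x) ^ j      ≡⟨ cong (fromℕ (suc j) *_) (^-distrib-* (1ℚ + 1ℚ) (L x) j) ⟩
          fromℕ (suc j) * ((1ℚ + 1ℚ) ^ j * L x ^ j)  ≤⟨ *-monoˡ (0≤fromℕ (suc j)) (*-monoʳ (0≤L^ x j) (≤-trans (≤-reflexive (sym (*-identityˡ ((1ℚ + 1ℚ) ^ j)))) (*-monoʳ {(1ℚ + 1ℚ) ^ j} {1ℚ} {1ℚ + 1ℚ} (0≤^ (0≤+ 0≤1 0≤1) j) (p≤p+q {1ℚ} 0≤1)))) ⟩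
          fromℕ (suc j) * ((1ℚ + 1ℚ) ^ suc j * L x ^ j) ≡⟨ cong (λ t → fromℕ (suc j) * ((1ℚ + 1ℚ) ^ suc j * t)) (sym (L^suc*Λ x j)) ⟩
          fromℕ (suc j) * ((1ℚ + 1ℚ) ^ suc j * (L x ^ suc j * Λ x)) ∎

      term : ∀ i → i ℕ.< x → ∣ n * G j (x ÷ suc i) - X * (w i ^ suc j - w (suc i) ^ suc j) ∣ ≤ n * l + X * (n * β) * recip (suc i)
      term i i<x = begin
        ∣ n * (Y * Ly ^ j) - X * (w i ^ suc j - v ^ suc j) ∣      ≤⟨ ∣-∣-triangle (n * (Y * Ly ^ j)) (n * (X * r * Ly ^ j)) (X * (w i ^ suc j - v ^ suc j)) ⟩
        ∣ n * (Y * Ly ^ j) - n * (X * r * Ly ^ j) ∣ + ∣ n * (X * r * Ly ^ j) - X * (w i ^ suc j - v ^ suc j) ∣ ≤⟨ +-mono-≤ first second ⟩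
        n * l + X * (n * β) * r                                   ∎
        where
        r = recip (suc i)
        y = x ÷ suc i
        Y = fromℕ y
        Ly = L y
        v = w (suc i)
        w≡ : w i ≡ v + r
        w≡ = solve 3 (λ l h r → l :- h := l :- (h :+ r) :+ r) refl (L x) (H i) r
        0≤v : 0ℚ ≤ v
        0≤v = 0≤difference (≤-trans (H-mono i<x) (H≤L x))
        v≤L : v ≤ L x
        v≤L = ≤-by (H (suc i)) (0≤H (suc i)) (solve 2 (λ l h → l :- h :+ h := l) refl (L x) (H (suc i)))
        v≤Ly : v ≤ Ly
        v≤Ly = ≤-trans (+-monoˡ-≤ (- H (suc i)) (L-÷-upper x (suc i))) (≤-reflexive (solve 2 (λ h l → h :+ l :- h := l) refl (H (suc i)) Ly))
        first : ∣ n * (Y * Ly ^ j) - n * (X * r * Ly ^ j) ∣ ≤ n * l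
        first = begin
          ∣ n * (Y * Ly ^ j) - n * (X * r * Ly ^ j) ∣    ≡⟨ ∣-∣-sym (n * (Y * Ly ^ j)) (n * (X * r * Ly ^ j)) ⟩
          ∣ n * (X * r * Ly ^ j) - n * (Y * Ly ^ j) ∣    ≡⟨ cong ∣_∣ (solve 4 (λ n a y p → n :* (a :* p) :- n :* (y :* p) := n :* ((a :- y) :* p)) refl n (X * r) Y (Ly ^ j)) ⟩
          ∣ n * ((X * r - Y) * Ly ^ j) ∣                 ≡⟨ 0≤p⇒∣p∣≡p (0≤* (0≤fromℕ (suc j)) (0≤* (0≤difference (fromℕ-÷-≤ x i)) (0≤L^ y j))) ⟩
          n * ((X * r - Y) * Ly ^ j)                     ≤⟨ *-monoˡ (0≤fromℕ (suc j)) (*-mono (0≤difference (fromℕ-÷-≤ x i)) (0≤L^ y j) (fromℕ-÷-≥ x i) (^-mono (0≤L y) (L-mono (÷-≤ x (suc i))) j)) ⟩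
          n * (1ℚ * l)                                   ≡⟨ cong (n *_) (*-identityˡ l) ⟩
          n * l                                          ∎
        -- Apart from the factor X, both quantities lie between n v^j r and n (v + 1)^j r: the first
        -- because L(y) lies between v and v + 1, the second by the two mean value inequalities.
        second : ∣ n * (X * r * Ly ^ j) - X * (w i ^ suc j - v ^ suc j) ∣ ≤ X * (n * β) * r
        second = begin
          ∣ n * (X * r * Ly ^ j) - X * (w i ^ suc j - v ^ suc j) ∣   ≡⟨ cong ∣_∣ (solve 5 (λ n x r p d → n :* (x :* r :* p) :- x :* d := x :* (n :* p :* r :- d)) refl n X r (Ly ^ j) (w i ^ suc j - v ^ suc j)) ⟩
          ∣ X * (n * Ly ^ j * r - (w i ^ suc j - v ^ suc j)) ∣       ≡⟨ trans (∣p*q∣≡∣p∣*∣q∣ X _) (cong (_* ∣ n * Ly ^ j * r - (w i ^ suc j - v ^ suc j) ∣) (0≤p⇒∣p∣≡p (0≤fromℕ x))) ⟩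
          X * ∣ n * Ly ^ j * r - (w i ^ suc j - v ^ suc j) ∣         ≤⟨ *-monoˡ (0≤fromℕ x) (between lower₁ upper₁ lower₂ upper₂) ⟩
          X * (n * (v + 1ℚ) ^ j * r - n * v ^ j * r)                 ≡⟨ solve 5 (λ x n p q r → x :* (n :* p :* r :- n :* q :* r) := x :* (n :* (p :- q)) :* r) refl X n ((v + 1ℚ) ^ j) (v ^ j) r ⟩
          X * (n * ((v + 1ℚ) ^ j - v ^ j)) * r                       ≤⟨ *-monoʳ 0≤r (*-monoˡ (0≤fromℕ x) (*-monoˡ (0≤fromℕ (suc j)) (shifted 0≤v v≤L))) ⟩
          X * (n * β) * r                                            ∎
          where
          0≤r = 0≤recip (suc i)
          nr : ∀ {a b} → a ≤ b → n * a * r ≤ n * b * r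
          nr h = *-monoʳ 0≤r (*-monoˡ (0≤fromℕ (suc j)) h)
          lower₁ = nr (^-mono 0≤v v≤Ly j)
          upper₁ = nr (^-mono (0≤L y) (L-÷-lower i<x) j)
          d≡r : (v + r) - v ≡ r
          d≡r = solve 2 (λ v r → v :+ r :- v := r) refl v r
          lower₂ : n * v ^ j * r ≤ w i ^ suc j - v ^ suc j
          lower₂ = subst₂ (λ a d → n * v ^ j * d ≤ a ^ suc j - v ^ suc j) (sym w≡) d≡r (^-difference-lower 0≤v (p≤p+q 0≤r) j)
          upper₂ : w i ^ suc j - v ^ suc j ≤ n * (v + 1ℚ) ^ j * r
          upper₂ = subst (λ a → a ^ suc j - v ^ suc j ≤ n * (v + 1ℚ) ^ j * r) (sym w≡) (≤-trans (^-difference 0≤v (p≤p+q 0≤r) j)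
            (≤-trans (≤-reflexive (cong (n * (v + r) ^ j *_) d≡r)) (nr (^-mono (0≤+ 0≤v 0≤r) (+-monoʳ-≤ v (recip≤1 (suc i))) j))))

      telescope : ∀ m → sum (λ i → X * (w i ^ suc j - w (suc i) ^ suc j)) m ≡ X * (w 0 ^ suc j - w m ^ suc j)
      telescope zero    = solve 2 (λ x a → con 0ℚ := x :* (a :- a)) refl X (w 0 ^ suc j)
      telescope (suc m) = trans (cong (_+ X * (w m ^ suc j - w (suc m) ^ suc j)) (telescope m))
        (solve 4 (λ x a b c → x :* (a :- b) :+ x :* (b :- c) := x :* (a :- c)) refl X (w 0 ^ suc j) (w m ^ suc j) (w (suc m) ^ suc j))

    -- The discrete form of the integral of (j + 1) (log(x/t))^j dt/t over 1 ≤ t ≤ x, which is (log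
    -- x)^(j+1): each term is compared with a difference of (j + 1)-st powers of `w`.
    G-sum : ∣ fromℕ (suc j) * sum (λ i → G j (x ÷ suc i)) x - G (suc j) x ∣ ≤ K j * G j x
    G-sum = begin
      ∣ n * S - X * L x ^ suc j ∣                               ≤⟨ ∣-∣-triangle (n * S) (X * (L x ^ suc j - 1ℚ)) (X * L x ^ suc j) ⟩
      ∣ n * S - X * (L x ^ suc j - 1ℚ) ∣ + ∣ X * (L x ^ suc j - 1ℚ) - X * L x ^ suc j ∣ ≤⟨ +-mono-≤ main boundary ⟩
      (n * X * l + n * (fromℕ j * 2^j) * (X * l)) + X * l       ≡⟨ solve 4 (λ n c x l → n :* x :* l :+ n :* c :* (x :* l) :+ x :* l := (n :+ n :* c :+ con 1ℚ) :* (x :* l)) refl n (fromℕ j * 2^j) X l ⟩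
      K j * G j x                                               ∎
      where
      S = sum (λ i → G j (x ÷ suc i)) x
      w0 : w 0 ≡ L x
      w0 = solve 1 (λ l → l :- con 0ℚ := l) refl (L x)
      wx : w x ≡ 1ℚ
      wx = solve 1 (λ h → con 1ℚ :+ h :- h := con 1ℚ) refl (H x)
      1^ : ∀ m → 1ℚ ^ m ≡ 1ℚ
      1^ zero    = refl
      1^ (suc m) = trans (*-identityˡ _) (1^ m)
      -- The telescoping sum ends at `w x`, which is 1 and not 0, as `L x` is 1 + `H x`.
      boundary : ∣ X * (L x ^ suc j - 1ℚ) - X * L x ^ suc j ∣ ≤ X * l
      boundary = begin
        ∣ X * (L x ^ suc j - 1ℚ) - X * L x ^ suc j ∣   ≡⟨ cong ∣_∣ (solve 2 (λ x l → x :* (l :- con 1ℚ) :- x :* l := :- x) refl X (L x ^ suc j)) ⟩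
        ∣ - X ∣                                        ≡⟨ trans (∣-p∣≡∣p∣ X) (0≤p⇒∣p∣≡p (0≤fromℕ x)) ⟩
        X                                              ≡⟨ sym (*-identityʳ X) ⟩
        X * 1ℚ                                         ≤⟨ *-monoˡ (0≤fromℕ x) (1≤^ (1≤L x) j) ⟩
        X * l                                          ∎
      main : ∣ n * S - X * (L x ^ suc j - 1ℚ) ∣ ≤ n * X * l + n * (fromℕ j * 2^j) * (X * l)
      main = begin
        ∣ n * S - X * (L x ^ suc j - 1ℚ) ∣
          ≡⟨ cong ∣_∣ (cong₂ _-_ (sym (sum-*ˡ n _ x)) (sym (trans (telescope x) (cong₂ (λ a b → X * (a - b)) (cong (_^ suc j) w0) (trans (cong (_^ suc j) wx) (1^ (suc j))))))) ⟩
        ∣ sum (λ i → n * G j (x ÷ suc i)) x - sum (λ i → X * (w i ^ suc j - w (suc i) ^ suc j)) x ∣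
          ≡⟨ cong ∣_∣ (sym (ℚ-sums.sum-− (λ i → n * G j (x ÷ suc i)) (λ i → X * (w i ^ suc j - w (suc i) ^ suc j)) x)) ⟩
        ∣ sum (λ i → n * G j (x ÷ suc i) - X * (w i ^ suc j - w (suc i) ^ suc j)) x ∣
          ≤⟨ ∣sum∣ x term ⟩
        sum (λ i → n * l + X * (n * β) * recip (suc i)) x
          ≡⟨ trans (sum-+ (λ _ → n * l) _ x) (cong₂ _+_ (sum-const (n * l) x) (sum-*ˡ (X * (n * β)) _ x)) ⟩
        X * (n * l) + X * (n * β) * H x
          ≡⟨ solve 7 (λ x n l j p a h → x :* (n :* l) :+ x :* (n :* (j :* (p :* (l :* a)))) :* h := n :* x :* l :+ n :* (j :* p) :* (x :* l) :* (h :* a)) refl X n l (fromℕ j) 2^j (Λ x) (H x) ⟩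
        n * X * l + n * (fromℕ j * 2^j) * (X * l) * (H x * Λ x)
          ≤⟨ +-monoʳ-≤ (n * X * l) (*-monoˡ (0≤* (0≤* (0≤fromℕ (suc j)) (0≤* (0≤fromℕ j) (0≤^ (0≤+ 0≤1 0≤1) j))) (0≤G j x)) (≤-trans (*-monoʳ (0≤Λ x) (H≤L x)) (≤-reflexive (L*Λ x)))) ⟩
        n * X * l + n * (fromℕ j * 2^j) * (X * l) * 1ℚ
          ≡⟨ cong (n * X * l +_) (*-identityʳ _) ⟩
        n * X * l + n * (fromℕ j * 2^j) * (X * l) ∎

  G-sum-≤ : ∀ j x → sum (λ i → G j (x ÷ suc i)) x ≤ G (suc j) x
  G-sum-≤ j x = begin
    sum (λ i → G j (x ÷ suc i)) x           ≤⟨ sum-mono x (λ i _ → G-÷-≤ j x i) ⟩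
    sum (λ i → G j x * recip (suc i)) x     ≡⟨ sum-*ˡ (G j x) _ x ⟩
    G j x * H x                             ≤⟨ *-monoˡ (0≤G j x) (H≤L x) ⟩
    G j x * L x                             ≡⟨ solve 3 (λ x p l → (x :* p) :* l := x :* (l :* p)) refl (fromℕ x) (L x ^ j) (L x) ⟩
    G (suc j) x                             ∎

-- Convergent series and products over prime powers.

module Weights where
  open import Data.Nat as ℕ using (ℕ; zero; suc; z≤n; s≤s)
  import Data.Nat.Properties as ℕₚ
  open import Data.Integer using (+_)
  open import Data.Rational hiding (_÷_)
  open import Data.Rational.Properties
  open import Data.Rational.Solver using (module +-*-Solver)
  open import Data.Product using (∃; _×_; _,_)
  open import Relation.Nullary using (yes; no)
  open import Relation.Binary.PropositionalEquality using (_≡_; refl; sym; trans; cong)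
  open Rationals
  open Sums
  open Harmonic
  open ℚ-sums using (sum; sum-mono; sum-cong; sum-*ˡ)
  open +-*-Solver using (solve; _:=_; _:+_; _:*_; _:-_; :-_; con)
  open ≤-Reasoning

  -- Both are below 2. Growth like ρ^α leaves the ratio ρ/p at most 3/4 even for p = 2, and σ =
  -- (7/6) ρ absorbs a further factor α + 1 with the ratio still at most 7/8.
  ρ σ : ℚ
  ρ = + 3 / 2
  σ = + 7 / 4

  private
    1≤ρ : 1ℚ ≤ ρ
    1≤ρ = ≤-by ½ 0≤½ refl

    0≤ρ : 0ℚ ≤ ρ
    0≤ρ = nonNegative⁻¹ ρ

    0≤σ : 0ℚ ≤ σ
    0≤σ = nonNegative⁻¹ σ

  0≤ρ^ : ∀ n → 0ℚ ≤ ρ ^ n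
  0≤ρ^ = 0≤^ 0≤ρ

  -- Used to bound (1 + t)^n from above by 1/(1 - n t); in this form it needs no condition on n t.
  inverse-bernoulli : ∀ {t} → 0ℚ ≤ t → ∀ n → (1ℚ + t) ^ n * (1ℚ - fromℕ n * t) ≤ 1ℚ
  inverse-bernoulli {t} 0≤t zero = ≤-reflexive (solve 1 (λ t → con 1ℚ :* (con 1ℚ :- con 0ℚ :* t) := con 1ℚ) refl t)
  inverse-bernoulli {t} 0≤t (suc n) = begin
    (1ℚ + t) * p * (1ℚ - fromℕ (suc n) * t)   ≡⟨ cong (λ x → (1ℚ + t) * p * (1ℚ - x * t)) (fromℕ-suc n) ⟩
    (1ℚ + t) * p * (1ℚ - (1ℚ + x) * t)        ≤⟨ ≤-by (p * ((1ℚ + x) * (t * t))) (0≤* (0≤^ (0≤+ 0≤1 0≤t) n) (0≤* (0≤+ 0≤1 (0≤fromℕ n)) (0≤* 0≤t 0≤t)))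
        (solve 3 (λ t p x → (con 1ℚ :+ t) :* p :* (con 1ℚ :- (con 1ℚ :+ x) :* t) :+ p :* ((con 1ℚ :+ x) :* (t :* t)) := p :* (con 1ℚ :- x :* t)) refl t p x) ⟩
    p * (1ℚ - x * t)                          ≤⟨ inverse-bernoulli 0≤t n ⟩
    1ℚ                                        ∎
    where
    p = (1ℚ + t) ^ n
    x = fromℕ n

  -- For α ≥ 3 l consecutive values have ratio at most 1/(1 - l/(α + 1)) ≤ 1/(1 - 1/3) = ρ, by
  -- `inverse-bernoulli`; the values up to 3 l are covered by C.
  polynomial≤exponential : ∀ l → ∃ λ C → 0ℚ ≤ C × ∀ α → fromℕ (suc α) ^ l ≤ C * ρ ^ α
  polynomial≤exponential l = C , 0≤C , bound
    where
    C = fromℕ (suc (3 ℕ.* l)) ^ l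
    0≤C : 0ℚ ≤ C
    0≤C = 0≤^ (0≤fromℕ (suc (3 ℕ.* l))) l
    small : ∀ α → α ℕ.≤ 3 ℕ.* l → fromℕ (suc α) ^ l ≤ C * ρ ^ α
    small α h = ≤-trans (^-mono (0≤fromℕ (suc α)) (fromℕ-mono (s≤s h)) l)
      (≤-trans (≤-reflexive (sym (*-identityʳ C))) (*-monoˡ 0≤C (1≤^ 1≤ρ α)))
    step : ∀ α → 3 ℕ.* l ℕ.≤ α → fromℕ (suc (suc α)) ^ l ≤ ρ * fromℕ (suc α) ^ l
    step α h = begin
      fromℕ (suc (suc α)) ^ l     ≡⟨ cong (_^ l) (trans (fromℕ-suc (suc α)) (trans (cong (_+ x) (sym (fromℕ-recip α))) (solve 2 (λ x t → x :* t :+ x := (con 1ℚ :+ t) :* x) refl x t))) ⟩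
      ((1ℚ + t) * x) ^ l          ≡⟨ ^-distrib-* (1ℚ + t) x l ⟩
      (1ℚ + t) ^ l * x ^ l        ≤⟨ *-monoʳ (0≤^ (0≤fromℕ (suc α)) l) ratio ⟩
      ρ * x ^ l                   ∎
      where
      x = fromℕ (suc α)
      t = recip (suc α)
      3lt : (1ℚ + 1ℚ + 1ℚ) * (fromℕ l * t) ≤ 1ℚ
      3lt = begin
        (1ℚ + 1ℚ + 1ℚ) * (fromℕ l * t)   ≡⟨ trans (sym (*-assoc (1ℚ + 1ℚ + 1ℚ) (fromℕ l) t)) (cong (_* t) (sym (fromℕ-* 3 l))) ⟩
        fromℕ (3 ℕ.* l) * t              ≤⟨ *-monoʳ (0≤recip (suc α)) (fromℕ-mono (ℕₚ.≤-trans h (ℕₚ.n≤1+n α))) ⟩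
        x * t                            ≡⟨ fromℕ-recip α ⟩
        1ℚ                               ∎
      ⅔ : ℚ
      ⅔ = + 2 / 3
      ⅔≤ : ⅔ ≤ 1ℚ - fromℕ l * t
      ⅔≤ = begin
        ⅔                                             ≤⟨ ≤-by (+ 1 / 3 * (1ℚ - (1ℚ + 1ℚ + 1ℚ) * (fromℕ l * t))) (0≤* (0≤recip 3) (0≤difference 3lt))
          (solve 1 (λ a → con ⅔ :+ con (+ 1 / 3) :* (con 1ℚ :- (con 1ℚ :+ con 1ℚ :+ con 1ℚ) :* a) := con 1ℚ :- a) refl (fromℕ l * t)) ⟩
        1ℚ - fromℕ l * t ∎
      ratio : (1ℚ + t) ^ l ≤ ρ
      ratio = *-cancel-≤ {r = ⅔} (positive⁻¹ ⅔) (≤-trans (*-monoˡ (0≤^ (0≤+ 0≤1 (0≤recip (suc α))) l) ⅔≤) (inverse-bernoulli (0≤recip (suc α)) l))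
    bound : ∀ α → fromℕ (suc α) ^ l ≤ C * ρ ^ α
    bound zero = small 0 z≤n
    bound (suc α) with suc α ℕ.≤? 3 ℕ.* l
    ... | yes h = small (suc α) h
    ... | no ¬h = ≤-trans (step α (ℕ.s≤s⁻¹ (ℕₚ.≰⇒> ¬h))) (≤-trans (*-monoˡ 0≤ρ (bound α))
      (≤-reflexive (solve 3 (λ r c p → r :* (c :* p) := c :* (r :* p)) refl ρ C (ρ ^ α))))

  -- Bernoulli's inequality gives n + 1 ≤ 6 (1 + 1/6)^n, and (7/6) ρ = σ.
  linear*ρ^ : ∀ n → fromℕ (suc n) * ρ ^ n ≤ fromℕ 6 * σ ^ n
  linear*ρ^ n = begin
    fromℕ (suc n) * ρ ^ n                       ≤⟨ *-monoʳ (0≤ρ^ n) base ⟩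
    fromℕ 6 * (1ℚ + + 1 / 6) ^ n * ρ ^ n        ≡⟨ trans (*-assoc (fromℕ 6) ((1ℚ + + 1 / 6) ^ n) (ρ ^ n)) (cong (fromℕ 6 *_) (sym (^-distrib-* (1ℚ + + 1 / 6) ρ n))) ⟩
    fromℕ 6 * σ ^ n                             ∎
    where
    base : fromℕ (suc n) ≤ fromℕ 6 * (1ℚ + + 1 / 6) ^ n
    base = begin
      fromℕ (suc n)                        ≡⟨ fromℕ-suc n ⟩
      1ℚ + fromℕ n                         ≤⟨ ≤-by (fromℕ 5) (0≤fromℕ 5) (solve 1 (λ x → con 1ℚ :+ x :+ con (fromℕ 5) := con (fromℕ 6) :* (con 1ℚ :+ x :* con (+ 1 / 6))) refl (fromℕ n)) ⟩
      fromℕ 6 * (1ℚ + fromℕ n * (+ 1 / 6)) ≤⟨ *-monoˡ (0≤fromℕ 6) (bernoulli (0≤recip 6) n) ⟩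
      fromℕ 6 * (1ℚ + + 1 / 6) ^ n         ∎

  -- The condition 1 + s q ≤ s expresses s ≥ 1/(1 - q) without division. The remainder s q^n is kept
  -- on the left to carry the induction.
  geometric-sum : ∀ {q s} → 0ℚ ≤ q → 1ℚ + s * q ≤ s → 0ℚ ≤ s → ∀ n → sum (q ^_) n + s * q ^ n ≤ s
  geometric-sum {q} {s} 0≤q h 0≤s zero = ≤-reflexive (solve 1 (λ s → con 0ℚ :+ s :* con 1ℚ := s) refl s)
  geometric-sum {q} {s} 0≤q h 0≤s (suc n) = begin
    sum (q ^_) n + q ^ n + s * (q * q ^ n)     ≡⟨ solve 4 (λ a p s q → a :+ p :+ s :* (q :* p) := a :+ (con 1ℚ :+ s :* q) :* p) refl (sum (q ^_) n) (q ^ n) s q ⟩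
    sum (q ^_) n + (1ℚ + s * q) * q ^ n        ≤⟨ +-monoʳ-≤ (sum (q ^_) n) (*-monoʳ (0≤^ 0≤q n) h) ⟩
    sum (q ^_) n + s * q ^ n                   ≤⟨ geometric-sum 0≤q h 0≤s n ⟩
    s                                          ∎

  -- Σ p^(-α) (3/2)^α L(p^α) over α ≥ 2 is O(a p).
  a : ℕ → ℚ
  a n = L n * (recip n * recip n)

  0≤a : ∀ n → 0ℚ ≤ a n
  0≤a n = 0≤* (0≤L n) (0≤* (0≤recip n) (0≤recip n))

  weight : ℕ → ℕ → ℚ
  weight p α = ρ ^ α * (L (p ℕ.^ α) * recip (p ℕ.^ α))

  recip≤½ : ∀ {p} → 2 ℕ.≤ p → recip p ≤ ½
  recip≤½ {suc p} (s≤s h) = recip-anti {1} {p} h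

  weight-≤ : ∀ p α → weight (suc p) α ≤ fromℕ 6 * L (suc p) * (σ * recip (suc p)) ^ α
  weight-≤ p α = begin
    ρ ^ α * (L (suc p ℕ.^ α) * recip (suc p ℕ.^ α))           ≤⟨ *-monoˡ (0≤ρ^ α) (*-mono (0≤L (suc p ℕ.^ α)) (0≤recip (suc p ℕ.^ α)) (L-^ p α) (≤-reflexive (recip-^ (suc p) α))) ⟩
    ρ ^ α * (fromℕ (suc α) * L (suc p) * recip (suc p) ^ α)   ≡⟨ solve 4 (λ r x l y → r :* (x :* l :* y) := (x :* r) :* (l :* y)) refl (ρ ^ α) (fromℕ (suc α)) (L (suc p)) (recip (suc p) ^ α) ⟩
    fromℕ (suc α) * ρ ^ α * (L (suc p) * recip (suc p) ^ α)   ≤⟨ *-monoʳ (0≤* (0≤L (suc p)) (0≤^ (0≤recip (suc p)) α)) (linear*ρ^ α) ⟩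
    fromℕ 6 * σ ^ α * (L (suc p) * recip (suc p) ^ α)         ≡⟨ solve 4 (λ c s l y → c :* s :* (l :* y) := c :* l :* (s :* y)) refl (fromℕ 6) (σ ^ α) (L (suc p)) (recip (suc p) ^ α) ⟩
    fromℕ 6 * L (suc p) * (σ ^ α * recip (suc p) ^ α)         ≡⟨ cong (fromℕ 6 * L (suc p) *_) (sym (^-distrib-* σ (recip (suc p)) α)) ⟩
    fromℕ 6 * L (suc p) * (σ * recip (suc p)) ^ α             ∎

  -- 147 = 6 (7/4)^2 8: the 6 is from `linear*ρ^`, the square is from starting at α = 2, and 8 =
  -- 1/(1 - 7/8) sums the geometric series.
  weight-sum : ∀ {p} → 2 ℕ.≤ p → ∀ n → sum (λ α → weight p (suc (suc α))) n ≤ fromℕ 147 * a p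
  weight-sum {suc p-1} 2≤p n = begin
    sum (λ α → weight p (suc (suc α))) n                     ≤⟨ sum-mono n (λ α _ → weight-≤ p-1 (suc (suc α))) ⟩
    sum (λ α → c * (q * (q * q ^ α))) n                      ≡⟨ sum-cong n (λ α _ → solve 3 (λ c q r → c :* (q :* (q :* r)) := c :* q :* q :* r) refl c q (q ^ α)) ⟩
    sum (λ α → c * q * q * q ^ α) n                          ≡⟨ sum-*ˡ (c * q * q) (q ^_) n ⟩
    c * q * q * sum (q ^_) n                                 ≤⟨ *-monoˡ (0≤* (0≤* (0≤* (0≤fromℕ 6) (0≤L p)) 0≤q) 0≤q)
        (≤-trans (p≤p+q (0≤* (0≤fromℕ 8) (0≤^ 0≤q n))) (geometric-sum 0≤q ratio (0≤fromℕ 8) n)) ⟩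
    c * q * q * fromℕ 8                                      ≡⟨ solve 2 (λ l y → con (fromℕ 6) :* l :* (con σ :* y) :* (con σ :* y) :* con (fromℕ 8) := con (fromℕ 147) :* (l :* (y :* y))) refl (L p) y ⟩
    fromℕ 147 * a p                                          ∎
    where
    p = suc p-1
    y = recip p
    q = σ * y
    c = fromℕ 6 * L p
    0≤q : 0ℚ ≤ q
    0≤q = 0≤* 0≤σ (0≤recip p)
    ratio : 1ℚ + fromℕ 8 * q ≤ fromℕ 8
    ratio = ≤-trans (+-monoʳ-≤ 1ℚ (*-monoˡ (0≤fromℕ 8) (*-monoˡ 0≤σ (recip≤½ 2≤p)))) (≤-reflexive refl)

  -- The Euler products below are dominated by powers of this convergent product.
  ϖ : ℕ → ℚ
  ϖ zero          = 1ℚ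
  ϖ (suc zero)    = 1ℚ
  ϖ (suc (suc n)) = ϖ (suc n) * (1ℚ + recip 8 * a (suc (suc n)))

  1≤ϖ : ∀ n → 1ℚ ≤ ϖ n
  1≤ϖ zero          = ≤-refl
  1≤ϖ (suc zero)    = ≤-refl
  1≤ϖ (suc (suc n)) = *-mono 0≤1 0≤1 (1≤ϖ (suc n)) (p≤p+q (0≤* (0≤recip 8) (0≤a (suc (suc n)))))

  0≤ϖ : ∀ n → 0ℚ ≤ ϖ n
  0≤ϖ n = ≤-trans 0≤1 (1≤ϖ n)

  u≤4 : ∀ n → u (suc n) ≤ fromℕ 4
  u≤4 zero    = ≤-reflexive refl
  u≤4 (suc n) = ≤-trans (≤-by (u (suc n) - u (suc (suc n))) (≤-trans (0≤a (suc (suc n))) (u-telescopes n))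
    (solve 2 (λ v w → v :+ (w :- v) := w) refl (u (suc (suc n))) (u (suc n)))) (u≤4 n)

  -- The product ϖ(n) (1/2 + u(n)/8) equals 1 at n = 1, where u = 4, and does not increase
  -- afterwards: the decrement of `u` pays for the new factor. The 1/8 in ϖ is chosen so that u/8 ≤
  -- 1/2.
  ϖ-bound : ∀ n → ϖ n ≤ 1ℚ + 1ℚ
  ϖ-bound zero    = p≤p+q 0≤1
  ϖ-bound (suc n) = *-cancel-≤ {r = ½} (positive⁻¹ ½) (≤-trans (*-monoˡ (0≤ϖ (suc n)) half) (invariant n))
    where
    invariant : ∀ n → ϖ (suc n) * (½ + recip 8 * u (suc n)) ≤ 1ℚ
    invariant zero    = ≤-reflexive refl
    invariant (suc n) = begin
      ϖ (suc n) * (1ℚ + e * x) * (½ + e * v)         ≡⟨ *-assoc (ϖ (suc n)) (1ℚ + e * x) (½ + e * v) ⟩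
      ϖ (suc n) * ((1ℚ + e * x) * (½ + e * v))       ≤⟨ *-monoˡ (0≤ϖ (suc n)) (≤-by (e * (w - v - x) + e * x * (½ - e * v))
        (0≤+ (0≤* (0≤recip 8) (0≤difference (u-telescopes n))) (0≤* (0≤* (0≤recip 8) (0≤a (suc (suc n)))) (0≤difference (*-monoˡ (0≤recip 8) (u≤4 (suc n))))))
        (solve 3 (λ x v w → (con 1ℚ :+ con e :* x) :* (con ½ :+ con e :* v) :+ (con e :* (w :- v :- x) :+ con e :* x :* (con ½ :- con e :* v)) := con ½ :+ con e :* w) refl x v w)) ⟩
      ϖ (suc n) * (½ + e * w)                        ≤⟨ invariant n ⟩
      1ℚ                                             ∎
      where
      e = recip 8
      x = a (suc (suc n))
      v = u (suc (suc n))
      w = u (suc n)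
    half : ½ ≤ ½ + recip 8 * u (suc n)
    half = p≤p+q (0≤* (0≤recip 8) (0≤u (suc n)))

  recip-scaled-small : ∀ {B} → 0ℚ ≤ B → ∀ ε → 0ℚ < ε → ∃ λ N → ∀ n → N ℕ.≤ n → B * recip (suc n) ≤ ε
  recip-scaled-small {B} 0≤B ε ε>0 =
    let B+1>0 = <-≤-trans 0<1 (p≤q+p 0≤B)
        N , hN = recip-small (ε * reciprocal B+1>0) (pos* ε>0 (reciprocal>0 B+1>0))
    in N , λ n N≤n → ≤-trans (*-mono 0≤B (0≤recip (suc n)) (p≤p+q 0≤1) (≤-trans (recip-anti N≤n) hN)) (≤-reflexive (cancel B+1>0 ε))

  -- This is ρ/2, the largest ratio ρ/p; it governs the convergence of all local series.
  θ : ℚ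
  θ = + 3 / 4

  0≤θ : 0ℚ ≤ θ
  0≤θ = nonNegative⁻¹ θ

  θ^-≤ : ∀ n → θ ^ n ≤ fromℕ 3 * recip (suc n)
  θ^-≤ n = *-cancel-≤ (0<fromℕ n) (begin
    θ ^ n * fromℕ (suc n)                          ≡⟨ cong (θ ^ n *_) (fromℕ-suc n) ⟩
    θ ^ n * (1ℚ + fromℕ n)                         ≤⟨ *-monoˡ (0≤^ 0≤θ n) (≤-by (fromℕ 2) (0≤fromℕ 2) (solve 1 (λ x → con 1ℚ :+ x :+ con (fromℕ 2) := con (fromℕ 3) :* (con 1ℚ :+ x :* con (recip 3))) refl (fromℕ n))) ⟩
    θ ^ n * (fromℕ 3 * (1ℚ + fromℕ n * recip 3))   ≤⟨ *-monoˡ (0≤^ 0≤θ n) (*-monoˡ (0≤fromℕ 3) (bernoulli (0≤recip 3) n)) ⟩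
    θ ^ n * (fromℕ 3 * (1ℚ + recip 3) ^ n)         ≡⟨ solve 3 (λ a b c → a :* (b :* c) := b :* (a :* c)) refl (θ ^ n) (fromℕ 3) ((1ℚ + recip 3) ^ n) ⟩
    fromℕ 3 * (θ ^ n * (1ℚ + recip 3) ^ n)         ≡⟨ cong (fromℕ 3 *_) (trans (sym (^-distrib-* θ (1ℚ + recip 3) n)) (1^ n)) ⟩
    fromℕ 3 * 1ℚ                                   ≡⟨ cong (fromℕ 3 *_) (trans (sym (fromℕ-recip n)) (*-comm (fromℕ (suc n)) (recip (suc n)))) ⟩
    fromℕ 3 * (recip (suc n) * fromℕ (suc n))      ≡⟨ sym (*-assoc (fromℕ 3) (recip (suc n)) (fromℕ (suc n))) ⟩
    fromℕ 3 * recip (suc n) * fromℕ (suc n)        ∎)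
    where
    1^ : ∀ n → 1ℚ ^ n ≡ 1ℚ
    1^ zero    = refl
    1^ (suc n) = trans (*-identityˡ (1ℚ ^ n)) (1^ n)

  θ^-small : ∀ {B} → 0ℚ ≤ B → ∀ ε → 0ℚ < ε → ∃ λ N → ∀ n → N ℕ.≤ n → B * θ ^ n ≤ ε
  θ^-small {B} 0≤B ε ε>0 = let N , hN = recip-scaled-small (0≤* 0≤B (0≤fromℕ 3)) ε ε>0
    in N , λ n N≤n → ≤-trans (*-monoˡ 0≤B (θ^-≤ n)) (≤-trans (≤-reflexive (sym (*-assoc B (fromℕ 3) (recip (suc n))))) (hN n N≤n))

  ρ^*recip^-≤ : ∀ {p} → 2 ℕ.≤ p → ∀ α → ρ ^ α * recip (p ℕ.^ α) ≤ θ ^ α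
  ρ^*recip^-≤ {p} 2≤p α = begin
    ρ ^ α * recip (p ℕ.^ α)   ≡⟨ trans (cong (ρ ^ α *_) (recip-^ p α)) (sym (^-distrib-* ρ (recip p) α)) ⟩
    (ρ * recip p) ^ α         ≤⟨ ^-mono (0≤* 0≤ρ (0≤recip p)) (*-monoˡ 0≤ρ (recip≤½ 2≤p)) α ⟩
    θ ^ α                     ∎

  u-scaled-small : ∀ {B} → 0ℚ ≤ B → ∀ ε → 0ℚ < ε → ∃ λ N → ∀ n → N ℕ.≤ n → B * u (suc n) ≤ ε
  u-scaled-small {B} 0≤B ε ε>0 =
    let B+1>0 = <-≤-trans 0<1 (p≤q+p 0≤B)
        N , hN = u-small (ε * reciprocal B+1>0) (pos* ε>0 (reciprocal>0 B+1>0))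
    in N , λ n N≤n → ≤-trans (*-mono 0≤B (0≤u (suc n)) (p≤p+q 0≤1) (hN n N≤n)) (≤-reflexive (cancel B+1>0 ε))

  ϖ-mono : ∀ n → ϖ n ≤ ϖ (suc n)
  ϖ-mono zero    = ≤-refl
  ϖ-mono (suc n) = ≤-trans (≤-reflexive (sym (*-identityʳ (ϖ (suc n))))) (*-monoˡ (0≤ϖ (suc n)) (p≤p+q (0≤* (0≤recip 8) (0≤a (suc (suc n))))))

  -- A factor 1 + B a(p) with any constant B fits under a power of the one product ϖ: by Bernoulli
  -- (1 + a/8)^κ ≥ 1 + κ a/8 ≥ 1 + B a.
  ϖ^-step : ∀ {B} κ → fromℕ 8 * B ≤ fromℕ κ → ∀ n → ϖ (suc n) ^ κ * (1ℚ + B * a (suc (suc n))) ≤ ϖ (suc (suc n)) ^ κ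
  ϖ^-step {B} κ h n = begin
    ϖ (suc n) ^ κ * (1ℚ + B * x)                        ≡⟨ cong (λ t → ϖ (suc n) ^ κ * (1ℚ + t)) (solve 2 (λ b x → b :* x := (con (fromℕ 8) :* b) :* (con (recip 8) :* x)) refl B x) ⟩
    ϖ (suc n) ^ κ * (1ℚ + fromℕ 8 * B * (recip 8 * x))  ≤⟨ *-monoˡ (0≤^ (0≤ϖ (suc n)) κ) (+-monoʳ-≤ 1ℚ (*-monoʳ 0≤x/8 h)) ⟩
    ϖ (suc n) ^ κ * (1ℚ + fromℕ κ * (recip 8 * x))      ≤⟨ *-monoˡ (0≤^ (0≤ϖ (suc n)) κ) (bernoulli 0≤x/8 κ) ⟩
    ϖ (suc n) ^ κ * (1ℚ + recip 8 * x) ^ κ              ≡⟨ sym (^-distrib-* (ϖ (suc n)) (1ℚ + recip 8 * x) κ) ⟩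
    ϖ (suc (suc n)) ^ κ                                 ∎
    where
    x = a (suc (suc n))
    0≤x/8 : 0ℚ ≤ recip 8 * x
    0≤x/8 = 0≤* (0≤recip 8) (0≤a (suc (suc n)))

-- Complete normed algebras with rational norm bounds.

module BanachAlgebras where
  open import Algebra.Bundles using (CommutativeRing)
  open import Data.Nat as ℕ using (ℕ; zero; suc)
  import Data.Nat.Properties as ℕₚ
  open import Data.Rational as ℚ using (ℚ; 0ℚ; 1ℚ)
  import Data.Rational.Properties as ℚₚ
  open import Data.Product using (∃; _,_)
  open import Data.Maybe using (Maybe; just; nothing)
  open import Level using (0ℓ)
  open import Relation.Nullary using (yes; no)
  open import Relation.Binary.PropositionalEquality as ≡ using (_≡_)
  open import Algebra.Solver.Ring.AlmostCommutativeRing using (fromCommutativeRing; _-Raw-AlmostCommutative⟶_)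
  import Algebra.Solver.Ring as RingSolver
  open Rationals using (0≤1; split; half>0; pos*; reciprocal; reciprocal>0; cancel; p≤p+q)
  open Sums

  -- z ⊑ b says that the norm of z is at most b.
  record BanachAlgebra : Set₁ where
    field
      commutativeRing : CommutativeRing 0ℓ 0ℓ
    open CommutativeRing commutativeRing public hiding (zero)
    infix 4 _⊑_
    field
      ι         : ℚ → Carrier
      ι-0       : ι 0ℚ ≈ 0#
      ι-1       : ι 1ℚ ≈ 1#
      ι-+       : ∀ p q → ι (p ℚ.+ q) ≈ ι p + ι q
      ι-*       : ∀ p q → ι (p ℚ.* q) ≈ ι p * ι q
      ι-neg     : ∀ p → ι (ℚ.- p) ≈ - ι p
      _⊑_       : Carrier → ℚ → Set
      ⊑-resp    : ∀ {y z b} → y ≈ z → y ⊑ b → z ⊑ b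
      ⊑-mono    : ∀ {z b c} → b ℚ.≤ c → z ⊑ b → z ⊑ c
      ⊑⇒0≤      : ∀ {z b} → z ⊑ b → 0ℚ ℚ.≤ b
      ⊑-ι       : ∀ q → ι q ⊑ ℚ.∣ q ∣
      ⊑-+       : ∀ {y z b c} → y ⊑ b → z ⊑ c → y + z ⊑ b ℚ.+ c
      ⊑-*       : ∀ {y z b c} → y ⊑ b → z ⊑ c → y * z ⊑ b ℚ.* c
      ⊑-neg     : ∀ {z b} → z ⊑ b → - z ⊑ b
      ⊑-closed  : ∀ {z b} → (∀ ε → 0ℚ ℚ.< ε → z ⊑ b ℚ.+ ε) → z ⊑ b
      ⊑-bounded : ∀ z → ∃ λ b → z ⊑ b

    infix 4 _⟶_
    _⟶_ : (ℕ → Carrier) → Carrier → Set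
    a ⟶ z = ∀ ε → 0ℚ ℚ.< ε → ∃ λ N → ∀ n → N ℕ.≤ n → a n - z ⊑ ε

    field
      complete : (a : ℕ → Carrier) →
        (∀ ε → 0ℚ ℚ.< ε → ∃ λ N → ∀ m n → N ℕ.≤ m → m ℕ.≤ n → a n - a m ⊑ ε) → ∃ λ z → a ⟶ z

  module BanachAlgebra-lemmas (𝔸 : BanachAlgebra) where
    open BanachAlgebra 𝔸
    open import Relation.Binary.Reasoning.Setoid setoid

    private
      coefficients : ℚ.+-*-rawRing -Raw-AlmostCommutative⟶ fromCommutativeRing commutativeRing
      coefficients = record { ⟦_⟧ = ι ; +-homo = ι-+ ; *-homo = ι-* ; -‿homo = ι-neg ; 0-homo = ι-0 ; 1-homo = ι-1 }

      sameCoefficient : ∀ p q → Maybe (ι p ≈ ι q)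
      sameCoefficient p q with p ℚₚ.≟ q
      ... | yes ≡.refl = just refl
      ... | no  _      = nothing

    module Solver = RingSolver ℚ.+-*-rawRing (fromCommutativeRing commutativeRing) coefficients sameCoefficient
    open Solver using (solve; _:=_; _:+_; _:*_; _:-_; :-_)
    open Sum commutativeRing public

    infixr 9 _^_
    _^_ : Carrier → ℕ → Carrier
    z ^ zero  = 1#
    z ^ suc n = z * z ^ n

    ⊑-ι′ : ∀ {q} → 0ℚ ℚ.≤ q → ι q ⊑ q
    ⊑-ι′ {q} 0≤q = ≡.subst (ι q ⊑_) (ℚₚ.0≤p⇒∣p∣≡p 0≤q) (⊑-ι q)

    ⊑-ι-≤ : ∀ {p q} → ℚ.∣ p ∣ ℚ.≤ q → ι p ⊑ q
    ⊑-ι-≤ h = ⊑-mono h (⊑-ι _)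

    ⊑-0 : 0# ⊑ 0ℚ
    ⊑-0 = ⊑-resp ι-0 (⊑-ι′ ℚₚ.≤-refl)

    ⊑-1 : 1# ⊑ 1ℚ
    ⊑-1 = ⊑-resp ι-1 (⊑-ι′ 0≤1)

    ⊑-− : ∀ {y z b c} → y ⊑ b → z ⊑ c → y - z ⊑ b ℚ.+ c
    ⊑-− hy hz = ⊑-+ hy (⊑-neg hz)

    ⊑-swap : ∀ {y z b} → y - z ⊑ b → z - y ⊑ b
    ⊑-swap {y} {z} h = ⊑-resp (solve 2 (λ y z → :- (y :- z) := z :- y) refl y z) (⊑-neg h)

    ⊑-of-difference : ∀ {y z b c} → y - z ⊑ b → z ⊑ c → y ⊑ c ℚ.+ b
    ⊑-of-difference {y} {z} h hz = ⊑-resp (solve 2 (λ y z → z :+ (y :- z) := y) refl y z) (⊑-+ hz h)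

    ⊑-sum : ∀ {a b} n → (∀ i → i ℕ.< n → a i ⊑ b i) → sum a n ⊑ ℚ-sums.sum b n
    ⊑-sum zero    h = ⊑-0
    ⊑-sum (suc n) h = ⊑-+ (⊑-sum n (λ i i<n → h i (ℕₚ.m<n⇒m<1+n i<n))) (h n (ℕₚ.n<1+n n))

    ι-− : ∀ p q → ι (p ℚ.- q) ≈ ι p - ι q
    ι-− p q = trans (ι-+ p (ℚ.- q)) (+-congˡ (ι-neg q))

    ι-sum : ∀ a n → sum (λ i → ι (a i)) n ≈ ι (ℚ-sums.sum a n)
    ι-sum a zero    = sym ι-0
    ι-sum a (suc n) = trans (+-congʳ (ι-sum a n)) (sym (ι-+ _ (a n)))

    ⟶-cong : ∀ {a b z} → (∀ n → a n ≈ b n) → a ⟶ z → b ⟶ z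
    ⟶-cong h a⟶z ε ε>0 = let N , hN = a⟶z ε ε>0 in N , λ n N≤n → ⊑-resp (+-congʳ (h n)) (hN n N≤n)

    ⟶-− : ∀ {a b y z} → a ⟶ y → b ⟶ z → (λ n → a n - b n) ⟶ y - z
    ⟶-− {a} {b} {y} {z} ha hb ε ε>0 =
      let M , hM = ha (ε ℚ.* ℚ.½) (half>0 ε>0)
          N , hN = hb (ε ℚ.* ℚ.½) (half>0 ε>0)
      in M ℕ.⊔ N , λ n h → ⊑-mono (split ℚₚ.≤-refl ℚₚ.≤-refl)
        (⊑-resp (solve 4 (λ a b y z → (a :- y) :- (b :- z) := (a :- b) :- (y :- z)) refl (a n) (b n) y z)
          (⊑-− (hM n (ℕₚ.≤-trans (ℕₚ.m≤m⊔n M N) h)) (hN n (ℕₚ.≤-trans (ℕₚ.m≤n⊔m M N) h))))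

    ⟶-*ˡ : ∀ {a z} c → a ⟶ z → (λ n → c * a n) ⟶ c * z
    ⟶-*ˡ {a} {z} c ha ε ε>0 =
      let B , c⊑B = ⊑-bounded c
          B+1>0 = ℚₚ.<-≤-trans (ℚₚ.positive⁻¹ 1ℚ) (≡.subst (1ℚ ℚ.≤_) (ℚₚ.+-comm 1ℚ B) (p≤p+q (⊑⇒0≤ c⊑B)))
          N , hN = ha (ε ℚ.* reciprocal B+1>0) (pos* ε>0 (reciprocal>0 B+1>0))
      in N , λ n N≤n → ⊑-mono (ℚₚ.≤-reflexive (cancel B+1>0 ε))
        (⊑-resp (solve 3 (λ c a z → c :* (a :- z) := c :* a :- c :* z) refl c (a n) z)
          (⊑-* (⊑-mono (p≤p+q 0≤1) c⊑B) (hN n N≤n)))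

    -- Carries bounds for partial sums and partial products over to infinite ones, with no loss in
    -- the constant; this is where `⊑-closed` is needed.
    ⊑-limit : ∀ {a z y b} → a ⟶ z → (∃ λ N → ∀ n → N ℕ.≤ n → y - a n ⊑ b) → y - z ⊑ b
    ⊑-limit {a} {z} {y} ha (M , hM) = ⊑-closed λ ε ε>0 →
      let N , hN = ha ε ε>0
          n = M ℕ.⊔ N
      in ⊑-resp (solve 3 (λ y a z → (y :- a) :+ (a :- z) := y :- z) refl y (a n) z)
           (⊑-+ (hM n (ℕₚ.m≤m⊔n M N)) (hN n (ℕₚ.m≤n⊔m M N)))

-- The sieve: rough integers and operators built from x -> x/m.

module Operators where
  open import Data.Nat as ℕ using (ℕ; zero; suc; z≤n; s≤s)
  import Data.Nat.Properties as ℕₚ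
  open import Data.Nat.Divisibility using (_∣_; _∣?_; ∣n⇒∣m*n; ∣1⇒≡1; ∣-trans; ∣-refl)
  open import Data.Nat.Primality using (Prime; prime?; euclidsLemma; prime⇒irreducible; prime⇒nonTrivial; ¬prime⇒composite)
  open import Data.Nat.Divisibility.Core using (hasNonTrivialDivisor)
  open import Data.Nat.Induction using (<-rec)
  open import Data.Product using (∃; _×_; _,_)
  open import Data.Sum using (inj₁; inj₂)
  open import Relation.Nullary using (¬_; Dec; yes; no)
  open import Relation.Nullary.Negation using (contradiction)
  open import Relation.Binary.PropositionalEquality as ≡ using (_≡_; _≢_)
  open Quotients
  open Sums
  open BanachAlgebras

  prime⇒2≤ : ∀ {p} → Prime p → 2 ℕ.≤ p
  prime⇒2≤ {suc (suc p)} _ = s≤s (s≤s z≤n)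
  prime⇒2≤ {zero} pr = contradiction (prime⇒nonTrivial pr) λ ()
  prime⇒2≤ {suc zero} pr = contradiction (prime⇒nonTrivial pr) λ ()

  primeDivisor : ∀ n → 2 ℕ.≤ n → ∃ λ p → Prime p × p ∣ n × p ℕ.≤ n
  primeDivisor = <-rec _ λ n rec 2≤n → go n rec 2≤n (prime? n)
    where
    go : ∀ n → (∀ {m} → m ℕ.< n → 2 ℕ.≤ m → ∃ λ p → Prime p × p ∣ m × p ℕ.≤ m) → 2 ℕ.≤ n →
         Dec (Prime n) → ∃ λ p → Prime p × p ∣ n × p ℕ.≤ n
    go n rec 2≤n (yes pr) = n , pr , ∣-refl , ℕₚ.≤-refl
    go n rec 2≤n (no ¬pr) with ¬prime⇒composite {{ℕ.n>1⇒nonTrivial 2≤n}} ¬pr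
    ... | hasNonTrivialDivisor d<n d∣n =
      let p , pr , p∣d , p≤d = rec d<n (ℕ.nonTrivial⇒n>1 _)
      in p , pr , ∣-trans p∣d d∣n , ℕₚ.≤-trans p≤d (ℕₚ.<⇒≤ d<n)

  prime∤ : ∀ {p q} → Prime p → Prime q → q ≢ p → ¬ (q ∣ p)
  prime∤ pr-p pr-q q≢p q∣p with prime⇒irreducible pr-p q∣p
  ... | inj₁ ≡.refl = contradiction (prime⇒2≤ pr-q) λ { (s≤s ()) }
  ... | inj₂ q≡p = q≢p q≡p

  module Roughness (𝔸 : BanachAlgebra) where
    open BanachAlgebra 𝔸

    -- χ N is the indicator function of the integers without prime factors ≤ N.
    keep : ∀ {A B : Set} → Dec A → Dec B → Carrier → Carrier
    keep (yes _) (yes _) c = 0#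
    keep (yes _) (no _)  c = c
    keep (no _)  _       c = c

    χ : ℕ → ℕ → Carrier
    χ zero    n = 1#
    χ (suc N) n = keep (prime? (suc N)) (suc N ∣? n) (χ N n)

    χ-composite : ∀ N n → ¬ Prime (suc N) → χ (suc N) n ≡ χ N n
    χ-composite N n ¬pr with prime? (suc N)
    ... | yes pr = contradiction pr ¬pr
    ... | no _   = ≡.refl

    χ-∤ : ∀ N n → ¬ (suc N ∣ n) → χ (suc N) n ≡ χ N n
    χ-∤ N n ∤n with prime? (suc N) | suc N ∣? n
    ... | yes _ | yes d = contradiction d ∤n
    ... | yes _ | no  _ = ≡.refl
    ... | no  _ | _     = ≡.refl

    χ-∣ : ∀ N n → Prime (suc N) → suc N ∣ n → χ (suc N) n ≡ 0#
    χ-∣ N n pr ∣n with prime? (suc N) | suc N ∣? n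
    ... | yes _ | yes _  = ≡.refl
    ... | yes _ | no  ∤n = contradiction ∣n ∤n
    ... | no ¬pr | _     = contradiction pr ¬pr

    χ-vanishes : ∀ N n {p} → Prime p → p ℕ.≤ N → p ∣ n → χ N n ≡ 0#
    χ-vanishes zero    n pr p≤0 p∣n = contradiction (ℕₚ.≤-trans (prime⇒2≤ pr) p≤0) λ ()
    χ-vanishes (suc N) n pr p≤N p∣n with ℕₚ.m≤n⇒m<n∨m≡n p≤N
    ... | inj₂ ≡.refl = χ-∣ N n pr p∣n
    ... | inj₁ p<1+N with prime? (suc N) | suc N ∣? n
    ...   | yes _ | yes _ = ≡.refl
    ...   | yes _ | no _  = χ-vanishes N n pr (ℕ.s≤s⁻¹ p<1+N) p∣n
    ...   | no _  | _     = χ-vanishes N n pr (ℕ.s≤s⁻¹ p<1+N) p∣n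

    χ-1 : ∀ N → χ N 1 ≡ 1#
    χ-1 zero    = ≡.refl
    χ-1 (suc N) with prime? (suc N)
    ... | no _ = χ-1 N
    ... | yes pr with suc N ∣? 1
    ...   | no _  = χ-1 N
    ...   | yes d = contradiction (≡.subst (2 ℕ.≤_) (∣1⇒≡1 d) (prime⇒2≤ pr)) λ { (s≤s ()) }

    χ-small : ∀ N n → 2 ℕ.≤ n → n ℕ.≤ N → χ N n ≡ 0#
    χ-small N n 2≤n n≤N = let p , pr , p∣n , p≤n = primeDivisor n 2≤n in χ-vanishes N n pr (ℕₚ.≤-trans p≤n n≤N) p∣n

    χ-prime* : ∀ N p n → Prime p → N ℕ.< p → χ N (p ℕ.* n) ≡ χ N n
    χ-prime* zero    p n pr N<p = ≡.refl
    χ-prime* (suc N) p n pr N<p with prime? (suc N) | suc N ∣? p ℕ.* n | suc N ∣? n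
    ... | no _   | _     | _     = χ-prime* N p n pr (ℕₚ.<⇒≤ N<p)
    ... | yes _  | yes _ | yes _ = ≡.refl
    ... | yes _  | no _  | no _  = χ-prime* N p n pr (ℕₚ.<⇒≤ N<p)
    ... | yes _  | no ∤pn | yes d = contradiction (∣n⇒∣m*n p d) ∤pn
    ... | yes pr′ | yes d | no ∤n with euclidsLemma p n pr′ d
    ...   | inj₁ d′ = contradiction d′ (prime∤ pr pr′ (λ e → ℕₚ.<-irrefl e N<p))
    ...   | inj₂ d′ = contradiction d′ ∤n

  module PowerSeries (𝔸 : BanachAlgebra) where
    open BanachAlgebra 𝔸

    iterate : ((ℕ → Carrier) → (ℕ → Carrier)) → ℕ → (ℕ → Carrier) → ℕ → Carrier
    iterate Q zero    F = F
    iterate Q (suc k) F = Q (iterate Q k F)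

    -- Multiplies the power series with coefficients h by 1 - X.
    difference : (ℕ → Carrier) → ℕ → Carrier
    difference h zero    = h zero
    difference h (suc α) = h (suc α) - h α

    -- The summatory function of the unit of Dirichlet convolution, which is supported at n = 1.
    δ : ℕ → Carrier
    δ zero    = 0#
    δ (suc _) = 1#

  module QuotientOperators (𝔸 : BanachAlgebra) (M : ℕ) where
    open BanachAlgebra 𝔸
    open BanachAlgebra-lemmas 𝔸
    open Roughness 𝔸
    open PowerSeries 𝔸
    open Solver using (solve; _:=_; _:+_; _:*_; _:-_; :-_; con)
    open import Relation.Binary.Reasoning.Setoid setoid

    infix 4 _≗_
    -- Below `M` every operator can be cut off after `M` terms: later quotients are 0, where the
    -- functions vanish. Quotients of arguments below `M` stay below `M`, so the relation is a
    -- congruence for the operators.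
    _≗_ : (F G : ℕ → Carrier) → Set
    F ≗ G = ∀ x → x ℕ.< M → F x ≈ G x

    ≗-trans : ∀ {F G K} → F ≗ G → G ≗ K → F ≗ K
    ≗-trans FG GK x x<M = trans (FG x x<M) (GK x x<M)

    ≗-sym : ∀ {F G} → F ≗ G → G ≗ F
    ≗-sym FG x x<M = sym (FG x x<M)

    opaque
      -- A common form of `T`, with m(i) = p^i, and `U`, with m(i) = i + 1, so that one exchange of
      -- sums proves all of them to commute.
      op : (ℕ → Carrier) → (ℕ → ℕ) → (ℕ → Carrier) → ℕ → Carrier
      op a m F x = sum (λ i → a i * F (x ÷ m i)) M

      Δ : ℕ → (ℕ → Carrier) → ℕ → Carrier
      Δ p F x = F x - F (x ÷ p)

    opaque
      unfolding op Δ

      op-cong : ∀ a m {F G} → F ≗ G → op a m F ≗ op a m G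
      op-cong a m FG x x<M = sum-cong M λ i _ → *-congˡ (FG (x ÷ m i) (ℕₚ.≤-<-trans (÷-≤ x (m i)) x<M))

      Δ-cong : ∀ p {F G} → F ≗ G → Δ p F ≗ Δ p G
      Δ-cong p FG x x<M = +-cong (FG x x<M) (-‿cong (FG (x ÷ p) (ℕₚ.≤-<-trans (÷-≤ x p) x<M)))

      op-comm : ∀ a m b n F → op a m (op b n F) ≗ op b n (op a m F)
      op-comm a m b n F x _ = begin
        sum (λ i → a i * sum (λ j → b j * F (x ÷ m i ÷ n j)) M) M    ≈⟨ sum-cong M (λ i _ → sym (sum-*ˡ (a i) _ M)) ⟩
        sum (λ i → sum (λ j → a i * (b j * F (x ÷ m i ÷ n j))) M) M  ≈⟨ sum-swap _ M M ⟩
        sum (λ j → sum (λ i → a i * (b j * F (x ÷ m i ÷ n j))) M) M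
          ≈⟨ sum-cong M (λ j _ → sum-cong M (λ i _ → trans (*-congˡ (*-congˡ (reflexive (≡.cong F (÷-comm x (m i) (n j))))))
               (solve 3 (λ a b f → a :* (b :* f) := b :* (a :* f)) refl (a i) (b j) _))) ⟩
        sum (λ j → sum (λ i → b j * (a i * F (x ÷ n j ÷ m i))) M) M  ≈⟨ sum-cong M (λ j _ → sum-*ˡ (b j) _ M) ⟩
        sum (λ j → b j * sum (λ i → a i * F (x ÷ n j ÷ m i)) M) M    ∎

      op-Δ : ∀ a m p F → op a m (Δ p F) ≗ Δ p (op a m F)
      op-Δ a m p F x _ = trans (sum-cong M λ i _ → trans
          (solve 3 (λ a f g → a :* (f :- g) := a :* f :- a :* g) refl (a i) (F (x ÷ m i)) (F (x ÷ m i ÷ p)))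
          (+-congˡ (-‿cong (*-congˡ (reflexive (≡.cong F (÷-comm x (m i) p)))))))
        (sum-− _ _ M)

      op-0 : ∀ a m {F} → F 0 ≈ 0# → op a m F 0 ≈ 0#
      op-0 a m {F} F0 = sum-zero M λ i _ → trans (*-congˡ (trans (reflexive (≡.cong F (0÷ (m i)))) F0)) (zeroʳ (a i))

      Δ-0 : ∀ p {F} → F 0 ≈ 0# → Δ p F 0 ≈ 0#
      Δ-0 p {F} F0 = trans (+-cong F0 (-‿cong (trans (reflexive (≡.cong F (0÷ p))) F0))) (-‿inverseʳ 0#)

    T : (ℕ → Carrier) → ℕ → (ℕ → Carrier) → ℕ → Carrier
    T h p = op h (p ℕ.^_)

    U : ℕ → (ℕ → Carrier) → ℕ → Carrier
    U N = op (λ i → χ N (suc i)) suc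

    -- Abel summation with the boundary term h(m - 1) G(m) assumed to vanish. The index m - 1 is
    -- described as the i with suc i ≡ m, so that m = 0 demands nothing.
    summation-by-parts : ∀ (h G : ℕ → Carrier) m → (∀ i → suc i ≡ m → h i * G m ≈ 0#) →
      sum (λ i → difference h i * G i) m ≈ sum (λ i → h i * (G i - G (suc i))) m
    summation-by-parts h G zero    _    = refl
    summation-by-parts h G (suc m) last = begin
      sum (λ i → difference h i * G i) (suc m)                                            ≈⟨ sum-shift _ m ⟩
      h 0 * G 0 + sum (λ i → (h (suc i) - h i) * G (suc i)) m                             ≈⟨ +-congˡ (trans (sum-cong m λ i _ →
          solve 3 (λ a b g → (a :- b) :* g := a :* g :- b :* g) refl (h (suc i)) (h i) (G (suc i))) (sum-− _ _ m)) ⟩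
      h 0 * G 0 + (sum (λ i → h (suc i) * G (suc i)) m - sum (λ i → h i * G (suc i)) m)   ≈⟨ sym (+-assoc _ _ _) ⟩
      h 0 * G 0 + sum (λ i → h (suc i) * G (suc i)) m - sum (λ i → h i * G (suc i)) m
        ≈⟨ +-cong (sym (sum-shift (λ i → h i * G i) m)) (-‿cong (sym (trans (+-congˡ (last m ≡.refl)) (+-identityʳ _)))) ⟩
      sum (λ i → h i * G i) (suc m) - sum (λ i → h i * G (suc i)) (suc m)                 ≈⟨ sym (sum-− _ _ (suc m)) ⟩
      sum (λ i → h i * G i - h i * G (suc i)) (suc m)                                     ≈⟨ sum-cong (suc m) (λ i _ →
          solve 3 (λ a f g → a :* f :- a :* g := a :* (f :- g)) refl (h i) (G i) (G (suc i))) ⟩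
      sum (λ i → h i * (G i - G (suc i))) (suc m)                                         ∎

    opaque
      unfolding op Δ

      -- Multiplying the coefficient series by 1 - X amounts to applying 1 - V_p first. The boundary
      -- term vanishes because x < M < p^M makes the last quotient 0.
      T-difference : ∀ h {p F} → 2 ℕ.≤ p → F 0 ≈ 0# → T (difference h) p F ≗ T h p (Δ p F)
      T-difference h {p} {F} 2≤p F0 x x<M = trans
        (summation-by-parts h (λ i → F (x ÷ p ℕ.^ i)) M λ i _ → trans (*-congˡ (trans
          (reflexive (≡.cong F (÷-small (ℕₚ.<-trans x<M (n<m^n 2≤p M))))) F0)) (zeroʳ (h i)))
        (sum-cong M λ i _ → *-congˡ (+-congˡ (-‿cong (reflexive
          (≡.cong F (≡.trans (≡.cong (x ÷_) (ℕₚ.*-comm p (p ℕ.^ i))) (≡.sym (÷-* x (p ℕ.^ i) p))))))))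

    sum-head : ∀ a m → 0 ℕ.< m → (∀ i → suc i ℕ.< m → a (suc i) ≈ 0#) → sum a m ≈ a 0
    sum-head a (suc m) _ h = trans (sum-shift a m) (trans (+-congˡ (sum-zero m λ i i<m → h i (s≤s i<m))) (+-identityʳ (a 0)))

    -- Sorts indices by divisibility by p: b′ agrees with b away from the multiples of p and
    -- vanishes on them, and the multiples are listed as p (i + 1). In the induction the second sum
    -- grows exactly when p divides suc x.
    sum-split : ∀ p → .{{_ : ℕ.NonZero p}} → ∀ (b b′ : ℕ → Carrier) →
      (∀ n → ¬ (p ∣ suc n) → b (suc n) ≈ b′ (suc n)) → (∀ n → p ∣ suc n → b′ (suc n) ≈ 0#) →
      ∀ x → sum (λ i → b (suc i)) x ≈ sum (λ i → b′ (suc i)) x + sum (λ i → b (p ℕ.* suc i)) (x ÷ p)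
    sum-split p b b′ h∤ h∣ zero = sym (trans (+-identityˡ _) (reflexive (≡.cong (sum _) (0÷ p))))
    sum-split p b b′ h∤ h∣ (suc x) with p ∣? suc x
    ... | yes d = begin
      sum (λ i → b (suc i)) x + b (suc x)                             ≈⟨ +-congʳ (sum-split p b b′ h∤ h∣ x) ⟩
      S′ + S″ + b (suc x)                                             ≈⟨ solve 3 (λ s t b → s :+ t :+ b := s :+ con ℚ.0ℚ :+ (t :+ b)) refl S′ S″ (b (suc x)) ⟩
      S′ + ι ℚ.0ℚ + (S″ + b (suc x))                                  ≈⟨ +-cong (+-congˡ (trans ι-0 (sym (h∣ x d)))) (+-congˡ (reflexive (≡.cong b (÷-suc-∣ x p d)))) ⟩
      S′ + b′ (suc x) + sum (λ i → b (p ℕ.* suc i)) (suc (x ÷ p))     ≈⟨ +-congˡ (reflexive (≡.cong (sum _) (≡.sym (÷-unique (suc x) p (suc (x ÷ p))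
          (ℕₚ.≤-reflexive (≡.sym (÷-suc-∣ x p d))) (ℕₚ.≤-<-trans (ℕₚ.≤-reflexive (÷-suc-∣ x p d)) (ℕₚ.*-monoʳ-< p (ℕₚ.n<1+n _))))))) ⟩
      S′ + b′ (suc x) + sum (λ i → b (p ℕ.* suc i)) (suc x ÷ p)       ∎
      where
      import Data.Rational as ℚ
      S′ = sum (λ i → b′ (suc i)) x
      S″ = sum (λ i → b (p ℕ.* suc i)) (x ÷ p)
    ... | no ∤ = begin
      sum (λ i → b (suc i)) x + b (suc x)                             ≈⟨ +-cong (sum-split p b b′ h∤ h∣ x) (h∤ x ∤) ⟩
      S′ + S″ + b′ (suc x)                                            ≈⟨ solve 3 (λ s t b → s :+ t :+ b := s :+ b :+ t) refl S′ S″ (b′ (suc x)) ⟩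
      S′ + b′ (suc x) + S″                                            ≈⟨ +-congˡ (reflexive (≡.cong (sum _) (≡.sym (÷-suc-∤ x p ∤)))) ⟩
      S′ + b′ (suc x) + sum (λ i → b (p ℕ.* suc i)) (suc x ÷ p)       ∎
      where
      S′ = sum (λ i → b′ (suc i)) x
      S″ = sum (λ i → b (p ℕ.* suc i)) (x ÷ p)

    opaque
      unfolding op Δ

      U-composite : ∀ N F → ¬ Prime (suc N) → ∀ x → U (suc N) F x ≈ U N F x
      U-composite N F ¬pr x = sum-cong M λ i _ → *-congʳ (reflexive (χ-composite N (suc i) ¬pr))

      -- The multiples of p = N + 1 without prime factors ≤ N are p times such integers, so V_p U_N
      -- is the part of U_N over multiples of p. The two sums end at different places, but the extra
      -- terms only see F 0.
      U-prime : ∀ N {F} → Prime (suc N) → F 0 ≈ 0# → Δ (suc N) (U N F) ≗ U (suc N) F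
      U-prime N {F} pr F0 x x<M = begin
        U N F x - U N F (x ÷ p)               ≈⟨ +-cong (sum-split p (λ n → χ N n * F (x ÷ n)) (λ n → χ p n * F (x ÷ n))
            (λ n ∤n → *-congʳ (reflexive (≡.sym (χ-∤ N (suc n) ∤n))))
            (λ n ∣n → trans (*-congʳ (reflexive (χ-∣ N (suc n) pr ∣n))) (zeroˡ _)) M) (-‿cong multiples) ⟩
        U p F x + S - S                       ≈⟨ solve 2 (λ u s → u :+ s :- s := u) refl (U p F x) S ⟩
        U p F x                               ∎
        where
        p : ℕ
        p = suc N
        S : Carrier
        S = sum (λ i → χ N (p ℕ.* suc i) * F (x ÷ (p ℕ.* suc i))) (M ÷ p)
        multiples : U N F (x ÷ p) ≈ S
        multiples = begin
          sum (λ i → χ N (suc i) * F (x ÷ p ÷ suc i)) M          ≈⟨ sum-cong M (λ i _ → *-cong (reflexive (≡.sym (χ-prime* N p (suc i) pr ℕₚ.≤-refl))) (reflexive (≡.cong F (÷-* x p (suc i))))) ⟩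
          sum (λ i → χ N (p ℕ.* suc i) * F (x ÷ (p ℕ.* suc i))) M ≈⟨ sum-extend (÷-≤ M p) (λ i h → trans (*-congˡ (trans (reflexive (≡.cong F
              (÷-small (ℕₚ.<-≤-trans x<M (ℕₚ.≤-trans (ℕₚ.<⇒≤ (÷-upper M p)) (ℕₚ.*-monoʳ-≤ p (s≤s h))))))) F0)) (zeroʳ _)) ⟩
          S                                                      ∎

    opaque
      unfolding op

      U-0 : ∀ {F} → F 0 ≈ 0# → ∀ x → x ℕ.< M → U 0 F x ≈ sum (λ i → F (x ÷ suc i)) x
      U-0 {F} F0 x x<M = trans (sum-cong M λ i _ → *-identityˡ (F (x ÷ suc i)))
        (sum-extend (ℕₚ.<⇒≤ x<M) λ i x≤i → trans (reflexive (≡.cong F (÷-small (s≤s x≤i)))) F0)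

      T-extend : ∀ h {p F} → 2 ℕ.≤ p → F 0 ≈ 0# → ∀ {x m} → x ℕ.< M → M ℕ.≤ m →
        T h p F x ≈ sum (λ α → h α * F (x ÷ p ℕ.^ α)) m
      T-extend h {p} {F} 2≤p F0 {x} x<M M≤m = sym (sum-extend M≤m λ i M≤i → trans (*-congˡ (trans
        (reflexive (≡.cong F (÷-small (ℕₚ.<-trans (ℕₚ.<-≤-trans x<M M≤i) (n<m^n 2≤p i))))) F0)) (zeroʳ (h i)))

    opaque
      unfolding op Δ

      U-large : ∀ {N F} → M ℕ.≤ N → U N F ≗ F
      U-large {N} {F} M≤N x x<M = trans
        (sum-head _ M (ℕₚ.≤-<-trans z≤n x<M) λ i i<M →
          trans (*-congʳ (reflexive (χ-small N (suc (suc i)) (s≤s (s≤s z≤n)) (ℕₚ.≤-trans i<M M≤N)))) (zeroˡ _))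
        (trans (*-cong (reflexive (χ-1 N)) (reflexive (≡.cong F (÷1 x)))) (*-identityˡ (F x)))

    iterate-U-0 : ∀ N k → iterate (U N) k δ 0 ≈ 0#
    iterate-U-0 N zero    = refl
    iterate-U-0 N (suc k) = op-0 _ _ (iterate-U-0 N k)

    -- The exact identity for the summatory function of f.

    module Sieve (f : ℕ → Carrier) (f-1 : f 1 ≈ 1#)
      (f-* : ∀ p α n → Prime p → ¬ (p ∣ suc n) → f (p ℕ.^ α ℕ.* suc n) ≈ f (p ℕ.^ α) * f (suc n)) where

      -- Interpolates between the summatory function of f at N = 0 and δ once N ≥ M.
      Φ : ℕ → ℕ → Carrier
      Φ N = sum (λ i → χ N (suc i) * f (suc i))

      Φ-composite : ∀ N x → ¬ Prime (suc N) → Φ N x ≈ Φ (suc N) x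
      Φ-composite N x ¬pr = sum-cong x λ i _ → *-congʳ (reflexive (≡.sym (χ-composite N (suc i) ¬pr)))

      opaque
        unfolding op

        -- Sorts by the exact power of p. `A j` sums f(p^j n) over n without prime factors ≤ N;
        -- splitting off the n prime to p leaves `A (suc j)` at y/p, and after M steps p^M exceeds
        -- x.
        Φ-prime : ∀ N → Prime (suc N) → Φ N ≗ T (λ α → f (suc N ℕ.^ α)) (suc N) (Φ (suc N))
        Φ-prime N pr x x<M = begin
          Φ N x                                  ≈⟨ sum-cong x (λ i _ → *-congˡ (reflexive (≡.cong f (≡.sym (ℕₚ.*-identityˡ (suc i)))))) ⟩
          A 0 x                                  ≈⟨ iterated M ⟩
          S M + A M (x ÷ p ℕ.^ M)                ≈⟨ +-congˡ (reflexive (≡.cong (A M) (÷-small (ℕₚ.<-trans x<M (n<m^n (prime⇒2≤ pr) M))))) ⟩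
          S M + 0#                               ≈⟨ +-identityʳ (S M) ⟩
          S M                                    ∎
          where
          p : ℕ
          p = suc N
          A : ℕ → ℕ → Carrier
          A j = sum (λ i → χ N (suc i) * f (p ℕ.^ j ℕ.* suc i))
          S : ℕ → Carrier
          S = sum (λ α → f (p ℕ.^ α) * Φ p (x ÷ p ℕ.^ α))
          exponent : ∀ j n → p ℕ.^ j ℕ.* (p ℕ.* n) ≡ p ℕ.^ suc j ℕ.* n
          exponent j n = ≡.trans (≡.sym (ℕₚ.*-assoc (p ℕ.^ j) p n)) (≡.cong (ℕ._* n) (ℕₚ.*-comm (p ℕ.^ j) p))
          A-step : ∀ j y → A j y ≈ f (p ℕ.^ j) * Φ p y + A (suc j) (y ÷ p)
          A-step j y = begin
            A j y
              ≈⟨ sum-split p (λ n → χ N n * f (p ℕ.^ j ℕ.* n)) (λ n → f (p ℕ.^ j) * (χ p n * f n))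
                   (λ n ∤n → trans (*-cong (reflexive (≡.sym (χ-∤ N (suc n) ∤n))) (f-* p j n pr ∤n))
                      (solve 3 (λ c a b → c :* (a :* b) := a :* (c :* b)) refl (χ p (suc n)) (f (p ℕ.^ j)) (f (suc n))))
                   (λ n ∣n → trans (*-congˡ (trans (*-congʳ (reflexive (χ-∣ N (suc n) pr ∣n))) (zeroˡ _))) (zeroʳ _)) y ⟩
            sum (λ i → f (p ℕ.^ j) * (χ p (suc i) * f (suc i))) y + sum (λ i → χ N (p ℕ.* suc i) * f (p ℕ.^ j ℕ.* (p ℕ.* suc i))) (y ÷ p)
              ≈⟨ +-cong (sum-*ˡ _ _ y) (sum-cong (y ÷ p) λ i _ → *-cong (reflexive (χ-prime* N p (suc i) pr ℕₚ.≤-refl)) (reflexive (≡.cong f (exponent j (suc i))))) ⟩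
            f (p ℕ.^ j) * Φ p y + A (suc j) (y ÷ p) ∎
          iterated : ∀ J → A 0 x ≈ S J + A J (x ÷ p ℕ.^ J)
          iterated zero    = sym (trans (+-identityˡ _) (reflexive (≡.cong (A 0) (÷1 x))))
          iterated (suc J) = begin
            A 0 x                                                              ≈⟨ iterated J ⟩
            S J + A J (x ÷ p ℕ.^ J)                                            ≈⟨ +-congˡ (A-step J (x ÷ p ℕ.^ J)) ⟩
            S J + (f (p ℕ.^ J) * Φ p (x ÷ p ℕ.^ J) + A (suc J) (x ÷ p ℕ.^ J ÷ p)) ≈⟨ sym (+-assoc _ _ _) ⟩
            S (suc J) + A (suc J) (x ÷ p ℕ.^ J ÷ p)
              ≈⟨ +-congˡ (reflexive (≡.cong (A (suc J)) (≡.trans (÷-* x (p ℕ.^ J) p) (≡.cong (x ÷_) (ℕₚ.*-comm (p ℕ.^ J) p))))) ⟩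
            S (suc J) + A (suc J) (x ÷ p ℕ.^ suc J)                            ∎

      Φ-large : ∀ {N} → M ℕ.≤ N → Φ N ≗ δ
      Φ-large M≤N zero    _   = refl
      Φ-large {N} M≤N (suc x) x<M = trans
        (sum-head _ (suc x) (s≤s z≤n) λ i i<x → trans (*-congʳ (reflexive
          (χ-small N (suc (suc i)) (s≤s (s≤s z≤n)) (ℕₚ.≤-trans i<x (ℕₚ.≤-trans (ℕₚ.<⇒≤ x<M) M≤N))))) (zeroˡ _))
        (trans (*-cong (reflexive (χ-1 N)) f-1) (*-identityˡ 1#))

      T? : (ℕ → ℕ → Carrier) → ∀ {n} → Dec (Prime n) → (ℕ → Carrier) → ℕ → Carrier
      T? h {n} (yes _) = T (h n) n
      T? h     (no _)  = λ F → F

      -- Applies the largest prime first, the order in which `Φ-P` rewrites Φ N inside the product.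
      -- `E` applies it last, so that an asymptotic formula can be extended by one more prime at a
      -- time.
      P : ℕ → (ℕ → Carrier) → ℕ → Carrier
      P zero    F = F
      P (suc N) F = P N (T? (λ p α → f (p ℕ.^ α)) (prime? (suc N)) F)

      E : (ℕ → ℕ → Carrier) → ℕ → (ℕ → Carrier) → ℕ → Carrier
      E h zero    F = F
      E h (suc N) F = T? h (prime? (suc N)) (E h N F)

      T?-cong : ∀ h {n} (d : Dec (Prime n)) {F G} → F ≗ G → T? h d F ≗ T? h d G
      T?-cong h (yes _) FG = op-cong _ _ FG
      T?-cong h (no _)  FG = FG

      P-cong : ∀ N {F G} → F ≗ G → P N F ≗ P N G
      P-cong zero    FG = FG
      P-cong (suc N) FG = P-cong N (T?-cong _ (prime? (suc N)) FG)

      T?-0 : ∀ h {n} (d : Dec (Prime n)) {F} → F 0 ≈ 0# → T? h d F 0 ≈ 0#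
      T?-0 h (yes _) F0 = op-0 _ _ F0
      T?-0 h (no _)  F0 = F0

      P-0 : ∀ N {F} → F 0 ≈ 0# → P N F 0 ≈ 0#
      P-0 zero    F0 = F0
      P-0 (suc N) F0 = P-0 N (T?-0 _ (prime? (suc N)) F0)

      E-0 : ∀ h N {F} → F 0 ≈ 0# → E h N F 0 ≈ 0#
      E-0 h zero    F0 = F0
      E-0 h (suc N) F0 = T?-0 h (prime? (suc N)) (E-0 h N F0)

      P-op : ∀ N a m F → P N (op a m F) ≗ op a m (P N F)
      P-op zero    a m F x _ = refl
      P-op (suc N) a m F = ≗-trans (P-cong N (commute (prime? (suc N)))) (P-op N a m _)
        where
        commute : (d : Dec (Prime (suc N))) → T? _ d (op a m F) ≗ op a m (T? _ d F)
        commute (yes _) = op-comm _ _ a m F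
        commute (no _) x _ = refl

      P-Δ : ∀ N p F → P N (Δ p F) ≗ Δ p (P N F)
      P-Δ zero    p F x _ = refl
      P-Δ (suc N) p F = ≗-trans (P-cong N (commute (prime? (suc N)))) (P-Δ N p _)
        where
        commute : (d : Dec (Prime (suc N))) → T? _ d (Δ p F) ≗ Δ p (T? _ d F)
        commute (yes _) = op-Δ _ _ p F
        commute (no _) x _ = refl

      Φ-P : ∀ N → Φ 0 ≗ P N (Φ N)
      Φ-P zero    x _ = refl
      Φ-P (suc N) = ≗-trans (Φ-P N) (P-cong N (step (prime? (suc N))))
        where
        step : (d : Dec (Prime (suc N))) → Φ N ≗ T? _ d (Φ (suc N))
        step (yes pr) = Φ-prime N pr
        step (no ¬pr) x _ = Φ-composite N x ¬pr

      -- Each difference is moved inwards until it meets its own `U N` and turns it into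
      -- `U (suc N)`, by `U-prime`.
      iterate-Δ-U : ∀ N k → Prime (suc N) → iterate (Δ (suc N)) k (iterate (U N) k δ) ≗ iterate (U (suc N)) k δ
      iterate-Δ-U N zero    pr x _ = refl
      iterate-Δ-U N (suc k) pr = ≗-trans (inner k) (op-cong _ _ (iterate-Δ-U N k pr))
        where
        p = suc N
        G = iterate (U N) k δ
        inner : ∀ j → Δ p (iterate (Δ p) j (U N G)) ≗ U p (iterate (Δ p) j G)
        inner zero    = U-prime N pr (iterate-U-0 N k)
        inner (suc j) = ≗-trans (Δ-cong p (inner j)) (≗-sym (op-Δ _ _ p _))

      T-iterate-difference : ∀ h k {p F} → 2 ℕ.≤ p → F 0 ≈ 0# → T (iterate difference k h) p F ≗ T h p (iterate (Δ p) k F)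
      T-iterate-difference h zero    2≤p F0 x _ = refl
      T-iterate-difference h (suc k) {p} {F} 2≤p F0 = ≗-trans (T-difference _ 2≤p F0)
        (≗-trans (T-iterate-difference h k 2≤p (Δ-0 p F0)) (op-cong _ _ (rotate k)))
        where
        rotate : ∀ k → iterate (Δ p) k (Δ p F) ≗ Δ p (iterate (Δ p) k F)
        rotate zero    x _ = refl
        rotate (suc k) = Δ-cong p (rotate k)

      module _ (k : ℕ) where

        coefficients : ℕ → ℕ → Carrier
        coefficients p = iterate difference k (λ α → f (p ℕ.^ α))

        -- The factor at a new prime p is T_p (1 - V_p)^k. Its k differences commute with `P N` and
        -- are used up in passing from U N to U (suc N).
        E-P : ∀ N → E coefficients N (iterate (U 0) k δ) ≗ P N (iterate (U N) k δ)
        E-P zero    x _ = refl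
        E-P (suc N) = ≗-trans (T?-cong coefficients (prime? (suc N)) (E-P N)) (step (prime? (suc N)))
          where
          G = iterate (U N) k δ
          step : (d : Dec (Prime (suc N))) → T? coefficients d (P N G) ≗ P N (T? (λ p α → f (p ℕ.^ α)) d (iterate (U (suc N)) k δ))
          step (no ¬pr) = P-cong N (same k)
            where
            same : ∀ j → iterate (U N) j δ ≗ iterate (U (suc N)) j δ
            same zero    x _ = refl
            same (suc j) = ≗-trans (op-cong _ _ (same j)) (λ x _ → sym (U-composite N _ ¬pr x))
          step (yes pr) = ≗-trans (T-iterate-difference _ k (prime⇒2≤ pr) (P-0 N (iterate-U-0 N k)))
            (≗-trans (op-cong _ _ (≗-trans (≗-sym (P-Δs k G)) (P-cong N (iterate-Δ-U N k pr)))) (≗-sym (P-op N _ _ _)))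
            where
            P-Δs : ∀ j F → P N (iterate (Δ (suc N)) j F) ≗ iterate (Δ (suc N)) j (P N F)
            P-Δs zero    F x _ = refl
            P-Δs (suc j) F = ≗-trans (P-Δ N _ _) (Δ-cong (suc N) (P-Δs j F))

        -- For N ≥ M both Φ N and the k-th iterate of U N at δ agree with δ, so `Φ-P` and `E-P` have
        -- the common value P N δ.
        summatory-E : ∀ {N} → M ℕ.≤ N → sum (λ i → f (suc i)) ≗ E coefficients N (iterate (U 0) k δ)
        summatory-E {N} M≤N = ≗-trans (λ x _ → sum-cong x (λ i _ → sym (*-identityˡ _)))
          (≗-trans (Φ-P N) (≗-trans (P-cong N (≗-trans (Φ-large M≤N) (≗-sym (U-larges k)))) (≗-sym (E-P N))))
          where
          U-larges : ∀ j → iterate (U N) j δ ≗ δ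
          U-larges zero    x _ = refl
          U-larges (suc j) = ≗-trans (op-cong _ _ (U-larges j)) (U-large M≤N)

-- Divisor sums, and the effect of one prime on an asymptotic formula.

module Asymptotics where
  open import Data.Nat as ℕ using (ℕ; zero; suc; z≤n; s≤s; _!)
  import Data.Nat.Properties as ℕₚ
  open import Data.Nat.Divisibility using (_∣_)
  open import Data.Rational as ℚ using (ℚ; 0ℚ; 1ℚ)
  import Data.Rational.Properties as ℚₚ
  open import Data.Rational.Solver using (module +-*-Solver)
  open import Data.Product using (∃; _×_; _,_)
  open import Relation.Nullary.Negation using (contradiction)
  open import Relation.Binary.PropositionalEquality as ≡ using (_≡_)
  open Rationals hiding (_^_)
  open Rationals using () renaming (_^_ to _^ℚ_)
  open Quotients
  open Sums
  open Harmonic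
  open Growth
  open Weights
  open BanachAlgebras
  open Operators
  private module ℚS = +-*-Solver

  factorial-recip : ∀ j → recip (suc j !) ≡ recip (suc j) ℚ.* recip (j !)
  factorial-recip j = recip-* (suc j) (j !)

  module DivisorSums (𝔸 : BanachAlgebra) where
    open BanachAlgebra 𝔸
    open BanachAlgebra-lemmas 𝔸
    open PowerSeries 𝔸
    module Q = QuotientOperators 𝔸
    open Solver using (solve; _:=_; _:+_; _:*_; _:-_; :-_; con)
    open import Relation.Binary.Reasoning.Setoid setoid

    -- The divisor sums with j = 0 have no error.
    error : ℕ → ℕ → ℚ
    error zero    x = 0ℚ
    error (suc j) x = G j x

    error≤W : ∀ j x → error j x ℚ.≤ W j x
    error≤W zero    x = 0≤W 0 x
    error≤W (suc j) x = ℚₚ.≤-reflexive (≡.sym (W-suc j x))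

    error-sum : ∀ j x → ℚ-sums.sum (λ i → error j (x ÷ suc i)) x ℚ.≤ error (suc j) x
    error-sum zero    x = ℚₚ.≤-trans (ℚₚ.≤-reflexive (ℚ-sums.sum-zero x (λ _ _ → ≡.refl))) (0≤G 0 x)
    error-sum (suc j) x = G-sum-≤ j x

    δ-÷ : ∀ {x i} → i ℕ.< x → δ (x ÷ suc i) ≡ 1#
    δ-÷ {x} {i} i<x with x ÷ suc i | ÷-upper x (suc i)
    ... | zero  | h = contradiction (≡.subst (x ℕ.<_) (ℕₚ.*-identityʳ (suc i)) h) (ℕₚ.<⇒≱ (s≤s i<x))
    ... | suc _ | _ = ≡.refl

    -- Induction by D_{k+1}(x) = Σ D_k(x/i) and `G-sum`. It matters that the start is exact: an
    -- error x / log x there would sum to order x log log x, more than the O(x) allowed at the next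
    -- stage.
    divisor-asymptotic : ∀ j → ∃ λ C → 0ℚ ℚ.≤ C × ∀ M x → x ℕ.< M →
      iterate (Q.U M 0) (suc j) δ x - ι (recip (j !) ℚ.* G j x) ⊑ C ℚ.* error j x
    divisor-asymptotic zero = 0ℚ , ℚₚ.≤-refl , λ M x x<M → ⊑-mono (ℚₚ.≤-reflexive (≡.sym (ℚₚ.*-zeroˡ 0ℚ))) (⊑-resp (sym (begin
      Q.U M 0 δ x - ι (1ℚ ℚ.* (fromℕ x ℚ.* 1ℚ))    ≈⟨ +-cong (trans (Q.U-0 M refl x x<M)
          (trans (sum-cong x λ i i<x → trans (reflexive (δ-÷ i<x)) (sym ι-1)) (trans (ι-sum (λ _ → 1ℚ) x) (reflexive (≡.cong ι (sum-const 1ℚ x))))))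
          (-‿cong (reflexive (≡.cong ι (ℚₚ.*-identityˡ _)))) ⟩
      ι (fromℕ x ℚ.* 1ℚ) - ι (fromℕ x ℚ.* 1ℚ)      ≈⟨ -‿inverseʳ _ ⟩
      0#                                           ∎)) ⊑-0)
    divisor-asymptotic (suc j) =
      let C , 0≤C , h = divisor-asymptotic j
      in C ℚ.+ K j , 0≤+ 0≤C (0≤K j) , λ M x x<M →
        let D = iterate (Q.U M 0) (suc j) δ
            S = ℚ-sums.sum (λ i → G j (x ÷ suc i)) x
            c = recip (j !)
            c′ = recip (suc j !)
            n = fromℕ (suc j)
            rescale : c ℚ.* S ℚ.- c′ ℚ.* G (suc j) x ≡ c′ ℚ.* (n ℚ.* S ℚ.- G (suc j) x)
            rescale = ≡.trans (≡.cong (λ t → t ℚ.* S ℚ.- c′ ℚ.* G (suc j) x) (c≡ j))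
              (ℚS.solve 4 (λ c n s g → (c ℚS.:* n) ℚS.:* s ℚS.:- c ℚS.:* g ℚS.:= c ℚS.:* (n ℚS.:* s ℚS.:- g)) ≡.refl c′ n S (G (suc j) x))
            second : ι (c ℚ.* S ℚ.- c′ ℚ.* G (suc j) x) ⊑ K j ℚ.* G j x
            second = ⊑-ι-≤ (ℚₚ.≤-trans (ℚₚ.≤-reflexive (≡.trans (≡.cong ℚ.∣_∣ rescale) (≡.trans (ℚₚ.∣p*q∣≡∣p∣*∣q∣ c′ (n ℚ.* S ℚ.- G (suc j) x)) (≡.cong (ℚ._* ℚ.∣ n ℚ.* S ℚ.- G (suc j) x ∣) (ℚₚ.0≤p⇒∣p∣≡p (0≤recip (suc j !)))))))
              (ℚₚ.≤-trans (*-mono (0≤recip (suc j !)) (ℚₚ.0≤∣p∣ (n ℚ.* S ℚ.- G (suc j) x)) (recip≤1 (suc j !)) (G-sum j x)) (ℚₚ.≤-reflexive (ℚₚ.*-identityˡ _))))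
            first : sum (λ i → D (x ÷ suc i) - ι (c ℚ.* G j (x ÷ suc i))) x ⊑ C ℚ.* G j x
            first = ⊑-mono (ℚₚ.≤-trans (ℚₚ.≤-reflexive (ℚ-sums.sum-*ˡ C (λ i → error j (x ÷ suc i)) x)) (*-monoˡ 0≤C (error-sum j x)))
              (⊑-sum x λ i _ → h M (x ÷ suc i) (ℕₚ.≤-<-trans (÷-≤ x (suc i)) x<M))
        in ⊑-mono (ℚₚ.≤-reflexive (≡.sym (ℚₚ.*-distribʳ-+ (G j x) C (K j)))) (⊑-resp (begin
          sum (λ i → D (x ÷ suc i) - ι (c ℚ.* G j (x ÷ suc i))) x + ι (c ℚ.* S ℚ.- c′ ℚ.* G (suc j) x)
            ≈⟨ +-cong (sum-− (λ i → D (x ÷ suc i)) (λ i → ι (c ℚ.* G j (x ÷ suc i))) x) (ι-− (c ℚ.* S) (c′ ℚ.* G (suc j) x)) ⟩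
          sum (λ i → D (x ÷ suc i)) x - sum (λ i → ι (c ℚ.* G j (x ÷ suc i))) x + (ι (c ℚ.* S) - ι (c′ ℚ.* G (suc j) x))
            ≈⟨ +-congʳ (+-congˡ (-‿cong (trans (ι-sum _ x) (reflexive (≡.cong ι (ℚ-sums.sum-*ˡ c (λ i → G j (x ÷ suc i)) x)))))) ⟩
          sum (λ i → D (x ÷ suc i)) x - ι (c ℚ.* S) + (ι (c ℚ.* S) - ι (c′ ℚ.* G (suc j) x))
            ≈⟨ solve 3 (λ a b c → a :- b :+ (b :- c) := a :- c) refl (sum (λ i → D (x ÷ suc i)) x) (ι (c ℚ.* S)) (ι (c′ ℚ.* G (suc j) x)) ⟩
          sum (λ i → D (x ÷ suc i)) x - ι (c′ ℚ.* G (suc j) x)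
            ≈⟨ +-congʳ (sym (Q.U-0 M (Q.iterate-U-0 M 0 (suc j)) x x<M)) ⟩
          Q.U M 0 D x - ι (c′ ℚ.* G (suc j) x) ∎) (⊑-+ first second))
      where
      c≡ : ∀ j → recip (j !) ≡ recip (suc j !) ℚ.* fromℕ (suc j)
      c≡ j = ≡.sym (≡.trans (≡.cong (ℚ._* fromℕ (suc j)) (factorial-recip j))
        (≡.trans (ℚS.solve 3 (λ r c n → (r ℚS.:* c) ℚS.:* n ℚS.:= (n ℚS.:* r) ℚS.:* c) ≡.refl (recip (suc j)) (recip (j !)) (fromℕ (suc j)))
        (≡.trans (≡.cong (ℚ._* recip (j !)) (fromℕ-recip j)) (ℚₚ.*-identityˡ _))))

  -- A single Euler factor and its operator.

  module LocalFactor (𝔸 : BanachAlgebra) where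
    open BanachAlgebra 𝔸
    open BanachAlgebra-lemmas 𝔸
    open Solver using (solve; _:=_; _:+_; _:*_; _:-_; :-_; con)
    open import Relation.Binary.Reasoning.Setoid setoid

    module _ (h : ℕ → Carrier) (p : ℕ) (2≤p : 2 ℕ.≤ p)
      (h-0 : h 0 ≈ 1#) (h-1 : h 1 ≈ 0#) (C : ℚ) (0≤C : 0ℚ ℚ.≤ C) (h-bound : ∀ α → h α ⊑ C ℚ.* ρ ^ℚ α) where

      η : ℚ
      η = C ℚ.* (fromℕ 147 ℚ.* a p)

      -- As h(1) = 0, the sum over α ≥ 1 starts at α = 2, where `weight-sum` applies. The scale Z is
      -- 1 for the Euler factor itself and a multiple of the error term for the operator.
      tail-bound : ∀ (t : ℕ → Carrier) Z → 0ℚ ℚ.≤ Z → t 1 ≈ 0# → (∀ α → t (2 ℕ.+ α) ⊑ C ℚ.* weight p (2 ℕ.+ α) ℚ.* Z) →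
        ∀ n → sum t (2 ℕ.+ n) - t 0 ⊑ η ℚ.* Z
      tail-bound t Z 0≤Z t1 t≥2 n = ⊑-mono
        (ℚₚ.≤-trans (ℚₚ.≤-reflexive (≡.trans (ℚ-sums.sum-*ʳ (λ α → C ℚ.* weight p (2 ℕ.+ α)) Z n) (≡.cong (ℚ._* Z) (ℚ-sums.sum-*ˡ C (λ α → weight p (2 ℕ.+ α)) n))))
          (*-monoʳ 0≤Z (*-monoˡ 0≤C (weight-sum 2≤p n))))
        (⊑-resp (begin
          sum (λ α → t (2 ℕ.+ α)) n                                ≈⟨ solve 2 (λ a b → b := a :+ (con 0ℚ :+ b) :- a) refl (t 0) _ ⟩
          t 0 + (ι 0ℚ + sum (λ α → t (2 ℕ.+ α)) n) - t 0           ≈⟨ +-congʳ (+-congˡ (+-congʳ (trans ι-0 (sym t1)))) ⟩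
          t 0 + (t 1 + sum (λ α → t (2 ℕ.+ α)) n) - t 0            ≈⟨ +-congʳ (+-congˡ (sym (sum-shift (λ α → t (suc α)) n))) ⟩
          t 0 + sum (λ α → t (suc α)) (suc n) - t 0                ≈⟨ +-congʳ (sym (sum-shift t (suc n))) ⟩
          sum t (2 ℕ.+ n) - t 0                                    ∎)
          (⊑-sum n λ α _ → t≥2 α))

      series : ℕ → Carrier
      series = sum (λ α → h α * ι (recip (p ℕ.^ α)))

      module _ {e : Carrier} (series⟶e : series ⟶ e) where

        factor-1 : e - 1# ⊑ η
        factor-1 = ⊑-swap (⊑-limit series⟶e (2 , λ { (suc (suc n)) (s≤s (s≤s _)) → ⊑-swap
          (⊑-mono (ℚₚ.≤-reflexive (ℚₚ.*-identityʳ η)) (⊑-resp (+-congˡ (-‿cong (trans (*-cong h-0 ι-1) (*-identityˡ 1#))))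
            (tail-bound (λ α → h α * ι (recip (p ℕ.^ α))) 1ℚ 0≤1 (trans (*-congʳ h-1) (zeroˡ _))
              (λ α → ⊑-mono (ℚₚ.≤-trans (ℚₚ.≤-reflexive (ℚₚ.*-assoc C _ _)) (ℚₚ.≤-trans (*-monoˡ 0≤C (*-monoˡ (0≤ρ^ (2 ℕ.+ α))
                  (ℚₚ.≤-trans (ℚₚ.≤-reflexive (≡.sym (ℚₚ.*-identityˡ _))) (*-monoʳ (0≤recip (p ℕ.^ (2 ℕ.+ α))) (1≤L (p ℕ.^ (2 ℕ.+ α)))))))
                  (ℚₚ.≤-reflexive (≡.sym (ℚₚ.*-identityʳ _)))))
                (⊑-* (h-bound (2 ℕ.+ α)) (⊑-ι′ (0≤recip (p ℕ.^ (2 ℕ.+ α)))))) n))) }))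

        module _ (M j : ℕ) (F : ℕ → Carrier) (F-0 : F 0 ≈ 0#) (c : Carrier) (B : ℚ) (c⊑B : c ⊑ B)
          (F-asymptotic : ∀ x → x ℕ.< M → F x - c * ι (G j x) ⊑ B ℚ.* W j x) where
          open QuotientOperators 𝔸 M using (T; T-extend)

          0≤B : 0ℚ ℚ.≤ B
          0≤B = ⊑⇒0≤ c⊑B

          -- Each F(x/p^α) is compared with c G(x)/p^α. The discrepancy is at most L(p^α)/p^α times
          -- (3 + j) B W, with 2 from `W-÷` and j + 1 from `G-÷`; for this sum one B bounds both the
          -- coefficient c and the error.
          T-asymptotic : ∀ x → x ℕ.< M → T h p F x - c * e * ι (G j x) ⊑ B ℚ.* (1ℚ ℚ.+ fromℕ (3 ℕ.+ j) ℚ.* η) ℚ.* W j x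
          T-asymptotic x x<M = ⊑-resp (+-congˡ (-‿cong (solve 3 (λ c g e → (c :* g) :* e := c :* e :* g) refl c (ι (G j x)) e)))
            (⊑-limit (⟶-*ˡ (c * ι (G j x)) series⟶e) (2 ℕ.+ M , λ { (suc (suc n)) (s≤s (s≤s M≤n)) → partial n (ℕₚ.≤-trans M≤n (ℕₚ.≤-trans (ℕₚ.n≤1+n n) (ℕₚ.n≤1+n _))) }))
            where
            Z = fromℕ (3 ℕ.+ j) ℚ.* B ℚ.* W j x
            y : ℕ → ℕ
            y α = x ÷ p ℕ.^ α
            r : ℕ → ℚ
            r α = recip (p ℕ.^ α)
            t : ℕ → Carrier
            t α = h α * ((F (y α) - c * ι (G j (y α))) + c * ι (G j (y α) ℚ.- G j x ℚ.* r α))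
            bracket : ∀ n → 0 ℕ.< n →
              (F (x ÷ n) - c * ι (G j (x ÷ n))) + c * ι (G j (x ÷ n) ℚ.- G j x ℚ.* recip n) ⊑ L n ℚ.* recip n ℚ.* Z
            bracket (suc m) _ = ⊑-mono (ℚₚ.≤-reflexive total) (⊑-+
                (⊑-mono (*-monoˡ 0≤B (W-÷ j x m)) (F-asymptotic (x ÷ suc m) (ℕₚ.≤-<-trans (÷-≤ x (suc m)) x<M)))
                (⊑-* c⊑B (⊑-ι-≤ (G-÷ j x m))))
              where
              v = L (suc m) ℚ.* recip (suc m)
              total : B ℚ.* ((1ℚ ℚ.+ 1ℚ) ℚ.* v ℚ.* W j x) ℚ.+ B ℚ.* (fromℕ (suc j) ℚ.* v ℚ.* W j x) ≡ v ℚ.* Z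
              total = ≡.trans (ℚS.solve 4 (λ b v w n → b ℚS.:* ((ℚS.con 1ℚ ℚS.:+ ℚS.con 1ℚ) ℚS.:* v ℚS.:* w) ℚS.:+ b ℚS.:* (n ℚS.:* v ℚS.:* w)
                  ℚS.:= v ℚS.:* ((ℚS.con (fromℕ 2) ℚS.:+ n) ℚS.:* b ℚS.:* w)) ≡.refl B v (W j x) (fromℕ (suc j)))
                (≡.cong (λ n → v ℚ.* (n ℚ.* B ℚ.* W j x)) (≡.sym (fromℕ-+ 2 (suc j))))
            -- The term α = 0 passes the old error on with factor exactly 1. Any constant above 1
            -- would ruin the product over all primes.
            head : t 0 ⊑ B ℚ.* W j x
            head = ⊑-resp (sym (begin
              t 0                                                                             ≈⟨ trans (*-congʳ h-0) (*-identityˡ _) ⟩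
              (F (x ÷ 1) - c * ι (G j (x ÷ 1))) + c * ι (G j (x ÷ 1) ℚ.- G j x ℚ.* 1ℚ)        ≈⟨ reflexive (≡.cong (λ z → (F z - c * ι (G j z)) + c * ι (G j z ℚ.- G j x ℚ.* 1ℚ)) (÷1 x)) ⟩
              (F x - c * ι (G j x)) + c * ι (G j x ℚ.- G j x ℚ.* 1ℚ)                          ≈⟨ +-congˡ (trans (*-congˡ (trans (reflexive (≡.cong ι
                  (ℚS.solve 1 (λ g → g ℚS.:- g ℚS.:* ℚS.con 1ℚ ℚS.:= ℚS.con 0ℚ) ≡.refl (G j x)))) ι-0)) (zeroʳ c)) ⟩
              (F x - c * ι (G j x)) + 0#                                                      ≈⟨ +-identityʳ _ ⟩
              F x - c * ι (G j x)                                                             ∎)) (F-asymptotic x x<M)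
            tail : ∀ n → sum t (2 ℕ.+ n) - t 0 ⊑ η ℚ.* Z
            tail = tail-bound t Z (0≤* (0≤* (0≤fromℕ (3 ℕ.+ j)) 0≤B) (0≤W j x)) (trans (*-congʳ h-1) (zeroˡ _)) λ α →
              ⊑-mono (ℚₚ.≤-reflexive (ℚS.solve 4 (λ c s v z → (c ℚS.:* s) ℚS.:* (v ℚS.:* z) ℚS.:= c ℚS.:* (s ℚS.:* v) ℚS.:* z) ≡.refl C (ρ ^ℚ (2 ℕ.+ α)) (L (p ℕ.^ (2 ℕ.+ α)) ℚ.* r (2 ℕ.+ α)) Z))
                (⊑-* (h-bound (2 ℕ.+ α)) (bracket (p ℕ.^ (2 ℕ.+ α)) (ℕₚ.≤-<-trans z≤n (n<m^n 2≤p (2 ℕ.+ α)))))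
            partial : ∀ n → M ℕ.≤ 2 ℕ.+ n → T h p F x - c * ι (G j x) * series (2 ℕ.+ n) ⊑ B ℚ.* (1ℚ ℚ.+ fromℕ (3 ℕ.+ j) ℚ.* η) ℚ.* W j x
            partial n M≤m = ⊑-mono (ℚₚ.≤-reflexive (ℚS.solve 4 (λ b w n e → b ℚS.:* w ℚS.:+ e ℚS.:* (n ℚS.:* b ℚS.:* w) ℚS.:= b ℚS.:* (ℚS.con 1ℚ ℚS.:+ n ℚS.:* e) ℚS.:* w) ≡.refl B (W j x) (fromℕ (3 ℕ.+ j)) η))
              (⊑-resp (begin
                sum t (2 ℕ.+ n)
                  ≈⟨ sum-cong (2 ℕ.+ n) (λ α _ → trans (*-congˡ (+-congˡ (*-congˡ (trans (ι-− (G j (y α)) (G j x ℚ.* r α)) (+-congˡ (-‿cong (ι-* (G j x) (r α))))))))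
                       (solve 6 (λ h f c g k r → h :* ((f :- c :* g) :+ c :* (g :- k :* r)) := h :* f :- c :* k :* (h :* r)) refl (h α) (F (y α)) c (ι (G j (y α))) (ι (G j x)) (ι (r α)))) ⟩
                sum (λ α → h α * F (y α) - c * ι (G j x) * (h α * ι (r α))) (2 ℕ.+ n)
                  ≈⟨ sum-− _ _ (2 ℕ.+ n) ⟩
                sum (λ α → h α * F (y α)) (2 ℕ.+ n) - sum (λ α → c * ι (G j x) * (h α * ι (r α))) (2 ℕ.+ n)
                  ≈⟨ +-cong (sym (T-extend h 2≤p F-0 x<M M≤m)) (-‿cong (sum-*ˡ (c * ι (G j x)) (λ α → h α * ι (r α)) (2 ℕ.+ n))) ⟩
                T h p F x - c * ι (G j x) * series (2 ℕ.+ n) ∎)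
              (⊑-of-difference (tail n) head))

-- Local series, Euler products and the mean value over all primes.

module MeanValues where
  open import Data.Nat as ℕ using (ℕ; zero; suc; s≤s; _!)
  import Data.Nat.Properties as ℕₚ
  open import Data.Nat.Divisibility using (_∣_)
  open import Data.Nat.Primality using (Prime; prime?; prime[2])
  open import Data.Rational as ℚ using (ℚ; 0ℚ; 1ℚ; ½)
  import Data.Rational.Properties as ℚₚ
  open import Data.Rational.Solver using (module +-*-Solver)
  open import Data.Product using (∃; _×_; _,_; proj₁; proj₂)
  open import Relation.Nullary using (¬_; Dec; yes; no)
  open import Relation.Binary.PropositionalEquality as ≡ using (_≡_)
  open Rationals hiding (_^_)
  open Rationals using () renaming (_^_ to _^ℚ_)
  open Quotients
  open Sums
  open Harmonic
  open Growth
  open Weights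
  open BanachAlgebras
  open Operators
  open Asymptotics
  private module ℚS = +-*-Solver

  module EulerProducts (𝔸 : BanachAlgebra) where
    open BanachAlgebra 𝔸
    open BanachAlgebra-lemmas 𝔸
    open PowerSeries 𝔸
    open Solver using (solve; _:=_; _:+_; _:*_; _:-_; :-_; con)
    open import Relation.Binary.Reasoning.Setoid setoid

    telescope : ∀ {s : ℕ → Carrier} {v : ℕ → ℚ} → (∀ n → s (suc n) - s n ⊑ v n ℚ.- v (suc n)) →
      ∀ m i → s (i ℕ.+ m) - s m ⊑ v m ℚ.- v (i ℕ.+ m)
    telescope {s} {v} h m zero = ⊑-mono (ℚₚ.≤-reflexive (≡.sym (ℚₚ.+-inverseʳ (v m)))) (⊑-resp (sym (-‿inverseʳ (s m))) ⊑-0)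
    telescope {s} {v} h m (suc i) = ⊑-mono
      (ℚₚ.≤-reflexive (ℚS.solve 3 (λ a b c → (b ℚS.:- c) ℚS.:+ (a ℚS.:- b) ℚS.:= a ℚS.:- c) ≡.refl (v m) (v (i ℕ.+ m)) (v (suc i ℕ.+ m))))
      (⊑-resp (solve 3 (λ a b c → (c :- b) :+ (b :- a) := c :- a) refl (s m) (s (i ℕ.+ m)) (s (suc i ℕ.+ m)))
        (⊑-+ (h (i ℕ.+ m)) (telescope {s} {v} h m i)))

    -- The convergence test for both infinite processes: v is a geometric sequence for the local
    -- series and a multiple of `u` for the Euler product.
    telescope-converges : ∀ {s : ℕ → Carrier} {v : ℕ → ℚ} → (∀ n → s (suc n) - s n ⊑ v n ℚ.- v (suc n)) → (∀ n → 0ℚ ℚ.≤ v n) →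
      (∀ ε → 0ℚ ℚ.< ε → ∃ λ N → ∀ n → N ℕ.≤ n → v n ℚ.≤ ε) → ∃ λ z → s ⟶ z
    telescope-converges {s} {v} h 0≤v small = complete s λ ε ε>0 → let N , hN = small ε ε>0 in N , λ m n N≤m m≤n →
      ≡.subst (λ n → s n - s m ⊑ ε) (ℕₚ.m∸n+n≡m m≤n)
        (⊑-mono (ℚₚ.≤-trans (≤-by (v (n ℕ.∸ m ℕ.+ m)) (0≤v (n ℕ.∸ m ℕ.+ m)) (ℚS.solve 2 (λ a b → a ℚS.:- b ℚS.:+ b ℚS.:= a) ≡.refl (v m) (v (n ℕ.∸ m ℕ.+ m)))) (hN m N≤m))
          (telescope {s} {v} h m (n ℕ.∸ m)))

    dirichlet : (ℕ → Carrier) → ℕ → ℕ → Carrier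
    dirichlet h p = sum (λ α → h α * ι (recip (p ℕ.^ α)))

    dirichlet-converges : ∀ {h p C} → 2 ℕ.≤ p → (∀ α → h α ⊑ C ℚ.* ρ ^ℚ α) → ∃ λ z → dirichlet h p ⟶ z
    -- 4 = 1/(1 - θ), so the decrements of 4 C θ^n are exactly C θ^n.
    dirichlet-converges {h} {p} {C} 2≤p h≤ = telescope-converges {v = λ n → fromℕ 4 ℚ.* C ℚ.* θ ^ℚ n}
      (λ n → ⊑-mono (ℚₚ.≤-trans (ℚₚ.≤-reflexive (ℚₚ.*-assoc C (ρ ^ℚ n) (recip (p ℕ.^ n)))) (ℚₚ.≤-trans (*-monoˡ 0≤C (ρ^*recip^-≤ 2≤p n))
          (ℚₚ.≤-reflexive (ℚS.solve 2 (λ c t → c ℚS.:* t ℚS.:= ℚS.con (fromℕ 4) ℚS.:* c ℚS.:* t ℚS.:- ℚS.con (fromℕ 4) ℚS.:* c ℚS.:* (ℚS.con θ ℚS.:* t)) ≡.refl C (θ ^ℚ n)))))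
        (⊑-resp (solve 2 (λ a b → b := a :+ b :- a) refl (dirichlet h p n) (h n * ι (recip (p ℕ.^ n))))
          (⊑-* (h≤ n) (⊑-ι′ (0≤recip (p ℕ.^ n))))))
      (λ n → 0≤* (0≤* (0≤fromℕ 4) 0≤C) (0≤^ 0≤θ n))
      (θ^-small (0≤* (0≤fromℕ 4) 0≤C))
      where
      0≤C : 0ℚ ℚ.≤ C
      0≤C = ≡.subst (0ℚ ℚ.≤_) (ℚₚ.*-identityʳ C) (⊑⇒0≤ (h≤ 0))

    ⟶-shift : ∀ {s z} → (λ n → s (suc n)) ⟶ z → s ⟶ z
    ⟶-shift h ε ε>0 = let N , hN = h ε ε>0 in suc N , λ { (suc n) (s≤s N≤n) → hN n N≤n }

    ⟶-resp : ∀ {s y z} → y ≈ z → s ⟶ y → s ⟶ z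
    ⟶-resp y≈z h ε ε>0 = let N , hN = h ε ε>0 in N , λ n N≤n → ⊑-resp (+-congˡ (-‿cong y≈z)) (hN n N≤n)

    ⟶-suc : ∀ {s z} → s ⟶ z → (λ n → s (suc n)) ⟶ z
    ⟶-suc h ε ε>0 = let N , hN = h ε ε>0 in N , λ n N≤n → hN (suc n) (ℕₚ.m≤n⇒m≤1+n N≤n)

    -- Multiplying a power series by 1 - X multiplies its value at X = 1/p by 1 - 1/p. For partial
    -- sums this is exact when the subtracted sum is one term shorter.
    dirichlet-difference : ∀ h p {s} → dirichlet h p ⟶ s → dirichlet (difference h) p ⟶ ι (1ℚ ℚ.- recip p) * s
    dirichlet-difference h p {s} h⟶s = ⟶-resp (trans (solve 2 (λ y s → s :- y :* s := (con 1ℚ :- y) :* s) refl y s) (*-congʳ (sym (ι-− 1ℚ (recip p)))))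
      (⟶-shift (⟶-cong partial (⟶-− (⟶-suc h⟶s) (⟶-*ˡ y h⟶s))))
      where
      y = ι (recip p)
      r : ℕ → Carrier
      r α = ι (recip (p ℕ.^ α))
      partial : ∀ n → dirichlet h p (suc n) - y * dirichlet h p n ≈ dirichlet (difference h) p (suc n)
      partial zero    = trans (+-congˡ (trans (-‿cong (zeroʳ y)) (trans (sym (+-identityˡ (- 0#))) (-‿inverseʳ 0#)))) (+-identityʳ _)
      partial (suc n) = begin
        dirichlet h p (suc n) + h (suc n) * r (suc n) - y * (dirichlet h p n + h n * r n)
          ≈⟨ solve 7 (λ s t a b r r′ y → s :+ a :* r′ :- y :* (t :+ b :* r) := (s :- y :* t) :+ (a :* r′ :- b :* (y :* r))) refl
               (dirichlet h p (suc n)) (dirichlet h p n) (h (suc n)) (h n) (r n) (r (suc n)) y ⟩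
        (dirichlet h p (suc n) - y * dirichlet h p n) + (h (suc n) * r (suc n) - h n * (y * r n))
          ≈⟨ +-cong (partial n) (+-congˡ (-‿cong (*-congˡ (trans (sym (ι-* (recip p) (recip (p ℕ.^ n)))) (reflexive (≡.cong ι (≡.sym (recip-* p (p ℕ.^ n)))))))) ) ⟩
        dirichlet (difference h) p (suc n) + (h (suc n) * r (suc n) - h n * r (suc n))
          ≈⟨ +-congˡ (solve 3 (λ a b r → a :* r :- b :* r := (a :- b) :* r) refl (h (suc n)) (h n) (r (suc n))) ⟩
        dirichlet (difference h) p (suc (suc n)) ∎

    dirichlet-differences : ∀ i h p {s} → dirichlet h p ⟶ s → dirichlet (iterate difference i h) p ⟶ ι (1ℚ ℚ.- recip p) ^ i * s
    dirichlet-differences zero    h p {s} h⟶s = ⟶-resp (sym (*-identityˡ s)) h⟶s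
    dirichlet-differences (suc i) h p {s} h⟶s = ⟶-resp (sym (*-assoc _ _ s)) (dirichlet-difference _ p (dirichlet-differences i h p h⟶s))

    -- Each difference costs a factor 2, because ρ + 1 ≤ 2 ρ.
    differences-bound : ∀ {h C} → 0ℚ ℚ.≤ C → (∀ α → h α ⊑ C ℚ.* ρ ^ℚ α) → ∀ i α → iterate difference i h α ⊑ fromℕ 2 ^ℚ i ℚ.* C ℚ.* ρ ^ℚ α
    differences-bound {h} {C} 0≤C h≤ zero    α = ⊑-mono (ℚₚ.≤-reflexive (≡.cong (ℚ._* ρ ^ℚ α) (≡.sym (ℚₚ.*-identityˡ C)))) (h≤ α)
    differences-bound {h} {C} 0≤C h≤ (suc i) zero = ⊑-mono
      (*-monoʳ 0≤1 (*-monoʳ 0≤C (ℚₚ.≤-trans (ℚₚ.≤-reflexive (≡.sym (ℚₚ.*-identityˡ (fromℕ 2 ^ℚ i)))) (*-monoʳ (0≤^ (0≤fromℕ 2) i) (1≤fromℕ 1)))))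
      (differences-bound 0≤C h≤ i 0)
    differences-bound {h} {C} 0≤C h≤ (suc i) (suc α) = ⊑-mono
      (≤-by (fromℕ 2 ^ℚ i ℚ.* C ℚ.* ρ ^ℚ α ℚ.* ½) (0≤* (0≤* (0≤* (0≤^ (0≤fromℕ 2) i) 0≤C) (0≤ρ^ α)) 0≤½)
        (ℚS.solve 3 (λ p c r → p ℚS.:* c ℚS.:* (ℚS.con ρ ℚS.:* r) ℚS.:+ p ℚS.:* c ℚS.:* r ℚS.:+ p ℚS.:* c ℚS.:* r ℚS.:* ℚS.con ½
          ℚS.:= (ℚS.con (fromℕ 2) ℚS.:* p) ℚS.:* c ℚS.:* (ℚS.con ρ ℚS.:* r)) ≡.refl (fromℕ 2 ^ℚ i) C (ρ ^ℚ α)))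
      (⊑-− (differences-bound 0≤C h≤ i (suc α)) (differences-bound 0≤C h≤ i α))

    differences-0 : ∀ i h → iterate difference i h 0 ≡ h 0
    differences-0 zero    h = ≡.refl
    differences-0 (suc i) h = differences-0 i h

    -- Every difference lowers the first coefficient by h(0) = 1; k differences therefore cancel
    -- f(p) = k exactly.
    differences-1 : ∀ i h → h 0 ≈ 1# → iterate difference i h 1 + ι (fromℕ i) ≈ h 1
    differences-1 zero    h h0 = trans (+-congˡ ι-0) (+-identityʳ (h 1))
    differences-1 (suc i) h h0 = begin
      a₁ - a₀ + ι (fromℕ (suc i))       ≈⟨ +-cong (+-congˡ (-‿cong (trans (reflexive (differences-0 i h)) h0))) (trans (reflexive (≡.cong ι (fromℕ-suc i))) (trans (ι-+ 1ℚ (fromℕ i)) (+-congʳ ι-1))) ⟩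
      a₁ - 1# + (1# + ι (fromℕ i))      ≈⟨ solve 3 (λ a o x → a :- o :+ (o :+ x) := a :+ x) refl a₁ 1# (ι (fromℕ i)) ⟩
      a₁ + ι (fromℕ i)                  ≈⟨ differences-1 i h h0 ⟩
      h 1                               ∎
      where
      a₁ = iterate difference i h 1
      a₀ = iterate difference i h 0

    extend : ∀ {n} → Dec (Prime n) → (∀ p → Prime p → Carrier) → Carrier → Carrier
    extend {n} (yes pr) F z = z * F n pr
    extend     (no _)   F z = z

    primeProducts : (∀ p → Prime p → Carrier) → ℕ → Carrier
    primeProducts F zero    = 1#
    primeProducts F (suc N) = extend (prime? (suc N)) F (primeProducts F N)

    eulerFactor : ℕ → (∀ p → Prime p → Carrier) → ∀ p → Prime p → Carrier
    eulerFactor k localSum p pr = ι (1ℚ ℚ.- recip p) ^ k * localSum p pr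

    eulerFactor-unique : ∀ k localSum p pr {x y} → x ≈ ι (1ℚ ℚ.- recip p) ^ k → y ≈ x * localSum p pr → y ≈ eulerFactor k localSum p pr
    eulerFactor-unique k localSum p pr h h′ = trans h′ (*-congʳ h)

    -- Any sequence obeying the recursion of a sum is that sum. This lemma and its analogues below
    -- identify the sums, powers and products in the definition of C_f with those of the abstract
    -- algebra.
    sum-unique : ∀ {s b : ℕ → Carrier} → s 0 ≈ 0# → (∀ n → s (suc n) ≈ s n + b n) → ∀ n → s n ≈ sum b n
    sum-unique h₀ h zero    = h₀
    sum-unique h₀ h (suc n) = trans (h n) (+-congʳ (sum-unique h₀ h n))

    dirichlet-unique : ∀ {s h : ℕ → Carrier} {p} → s 0 ≈ 0# → (∀ n → s (suc n) ≈ s n + h n * ι (recip (p ℕ.^ n))) → ∀ n → s n ≈ dirichlet h p n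
    dirichlet-unique {s} {h} {p} = sum-unique {s} {λ α → h α * ι (recip (p ℕ.^ α))}

    ^-unique : ∀ {s : ℕ → Carrier} {z} → s 0 ≈ 1# → (∀ n → s (suc n) ≈ z * s n) → ∀ n → s n ≈ z ^ n
    ^-unique h₀ h zero    = h₀
    ^-unique h₀ h (suc n) = trans (h n) (*-congˡ (^-unique h₀ h n))

    primeProducts-unique : ∀ {s : ℕ → Carrier} {F} → s 0 ≈ 1# →
      (∀ n pr → prime? (suc n) ≡ yes pr → s (suc n) ≈ s n * F (suc n) pr) →
      (∀ n ¬pr → prime? (suc n) ≡ no ¬pr → s (suc n) ≈ s n) → ∀ n → s n ≈ primeProducts F n
    primeProducts-unique h₀ h-yes h-no zero = h₀
    primeProducts-unique {s} {F} h₀ h-yes h-no (suc n) with prime? (suc n) in eq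
    ... | yes pr = trans (h-yes n pr eq) (*-congʳ (primeProducts-unique h₀ h-yes h-no n))
    ... | no ¬pr = trans (h-no n ¬pr eq) (primeProducts-unique h₀ h-yes h-no n)

    ⊑-replace : ∀ {s s′ z b} → s ≈ s′ → s′ - z ⊑ b → s - z ⊑ b
    ⊑-replace s≈s′ = ⊑-resp (+-congʳ (sym s≈s′))

    ⟶-replace : ∀ {a b z} → (∀ n → a n ≈ b n) → b ⟶ z → a ⟶ z
    ⟶-replace h = ⟶-cong (λ n → sym (h n))

  -- Accumulating the factors of all primes with uniform constants.

  module MeanValue (𝔸 : BanachAlgebra) where
    open BanachAlgebra 𝔸
    open BanachAlgebra-lemmas 𝔸
    open PowerSeries 𝔸
    open EulerProducts 𝔸
    open Solver using (solve; _:=_; _:+_; _:*_; _:-_; :-_; con)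
    open import Relation.Binary.Reasoning.Setoid setoid
    private
      module D = DivisorSums 𝔸
      module LF = LocalFactor 𝔸

    module _ (j : ℕ) (f : ℕ → Carrier) (f-1 : f 1 ≈ 1#)
      (f-* : ∀ p α n → Prime p → ¬ (p ∣ suc n) → f (p ℕ.^ α ℕ.* suc n) ≈ f (p ℕ.^ α) * f (suc n))
      (f-prime : ∀ p → Prime p → f p ≈ ι (fromℕ (suc j)))
      (C : ℚ) (f-bound : ∀ p α → Prime p → f (p ℕ.^ α) ⊑ C ℚ.* ρ ^ℚ α) where

      module Q (M : ℕ) = QuotientOperators.Sieve 𝔸 M f f-1 f-*

      localSum : ∀ p → Prime p → Carrier
      localSum p pr = proj₁ (dirichlet-converges {C = C} (prime⇒2≤ pr) (λ α → f-bound p α pr))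

      localSum-converges : ∀ p pr → dirichlet (λ α → f (p ℕ.^ α)) p ⟶ localSum p pr
      localSum-converges p pr = proj₂ (dirichlet-converges {C = C} (prime⇒2≤ pr) (λ α → f-bound p α pr))

      factor : ∀ p → Prime p → Carrier
      factor = eulerFactor (suc j) localSum

      private
        0≤C : 0ℚ ℚ.≤ C
        0≤C = ≡.subst (0ℚ ℚ.≤_) (ℚₚ.*-identityʳ C) (⊑⇒0≤ (f-bound 2 0 prime[2]))

        C′ : ℚ
        C′ = fromℕ 2 ^ℚ suc j ℚ.* C

        0≤C′ : 0ℚ ℚ.≤ C′
        0≤C′ = 0≤* (0≤^ (0≤fromℕ 2) (suc j)) 0≤C

        h : ℕ → ℕ → Carrier
        h p = iterate difference (suc j) (λ α → f (p ℕ.^ α))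

        h-0 : ∀ p → h p 0 ≈ 1#
        h-0 p = trans (reflexive (differences-0 (suc j) _)) f-1

        h-1 : ∀ p → Prime p → h p 1 ≈ 0#
        h-1 p pr = begin
          h p 1                                                  ≈⟨ solve 2 (λ a b → a := a :+ b :- b) refl (h p 1) (ι (fromℕ (suc j))) ⟩
          h p 1 + ι (fromℕ (suc j)) - ι (fromℕ (suc j))          ≈⟨ +-congʳ (trans (differences-1 (suc j) (λ α → f (p ℕ.^ α)) f-1) (trans (reflexive (≡.cong f (ℕₚ.*-identityʳ p))) (f-prime p pr))) ⟩
          ι (fromℕ (suc j)) - ι (fromℕ (suc j))                  ≈⟨ -‿inverseʳ _ ⟩
          0#                                                     ∎

        h-bound : ∀ p → Prime p → ∀ α → h p α ⊑ C′ ℚ.* ρ ^ℚ α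
        h-bound p pr = differences-bound 0≤C (λ α → f-bound p α pr) (suc j)

        series⟶factor : ∀ p pr → dirichlet (h p) p ⟶ factor p pr
        series⟶factor p pr = dirichlet-differences (suc j) _ p (localSum-converges p pr)

        -- Makes the loss of `T-asymptotic` at p equal to 1 + q a(p).
        q : ℚ
        q = fromℕ (3 ℕ.+ j) ℚ.* (C′ ℚ.* fromℕ 147)

        0≤q : 0ℚ ℚ.≤ q
        0≤q = 0≤* (0≤fromℕ (3 ℕ.+ j)) (0≤* 0≤C′ (0≤fromℕ 147))

        -- As κ ≥ 8 q, `ϖ^-step` keeps the accumulated losses up to N below ϖ(N)^κ, hence below `B∞`
        -- = 2^κ for every N.
        κ : ℕ
        κ = proj₁ (above (fromℕ 8 ℚ.* q))

        ϖ^ : ℕ → ℚ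
        ϖ^ N = ϖ N ^ℚ κ

        0≤ϖ^ : ∀ N → 0ℚ ℚ.≤ ϖ^ N
        0≤ϖ^ N = 0≤^ (0≤ϖ N) κ

        ϖ^-mono : ∀ N → ϖ^ N ℚ.≤ ϖ^ (suc N)
        ϖ^-mono N = ^-mono (0≤ϖ N) (ϖ-mono N) κ

        B∞ : ℚ
        B∞ = (1ℚ ℚ.+ 1ℚ) ^ℚ κ

        ϖ^≤B∞ : ∀ N → ϖ^ N ℚ.≤ B∞
        ϖ^≤B∞ N = ^-mono (0≤ϖ N) (ϖ-bound N) κ

        growth : ∀ {n} → Prime (suc n) → ϖ^ n ℚ.* (1ℚ ℚ.+ q ℚ.* a (suc n)) ℚ.≤ ϖ^ (suc n)
        growth {zero}  pr with prime⇒2≤ pr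
        ... | s≤s ()
        growth {suc n} pr = ϖ^-step {q} κ (proj₂ (above (fromℕ 8 ℚ.* q))) n

        pp : ℕ → Carrier
        pp = primeProducts factor

        factor-1 : ∀ p pr → factor p pr - 1# ⊑ q ℚ.* a p
        factor-1 p pr = ⊑-mono
          (ℚₚ.≤-trans (ℚₚ.≤-reflexive (ℚS.solve 3 (λ c n x → c ℚS.:* (n ℚS.:* x) ℚS.:= ℚS.con 1ℚ ℚS.:* (c ℚS.:* n) ℚS.:* x) ≡.refl C′ (fromℕ 147) (a p)))
            (*-monoʳ (0≤a p) (*-monoʳ (0≤* 0≤C′ (0≤fromℕ 147)) (1≤fromℕ (2 ℕ.+ j)))))
          (LF.factor-1 (h p) p (prime⇒2≤ pr) (h-0 p) (h-1 p pr) C′ 0≤C′ (h-bound p pr) (series⟶factor p pr))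

        pp-bound : ∀ N → pp N ⊑ ϖ^ N
        pp-bound zero    = ⊑-mono (1≤^ ℚₚ.≤-refl κ) ⊑-1
        pp-bound (suc N) = go (prime? (suc N))
          where
          go : (d : Dec (Prime (suc N))) → extend d factor (pp N) ⊑ ϖ^ (suc N)
          go (yes pr) = ⊑-mono (growth pr) (⊑-* (pp-bound N) (⊑-of-difference (factor-1 (suc N) pr) ⊑-1))
          go (no _)   = ⊑-mono (ϖ^-mono N) (pp-bound N)

        pp-step : ∀ n → pp (suc (suc n)) - pp (suc n) ⊑ B∞ ℚ.* q ℚ.* u (suc n) ℚ.- B∞ ℚ.* q ℚ.* u (suc (suc n))
        pp-step n = go (prime? (suc (suc n)))
          where
          N = suc n
          0≤B∞q : 0ℚ ℚ.≤ B∞ ℚ.* q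
          0≤B∞q = 0≤* (ℚₚ.≤-trans (0≤ϖ^ N) (ϖ^≤B∞ N)) 0≤q
          rearranged : B∞ ℚ.* q ℚ.* (u N ℚ.- u (suc N)) ≡ B∞ ℚ.* q ℚ.* u N ℚ.- B∞ ℚ.* q ℚ.* u (suc N)
          rearranged = ℚS.solve 3 (λ b x y → b ℚS.:* (x ℚS.:- y) ℚS.:= b ℚS.:* x ℚS.:- b ℚS.:* y) ≡.refl (B∞ ℚ.* q) (u N) (u (suc N))
          go : (d : Dec (Prime (suc N))) → extend d factor (pp N) - pp N ⊑ B∞ ℚ.* q ℚ.* u N ℚ.- B∞ ℚ.* q ℚ.* u (suc N)
          go (no _)   = ⊑-mono (ℚₚ.≤-trans (0≤* 0≤B∞q (ℚₚ.≤-trans (0≤a (suc N)) (u-telescopes n))) (ℚₚ.≤-reflexive rearranged)) (⊑-resp (sym (-‿inverseʳ (pp N))) ⊑-0)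
          go (yes pr) = ⊑-mono (ℚₚ.≤-trans (*-mono (0≤ϖ^ N) (0≤* 0≤q (0≤a (suc N))) (ϖ^≤B∞ N) (*-monoˡ 0≤q (u-telescopes n)))
              (ℚₚ.≤-reflexive (≡.trans (≡.sym (ℚₚ.*-assoc B∞ q (u N ℚ.- u (suc N)))) rearranged)))
            (⊑-resp (trans (solve 3 (λ p e o → p :* (e :- o) := p :* e :- p :* o) refl (pp N) (factor (suc N) pr) 1#) (+-congˡ (-‿cong (*-identityʳ (pp N)))))
              (⊑-* (pp-bound N) (factor-1 (suc N) pr)))

      product-converges : ∃ λ z → primeProducts factor ⟶ z
      product-converges =
        let 0≤B∞q = 0≤* (ℚₚ.≤-trans (0≤ϖ^ 0) (ϖ^≤B∞ 0)) 0≤q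
            -- Started at index 1: u 0 = 0 because `recip 0` is 0, and `u` decreases only from 1 on.
            z , hz = telescope-converges {s = λ n → pp (suc n)} {v = λ n → B∞ ℚ.* q ℚ.* u (suc n)} pp-step
              (λ n → 0≤* 0≤B∞q (0≤u (suc n))) (u-scaled-small 0≤B∞q)
        in z , ⟶-shift hz

      private
        c : ℚ
        c = recip (j !)

        -- The added 1 makes the same constant bound the coefficient 1/j! as well, as `T-asymptotic`
        -- requires.
        B₀ : ℚ
        B₀ = proj₁ (D.divisor-asymptotic j) ℚ.+ 1ℚ

        1≤B₀ : 1ℚ ℚ.≤ B₀
        1≤B₀ = p≤q+p (proj₁ (proj₂ (D.divisor-asymptotic j)))

        B : ℕ → ℚ
        B N = B₀ ℚ.* ϖ^ N

        0≤B₀ : 0ℚ ℚ.≤ B₀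
        0≤B₀ = ℚₚ.≤-trans 0≤1 1≤B₀

        cpp-bound : ∀ N → ι c * pp N ⊑ B N
        cpp-bound N = ⊑-* (⊑-mono (ℚₚ.≤-trans (recip≤1 (j !)) 1≤B₀) (⊑-ι′ (0≤recip (j !)))) (pp-bound N)

        module _ (M : ℕ) where
          open Q M
          F₀ : ℕ → Carrier
          F₀ = iterate (QuotientOperators.U 𝔸 M 0) (suc j) δ

          -- Starts from the divisor sums and adds one integer at a time; a prime multiplies the
          -- main coefficient by its Euler factor and the constant by at most ϖ^(N + 1)/ϖ^(N).
          E-asymptotic : ∀ N x → x ℕ.< M → E h N F₀ x - ι c * pp N * ι (G j x) ⊑ B N ℚ.* W j x
          E-asymptotic zero x x<M = ⊑-mono (ℚₚ.≤-trans (*-monoˡ 0≤C₀ (D.error≤W j x))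
              (*-monoʳ (0≤W j x) (ℚₚ.≤-trans (p≤p+q {C₀} 0≤1) (ℚₚ.≤-trans (ℚₚ.≤-reflexive (≡.sym (ℚₚ.*-identityʳ B₀))) (*-monoˡ 0≤B₀ (1≤^ ℚₚ.≤-refl κ))))))
            (⊑-resp (+-congˡ (-‿cong (trans (ι-* c (G j x)) (*-congʳ (sym (*-identityʳ (ι c))))))) (proj₂ (proj₂ (D.divisor-asymptotic j)) M x x<M))
            where
            C₀ = proj₁ (D.divisor-asymptotic j)
            0≤C₀ = proj₁ (proj₂ (D.divisor-asymptotic j))
          E-asymptotic (suc N) = go (prime? (suc N))
            where
            go : (d : Dec (Prime (suc N))) → ∀ x → x ℕ.< M → T? h d (E h N F₀) x - ι c * extend d factor (pp N) * ι (G j x) ⊑ B (suc N) ℚ.* W j x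
            go (no _)   x x<M = ⊑-mono (*-monoʳ (0≤W j x) (*-monoˡ 0≤B₀ (ϖ^-mono N))) (E-asymptotic N x x<M)
            go (yes pr) x x<M = ⊑-mono (*-monoʳ (0≤W j x) bound) (⊑-resp (+-congˡ (-‿cong (*-congʳ (*-assoc (ι c) (pp N) (factor (suc N) pr)))))
              (LF.T-asymptotic (h (suc N)) (suc N) (prime⇒2≤ pr) (h-0 (suc N)) (h-1 (suc N) pr) C′ 0≤C′ (h-bound (suc N) pr) (series⟶factor (suc N) pr)
                M j (E h N F₀) (E-0 h N (QuotientOperators.iterate-U-0 𝔸 M 0 (suc j))) (ι c * pp N) (B N) (cpp-bound N) (E-asymptotic N) x x<M))
              where
              n = fromℕ (3 ℕ.+ j)
              bound : B N ℚ.* (1ℚ ℚ.+ n ℚ.* (C′ ℚ.* (fromℕ 147 ℚ.* a (suc N)))) ℚ.≤ B (suc N)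
              bound = ℚₚ.≤-trans (ℚₚ.≤-reflexive (ℚS.solve 6 (λ b w n c m x → b ℚS.:* w ℚS.:* (ℚS.con 1ℚ ℚS.:+ n ℚS.:* (c ℚS.:* (m ℚS.:* x)))
                  ℚS.:= b ℚS.:* (w ℚS.:* (ℚS.con 1ℚ ℚS.:+ n ℚS.:* (c ℚS.:* m) ℚS.:* x))) ≡.refl B₀ (ϖ^ N) n C′ (fromℕ 147) (a (suc N))))
                (*-monoˡ 0≤B₀ (growth pr))

      -- For fixed x take M = x + 1. The sum over f is the same expression for every N ≥ M and the
      -- error constants stay below B₀ B∞, so the partial Euler products may be replaced by their
      -- limit.
      mean-value : ∃ λ A → 0ℚ ℚ.≤ A × ∀ x → sum (λ i → f (suc i)) x - ι (recip (j !)) * proj₁ product-converges * ι (G j x) ⊑ A ℚ.* W j x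
      mean-value = B₀ ℚ.* B∞ , 0≤* 0≤B₀ (ℚₚ.≤-trans (0≤ϖ^ 0) (ϖ^≤B∞ 0)) , λ x → ⊑-resp
        (+-congˡ (-‿cong (solve 3 (λ c g z → (c :* g) :* z := c :* z :* g) refl (ι c) (ι (G j x)) (proj₁ product-converges))))
        (⊑-limit (⟶-*ˡ (ι c * ι (G j x)) (proj₂ product-converges)) (suc x , λ N x<N → ⊑-mono (*-monoʳ (0≤W j x) (*-monoˡ 0≤B₀ (ϖ^≤B∞ N)))
          (⊑-resp (+-cong (sym (Q.summatory-E (suc x) (suc j) x<N x (ℕₚ.n<1+n x)))
              (-‿cong (solve 3 (λ c p g → c :* p :* g := (c :* g) :* p) refl (ι c) (pp N) (ι (G j x)))))
            (E-asymptotic (suc x) N x (ℕₚ.n<1+n x)))))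

-- The complex numbers as a complete normed algebra.

module ComplexAlgebra where
  open import Defs as D hiding (_+_; _*_; -_; _-_; _≤_; _<_; _^_; ∣_∣)
  open import Algebra.Bundles using (CommutativeRing)
  open import Data.Nat as ℕ using (ℕ; suc)
  import Data.Nat.Properties as ℕₚ
  open import Data.Rational as ℚ using (ℚ; 0ℚ; 1ℚ; ½; _+_; _*_; -_; _-_; _≤_; _<_; ∣_∣)
  open import Data.Rational.Properties hiding (≃-sym)
  open import Data.Rational.Solver using (module +-*-Solver)
  open import Data.Product using (∃; _×_; _,_; proj₁; proj₂)
  open import Level using (0ℓ)
  open import Relation.Nullary using (yes; no)
  open import Relation.Nullary.Negation using (contradiction)
  open import Relation.Binary.PropositionalEquality using (_≡_; refl; sym; trans; cong; cong₂; subst)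
  open Rationals hiding (_^_)
  open BanachAlgebras
  open +-*-Solver using (solve; _:=_; _:+_; _:*_; _:-_; :-_; con)
  open Cauchy-lemmas using (⊔-left; ⊔-right; eventually-bounded; product-estimate)

  Eventually : (ℕ → Set) → Set
  Eventually P = ∃ λ N → ∀ n → N ℕ.≤ n → P n

  both : ∀ {P Q : ℕ → Set} → Eventually P → Eventually Q → Eventually (λ n → P n × Q n)
  both (M , p) (N , q) = M ℕ.⊔ N , λ n h → p n (⊔-left {M} {N} h) , q n (⊔-right {M} {N} h)

  eventually : ∀ {P Q : ℕ → Set} → (∀ n → P n → Q n) → Eventually P → Eventually Q
  eventually f (N , p) = N , λ n N≤n → f n (p n N≤n)

  always : ∀ {P : ℕ → Set} → (∀ n → P n) → Eventually P
  always p = 0 , λ n _ → p n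

  pointwise : ∀ {x y} → (∀ n → seq x n ≡ seq y n) → x ≃ y
  pointwise {x} {y} h ε ε>0 = always λ n →
    subst (λ t → ∣ t ∣ ≤ ε) (sym (trans (cong (λ t → t - seq y n) (h n)) (+-inverseʳ (seq y n)))) (<⇒≤ ε>0)

  ≃-refl : ∀ {x} → x ≃ x
  ≃-refl {x} = pointwise {x} {x} λ _ → refl

  ≃-sym : ∀ {x y} → x ≃ y → y ≃ x
  ≃-sym {x} {y} h ε ε>0 = eventually (λ n → subst (_≤ ε) (∣-∣-sym (seq x n) (seq y n))) (h ε ε>0)

  ∣∣-triangle : ∀ {p q r b c} → ∣ p - q ∣ ≤ b → ∣ q - r ∣ ≤ c → ∣ p - r ∣ ≤ b + c
  ∣∣-triangle {p} {q} {r} h k = ≤-trans (≤-reflexive (cong ∣_∣ (solve 3 (λ p q r → p :- r := (p :- q) :+ (q :- r)) refl p q r)))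
    (≤-trans (∣p+q∣≤∣p∣+∣q∣ (p - q) (q - r)) (+-mono-≤ h k))

  ≃-trans : ∀ {x y z} → x ≃ y → y ≃ z → x ≃ z
  ≃-trans {x} {y} {z} h k ε ε>0 = eventually
    (λ n (a , b) → ≤-trans (∣∣-triangle {seq x n} {seq y n} {seq z n} a b) (≤-reflexive (halves ε)))
    (both (h (ε * ½) (half>0 ε>0)) (k (ε * ½) (half>0 ε>0)))

  +-cong : ∀ {x x′ y y′} → x ≃ x′ → y ≃ y′ → x D.+ y ≃ x′ D.+ y′
  +-cong {x} {x′} {y} {y′} h k ε ε>0 = eventually
    (λ n (a , b) → ≤-trans (≤-reflexive (cong ∣_∣ (solve 4 (λ p p′ q q′ → (p :+ q) :- (p′ :+ q′) := (p :- p′) :+ (q :- q′)) refl (seq x n) (seq x′ n) (seq y n) (seq y′ n))))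
      (≤-trans (∣p+q∣≤∣p∣+∣q∣ (seq x n - seq x′ n) (seq y n - seq y′ n)) (split a b)))
    (both (h (ε * ½) (half>0 ε>0)) (k (ε * ½) (half>0 ε>0)))

  neg-cong : ∀ {x x′} → x ≃ x′ → D.- x ≃ D.- x′
  neg-cong {x} {x′} h ε ε>0 = eventually
    (λ n a → ≤-trans (≤-reflexive (trans (cong ∣_∣ (solve 2 (λ p q → :- p :- :- q := :- (p :- q)) refl (seq x n) (seq x′ n))) (∣-p∣≡∣p∣ (seq x n - seq x′ n)))) a)
    (h ε ε>0)

  *-cong : ∀ {x x′ y y′} → x ≃ x′ → y ≃ y′ → x D.* y ≃ x′ D.* y′
  *-cong {x} {x′} {y} {y′} h k ε ε>0 =
    let A , 1≤A , hA = eventually-bounded {seq x} (cauchy x)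
        B , 1≤B , hB = eventually-bounded {seq y′} (cauchy y′)
        A>0 = <-≤-trans 0<1 1≤A
        B>0 = <-≤-trans 0<1 1≤B
        e>0 = half>0 ε>0
    in eventually (λ n ((a , b) , c , d) → ≤-trans (product-estimate A>0 B>0 e>0 (seq x n) (seq y n) (seq x′ n) (seq y′ n) a b c d) (≤-reflexive (halves ε)))
      (both (both hA hB) (both (h (ε * ½ * reciprocal B>0) (pos* e>0 (reciprocal>0 B>0))) (k (ε * ½ * reciprocal A>0) (pos* e>0 (reciprocal>0 A>0)))))

  pointwiseᶜ : ∀ {z w} → (∀ n → seq (re z) n ≡ seq (re w) n) → (∀ n → seq (im z) n ≡ seq (im w) n) → z ≃ᶜ w
  pointwiseᶜ {z} {w} h k = pointwise {re z} {re w} h , pointwise {im z} {im w} k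

  -ᶜ_ : ℂ → ℂ
  -ᶜ z = (D.- re z) +i (D.- im z)

  *ᶜ-cong : ∀ {z z′ w w′} → z ≃ᶜ z′ → w ≃ᶜ w′ → z *ᶜ w ≃ᶜ z′ *ᶜ w′
  *ᶜ-cong {a +i b} {a′ +i b′} {c +i d} {c′ +i d′} (ha , hb) (hc , hd) =
    +-cong {a D.* c} {a′ D.* c′} {D.- (b D.* d)} {D.- (b′ D.* d′)} (*-cong {a} {a′} {c} {c′} ha hc) (neg-cong {b D.* d} {b′ D.* d′} (*-cong {b} {b′} {d} {d′} hb hd)) ,
    +-cong {a D.* d} {a′ D.* d′} {b D.* c} {b′ D.* c′} (*-cong {a} {a′} {d} {d′} ha hd) (*-cong {b} {b′} {c} {c′} hb hc)

  *ᶜ-comm : ∀ z w → z *ᶜ w ≃ᶜ w *ᶜ z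
  *ᶜ-comm (a +i b) (c +i d) = pointwiseᶜ {(a +i b) *ᶜ (c +i d)} {(c +i d) *ᶜ (a +i b)}
    (λ n → solve 4 (λ a b c d → a :* c :- b :* d := c :* a :- d :* b) refl (seq a n) (seq b n) (seq c n) (seq d n))
    (λ n → solve 4 (λ a b c d → a :* d :+ b :* c := c :* b :+ d :* a) refl (seq a n) (seq b n) (seq c n) (seq d n))

  *ᶜ-assoc : ∀ z w v → z *ᶜ w *ᶜ v ≃ᶜ z *ᶜ (w *ᶜ v)
  *ᶜ-assoc (a +i b) (c +i d) (e +i f) = pointwiseᶜ {(a +i b) *ᶜ (c +i d) *ᶜ (e +i f)} {(a +i b) *ᶜ ((c +i d) *ᶜ (e +i f))}
    (λ n → solve 6 (λ a b c d e f → (a :* c :- b :* d) :* e :- (a :* d :+ b :* c) :* f := a :* (c :* e :- d :* f) :- b :* (c :* f :+ d :* e)) refl (seq a n) (seq b n) (seq c n) (seq d n) (seq e n) (seq f n))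
    (λ n → solve 6 (λ a b c d e f → (a :* c :- b :* d) :* f :+ (a :* d :+ b :* c) :* e := a :* (c :* f :+ d :* e) :+ b :* (c :* e :- d :* f)) refl (seq a n) (seq b n) (seq c n) (seq d n) (seq e n) (seq f n))

  *ᶜ-identityˡ : ∀ z → 1ℂ *ᶜ z ≃ᶜ z
  *ᶜ-identityˡ (a +i b) = pointwiseᶜ {1ℂ *ᶜ (a +i b)} {a +i b}
    (λ n → solve 2 (λ a b → con 1ℚ :* a :- con 0ℚ :* b := a) refl (seq a n) (seq b n))
    (λ n → solve 2 (λ a b → con 1ℚ :* b :+ con 0ℚ :* a := b) refl (seq a n) (seq b n))

  distribˡᶜ : ∀ z w v → z *ᶜ (w +ᶜ v) ≃ᶜ z *ᶜ w +ᶜ z *ᶜ v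
  distribˡᶜ (a +i b) (c +i d) (e +i f) = pointwiseᶜ {(a +i b) *ᶜ ((c +i d) +ᶜ (e +i f))} {(a +i b) *ᶜ (c +i d) +ᶜ (a +i b) *ᶜ (e +i f)}
    (λ n → solve 6 (λ a b c d e f → a :* (c :+ e) :- b :* (d :+ f) := (a :* c :- b :* d) :+ (a :* e :- b :* f)) refl (seq a n) (seq b n) (seq c n) (seq d n) (seq e n) (seq f n))
    (λ n → solve 6 (λ a b c d e f → a :* (d :+ f) :+ b :* (c :+ e) := (a :* d :+ b :* c) :+ (a :* f :+ b :* e)) refl (seq a n) (seq b n) (seq c n) (seq d n) (seq e n) (seq f n))

  ≃ᶜ-refl : ∀ {z} → z ≃ᶜ z
  ≃ᶜ-refl {z} = ≃-refl {re z} , ≃-refl {im z}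

  ≃ᶜ-sym : ∀ {z w} → z ≃ᶜ w → w ≃ᶜ z
  ≃ᶜ-sym {z} {w} (h , k) = ≃-sym {re z} {re w} h , ≃-sym {im z} {im w} k

  ≃ᶜ-trans : ∀ {z w v} → z ≃ᶜ w → w ≃ᶜ v → z ≃ᶜ v
  ≃ᶜ-trans {z} {w} {v} (h , k) (h′ , k′) = ≃-trans {re z} {re w} {re v} h h′ , ≃-trans {im z} {im w} {im v} k k′

  ℂ-ring : CommutativeRing 0ℓ 0ℓ
  ℂ-ring = record
    { Carrier = ℂ ; _≈_ = _≃ᶜ_ ; _+_ = _+ᶜ_ ; _*_ = _*ᶜ_ ; -_ = -ᶜ_ ; 0# = 0ℂ ; 1# = 1ℂ
    ; isCommutativeRing = record
      { isRing = record
        { +-isAbelianGroup = record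
          { isGroup = record
            { isMonoid = record
              { isSemigroup = record
                { isMagma = record
                  { isEquivalence = record
                    { refl = λ {z} → ≃ᶜ-refl {z} ; sym = λ {z} {w} → ≃ᶜ-sym {z} {w} ; trans = λ {z} {w} {v} → ≃ᶜ-trans {z} {w} {v} }
                  ; ∙-cong = λ {z} {z′} {w} {w′} (h , k) (h′ , k′) →
                      +-cong {re z} {re z′} {re w} {re w′} h h′ , +-cong {im z} {im z′} {im w} {im w′} k k′ }
                ; assoc = λ z w v → pointwiseᶜ {z +ᶜ w +ᶜ v} {z +ᶜ (w +ᶜ v)} (λ n → +-assoc (seq (re z) n) (seq (re w) n) (seq (re v) n)) (λ n → +-assoc (seq (im z) n) (seq (im w) n) (seq (im v) n)) }
              ; identity = (λ z → pointwiseᶜ {0ℂ +ᶜ z} {z} (λ n → +-identityˡ (seq (re z) n)) (λ n → +-identityˡ (seq (im z) n)))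
                         , (λ z → pointwiseᶜ {z +ᶜ 0ℂ} {z} (λ n → +-identityʳ (seq (re z) n)) (λ n → +-identityʳ (seq (im z) n))) }
            ; inverse = (λ z → pointwiseᶜ {(-ᶜ z) +ᶜ z} {0ℂ} (λ n → +-inverseˡ (seq (re z) n)) (λ n → +-inverseˡ (seq (im z) n)))
                      , (λ z → pointwiseᶜ {z +ᶜ (-ᶜ z)} {0ℂ} (λ n → +-inverseʳ (seq (re z) n)) (λ n → +-inverseʳ (seq (im z) n)))
            ; ⁻¹-cong = λ {z} {w} (h , k) → neg-cong {re z} {re w} h , neg-cong {im z} {im w} k }
          ; comm = λ z w → pointwiseᶜ {z +ᶜ w} {w +ᶜ z} (λ n → +-comm (seq (re z) n) (seq (re w) n)) (λ n → +-comm (seq (im z) n) (seq (im w) n)) }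
        ; *-cong = λ {z} {z′} {w} {w′} → *ᶜ-cong {z} {z′} {w} {w′}
        ; *-assoc = *ᶜ-assoc
        ; *-identity = *ᶜ-identityˡ , λ z → ≃ᶜ-trans {z *ᶜ 1ℂ} {1ℂ *ᶜ z} {z} (*ᶜ-comm z 1ℂ) (*ᶜ-identityˡ z)
        ; distrib = distribˡᶜ , λ z w v → ≃ᶜ-trans {(w +ᶜ v) *ᶜ z} {z *ᶜ (w +ᶜ v)} {w *ᶜ z +ᶜ v *ᶜ z} (*ᶜ-comm (w +ᶜ v) z)
            (≃ᶜ-trans {z *ᶜ (w +ᶜ v)} {z *ᶜ w +ᶜ z *ᶜ v} {w *ᶜ z +ᶜ v *ᶜ z} (distribˡᶜ z w v)
              (+-cong {re (z *ᶜ w)} {re (w *ᶜ z)} {re (z *ᶜ v)} {re (v *ᶜ z)} (proj₁ (*ᶜ-comm z w)) (proj₁ (*ᶜ-comm z v))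
              , +-cong {im (z *ᶜ w)} {im (w *ᶜ z)} {im (z *ᶜ v)} {im (v *ᶜ z)} (proj₂ (*ᶜ-comm z w)) (proj₂ (*ᶜ-comm z v)))) }
      ; *-comm = *ᶜ-comm } }

  -- The sum norm of the n-th approximation: rational and submultiplicative at every index, with no
  -- square root.
  norm : ℂ → ℕ → ℚ
  norm z n = ∣ seq (re z) n ∣ + ∣ seq (im z) n ∣

  0≤norm : ∀ z n → 0ℚ ≤ norm z n
  0≤norm z n = 0≤+ (0≤∣p∣ (seq (re z) n)) (0≤∣p∣ (seq (im z) n))

  infix 4 _⊑_
  _⊑_ : ℂ → ℚ → Set
  z ⊑ b = ∀ ε → 0ℚ < ε → Eventually λ n → norm z n ≤ b + ε

  norm-+ : ∀ z w n → norm (z +ᶜ w) n ≤ norm z n + norm w n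
  norm-+ (a +i b) (c +i d) n = ≤-trans (+-mono-≤ (∣p+q∣≤∣p∣+∣q∣ (seq a n) (seq c n)) (∣p+q∣≤∣p∣+∣q∣ (seq b n) (seq d n)))
    (≤-reflexive (solve 4 (λ a b c d → (a :+ c) :+ (b :+ d) := (a :+ b) :+ (c :+ d)) refl (∣ seq a n ∣) (∣ seq b n ∣) (∣ seq c n ∣) (∣ seq d n ∣)))

  norm-* : ∀ z w n → norm (z *ᶜ w) n ≤ norm z n * norm w n
  norm-* (a +i b) (c +i d) n = ≤-trans (+-mono-≤
      (≤-trans (∣p-q∣≤∣p∣+∣q∣ (A * C) (B * E)) (≤-reflexive (cong₂ _+_ (∣p*q∣≡∣p∣*∣q∣ A C) (∣p*q∣≡∣p∣*∣q∣ B E))))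
      (≤-trans (∣p+q∣≤∣p∣+∣q∣ (A * E) (B * C)) (≤-reflexive (cong₂ _+_ (∣p*q∣≡∣p∣*∣q∣ A E) (∣p*q∣≡∣p∣*∣q∣ B C)))))
    (≤-reflexive (solve 4 (λ a b c d → (a :* c :+ b :* d) :+ (a :* d :+ b :* c) := (a :+ b) :* (c :+ d)) refl (∣ A ∣) (∣ B ∣) (∣ C ∣) (∣ E ∣)))
    where
    A = seq a n
    B = seq b n
    C = seq c n
    E = seq d n

  norm-neg : ∀ z n → norm (-ᶜ z) n ≡ norm z n
  norm-neg z n = cong₂ _+_ (∣-p∣≡∣p∣ (seq (re z) n)) (∣-p∣≡∣p∣ (seq (im z) n))

  ⊑⇒0≤ : ∀ {z b} → z ⊑ b → 0ℚ ≤ b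
  ⊑⇒0≤ {z} {b} h = ≤-of-ε λ ε ε>0 → let N , hN = h ε ε>0 in ≤-trans (0≤norm z N) (hN N ℕₚ.≤-refl)

  ⊑-resp : ∀ {z w b} → z ≃ᶜ w → z ⊑ b → w ⊑ b
  ⊑-resp {a +i b} {c +i d} {s} (h , k) hz ε ε>0 = let e = ε * ½
                                                      e>0 = half>0 ε>0 in
    eventually (λ n (x , y , z) → ≤-trans (+-mono-≤ (lipschitz (seq a n) (seq c n) y) (lipschitz (seq b n) (seq d n) z))
      (≤-trans (≤-reflexive (solve 3 (λ p q e → (p :+ e) :+ (q :+ e) := (p :+ q) :+ (e :+ e)) refl (∣ seq a n ∣) (∣ seq b n ∣) (e * ½)))
      (≤-trans (+-mono-≤ x (≤-reflexive (halves e))) (≤-reflexive (trans (+-assoc s e e) (cong (s +_) (halves ε)))))))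
    (both (hz e e>0) (both (h (e * ½) (half>0 e>0)) (k (e * ½) (half>0 e>0))))
    where
    lipschitz : ∀ p q {e} → ∣ p - q ∣ ≤ e → ∣ q ∣ ≤ ∣ p ∣ + e
    lipschitz p q h = ≤-from-∣-∣ (≤-trans (∣∣-lipschitz q p) (≤-trans (≤-reflexive (∣-∣-sym q p)) h))

  ⊑-+ : ∀ {z w b c} → z ⊑ b → w ⊑ c → z +ᶜ w ⊑ b + c
  ⊑-+ {z} {w} {b} {c} h k ε ε>0 = eventually (λ n (x , y) → ≤-trans (norm-+ z w n) (≤-trans (+-mono-≤ x y)
      (≤-reflexive (trans (solve 3 (λ b c e → (b :+ e) :+ (c :+ e) := (b :+ c) :+ (e :+ e)) refl b c (ε * ½)) (cong ((b + c) +_) (halves ε))))))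
    (both (h (ε * ½) (half>0 ε>0)) (k (ε * ½) (half>0 ε>0)))

  ⊑-* : ∀ {z w b c} → z ⊑ b → w ⊑ c → z *ᶜ w ⊑ b * c
  ⊑-* {z} {w} {b} {c} h k ε ε>0 = eventually (λ n (x , y) → ≤-trans (norm-* z w n) (≤-trans (*-mono (0≤norm z n) (0≤norm w n) x y) bound))
    (both (h e e>0) (k e e>0))
    where
    0≤b = ⊑⇒0≤ {z} {b} h
    0≤c = ⊑⇒0≤ {w} {c} k
    -- With e = ε/d one has e ≤ 1, so (b + e) (c + e) exceeds b c by (b + c + e) e ≤ d e = ε.
    d = (b + c + 1ℚ) + ε
    1+b+c≤d : b + c + 1ℚ ≤ d
    1+b+c≤d = p≤p+q (<⇒≤ ε>0)
    0<d : 0ℚ < d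
    0<d = <-≤-trans (<-≤-trans 0<1 (p≤q+p (0≤+ 0≤b 0≤c))) 1+b+c≤d
    e = ε * reciprocal 0<d
    e>0 = pos* ε>0 (reciprocal>0 0<d)
    d*e : d * e ≡ ε
    d*e = cancel 0<d ε
    e≤1 : e ≤ 1ℚ
    e≤1 = *-cancel-≤ 0<d (≤-trans (≤-reflexive (trans (*-comm e d) d*e)) (≤-trans (p≤q+p (0≤+ (0≤+ 0≤b 0≤c) 0≤1)) (≤-reflexive (sym (*-identityˡ d)))))
    bound : (b + e) * (c + e) ≤ b * c + ε
    bound = ≤-trans (≤-by ((d - (b + c + e)) * e) (0≤* (0≤difference (≤-trans (+-monoʳ-≤ (b + c) e≤1) 1+b+c≤d)) (<⇒≤ e>0))
      (solve 4 (λ b c e d → (b :+ e) :* (c :+ e) :+ (d :- (b :+ c :+ e)) :* e := b :* c :+ d :* e) refl b c e d)) (≤-reflexive (cong (b * c +_) d*e))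

  ⊑-closed : ∀ {z b} → (∀ ε → 0ℚ < ε → z ⊑ b + ε) → z ⊑ b
  ⊑-closed {z} {b} h ε ε>0 = eventually (λ n x → ≤-trans x (≤-reflexive (trans (+-assoc b (ε * ½) (ε * ½)) (cong (b +_) (halves ε)))))
    (h (ε * ½) (half>0 ε>0) (ε * ½) (half>0 ε>0))

  ⊑-bounded : ∀ z → ∃ λ b → z ⊑ b
  ⊑-bounded z =
    let A , _ , hA = eventually-bounded {seq (re z)} (cauchy (re z))
        B , _ , hB = eventually-bounded {seq (im z)} (cauchy (im z))
    in A + B , λ ε ε>0 → eventually (λ n (x , y) → ≤-trans (+-mono-≤ x y) (p≤p+q (<⇒≤ ε>0))) (both hA hB)

  module RealLimit (x : ℕ → ℝ)
    (x-cauchy : ∀ ε → 0ℚ < ε → ∃ λ N → ∀ m n → N ℕ.≤ m → m ℕ.≤ n → Eventually λ k → ∣ seq (x n) k - seq (x m) k ∣ ≤ ε) where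

    e : ℕ → ℚ
    e j = recip (suc j)

    N K : ℕ → ℕ
    N j = proj₁ (x-cauchy (e j) (recip>0 j))
    K j = proj₁ (cauchy (x (N j)) (e j) (recip>0 j))

    -- A diagonal sequence: from x(N j), which is within 1/(j + 1) of all later members, take an
    -- approximation that is as accurate.
    y : ℕ → ℚ
    y j = seq (x (N j)) (K j)

    sampled : ∀ j k → K j ℕ.≤ k → ∣ y j - seq (x (N j)) k ∣ ≤ e j
    sampled j k K≤k = proj₂ (cauchy (x (N j)) (e j) (recip>0 j)) (K j) k ℕₚ.≤-refl K≤k

    close : ∀ j n → N j ℕ.≤ n → Eventually λ k → ∣ y j - seq (x n) k ∣ ≤ e j + e j
    close j n N≤n = eventually (λ k (a , b) → ∣∣-triangle {y j} {seq (x (N j)) k} {seq (x n) k} (sampled j k a) (subst (_≤ e j) (∣-∣-sym (seq (x n) k) (seq (x (N j)) k)) b))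
      (both (K j , λ k h → h) (proj₂ (x-cauchy (e j) (recip>0 j)) (N j) n ℕₚ.≤-refl N≤n))

    y-close : ∀ i j → ∣ y i - y j ∣ ≤ (e i + e i) + (e j + e j)
    y-close i j =
      let k₀ , h = both (close i (N i ℕ.⊔ N j) (ℕₚ.m≤m⊔n (N i) (N j))) (close j (N i ℕ.⊔ N j) (ℕₚ.m≤n⊔m (N i) (N j)))
          a , b = h k₀ ℕₚ.≤-refl
          s = seq (x (N i ℕ.⊔ N j)) k₀
      in ∣∣-triangle {y i} {s} {y j} a (subst (_≤ e j + e j) (∣-∣-sym (y j) s) b)

    -- Six errors 1/(j + 1) are added up in `converges`; the Cauchy property of the limit needs only
    -- four.
    six : ∀ ε → 0ℚ < ε → ∃ λ J → ∀ i → J ℕ.≤ i → e i ≤ ε * recip 6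
    six ε ε>0 = let J , h = recip-small (ε * recip 6) (pos* ε>0 (recip>0 5)) in J , λ i J≤i → ≤-trans (recip-anti J≤i) h

    4≤6 : ∀ {ε a b} → a ≤ ε * recip 6 → b ≤ ε * recip 6 → 0ℚ < ε → (a + a) + (b + b) ≤ ε
    4≤6 {ε} {a} {b} ha hb ε>0 = ≤-trans (+-mono-≤ (+-mono-≤ ha ha) (+-mono-≤ hb hb))
      (≤-by (ε * recip 6 + ε * recip 6) (0≤+ 0≤ 0≤) (solve 1 (λ x → (x :* con (recip 6) :+ x :* con (recip 6)) :+ (x :* con (recip 6) :+ x :* con (recip 6)) :+ (x :* con (recip 6) :+ x :* con (recip 6)) := x) refl ε))
      where
      0≤ : 0ℚ ≤ ε * recip 6
      0≤ = 0≤* (<⇒≤ ε>0) (0≤recip 6)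

    limit : ℝ
    limit = mkℝ y λ ε ε>0 → let J , h = six ε ε>0 in J , λ i j J≤i J≤j → ≤-trans (y-close i j) (4≤6 (h i J≤i) (h j J≤j) ε>0)

    converges : ∀ ε → 0ℚ < ε → ∃ λ M → ∀ n → M ℕ.≤ n → Eventually λ k → ∣ seq (x n) k - y k ∣ ≤ ε
    converges ε ε>0 = let J , h = six ε ε>0 in N J , λ n N≤n → eventually
      (λ k (J≤k , a) → ≤-trans (∣∣-triangle {seq (x n) k} {y J} {y k} (subst (_≤ e J + e J) (∣-∣-sym (y J) (seq (x n) k)) a) (y-close J k))
        (≤-trans (+-mono-≤ (+-mono-≤ (h J ℕₚ.≤-refl) (h J ℕₚ.≤-refl)) (+-mono-≤ (+-mono-≤ (h J ℕₚ.≤-refl) (h J ℕₚ.≤-refl)) (+-mono-≤ (h k J≤k) (h k J≤k))))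
          (≤-reflexive (solve 1 (λ x → (x :* con (recip 6) :+ x :* con (recip 6)) :+ ((x :* con (recip 6) :+ x :* con (recip 6)) :+ (x :* con (recip 6) :+ x :* con (recip 6))) := x) refl ε))))
      (both (J , λ k h → h) (close J n N≤n))

  complete : (a : ℕ → ℂ) → (∀ ε → 0ℚ < ε → ∃ λ N → ∀ m n → N ℕ.≤ m → m ℕ.≤ n → a n +ᶜ (-ᶜ a m) ⊑ ε) →
    ∃ λ z → ∀ ε → 0ℚ < ε → ∃ λ N → ∀ n → N ℕ.≤ n → a n +ᶜ (-ᶜ z) ⊑ ε
  complete a a-cauchy = Re.limit +i Im.limit , λ ε ε>0 →
    let M , hM = Re.converges (ε * ½) (half>0 ε>0)
        N , hN = Im.converges (ε * ½) (half>0 ε>0)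
    in M ℕ.⊔ N , λ n h δ δ>0 → eventually (λ k (p , q) → ≤-trans (split {ε} p q) (p≤p+q (<⇒≤ δ>0)))
      (both (hM n (⊔-left {M} {N} h)) (hN n (⊔-right {M} {N} h)))
    where
    component : (c : ℂ → ℝ) → (∀ z w k → ∣ seq (c z) k - seq (c w) k ∣ ≤ norm (z +ᶜ (-ᶜ w)) k) →
      ∀ ε → 0ℚ < ε → ∃ λ N → ∀ m n → N ℕ.≤ m → m ℕ.≤ n → Eventually λ k → ∣ seq (c (a n)) k - seq (c (a m)) k ∣ ≤ ε
    component c c≤ ε ε>0 = let N , h = a-cauchy (ε * ½) (half>0 ε>0) in N , λ m n N≤m m≤n →
      eventually (λ k b → ≤-trans (c≤ (a n) (a m) k) (≤-trans b (≤-reflexive (halves ε)))) (h m n N≤m m≤n (ε * ½) (half>0 ε>0))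
    module Re = RealLimit (λ n → re (a n)) (component re λ z w k → p≤p+q (0≤∣p∣ (seq (im z) k - seq (im w) k)))
    module Im = RealLimit (λ n → im (a n)) (component im λ z w k → p≤q+p (0≤∣p∣ (seq (re z) k - seq (re w) k)))

  ℂ-algebra : BanachAlgebra
  ℂ-algebra = record
    { commutativeRing = ℂ-ring
    ; ι = ℚ⇒ℂ
    ; ι-0 = ≃ᶜ-refl {0ℂ}
    ; ι-1 = ≃ᶜ-refl {1ℂ}
    ; ι-+ = λ p q → pointwiseᶜ {ℚ⇒ℂ (p + q)} {ℚ⇒ℂ p +ᶜ ℚ⇒ℂ q} (λ _ → refl) (λ _ → refl)
    ; ι-* = λ p q → pointwiseᶜ {ℚ⇒ℂ (p * q)} {ℚ⇒ℂ p *ᶜ ℚ⇒ℂ q}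
        (λ _ → solve 2 (λ p q → p :* q := p :* q :- con 0ℚ :* con 0ℚ) refl p q) (λ _ → solve 2 (λ p q → con 0ℚ := p :* con 0ℚ :+ con 0ℚ :* q) refl p q)
    ; ι-neg = λ p → pointwiseᶜ {ℚ⇒ℂ (- p)} { -ᶜ ℚ⇒ℂ p} (λ _ → refl) (λ _ → refl)
    ; _⊑_ = _⊑_
    ; ⊑-resp = λ {z} {w} {b} → ⊑-resp {z} {w} {b}
    ; ⊑-mono = λ {z} b≤c h ε ε>0 → eventually (λ n x → ≤-trans x (+-monoˡ-≤ ε b≤c)) (h ε ε>0)
    ; ⊑⇒0≤ = λ {z} {b} → ⊑⇒0≤ {z} {b}
    ; ⊑-ι = λ q ε ε>0 → always λ n → +-monoʳ-≤ ∣ q ∣ (<⇒≤ ε>0)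
    ; ⊑-+ = λ {z} {w} {b} {c} → ⊑-+ {z} {w} {b} {c}
    ; ⊑-* = λ {z} {w} {b} {c} → ⊑-* {z} {w} {b} {c}
    ; ⊑-neg = λ {z} {b} h ε ε>0 → eventually (λ n → subst (_≤ b + ε) (sym (norm-neg z n))) (h ε ε>0)
    ; ⊑-closed = λ {z} {b} → ⊑-closed {z} {b}
    ; ⊑-bounded = ⊑-bounded
    ; complete = complete
    }

  square-cancel : ∀ {r s} → 0ℚ ≤ s → r * r ≤ s * s → r ≤ s
  square-cancel {r} {s} 0≤s h with r ≤? s
  ... | yes r≤s = r≤s
  ... | no  r≰s = contradiction (<-≤-trans (≤-<-trans (*-monoˡ 0≤s (<⇒≤ s<r)) s*r<r*r) h) (<-irrefl refl)
    where
    s<r = ≰⇒> r≰s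
    s*r<r*r : s * r < r * r
    s*r<r*r = subst (_< r * r) (*-comm r s) (*-monoʳ-<-pos r {{ℚ.positive (≤-<-trans 0≤s s<r)}} s<r)

  ∣∣ᶜ≤norm : ∀ z n → seq (∣ z ∣ᶜ) n ≤ norm z n
  ∣∣ᶜ≤norm z n = square-cancel (0≤norm z n) (≤-trans (Root-lemmas.root-lower (0≤+ (0≤square a) (0≤square b)) n) (begin
    a * a + b * b                                 ≡⟨ cong₂ _+_ (∣∣² a) (∣∣² b) ⟩
    ∣ a ∣ * ∣ a ∣ + ∣ b ∣ * ∣ b ∣                 ≤⟨ ≤-by (∣ a ∣ * ∣ b ∣ + ∣ a ∣ * ∣ b ∣) (0≤+ 0≤ab 0≤ab)
       (solve 2 (λ a b → a :* a :+ b :* b :+ (a :* b :+ a :* b) := (a :+ b) :* (a :+ b)) refl (∣ a ∣) (∣ b ∣)) ⟩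
    norm z n * norm z n                           ∎))
    where
    open ≤-Reasoning
    a = seq (re z) n
    b = seq (im z) n
    0≤ab = 0≤* (0≤∣p∣ a) (0≤∣p∣ b)
    ∣∣² : ∀ p → p * p ≡ ∣ p ∣ * ∣ p ∣
    ∣∣² p = trans (sym (0≤p⇒∣p∣≡p (0≤square p))) (∣p*q∣≡∣p∣*∣q∣ p p)

  -- Each component is at most the modulus. The modulus is approximated by the lower ends of the
  -- bisection intervals, and ε covers their eventual widths.
  norm≤∣∣ᶜ : ∀ z ε → 0ℚ < ε → Eventually λ n → norm z n ≤ (seq (∣ z ∣ᶜ) n + ε) + (seq (∣ z ∣ᶜ) n + ε)
  norm≤∣∣ᶜ z ε ε>0 =
    let B , _ , hB = eventually-bounded {λ n → s n} (cauchy (re z D.* re z D.+ im z D.* im z))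
        L , hL = Root-lemmas.halved-small (1ℚ + B) ε ε>0
    in eventually (λ n (L≤n , s≤B) →
        let width≤ε = ≤-trans (≤-reflexive (Root-lemmas.width≡halved (s n) n)) (≤-trans (Root-lemmas.halved-anti (Root-lemmas.0≤width (0≤s n) 0) L≤n)
                        (≤-trans (Root-lemmas.halved-mono (+-monoʳ-≤ 1ℚ (≤-trans (p≤∣p∣ (s n)) s≤B)) L) hL))
            r = root (s n) n
            component : ∀ p → p * p ≤ s n → ∣ p ∣ ≤ r + ε
            component p h = ≤-trans (square-cancel {∣ p ∣} {r + width (s n) n} (0≤+ (Root-lemmas.0≤root (0≤s n) n) (Root-lemmas.0≤width (0≤s n) n))
              (≤-trans (≤-reflexive (trans (sym (∣p*q∣≡∣p∣*∣q∣ p p)) (0≤p⇒∣p∣≡p (0≤square p)))) (≤-trans h (Root-lemmas.root-upper (0≤s n) n))))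
              (+-monoʳ-≤ r width≤ε)
        in +-mono-≤ (component (seq (re z) n) (p≤p+q (0≤square (seq (im z) n)))) (component (seq (im z) n) (p≤q+p (0≤square (seq (re z) n)))))
      (both (L , λ n h → h) hB)
    where
    s : ℕ → ℚ
    s n = seq (re z) n * seq (re z) n + seq (im z) n * seq (im z) n
    0≤s : ∀ n → 0ℚ ≤ s n
    0≤s n = 0≤+ (0≤square (seq (re z) n)) (0≤square (seq (im z) n))

-- Partial sums of the exponential series on rational arguments.

module Exponential where
  open import Data.Nat as ℕ using (ℕ; zero; suc; z≤n; s≤s; _!)
  import Data.Nat.Properties as ℕₚ
  open import Data.Rational hiding (_÷_)
  open import Data.Rational.Properties
  open import Data.Rational.Solver using (module +-*-Solver)
  open import Data.Product using (∃; _,_)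
  open import Relation.Binary.PropositionalEquality using (_≡_; refl; sym; trans; cong; cong₂; subst)
  open Rationals
  open Sums
  open Harmonic
  open Growth
  open ℚ-sums using (sum; sum-mono; sum-cong; sum-*ˡ; sum-*ʳ; sum-+; sum-−; sum-shift; 0≤sum)
  open +-*-Solver using (solve; _:=_; _:+_; _:*_; _:-_; :-_; con)
  open ≤-Reasoning

  e : ℕ → ℚ → ℚ
  e n q = q ^ n * recip (n !)

  E : ℕ → ℚ → ℚ
  E n q = sum (λ i → e i q) n

  0≤e : ∀ n {q} → 0ℚ ≤ q → 0ℚ ≤ e n q
  0≤e n 0≤q = 0≤* (0≤^ 0≤q n) (0≤recip (n !))

  0≤E : ∀ n {q} → 0ℚ ≤ q → 0ℚ ≤ E n q
  0≤E n 0≤q = 0≤sum n λ i → 0≤e i 0≤q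

  e-mono : ∀ n {q r} → 0ℚ ≤ q → q ≤ r → e n q ≤ e n r
  e-mono n 0≤q q≤r = *-monoʳ (0≤recip (n !)) (^-mono 0≤q q≤r n)

  E-mono : ∀ n {q r} → 0ℚ ≤ q → q ≤ r → E n q ≤ E n r
  E-mono n 0≤q q≤r = sum-mono n λ i _ → e-mono i 0≤q q≤r

  ∣e∣ : ∀ n q → ∣ e n q ∣ ≡ e n ∣ q ∣
  ∣e∣ n q = trans (∣p*q∣≡∣p∣*∣q∣ (q ^ n) (recip (n !))) (cong₂ _*_ (∣^∣ q n) (0≤p⇒∣p∣≡p (0≤recip (n !))))

  ∣e∣-≤ : ∀ n {q b} → ∣ q ∣ ≤ b → ∣ e n q ∣ ≤ e n b
  ∣e∣-≤ n {q} h = ≤-trans (≤-reflexive (∣e∣ n q)) (e-mono n (0≤∣p∣ q) h)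

  factorial-recip′ : ∀ n → fromℕ (suc n) * recip (suc n !) ≡ recip (n !)
  factorial-recip′ n = fromℕ*recip n (n !)

  e-suc : ∀ n q → fromℕ (suc n) * e (suc n) q ≡ q * e n q
  e-suc n q = trans (solve 4 (λ m q p r → m :* (q :* p :* r) := q :* (p :* (m :* r))) refl (fromℕ (suc n)) q (q ^ n) (recip (suc n !)))
    (cong (λ t → q * (q ^ n * t)) (factorial-recip′ n))

  E-tail : ∀ {q b} → ∣ q ∣ ≤ b → ∀ m i → ∣ E (i ℕ.+ m) q - E m q ∣ ≤ E (i ℕ.+ m) b - E m b
  E-tail {q} {b} h m zero = ≤-reflexive (trans (cong ∣_∣ (+-inverseʳ (E m q))) (sym (+-inverseʳ (E m b))))
  E-tail {q} {b} h m (suc i) = begin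
    ∣ E (i ℕ.+ m) q + e (i ℕ.+ m) q - E m q ∣       ≡⟨ cong ∣_∣ (solve 3 (λ x y z → x :+ y :- z := (x :- z) :+ y) refl (E (i ℕ.+ m) q) (e (i ℕ.+ m) q) (E m q)) ⟩
    ∣ E (i ℕ.+ m) q - E m q + e (i ℕ.+ m) q ∣       ≤⟨ ∣p+q∣≤∣p∣+∣q∣ (E (i ℕ.+ m) q - E m q) (e (i ℕ.+ m) q) ⟩
    ∣ E (i ℕ.+ m) q - E m q ∣ + ∣ e (i ℕ.+ m) q ∣   ≤⟨ +-mono-≤ (E-tail h m i) (∣e∣-≤ (i ℕ.+ m) h) ⟩
    E (i ℕ.+ m) b - E m b + e (i ℕ.+ m) b           ≡⟨ solve 3 (λ x y z → (x :- z) :+ y := x :+ y :- z) refl (E (i ℕ.+ m) b) (e (i ℕ.+ m) b) (E m b) ⟩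
    E (suc i ℕ.+ m) b - E m b                       ∎

  module _ (b : ℕ) where
    private
      B = fromℕ b

      e-halves : ∀ {n} → 2 ℕ.* b ℕ.≤ suc n → e (suc n) B + e (suc n) B ≤ e n B
      e-halves {n} h = *-cancel-≤ (0<fromℕ n) (begin
        (e (suc n) B + e (suc n) B) * fromℕ (suc n)     ≡⟨ solve 2 (λ x m → (x :+ x) :* m := con (fromℕ 2) :* (m :* x)) refl (e (suc n) B) (fromℕ (suc n)) ⟩
        fromℕ 2 * (fromℕ (suc n) * e (suc n) B)         ≡⟨ cong (fromℕ 2 *_) (e-suc n B) ⟩
        fromℕ 2 * (B * e n B)                           ≡⟨ trans (sym (*-assoc (fromℕ 2) B (e n B))) (cong (_* e n B) (sym (fromℕ-* 2 b))) ⟩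
        fromℕ (2 ℕ.* b) * e n B                         ≤⟨ *-monoʳ (0≤e n (0≤fromℕ b)) (fromℕ-mono h) ⟩
        fromℕ (suc n) * e n B                           ≡⟨ *-comm (fromℕ (suc n)) (e n B) ⟩
        e n B * fromℕ (suc n)                           ∎)

      -- From index 2 b on, each term is at most half the one before, so twice the current term
      -- bounds everything that follows.
      E-remainder : ∀ {m} → 2 ℕ.* b ℕ.≤ m → ∀ i → E (i ℕ.+ m) B - E m B + (e (i ℕ.+ m) B + e (i ℕ.+ m) B) ≤ e m B + e m B
      E-remainder {m} h zero = ≤-reflexive (solve 2 (λ x y → x :- x :+ (y :+ y) := y :+ y) refl (E m B) (e m B))
      E-remainder {m} h (suc i) = ≤-trans (begin
        E n B + e n B - E m B + (e (suc n) B + e (suc n) B)      ≤⟨ +-monoʳ-≤ (E n B + e n B - E m B) (e-halves (ℕₚ.≤-trans h (ℕₚ.≤-trans (ℕₚ.m≤n+m m i) (ℕₚ.n≤1+n n)))) ⟩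
        E n B + e n B - E m B + e n B                            ≡⟨ solve 3 (λ x y z → x :+ y :- z :+ y := x :- z :+ (y :+ y)) refl (E n B) (e n B) (E m B) ⟩
        E n B - E m B + (e n B + e n B)                          ∎) (E-remainder h i)
        where n = i ℕ.+ m

      e-decay : ∀ i → fromℕ (suc i) * e (i ℕ.+ 2 ℕ.* b) B ≤ e (2 ℕ.* b) B
      e-decay i = ≤-trans (*-monoʳ (0≤e (i ℕ.+ 2 ℕ.* b) (0≤fromℕ b)) (≤-trans (≤-reflexive (fromℕ-suc i)) (≤-trans (+-monoʳ-≤ 1ℚ (≤-reflexive (sym (*-identityʳ (fromℕ i))))) (bernoulli 0≤1 i)))) (doubling i)
        where
        doubling : ∀ i → (1ℚ + 1ℚ) ^ i * e (i ℕ.+ 2 ℕ.* b) B ≤ e (2 ℕ.* b) B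
        doubling zero    = ≤-reflexive (*-identityˡ _)
        doubling (suc i) = ≤-trans (≤-reflexive (solve 2 (λ p x → (con 1ℚ :+ con 1ℚ) :* p :* x := p :* (x :+ x)) refl ((1ℚ + 1ℚ) ^ i) (e (suc i ℕ.+ 2 ℕ.* b) B)))
          (≤-trans (*-monoˡ (0≤^ (0≤+ 0≤1 0≤1) i) (e-halves (ℕₚ.≤-trans (ℕₚ.m≤n+m (2 ℕ.* b) i) (ℕₚ.n≤1+n _)))) (doubling i))

      e-small : ∀ ε → 0ℚ < ε → ∃ λ N → ∀ n → N ℕ.≤ n → e n B ≤ ε
      e-small ε ε>0 = let x = e (2 ℕ.* b) B
                          x+1>0 = <-≤-trans 0<1 (p≤q+p (0≤e (2 ℕ.* b) (0≤fromℕ b)))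
                          N , hN = recip-small (ε * reciprocal x+1>0) (pos* ε>0 (reciprocal>0 x+1>0))
        in N ℕ.+ 2 ℕ.* b , λ n N≤n → subst (λ n → e n B ≤ ε) (ℕₚ.m∸n+n≡m (ℕₚ.≤-trans (ℕₚ.m≤n+m (2 ℕ.* b) N) N≤n))
          (let i = n ℕ.∸ 2 ℕ.* b in *-cancel-≤ (0<fromℕ i) (begin
            e (i ℕ.+ 2 ℕ.* b) B * fromℕ (suc i)                ≡⟨ *-comm (e (i ℕ.+ 2 ℕ.* b) B) (fromℕ (suc i)) ⟩
            fromℕ (suc i) * e (i ℕ.+ 2 ℕ.* b) B                ≤⟨ e-decay i ⟩
            x                                                  ≤⟨ p≤p+q 0≤1 ⟩
            x + 1ℚ                                             ≡⟨ sym (trans (cong ((x + 1ℚ) *_) (trans (*-comm (recip (suc i)) (fromℕ (suc i))) (fromℕ-recip i))) (*-identityʳ (x + 1ℚ))) ⟩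
            (x + 1ℚ) * (recip (suc i) * fromℕ (suc i))         ≡⟨ sym (*-assoc (x + 1ℚ) (recip (suc i)) (fromℕ (suc i))) ⟩
            (x + 1ℚ) * recip (suc i) * fromℕ (suc i)           ≤⟨ *-monoʳ (0≤fromℕ (suc i)) (*-monoˡ (<⇒≤ x+1>0) (≤-trans (recip-anti (ℕₚ.m+n≤o⇒m≤o∸n N N≤n)) hN)) ⟩
            (x + 1ℚ) * (ε * reciprocal x+1>0) * fromℕ (suc i)  ≡⟨ cong (_* fromℕ (suc i)) (cancel x+1>0 ε) ⟩
            ε * fromℕ (suc i)                                  ∎))

    E-uniform : ∀ ε → 0ℚ < ε → ∃ λ N → ∀ m n → N ℕ.≤ m → m ℕ.≤ n → ∀ {q} → ∣ q ∣ ≤ fromℕ b → ∣ E n q - E m q ∣ ≤ ε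
    E-uniform ε ε>0 =
      let N , hN = e-small (ε * ½) (half>0 ε>0)
      in N ℕ.⊔ 2 ℕ.* b , λ m n h m≤n {q} q≤b → subst (λ n → ∣ E n q - E m q ∣ ≤ ε) (ℕₚ.m∸n+n≡m m≤n) (begin
        ∣ E (n ℕ.∸ m ℕ.+ m) q - E m q ∣         ≤⟨ E-tail q≤b m (n ℕ.∸ m) ⟩
        E (n ℕ.∸ m ℕ.+ m) B - E m B             ≤⟨ p≤p+q (0≤+ (0≤e (n ℕ.∸ m ℕ.+ m) (0≤fromℕ b)) (0≤e (n ℕ.∸ m ℕ.+ m) (0≤fromℕ b))) ⟩
        E (n ℕ.∸ m ℕ.+ m) B - E m B + (e (n ℕ.∸ m ℕ.+ m) B + e (n ℕ.∸ m ℕ.+ m) B) ≤⟨ E-remainder (ℕₚ.≤-trans (ℕₚ.m≤n⊔m N (2 ℕ.* b)) h) (n ℕ.∸ m) ⟩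
        e m B + e m B                           ≤⟨ split {ε} (hN m (ℕₚ.≤-trans (ℕₚ.m≤m⊔n N (2 ℕ.* b)) h)) (hN m (ℕₚ.≤-trans (ℕₚ.m≤m⊔n N (2 ℕ.* b)) h)) ⟩
        ε                                       ∎)

  convolution : ℕ → ℚ → ℚ → ℚ
  convolution n q r = sum (λ i → e i q * e (n ℕ.∸ i) r) (suc n)

  -- The binomial theorem without binomial coefficients: after multiplication by the degree, `e-suc`
  -- reduces to the previous case, and the weights i and n + 1 - i of the two parts add up to n + 1.
  e-+ : ∀ n q r → e n (q + r) ≡ convolution n q r
  e-+ zero    q r = refl
  e-+ (suc n) q r = *-cancelˡ m (begin-equality
    fromℕ (suc n) * e (suc n) (q + r)                 ≡⟨ e-suc n (q + r) ⟩
    (q + r) * e n (q + r)                             ≡⟨ cong ((q + r) *_) (e-+ n q r) ⟩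
    (q + r) * sum (λ i → e i q * e (n ℕ.∸ i) r) m     ≡⟨ sym (sum-*ˡ (q + r) (λ i → e i q * e (n ℕ.∸ i) r) m) ⟩
    sum (λ i → (q + r) * (e i q * e (n ℕ.∸ i) r)) m   ≡⟨ sum-cong m (λ i i<m → term i (ℕ.s≤s⁻¹ i<m)) ⟩
    sum (λ i → a (suc i) + b i) m                     ≡⟨ sum-+ (λ i → a (suc i)) b m ⟩
    sum (λ i → a (suc i)) m + sum b m                 ≡⟨ cong₂ _+_ (sym shifted) (sym extended) ⟩
    sum a (suc m) + sum b (suc m)                     ≡⟨ sym (sum-+ a b (suc m)) ⟩
    sum (λ i → a i + b i) (suc m)                     ≡⟨ sum-cong (suc m) (λ i i≤m → combine i (ℕ.s≤s⁻¹ i≤m)) ⟩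
    sum (λ i → fromℕ m * (e i q * e (m ℕ.∸ i) r)) (suc m) ≡⟨ sum-*ˡ (fromℕ m) (λ i → e i q * e (m ℕ.∸ i) r) (suc m) ⟩
    fromℕ m * convolution m q r                       ∎)
    where
    m = suc n
    a b : ℕ → ℚ
    a i = fromℕ i * e i q * e (m ℕ.∸ i) r
    b i = e i q * (fromℕ (m ℕ.∸ i) * e (m ℕ.∸ i) r)
    *-cancelˡ : ∀ m {x y} → fromℕ m * x ≡ fromℕ m * y → {{ℕ.NonZero m}} → x ≡ y
    *-cancelˡ (suc m) {x} {y} eq = begin-equality
      x                                       ≡⟨ undo x ⟩
      recip (suc m) * (fromℕ (suc m) * x)     ≡⟨ cong (recip (suc m) *_) eq ⟩
      recip (suc m) * (fromℕ (suc m) * y)     ≡⟨ sym (undo y) ⟩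
      y                                       ∎
      where
      undo : ∀ x → x ≡ recip (suc m) * (fromℕ (suc m) * x)
      undo x = sym (trans (solve 3 (λ r n x → r :* (n :* x) := (n :* r) :* x) refl (recip (suc m)) (fromℕ (suc m)) x)
        (trans (cong (_* x) (fromℕ-recip m)) (*-identityˡ x)))
    term : ∀ i → i ℕ.≤ n → (q + r) * (e i q * e (n ℕ.∸ i) r) ≡ a (suc i) + b i
    term i i≤n = begin-equality
      (q + r) * (e i q * e (n ℕ.∸ i) r)                           ≡⟨ solve 4 (λ q r x y → (q :+ r) :* (x :* y) := (q :* x) :* y :+ x :* (r :* y)) refl q r (e i q) (e (n ℕ.∸ i) r) ⟩
      q * e i q * e (n ℕ.∸ i) r + e i q * (r * e (n ℕ.∸ i) r)     ≡⟨ cong₂ (λ s t → s * e (n ℕ.∸ i) r + e i q * t) (sym (e-suc i q)) (sym (e-suc (n ℕ.∸ i) r)) ⟩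
      a (suc i) + e i q * (fromℕ (suc (n ℕ.∸ i)) * e (suc (n ℕ.∸ i)) r) ≡⟨ cong (λ k → a (suc i) + e i q * (fromℕ k * e k r)) (sym (ℕₚ.+-∸-assoc 1 i≤n)) ⟩
      a (suc i) + b i                                             ∎
    shifted : sum a (suc m) ≡ sum (λ i → a (suc i)) m
    shifted = trans (sum-shift a m) (trans (cong (_+ sum (λ i → a (suc i)) m) (trans (cong (_* e m r) (*-zeroˡ (e 0 q))) (*-zeroˡ (e m r)))) (+-identityˡ _))
    extended : sum b (suc m) ≡ sum b m
    extended = trans (cong (sum b m +_) (trans (cong (λ k → e m q * (fromℕ k * e k r)) (ℕₚ.n∸n≡0 m)) (trans (cong (e m q *_) (*-zeroˡ (e 0 r))) (*-zeroʳ (e m q))))) (+-identityʳ (sum b m))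
    combine : ∀ i → i ℕ.≤ m → a i + b i ≡ fromℕ m * (e i q * e (m ℕ.∸ i) r)
    combine i i≤m = begin-equality
      a i + b i                                                     ≡⟨ solve 4 (λ x y s t → x :* s :* t :+ s :* (y :* t) := (x :+ y) :* (s :* t)) refl (fromℕ i) (fromℕ (m ℕ.∸ i)) (e i q) (e (m ℕ.∸ i) r) ⟩
      (fromℕ i + fromℕ (m ℕ.∸ i)) * (e i q * e (m ℕ.∸ i) r)         ≡⟨ cong (_* (e i q * e (m ℕ.∸ i) r)) (trans (sym (fromℕ-+ i (m ℕ.∸ i))) (cong fromℕ (ℕₚ.m+[n∸m]≡n i≤m))) ⟩
      fromℕ m * (e i q * e (m ℕ.∸ i) r)                             ∎

  E-+ : ∀ n q r → E n (q + r) ≡ sum (λ i → e i q * E (n ℕ.∸ i) r) n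
  E-+ zero    q r = refl
  E-+ (suc n) q r = begin-equality
    E n (q + r) + e n (q + r)                                                                     ≡⟨ cong₂ _+_ (E-+ n q r) (e-+ n q r) ⟩
    sum (λ i → e i q * E (n ℕ.∸ i) r) n + (sum (λ i → e i q * e (n ℕ.∸ i) r) n + e n q * e (n ℕ.∸ n) r) ≡⟨ sym (+-assoc (sum (λ i → e i q * E (n ℕ.∸ i) r) n) _ _) ⟩
    sum (λ i → e i q * E (n ℕ.∸ i) r) n + sum (λ i → e i q * e (n ℕ.∸ i) r) n + e n q * e (n ℕ.∸ n) r
      ≡⟨ cong₂ _+_ (sym (sum-+ _ _ n)) (cong (e n q *_) last) ⟩
    sum (λ i → e i q * E (n ℕ.∸ i) r + e i q * e (n ℕ.∸ i) r) n + e n q * E (suc n ℕ.∸ n) r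
      ≡⟨ cong (_+ e n q * E (suc n ℕ.∸ n) r) (sum-cong n (λ i i<n → trans (sym (*-distribˡ-+ (e i q) (E (n ℕ.∸ i) r) (e (n ℕ.∸ i) r)))
           (cong (λ k → e i q * E k r) (sym (ℕₚ.+-∸-assoc 1 (ℕₚ.<⇒≤ i<n)))))) ⟩
    sum (λ i → e i q * E (suc n ℕ.∸ i) r) (suc n)                                                 ∎
    where
    last : e (n ℕ.∸ n) r ≡ E (suc n ℕ.∸ n) r
    last = trans (cong (λ k → e k r) (ℕₚ.n∸n≡0 n)) (sym (trans (cong (λ k → E k r) (ℕₚ.m+n∸n≡m 1 n)) (+-identityˡ (e 0 r))))

  E-index-mono : ∀ {m n q} → 0ℚ ≤ q → m ℕ.≤ n → E m q ≤ E n q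
  E-index-mono {m} {n} {q} 0≤q m≤n = subst (λ n → E m q ≤ E n q) (ℕₚ.m∸n+n≡m m≤n) (go (n ℕ.∸ m))
    where
    go : ∀ i → E m q ≤ E (i ℕ.+ m) q
    go zero    = ≤-refl
    go (suc i) = ≤-trans (go i) (p≤p+q (0≤e (i ℕ.+ m) 0≤q))

  -- For nonnegative arguments the triangle of exponents with sum below n lies inside the square.
  E-sub : ∀ n {q r} → 0ℚ ≤ q → 0ℚ ≤ r → E n (q + r) ≤ E n q * E n r
  E-sub n {q} {r} 0≤q 0≤r = begin
    E n (q + r)                               ≡⟨ E-+ n q r ⟩
    sum (λ i → e i q * E (n ℕ.∸ i) r) n       ≤⟨ sum-mono n (λ i _ → *-monoˡ (0≤e i 0≤q) (E-index-mono 0≤r (ℕₚ.m∸n≤m n i))) ⟩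
    sum (λ i → e i q * E n r) n               ≡⟨ sum-*ʳ (λ i → e i q) (E n r) n ⟩
    E n q * E n r                             ∎

  -- Conversely, an m by n rectangle of exponents lies inside the triangle of size m + n.
  E-super : ∀ m n {q r} → 0ℚ ≤ q → 0ℚ ≤ r → E m q * E n r ≤ E (m ℕ.+ n) (q + r)
  E-super m n {q} {r} 0≤q 0≤r = begin
    E m q * E n r                                          ≡⟨ sym (sum-*ʳ (λ i → e i q) (E n r) m) ⟩
    sum (λ i → e i q * E n r) m                            ≤⟨ sum-mono m (λ i i<m → *-monoˡ (0≤e i 0≤q) (E-index-mono 0≤r (ℕₚ.≤-trans (ℕₚ.m≤n+m n (m ℕ.∸ i)) (ℕₚ.≤-reflexive (sym (ℕₚ.+-∸-comm n (ℕₚ.<⇒≤ i<m))))))) ⟩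
    sum (λ i → e i q * E (m ℕ.+ n ℕ.∸ i) r) m              ≤⟨ longer n ⟩
    sum (λ i → e i q * E (m ℕ.+ n ℕ.∸ i) r) (n ℕ.+ m)      ≡⟨ cong (sum (λ i → e i q * E (m ℕ.+ n ℕ.∸ i) r)) (ℕₚ.+-comm n m) ⟩
    sum (λ i → e i q * E (m ℕ.+ n ℕ.∸ i) r) (m ℕ.+ n)      ≡⟨ sym (E-+ (m ℕ.+ n) q r) ⟩
    E (m ℕ.+ n) (q + r)                                    ∎
    where
    longer : ∀ k → sum (λ i → e i q * E (m ℕ.+ n ℕ.∸ i) r) m ≤ sum (λ i → e i q * E (m ℕ.+ n ℕ.∸ i) r) (k ℕ.+ m)
    longer zero    = ≤-refl
    longer (suc k) = ≤-trans (longer k) (p≤p+q (0≤* (0≤e (k ℕ.+ m) 0≤q) (0≤E (m ℕ.+ n ℕ.∸ (k ℕ.+ m)) 0≤r)))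

  -- For arguments of any sign the terms outside the triangle are dominated by those at (b, b),
  -- which `E-super` bounds by a tail of the series at 2 b.
  E-product : ∀ n {q r b} → ∣ q ∣ ≤ b → ∣ r ∣ ≤ b → ∣ E n q * E n r - E n (q + r) ∣ ≤ E (n ℕ.+ n) (b + b) - E n (b + b)
  E-product n {q} {r} {b} hq hr = begin
    ∣ E n q * E n r - E n (q + r) ∣                              ≡⟨ cong ∣_∣ (defect q r) ⟩
    ∣ sum (λ i → e i q * (E n r - E (n ℕ.∸ i) r)) n ∣            ≤⟨ ∣sum∣ n (λ i i<n → ≤-trans (≤-reflexive (∣p*q∣≡∣p∣*∣q∣ (e i q) (E n r - E (n ℕ.∸ i) r)))
        (*-mono (0≤∣p∣ (e i q)) (0≤∣p∣ (E n r - E (n ℕ.∸ i) r)) (∣e∣-≤ i hq)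
          (subst (λ k → ∣ E k r - E (n ℕ.∸ i) r ∣ ≤ E k b - E (n ℕ.∸ i) b) (ℕₚ.m+[n∸m]≡n (ℕₚ.<⇒≤ i<n)) (E-tail hr (n ℕ.∸ i) i)))) ⟩
    sum (λ i → e i b * (E n b - E (n ℕ.∸ i) b)) n                ≡⟨ sym (defect b b) ⟩
    E n b * E n b - E n (b + b)                                  ≤⟨ +-monoˡ-≤ (- E n (b + b)) (E-super n n 0≤b 0≤b) ⟩
    E (n ℕ.+ n) (b + b) - E n (b + b)                            ∎
    where
    0≤b = ≤-trans (0≤∣p∣ q) hq
    defect : ∀ q r → E n q * E n r - E n (q + r) ≡ sum (λ i → e i q * (E n r - E (n ℕ.∸ i) r)) n
    defect q r = sym (trans (sum-cong n (λ i _ → solve 3 (λ x y z → x :* (y :- z) := x :* y :- x :* z) refl (e i q) (E n r) (E (n ℕ.∸ i) r)))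
      (trans (sum-− _ _ n) (cong₂ _-_ (sum-*ʳ (λ i → e i q) (E n r) n) (sym (E-+ n q r)))))

  E-0 : ∀ n → E (suc n) 0ℚ ≡ 1ℚ
  E-0 zero    = refl
  E-0 (suc n) = trans (cong₂ _+_ (E-0 n) (trans (cong (_* recip (suc n !)) (*-zeroˡ (0ℚ ^ n))) (*-zeroˡ (recip (suc n !))))) (+-identityʳ 1ℚ)

  E-increment : ∀ n {q r} → 0ℚ ≤ q → q ≤ r → r - q ≤ E (2 ℕ.+ n) r - E (2 ℕ.+ n) q
  E-increment zero {q} {r} 0≤q q≤r = ≤-reflexive (solve 2 (λ q r → r :- q := (con 0ℚ :+ con 1ℚ :* con 1ℚ :+ r :* con 1ℚ :* con 1ℚ) :- (con 0ℚ :+ con 1ℚ :* con 1ℚ :+ q :* con 1ℚ :* con 1ℚ)) refl q r)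
  E-increment (suc n) {q} {r} 0≤q q≤r = ≤-trans (E-increment n 0≤q q≤r)
    (≤-by (e (2 ℕ.+ n) r - e (2 ℕ.+ n) q) (0≤difference (e-mono (2 ℕ.+ n) 0≤q q≤r))
      (solve 4 (λ x y s t → x :- y :+ (s :- t) := (x :+ s) :- (y :+ t)) refl (E (2 ℕ.+ n) r) (E (2 ℕ.+ n) q) (e (2 ℕ.+ n) r) (e (2 ℕ.+ n) q)))

  -- A mean value inequality: the derivative of `E (suc n)` is `E n`.
  E-increment-upper : ∀ n {q r} → 0ℚ ≤ q → q ≤ r → E (suc n) r - E (suc n) q ≤ (r - q) * E n r
  E-increment-upper zero {q} {r} 0≤q q≤r = ≤-reflexive (solve 2 (λ q r → con 1ℚ :- con 1ℚ := (r :- q) :* con 0ℚ) refl q r)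
  E-increment-upper (suc n) {q} {r} 0≤q q≤r = begin
    E (suc n) r + e (suc n) r - (E (suc n) q + e (suc n) q)      ≡⟨ solve 4 (λ x s y t → x :+ s :- (y :+ t) := (x :- y) :+ (s :- t)) refl (E (suc n) r) (e (suc n) r) (E (suc n) q) (e (suc n) q) ⟩
    (E (suc n) r - E (suc n) q) + (e (suc n) r - e (suc n) q)    ≤⟨ +-mono-≤ (E-increment-upper n 0≤q q≤r) step ⟩
    (r - q) * E n r + (r - q) * e n r                            ≡⟨ sym (*-distribˡ-+ (r - q) (E n r) (e n r)) ⟩
    (r - q) * E (suc n) r                                        ∎
    where
    c = recip (suc n !)
    step : e (suc n) r - e (suc n) q ≤ (r - q) * e n r
    step = begin
      r ^ suc n * c - q ^ suc n * c               ≡⟨ solve 3 (λ x y c → x :* c :- y :* c := (x :- y) :* c) refl (r ^ suc n) (q ^ suc n) c ⟩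
      (r ^ suc n - q ^ suc n) * c                 ≤⟨ *-monoʳ (0≤recip (suc n !)) (^-difference 0≤q q≤r n) ⟩
      fromℕ (suc n) * r ^ n * (r - q) * c         ≡⟨ solve 4 (λ m p d c → m :* p :* d :* c := d :* (p :* (m :* c))) refl (fromℕ (suc n)) (r ^ n) (r - q) c ⟩
      (r - q) * (r ^ n * (fromℕ (suc n) * c))     ≡⟨ cong (λ t → (r - q) * (r ^ n * t)) (factorial-recip′ n) ⟩
      (r - q) * e n r                             ∎

  E-upper : ∀ n {q} → 0ℚ ≤ q → q ≤ 1ℚ → E n q * (1ℚ - q) ≤ 1ℚ
  E-upper n {q} 0≤q q≤1 = ≤-trans (*-monoʳ (0≤difference q≤1) (sum-mono n (λ i _ → ≤-trans (*-monoˡ (0≤^ 0≤q i) (recip≤1 (i !))) (≤-reflexive (*-identityʳ (q ^ i))))))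
    (≤-trans (≤-reflexive (geometric n)) (≤-by (q ^ n) (0≤^ 0≤q n) (solve 1 (λ x → con 1ℚ :- x :+ x := con 1ℚ) refl (q ^ n))))
    where
    geometric : ∀ n → sum (q ^_) n * (1ℚ - q) ≡ 1ℚ - q ^ n
    geometric zero    = *-zeroˡ (1ℚ - q)
    geometric (suc n) = trans (*-distribʳ-+ (1ℚ - q) (sum (q ^_) n) (q ^ n)) (trans (cong (_+ q ^ n * (1ℚ - q)) (geometric n))
      (solve 2 (λ q x → (con 1ℚ :- x) :+ x :* (con 1ℚ :- q) := con 1ℚ :- q :* x) refl q (q ^ n)))

  E-multiple : ∀ n {q} → 0ℚ ≤ q → ∀ l → E (suc n) (fromℕ l * q) ≤ E (suc n) q ^ l
  E-multiple n {q} 0≤q zero    = ≤-reflexive (trans (cong (E (suc n)) (*-zeroˡ q)) (E-0 n))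
  E-multiple n {q} 0≤q (suc l) = begin
    E (suc n) (fromℕ (suc l) * q)                 ≡⟨ cong (E (suc n)) (trans (cong (_* q) (fromℕ-suc l)) (solve 2 (λ x q → (con 1ℚ :+ x) :* q := q :+ x :* q) refl (fromℕ l) q)) ⟩
    E (suc n) (q + fromℕ l * q)                   ≤⟨ E-sub (suc n) 0≤q (0≤* (0≤fromℕ l) 0≤q) ⟩
    E (suc n) q * E (suc n) (fromℕ l * q)         ≤⟨ *-monoˡ (0≤E (suc n) 0≤q) (E-multiple n 0≤q l) ⟩
    E (suc n) q ^ suc l                           ∎

  1≤H : ∀ n → 1ℚ ≤ H (suc n)
  1≤H n = H-mono {1} {suc n} (s≤s z≤n)

  -- The induction step is e^r ≤ 1/(1 - r), from the geometric series; with r = 1/(N + 2) the right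
  -- side is (N + 2)/(N + 1).
  E-harmonic-upper : ∀ n N → E (suc n) (H (suc N) - 1ℚ) ≤ fromℕ (suc N)
  E-harmonic-upper n zero    = ≤-reflexive (E-0 n)
  E-harmonic-upper n (suc N) = begin
    E (suc n) (H (suc N) + r - 1ℚ)               ≡⟨ cong (E (suc n)) (solve 2 (λ h r → h :+ r :- con 1ℚ := (h :- con 1ℚ) :+ r) refl (H (suc N)) r) ⟩
    E (suc n) (H (suc N) - 1ℚ + r)               ≤⟨ E-sub (suc n) (0≤difference (1≤H N)) (0≤recip (suc (suc N))) ⟩
    E (suc n) (H (suc N) - 1ℚ) * E (suc n) r     ≤⟨ *-monoʳ (0≤E (suc n) (0≤recip (suc (suc N)))) (E-harmonic-upper n N) ⟩
    fromℕ (suc N) * E (suc n) r                  ≡⟨ trans (cong (_* E (suc n) r) 1-r) (solve 3 (λ m y x → m :* y :* x := m :* (x :* y)) refl M (1ℚ - r) (E (suc n) r)) ⟩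
    M * (E (suc n) r * (1ℚ - r))                 ≤⟨ *-monoˡ (0≤fromℕ (suc (suc N))) (E-upper (suc n) (0≤recip (suc (suc N))) (recip≤1 (suc (suc N)))) ⟩
    M * 1ℚ                                       ≡⟨ *-identityʳ M ⟩
    M                                            ∎
    where
    r = recip (suc (suc N))
    M = fromℕ (suc (suc N))
    1-r : fromℕ (suc N) ≡ M * (1ℚ - r)
    1-r = sym (trans (solve 2 (λ m r → m :* (con 1ℚ :- r) := m :- m :* r) refl M r) (trans (cong₂ _-_ (fromℕ-suc (suc N)) (fromℕ-recip (suc N)))
      (solve 1 (λ x → con 1ℚ :+ x :- con 1ℚ := x) refl (fromℕ (suc N)))))

  -- Here 1 + 1/(N + 1) is the two-term sum at 1/(N + 1), so each step costs two further terms of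
  -- the series.
  E-harmonic-lower : ∀ N → ∃ λ m → fromℕ (suc N) ≤ E m (H N)
  E-harmonic-lower zero    = 1 , ≤-refl
  E-harmonic-lower (suc N) = let m , h = E-harmonic-lower N in m ℕ.+ 2 , (begin
    fromℕ (suc (suc N))                    ≡⟨ trans (fromℕ-suc (suc N)) (trans (cong (_+ fromℕ (suc N)) (sym (fromℕ-recip N))) (solve 2 (λ x r → x :* r :+ x := x :* (con 0ℚ :+ con 1ℚ :* con 1ℚ :+ r :* con 1ℚ :* con 1ℚ)) refl (fromℕ (suc N)) (recip (suc N)))) ⟩
    fromℕ (suc N) * E 2 (recip (suc N))    ≤⟨ *-monoʳ (0≤E 2 (0≤recip (suc N))) h ⟩
    E m (H N) * E 2 (recip (suc N))        ≤⟨ E-super m 2 (0≤H N) (0≤recip (suc N)) ⟩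
    E (m ℕ.+ 2) (H (suc N))                ∎)

-- Construction of the logarithm and bounds for real powers.

module Logarithm where
  open import Defs as D hiding (_+_; _*_; -_; _-_; _≤_; _<_; _^_; ∣_∣)
  open import Data.Nat as ℕ using (ℕ; zero; suc; z≤n; s≤s; _!)
  import Data.Nat.Properties as ℕₚ
  open import Data.Nat.Properties using (_!≢0)
  open import Data.Integer using (+_)
  open import Data.Rational as ℚ using (ℚ; 0ℚ; 1ℚ; ½; _+_; _*_; -_; _-_; _≤_; _<_; ∣_∣; _/_)
  open import Data.Rational.Properties hiding (≃-sym)
  open import Data.Rational.Solver using (module +-*-Solver)
  open import Data.Product using (∃; _×_; _,_; proj₁; proj₂)
  open import Data.Sum using (inj₁; inj₂; [_,_]′)
  open import Relation.Nullary using (Dec; yes; no; ¬_)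
  open import Relation.Nullary.Decidable using (toWitnessFalse)
  open import Relation.Binary.PropositionalEquality using (_≡_; refl; sym; trans; cong; cong₂; subst; subst₂)
  open Rationals
  open Harmonic
  open Exponential
  open ComplexAlgebra using (Eventually; both; eventually; ∣∣-triangle)
  open +-*-Solver using (solve; _:=_; _:+_; _:*_; _:-_; :-_; con)
  open Cauchy-lemmas using (eventually-bounded)
  open ≤-Reasoning

  recip-/ : ∀ m → .{{_ : ℕ.NonZero m}} → + 1 / m ≡ recip m
  recip-/ (suc m) = refl

  seq-^ : ∀ x n k → seq (x D.^ n) k ≡ seq x k ^ n
  seq-^ x zero    k = refl
  seq-^ x (suc n) k = cong (seq x k *_) (seq-^ x n k)

  private
    expTerm : ℝ → ℕ → ℝ
    expTerm x n = x D.^ n D.* ℚ⇒ℝ ((+ 1 / n !) {{n !≢0}})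

  seq-exp : ∀ x n k → seq (∑ (expTerm x) n) k ≡ E n (seq x k)
  seq-exp x zero    k = refl
  seq-exp x (suc n) k = cong₂ _+_ (seq-exp x n k) (cong₂ _*_ (seq-^ x n k) (recip-/ (n !) {{n !≢0}}))

  ExpApproximates : ℝ → ℝ → Set
  ExpApproximates x y = ∀ ε → 0ℚ < ε → ∃ λ N → ∀ n → N ℕ.≤ n → Eventually λ k → ∣ E n (seq x k) - seq y k ∣ ≤ ε

  IsExp⇒approximates : ∀ {x y} → IsExp x y → ExpApproximates x y
  IsExp⇒approximates {x} {y} h ε ε>0 =
    let N , hN = h (ℚ⇒ℝ ε) (ε , ε>0 , 0 , λ _ _ → ≤-reflexive (+-identityˡ ε))
    in N , λ n N≤n → let δ , δ>0 , hK = hN n N≤n in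
      eventually (λ k bound → subst (λ t → ∣ t - seq y k ∣ ≤ ε) (seq-exp x n k) (≤-trans (p≤p+q (<⇒≤ δ>0)) bound)) hK

  approximates⇒IsExp : ∀ {x y} → ExpApproximates x y → IsExp x y
  approximates⇒IsExp {x} {y} h ε (ε₀ , ε₀>0 , K , ε≥ε₀) =
    let N , hN = h (ε₀ * ½) (half>0 ε₀>0)
    in N , λ n N≤n → ε₀ * ½ , half>0 ε₀>0 ,
      eventually (λ k (bound , K≤k) → ≤-trans (≤-trans (+-monoˡ-≤ (ε₀ * ½) (subst (λ t → ∣ t - seq y k ∣ ≤ ε₀ * ½) (sym (seq-exp x n k)) bound)) (≤-reflexive (trans (halves ε₀) (sym (+-identityˡ ε₀)))))
          (ε≥ε₀ k K≤k))
        (both (hN n N≤n) (K , λ _ h → h))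

  E≥1 : ∀ n {q} → 0ℚ ≤ q → 1ℚ ≤ E (suc n) q
  E≥1 n 0≤q = subst (_≤ E (suc n) _) (E-0 n) (E-mono (suc n) ≤-refl 0≤q)

  bounded-by-ℕ : ∀ x → ∃ λ b → Eventually λ k → ∣ seq x k ∣ ≤ fromℕ b
  bounded-by-ℕ x = let B , _ , hB = eventually-bounded {seq x} (cauchy x)
                       b , B≤b = above B
    in b , eventually (λ k h → ≤-trans h B≤b) hB

  private
    -- The numbers behind `log-nonneg`: X approximates e^ℓ within 1/2, so X ≥ 3/2, while Y ≥ 1 and X
    -- Y differs from e^0 by at most 1/8.
    impossible : ∀ {X Y A} → fromℕ 2 ≤ A → ∣ X - A ∣ ≤ ½ → 1ℚ ≤ Y → ¬ (X * Y ≤ 1ℚ + recip 8)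
    impossible {X} {Y} {A} 2≤A close 1≤Y small = toWitnessFalse {a? = 1ℚ + ½ ≤? 1ℚ + recip 8} _ (begin
      1ℚ + ½           ≤⟨ 3/2≤X ⟩
      X                ≡⟨ sym (*-identityʳ X) ⟩
      X * 1ℚ           ≤⟨ *-monoˡ (≤-trans (nonNegative⁻¹ (1ℚ + ½)) 3/2≤X) 1≤Y ⟩
      X * Y            ≤⟨ small ⟩
      1ℚ + recip 8     ∎)
      where
      3/2≤X : 1ℚ + ½ ≤ X
      3/2≤X = begin
        1ℚ + ½         ≡⟨⟩
        fromℕ 2 - ½    ≤⟨ +-monoˡ-≤ (- ½) 2≤A ⟩
        A - ½          ≤⟨ +-monoˡ-≤ (- ½) (≤-from-∣-∣ {A} {X} (≤-trans (≤-reflexive (∣-∣-sym A X)) close)) ⟩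
        X + ½ - ½      ≡⟨ solve 1 (λ x → x :+ con ½ :- con ½ := x) refl X ⟩
        X              ∎
    nonneg : ∀ α → 2 ℕ.≤ α → ∀ b n q → ∣ q ∣ ≤ fromℕ b → ∣ E (suc n) q - fromℕ α ∣ ≤ ½ →
      (∀ {q} → ∣ q ∣ ≤ fromℕ (b ℕ.+ b) → ∣ E (suc n ℕ.+ suc n) q - E (suc n) q ∣ ≤ recip 8) → 0ℚ ≤ q
    nonneg α 2≤α b n q bound close unif = ≤-by-contradiction λ q<0 →
      impossible {E (suc n) q} {E (suc n) (- q)} {fromℕ α} (fromℕ-mono 2≤α) close (E≥1 n (neg-antimono-≤ (<⇒≤ q<0))) small
      where
      m = suc n
      2b = fromℕ (b ℕ.+ b)
      near : ∣ E m q * E m (- q) - E m (q + - q) ∣ ≤ recip 8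
      near = ≤-trans (E-product m bound (≤-trans (≤-reflexive (∣-p∣≡∣p∣ q)) bound))
        (subst (λ t → E (m ℕ.+ m) t - E m t ≤ recip 8) (fromℕ-+ b b)
          (≤-trans (p≤∣p∣ (E (m ℕ.+ m) 2b - E m 2b)) (unif (≤-reflexive (0≤p⇒∣p∣≡p (0≤fromℕ (b ℕ.+ b)))))))
      small : E m q * E m (- q) ≤ 1ℚ + recip 8
      small = subst (λ t → E m q * E m (- q) ≤ t + recip 8) (trans (cong (E m) (+-inverseʳ q)) (E-0 n)) (≤-from-∣-∣ near)

  -- e^ℓ ≥ 2 rules out ℓ < 0, because e^ℓ e^(-ℓ) = 1 and e^(-ℓ) ≥ 1 for ℓ < 0.
  log-nonneg : ∀ {ℓ α} → 2 ℕ.≤ α → IsLog (ℕ⇒ℝ α) ℓ → Eventually λ k → 0ℚ ≤ seq ℓ k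
  log-nonneg {ℓ} {α} 2≤α h = go (bounded-by-ℕ ℓ)
    where
    Uniform : ℕ → ℕ → Set
    Uniform b N = ∀ m n → N ℕ.≤ m → m ℕ.≤ n → ∀ {q} → ∣ q ∣ ≤ fromℕ (b ℕ.+ b) → ∣ E n q - E m q ∣ ≤ recip 8
    combine : ∀ b → (Eventually λ k → ∣ seq ℓ k ∣ ≤ fromℕ b) → ∃ (Uniform b) →
      (∃ λ N → ∀ n → N ℕ.≤ n → Eventually λ k → ∣ E n (seq ℓ k) - fromℕ α ∣ ≤ ½) → Eventually λ k → 0ℚ ≤ seq ℓ k
    combine b hB (N₁ , unif) (N₂ , appr) =
      let n = N₁ ℕ.⊔ N₂
      in eventually (λ k (bound , close) → nonneg α 2≤α b n (seq ℓ k) bound close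
            (unif (suc n) (suc n ℕ.+ suc n) (ℕₚ.≤-trans (ℕₚ.m≤m⊔n N₁ N₂) (ℕₚ.n≤1+n n)) (ℕₚ.m≤m+n (suc n) (suc n))))
          (both hB (appr (suc n) (ℕₚ.≤-trans (ℕₚ.m≤n⊔m N₁ N₂) (ℕₚ.n≤1+n n))))
    go : (∃ λ b → Eventually λ k → ∣ seq ℓ k ∣ ≤ fromℕ b) → Eventually λ k → 0ℚ ≤ seq ℓ k
    go (b , hB) = combine b hB (E-uniform (b ℕ.+ b) (recip 8) (recip>0 7)) (IsExp⇒approximates {ℓ} {ℕ⇒ℝ α} h ½ (positive⁻¹ ½))

  -- With an integer l ≥ K and ℓ = log α ≥ 0, exp(K ℓ) ≤ exp(ℓ)^l holds already for partial sums.
  -- The approximations cost 1 inside the power and 1 outside; l does not depend on α.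
  power-bound : ∀ {K} → 0ℝ D.< K → ∃ λ l → ∀ α v → 2 ℕ.≤ α → IsPower (ℕ⇒ℝ α) K v →
    Eventually λ k → seq v k ≤ fromℕ (suc α) ^ l + 1ℚ
  power-bound {K} (δ , δ>0 , M , K≥δ) = go (bounded-by-ℕ K)
    where
    bound : ∀ l n {α K ℓ v} → K ≤ fromℕ l → 0ℚ ≤ K → 0ℚ ≤ ℓ → ∣ E (suc n) ℓ - fromℕ α ∣ ≤ 1ℚ → ∣ E (suc n) (K * ℓ) - v ∣ ≤ 1ℚ → v ≤ fromℕ (suc α) ^ l + 1ℚ
    bound l n {α} {K} {ℓ} {v} K≤l 0≤K 0≤ℓ close₁ close₂ = begin
      v                                 ≤⟨ ≤-from-∣-∣ (≤-trans (≤-reflexive (∣-∣-sym v (E (suc n) (K * ℓ)))) close₂) ⟩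
      E (suc n) (K * ℓ) + 1ℚ            ≤⟨ +-monoˡ-≤ 1ℚ (E-mono (suc n) (0≤* 0≤K 0≤ℓ) (*-monoʳ 0≤ℓ K≤l)) ⟩
      E (suc n) (fromℕ l * ℓ) + 1ℚ      ≤⟨ +-monoˡ-≤ 1ℚ (E-multiple n 0≤ℓ l) ⟩
      E (suc n) ℓ ^ l + 1ℚ              ≤⟨ +-monoˡ-≤ 1ℚ (^-mono (0≤E (suc n) 0≤ℓ) (≤-trans (≤-from-∣-∣ close₁) (≤-reflexive (trans (+-comm (fromℕ α) 1ℚ) (sym (fromℕ-suc α))))) l) ⟩
      fromℕ (suc α) ^ l + 1ℚ            ∎
    Close : ℝ → ℝ → ℕ → Set
    Close x y N = ∀ n → N ℕ.≤ n → Eventually λ k → ∣ E n (seq x k) - seq y k ∣ ≤ 1ℚ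
    combine : ∀ l → (Eventually λ k → ∣ seq K k ∣ ≤ fromℕ l) → ∀ α v ℓ → (Eventually λ k → 0ℚ ≤ seq ℓ k) →
      ∃ (Close ℓ (ℕ⇒ℝ α)) → ∃ (Close (K D.* ℓ) v) → Eventually λ k → seq v k ≤ fromℕ (suc α) ^ l + 1ℚ
    combine l hB α v ℓ ℓ≥0 (N₁ , h₁) (N₂ , h₂) =
      let n = N₁ ℕ.⊔ N₂
      in eventually (λ k (((0≤ℓ , K≤l) , M≤k) , close₁ , close₂) → bound l n {α} (≤-trans (p≤∣p∣ (seq K k)) K≤l)
            (≤-trans (<⇒≤ δ>0) (≤-trans (≤-reflexive (sym (+-identityˡ δ))) (K≥δ k M≤k))) 0≤ℓ close₁ close₂)
          (both (both (both ℓ≥0 hB) (M , λ _ h → h))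
            (both (h₁ (suc n) (ℕₚ.≤-trans (ℕₚ.m≤m⊔n N₁ N₂) (ℕₚ.n≤1+n n))) (h₂ (suc n) (ℕₚ.≤-trans (ℕₚ.m≤n⊔m N₁ N₂) (ℕₚ.n≤1+n n)))))
    go : (∃ λ l → Eventually λ k → ∣ seq K k ∣ ≤ fromℕ l) → ∃ λ l → ∀ α v → 2 ℕ.≤ α → IsPower (ℕ⇒ℝ α) K v →
      Eventually λ k → seq v k ≤ fromℕ (suc α) ^ l + 1ℚ
    go (l , hB) = l , λ α v 2≤α (ℓ , log-ℓ , exp-v) → combine l hB α v ℓ (log-nonneg {ℓ} 2≤α log-ℓ)
      (IsExp⇒approximates {ℓ} {ℕ⇒ℝ α} log-ℓ 1ℚ 0<1) (IsExp⇒approximates {K D.* ℓ} {v} exp-v 1ℚ 0<1)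

  ∣-∣⇒lower : ∀ p q {c} → ∣ p - q ∣ ≤ c → q - c ≤ p
  ∣-∣⇒lower p q {c} h = begin
    q - c          ≤⟨ +-monoˡ-≤ (- c) (≤-from-∣-∣ {q} {p} (≤-trans (≤-reflexive (∣-∣-sym q p)) h)) ⟩
    p + c - c      ≡⟨ solve 2 (λ p c → p :+ c :- c := p) refl p c ⟩
    p              ∎

  pick : ∀ {A : Set} → Dec A → ℕ → ℕ → ℕ
  pick (yes _) m n = m
  pick (no _)  m n = n

  pick-elim : ∀ {A : Set} (P : ℕ → Set) (d : Dec A) {m n} → (A → P m) → (¬ A → P n) → P (pick d m n)
  pick-elim P (yes a) f g = f a
  pick-elim P (no ¬a) f g = g ¬a

  -- The largest j ≤ k with E n (j h) ≤ q, provided that E n 0 ≤ q.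
  search : ℕ → ℚ → ℚ → ℕ → ℕ
  search n h q zero    = zero
  search n h q (suc k) = pick (E n (fromℕ (suc k) * h) ≤? q) (suc k) (search n h q k)

  search-lower : ∀ n h q k → E n 0ℚ ≤ q → E n (fromℕ (search n h q k) * h) ≤ q
  search-lower n h q zero    h₀ = subst (λ t → E n t ≤ q) (sym (*-zeroˡ h)) h₀
  search-lower n h q (suc k) h₀ = pick-elim (λ j → E n (fromℕ j * h) ≤ q) (E n (fromℕ (suc k) * h) ≤? q) (λ p → p) (λ _ → search-lower n h q k h₀)

  search-upper : ∀ n h q k → q ≤ E n (fromℕ (suc k) * h) → q ≤ E n (fromℕ (suc (search n h q k)) * h)
  search-upper n h q zero    p = p
  search-upper n h q (suc k) p = pick-elim (λ j → q ≤ E n (fromℕ (suc j) * h)) (E n (fromℕ (suc k) * h) ≤? q) (λ _ → p)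
    (λ ¬p → search-upper n h q k (<⇒≤ (≰⇒> ¬p)))

  module Log (x : ℝ) (2≤x : ℕ⇒ℝ 2 D.≤ x) (b : ℕ) (q≤b : Eventually λ k → ∣ seq x k ∣ ≤ fromℕ b) where

    q : ℕ → ℚ
    q = seq x

    -- Enough steps of length 1/(k + 1) to reach q k, and hence to pass its logarithm, as the
    -- partial sums at y are at least y.
    fuel : ℕ → ℕ
    fuel k = proj₁ (above (q k * fromℕ (suc k)))

    s : ℕ → ℚ
    s k = fromℕ (search k (recip (suc k)) (q k) (fuel k)) * recip (suc k)

    0≤s : ∀ k → 0ℚ ≤ s k
    0≤s k = 0≤* (0≤fromℕ (search k (recip (suc k)) (q k) (fuel k))) (0≤recip (suc k))

    s-lower : ∀ k → 1ℚ ≤ q (suc k) → E (suc k) (s (suc k)) ≤ q (suc k)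
    s-lower k 1≤q = search-lower (suc k) (recip (suc (suc k))) (q (suc k)) (fuel (suc k)) (≤-trans (≤-reflexive (E-0 k)) 1≤q)

    s≤q : ∀ k → 1ℚ ≤ q (2 ℕ.+ k) → s (2 ℕ.+ k) ≤ q (2 ℕ.+ k)
    s≤q k 1≤q = begin
      t                          ≡⟨ solve 1 (λ t → t := t :- con 0ℚ) refl t ⟩
      t - 0ℚ                     ≤⟨ E-increment k ≤-refl (0≤s n) ⟩
      E n t - E n 0ℚ             ≤⟨ +-mono-≤ (s-lower (suc k) 1≤q) (neg-antimono-≤ {0ℚ} (≤-trans 0≤1 (≤-reflexive (sym (E-0 (suc k)))))) ⟩
      q n + - 0ℚ                 ≡⟨ solve 1 (λ t → t :- con 0ℚ := t) refl (q n) ⟩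
      q n                        ∎
      where
      n = 2 ℕ.+ k
      t = s n

    -- The next grid point reaches q, so the gap is at most the growth over one step h, which is at
    -- most h E(t) E(h). Here E(h) ≤ 2 because h ≤ 1/2.
    s-upper : ∀ k → 1ℚ ≤ q (2 ℕ.+ k) → q (2 ℕ.+ k) - E (2 ℕ.+ k) (s (2 ℕ.+ k)) ≤ recip (3 ℕ.+ k) * (fromℕ 2 * q (2 ℕ.+ k))
    s-upper k 1≤q = begin
      Q - E n t                  ≤⟨ +-monoˡ-≤ (- E n t) (≤-trans (search-upper n h Q (fuel n) fuelled) (≤-reflexive (cong (E n) next))) ⟩
      E n (t + h) - E n t        ≤⟨ E-increment-upper (suc k) (0≤s n) (p≤p+q 0≤h) ⟩
      (t + h - t) * E (suc k) (t + h) ≡⟨ cong (_* E (suc k) (t + h)) (solve 2 (λ t h → t :+ h :- t := h) refl t h) ⟩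
      h * E (suc k) (t + h)      ≤⟨ *-monoˡ 0≤h (≤-trans (E-index-mono (0≤+ (0≤s n) 0≤h) (ℕₚ.n≤1+n (suc k))) (≤-trans (E-sub n (0≤s n) 0≤h) (*-mono (0≤E n (0≤s n)) (0≤E n 0≤h) (s-lower (suc k) 1≤q) E-h))) ⟩
      h * (Q * fromℕ 2)          ≡⟨ cong (h *_) (*-comm Q (fromℕ 2)) ⟩
      h * (fromℕ 2 * Q)          ∎
      where
      n = 2 ℕ.+ k
      t = s n
      h = recip (suc n)
      Q = q n
      0≤h = 0≤recip (suc n)
      j = search n h Q (fuel n)
      next : fromℕ (suc j) * h ≡ t + h
      next = trans (cong (_* h) (fromℕ-suc j)) (solve 2 (λ j h → (con 1ℚ :+ j) :* h := j :* h :+ h) refl (fromℕ j) h)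
      E-h : E n h ≤ fromℕ 2
      E-h = *-cancel-≤ {r = ½} (positive⁻¹ ½) (≤-trans (*-monoˡ (0≤E n 0≤h) (≤-trans (≤-reflexive refl) (+-monoʳ-≤ 1ℚ (neg-antimono-≤ (recip-anti {1} {n} (s≤s z≤n))))))
        (≤-trans (E-upper n 0≤h (recip≤1 (suc n))) (≤-reflexive refl)))
      fuelled : Q ≤ E n (fromℕ (suc (fuel n)) * h)
      fuelled = begin
        Q                                           ≡⟨ sym (trans (*-assoc Q (fromℕ (suc n)) h) (trans (cong (Q *_) (fromℕ-recip n)) (*-identityʳ Q))) ⟩
        Q * fromℕ (suc n) * h                       ≤⟨ *-monoʳ 0≤h (≤-trans (proj₂ (above (Q * fromℕ (suc n)))) (fromℕ-mono (ℕₚ.n≤1+n (fuel n)))) ⟩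
        y                                           ≡⟨ solve 1 (λ y → y := y :- con 0ℚ) refl y ⟩
        y - 0ℚ                                      ≤⟨ E-increment k ≤-refl 0≤y ⟩
        E n y - E n 0ℚ                              ≤⟨ ≤-by (E n 0ℚ) (≤-trans 0≤1 (≤-reflexive (sym (E-0 (suc k))))) (solve 2 (λ a b → a :- b :+ b := a) refl (E n y) (E n 0ℚ)) ⟩
        E n y                                       ∎
        where
        y = fromℕ (suc (fuel n)) * h
        0≤y : 0ℚ ≤ y
        0≤y = 0≤* (0≤fromℕ (suc (fuel n))) 0≤h

    q-large : Eventually λ k → 1ℚ + ½ ≤ q k
    q-large = eventually bound (2≤x ½ (positive⁻¹ ½))
      where
      bound : ∀ k → fromℕ 2 ≤ q k + ½ → 1ℚ + ½ ≤ q k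
      bound k h = begin
        1ℚ + ½           ≡⟨⟩
        fromℕ 2 - ½      ≤⟨ +-monoˡ-≤ (- ½) h ⟩
        q k + ½ - ½      ≡⟨ solve 1 (λ a → a :+ con ½ :- con ½ := a) refl (q k) ⟩
        q k              ∎

    Good : ℕ → Set
    Good k = s k ≤ fromℕ b × E k (s k) ≤ q k × q k - E k (s k) ≤ recip (suc k) * (fromℕ 2 * fromℕ b) × 1ℚ + ½ ≤ q k

    good-at : ∀ k → 2 ℕ.≤ k → 1ℚ + ½ ≤ q k → ∣ q k ∣ ≤ fromℕ b → Good k
    good-at (suc zero) (s≤s ()) _ _
    good-at (suc (suc k)) _ large ∣q∣≤b = ≤-trans (s≤q k 1≤q) qn≤b , s-lower (suc k) 1≤q ,
      ≤-trans (s-upper k 1≤q) (*-monoˡ (0≤recip (3 ℕ.+ k)) (*-monoˡ (0≤fromℕ 2) qn≤b)) , large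
      where
      1≤q : 1ℚ ≤ q (2 ℕ.+ k)
      1≤q = ≤-trans (p≤p+q {1ℚ} 0≤½) large
      qn≤b : q (2 ℕ.+ k) ≤ fromℕ b
      qn≤b = ≤-trans (p≤∣p∣ (q (2 ℕ.+ k))) ∣q∣≤b

    good : Eventually Good
    good = eventually (λ k ((2≤k , large) , ∣q∣≤b) → good-at k 2≤k large ∣q∣≤b) (both (both (2 , λ _ h → h) q-large) q≤b)

    ∣s∣≤ : ∀ {k} → Good k → ∣ s k ∣ ≤ fromℕ b
    ∣s∣≤ {k} g = ≤-trans (≤-reflexive (0≤p⇒∣p∣≡p (0≤s k))) (proj₁ g)

    gap-small : ∀ ε → 0ℚ < ε → Eventually λ k → Good k × ∣ E k (s k) - q k ∣ ≤ ε
    gap-small ε ε>0 =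
      let B = fromℕ 2 * fromℕ b
          0≤B = 0≤* (0≤fromℕ 2) (0≤fromℕ b)
          B+1>0 = <-≤-trans 0<1 (p≤q+p 0≤B)
          N , hN = recip-small (ε * reciprocal B+1>0) (pos* ε>0 (reciprocal>0 B+1>0))
      in eventually (λ k (g , N≤k) → g , (begin
          ∣ E k (s k) - q k ∣                    ≡⟨ trans (∣-∣-sym (E k (s k)) (q k)) (0≤p⇒∣p∣≡p (0≤difference (proj₁ (proj₂ g)))) ⟩
          q k - E k (s k)                        ≤⟨ proj₁ (proj₂ (proj₂ g)) ⟩
          recip (suc k) * B                      ≤⟨ *-mono (0≤recip (suc k)) 0≤B (≤-trans (recip-anti N≤k) hN) (p≤p+q 0≤1) ⟩
          ε * reciprocal B+1>0 * (B + 1ℚ)        ≡⟨ trans (*-comm (ε * reciprocal B+1>0) (B + 1ℚ)) (cancel B+1>0 ε) ⟩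
          ε                                      ∎))
        (both good (N , λ _ h → h))

    -- The linear term alone gives slope at least 1, so arguments are at least as close as their
    -- exponentials; this turns the convergence of `q` into that of `s`.
    E-expands : ∀ k {a c} → 0ℚ ≤ a → 0ℚ ≤ c → ∣ a - c ∣ ≤ ∣ E (2 ℕ.+ k) a - E (2 ℕ.+ k) c ∣
    E-expands k {a} {c} 0≤a 0≤c with ≤-total a c
    ... | inj₂ c≤a = ≤-trans (≤-reflexive (0≤p⇒∣p∣≡p (0≤difference c≤a))) (≤-trans (E-increment k 0≤c c≤a) (p≤∣p∣ _))
    ... | inj₁ a≤c = subst₂ _≤_ (∣-∣-sym c a) (∣-∣-sym (E (2 ℕ.+ k) c) (E (2 ℕ.+ k) a))
      (≤-trans (≤-reflexive (0≤p⇒∣p∣≡p (0≤difference a≤c))) (≤-trans (E-increment k 0≤a a≤c) (p≤∣p∣ _)))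

    -- Both arguments are put into the partial sum with the larger number of terms. The four
    -- quarters of ε pay for changing that number, for the two grid errors and for the variation of
    -- `q`.
    s-cauchy : Cauchy s
    s-cauchy ε ε>0 = combine (ε * ½ * ½) (trans (cong₂ _+_ (halves (ε * ½)) (halves (ε * ½))) (halves ε))
        (gap-small (ε * ½ * ½) δ>0) (E-uniform b (ε * ½ * ½) δ>0) (cauchy x (ε * ½ * ½) δ>0)
      where
      δ>0 = half>0 (half>0 ε>0)
      combine : ∀ δ → (δ + δ) + (δ + δ) ≡ ε →
        (Eventually λ k → Good k × ∣ E k (s k) - q k ∣ ≤ δ) →
        (∃ λ N → ∀ m n → N ℕ.≤ m → m ℕ.≤ n → ∀ {r} → ∣ r ∣ ≤ fromℕ b → ∣ E n r - E m r ∣ ≤ δ) →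
        (∃ λ N → ∀ m n → N ℕ.≤ m → N ℕ.≤ n → ∣ q m - q n ∣ ≤ δ) → ∃ λ N → ∀ m n → N ℕ.≤ m → N ℕ.≤ n → ∣ s m - s n ∣ ≤ ε
      combine δ 4δ (N₁ , gap) (N₂ , unif) (N₃ , cau) = N , λ m n N≤m N≤n →
          [ ordered m n N≤m , (λ n≤m → ≤-trans (≤-reflexive (∣-∣-sym (s m) (s n))) (ordered n m N≤n n≤m)) ]′ (ℕₚ.≤-total m n)
        where
        N = 2 ℕ.+ (N₁ ℕ.⊔ (N₂ ℕ.⊔ N₃))
        +2 = ℕₚ.m≤n+m (N₁ ℕ.⊔ (N₂ ℕ.⊔ N₃)) 2
        N₁≤N = ℕₚ.≤-trans (ℕₚ.m≤m⊔n N₁ (N₂ ℕ.⊔ N₃)) +2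
        N₂≤N = ℕₚ.≤-trans (ℕₚ.m≤m⊔n N₂ N₃) (ℕₚ.≤-trans (ℕₚ.m≤n⊔m N₁ (N₂ ℕ.⊔ N₃)) +2)
        N₃≤N = ℕₚ.≤-trans (ℕₚ.m≤n⊔m N₂ N₃) (ℕₚ.≤-trans (ℕₚ.m≤n⊔m N₁ (N₂ ℕ.⊔ N₃)) +2)
        ordered : ∀ m n → N ℕ.≤ m → m ℕ.≤ n → ∣ s m - s n ∣ ≤ ε
        ordered m n N≤m m≤n =
          let gm , hm = gap m (ℕₚ.≤-trans N₁≤N N≤m)
              gn , hn = gap n (ℕₚ.≤-trans N₁≤N (ℕₚ.≤-trans N≤m m≤n))
              2≤n = ℕₚ.≤-trans (ℕₚ.m≤m+n 2 (N₁ ℕ.⊔ (N₂ ℕ.⊔ N₃))) (ℕₚ.≤-trans N≤m m≤n)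
          in begin
            ∣ s m - s n ∣                   ≤⟨ subst (λ n′ → ∣ s m - s n ∣ ≤ ∣ E n′ (s m) - E n′ (s n) ∣) (ℕₚ.m+[n∸m]≡n 2≤n) (E-expands (n ℕ.∸ 2) (0≤s m) (0≤s n)) ⟩
            ∣ E n (s m) - E n (s n) ∣       ≤⟨ ∣∣-triangle {E n (s m)} {q m} {E n (s n)}
                (∣∣-triangle {E n (s m)} {E m (s m)} {q m} (unif m n (ℕₚ.≤-trans N₂≤N N≤m) m≤n (∣s∣≤ gm)) hm)
                (∣∣-triangle {q m} {q n} {E n (s n)} (cau m n (ℕₚ.≤-trans N₃≤N N≤m) (ℕₚ.≤-trans N₃≤N (ℕₚ.≤-trans N≤m m≤n)))
                  (≤-trans (≤-reflexive (∣-∣-sym (q n) (E n (s n)))) hn)) ⟩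
            (δ + δ) + (δ + δ)               ≡⟨ 4δ ⟩
            ε                               ∎

    log : ℝ
    log = mkℝ s s-cauchy

    isLog : IsLog x log
    isLog = approximates⇒IsExp {log} {x} λ ε ε>0 →
      let N , unif = E-uniform b (ε * ½) (half>0 ε>0)
      in N , λ n N≤n → eventually (λ k ((g , hk) , n≤k) → ≤-trans
          (∣∣-triangle {E n (s k)} {E k (s k)} {q k} (≤-trans (≤-reflexive (∣-∣-sym (E n (s k)) (E k (s k)))) (unif n k N≤n n≤k (∣s∣≤ g))) hk)
          (≤-reflexive (halves ε)))
        (both (gap-small (ε * ½) (half>0 ε>0)) (n , λ _ h → h))

    E≥q-¼ : Eventually λ k → q k - recip 4 ≤ E k (s k)
    E≥q-¼ = eventually (λ k (_ , h) → ∣-∣⇒lower (E k (s k)) (q k) h) (gap-small (recip 4) (recip>0 3))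

    s≥⅛ : Eventually λ k → recip 8 ≤ s k
    s≥⅛ = eventually (λ k (h , g) → go k h g) (both E≥q-¼ good)
      where
      go : ∀ k → q k - recip 4 ≤ E k (s k) → Good k → recip 8 ≤ s k
      -- If s < 1/8, then E(s) (1 - s) ≥ (5/4) (7/8) = 35/32, against `E-upper`.
      go k h g = ≤-by-contradiction λ s<⅛ → toWitnessFalse {a? = (1ℚ + ½ - recip 4) * (1ℚ - recip 8) ≤? 1ℚ} _ (begin
          (1ℚ + ½ - recip 4) * (1ℚ - recip 8)     ≤⟨ *-mono (nonNegative⁻¹ (1ℚ + ½ - recip 4)) (nonNegative⁻¹ (1ℚ - recip 8)) (≤-trans (+-monoˡ-≤ (- recip 4) (proj₂ (proj₂ (proj₂ g)))) h) (+-monoʳ-≤ 1ℚ (neg-antimono-≤ (<⇒≤ s<⅛))) ⟩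
          E k (s k) * (1ℚ - s k)                  ≤⟨ E-upper k (0≤s k) (≤-trans (<⇒≤ s<⅛) (recip≤1 8)) ⟩
          1ℚ                                      ∎)

    log>0 : 0ℝ D.< log
    log>0 = recip 8 , recip>0 7 , eventually (λ k h → ≤-trans (≤-reflexive (+-identityˡ (recip 8))) h) s≥⅛

    -- The next two bounds hold because N + 1 ≤ e^(H_N) and e^(H_N - 1) ≤ N.
    s-harmonic-upper : ∀ N → (Eventually λ k → q k ≤ fromℕ (suc N)) → Eventually λ k → s k ≤ H N + 1ℚ
    s-harmonic-upper N q≤ =
      let m , hm = E-harmonic-lower N
      in eventually (λ k (((q≤N , g) , m≤k) , 2≤k) → go m hm k q≤N (proj₁ (proj₂ g)) m≤k 2≤k) (both (both (both q≤ good) (m , λ _ h → h)) (2 , λ _ h → h))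
      where
      go : ∀ m → fromℕ (suc N) ≤ E m (H N) → ∀ k → q k ≤ fromℕ (suc N) → E k (s k) ≤ q k → m ℕ.≤ k → 2 ℕ.≤ k → s k ≤ H N + 1ℚ
      go m hm (suc zero) _ _ _ (s≤s ())
      go m hm k@(suc (suc i)) q≤N lower m≤k _ = ≤-by-contradiction λ H+1<s → toWitnessFalse {a? = 1ℚ ≤? 0ℚ} _ (begin
          1ℚ                                ≡⟨ solve 1 (λ h → con 1ℚ := h :+ con 1ℚ :- h) refl (H N) ⟩
          H N + 1ℚ - H N                    ≤⟨ +-monoˡ-≤ (- H N) (<⇒≤ H+1<s) ⟩
          s k - H N                         ≤⟨ E-increment i (0≤H N) (≤-trans (p≤p+q 0≤1) (<⇒≤ H+1<s)) ⟩
          E k (s k) - E k (H N)             ≤⟨ +-mono-≤ (≤-trans lower q≤N) (neg-antimono-≤ (≤-trans hm (E-index-mono (0≤H N) m≤k))) ⟩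
          fromℕ (suc N) - fromℕ (suc N)     ≡⟨ +-inverseʳ (fromℕ (suc N)) ⟩
          0ℚ                                ∎)

    s-harmonic-lower : ∀ N → (Eventually λ k → fromℕ (suc N) - ½ ≤ q k) → Eventually λ k → H (suc N) - fromℕ 2 ≤ s k
    s-harmonic-lower N q≥ = eventually (λ k ((N≤q , h) , 2≤k) → go k N≤q h 2≤k) (both (both q≥ E≥q-¼) (2 , λ _ h → h))
      where
      go : ∀ k → fromℕ (suc N) - ½ ≤ q k → q k - recip 4 ≤ E k (s k) → 2 ℕ.≤ k → H (suc N) - fromℕ 2 ≤ s k
      go (suc zero) _ _ (s≤s ())
      -- If s < H - 2, the partial sum grows by at least 1 between s and H - 1, but the slacks 1/2
      -- and 1/4 leave room for only 3/4.
      go k@(suc (suc i)) N≤q h _ = ≤-by-contradiction λ s<H-2 → toWitnessFalse {a? = 1ℚ ≤? ½ + recip 4} _ (begin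
          1ℚ                                                ≡⟨ solve 1 (λ s → con 1ℚ := s :+ con 1ℚ :- s) refl (s k) ⟩
          s k + 1ℚ - s k                                    ≤⟨ +-monoˡ-≤ (- s k) (s+1≤ s<H-2) ⟩
          H (suc N) - 1ℚ - s k                              ≤⟨ E-increment i (0≤s k) (≤-trans (p≤p+q 0≤1) (s+1≤ s<H-2)) ⟩
          E k (H (suc N) - 1ℚ) - E k (s k)                  ≤⟨ +-mono-≤ (E-harmonic-upper (suc i) N) (neg-antimono-≤ (≤-trans (+-monoˡ-≤ (- recip 4) N≤q) h)) ⟩
          fromℕ (suc N) - (fromℕ (suc N) - ½ - recip 4)     ≡⟨ solve 1 (λ n → n :- (n :- con ½ :- con (recip 4)) := con (½ + recip 4)) refl (fromℕ (suc N)) ⟩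
          ½ + recip 4                                       ∎)
        where
        s+1≤ : s k < H (suc N) - fromℕ 2 → s k + 1ℚ ≤ H (suc N) - 1ℚ
        s+1≤ s<H-2 = ≤-trans (+-monoˡ-≤ 1ℚ (<⇒≤ s<H-2)) (≤-reflexive (solve 1 (λ h → h :- con (fromℕ 2) :+ con 1ℚ := h :- con 1ℚ) refl (H (suc N))))

  log-exists : ∀ x → ℕ⇒ℝ 2 D.≤ x → ∃ λ ℓ → IsLog x ℓ × 0ℝ D.< ℓ × (Eventually λ k → recip 8 ≤ seq ℓ k) ×
    (∀ N → (Eventually λ k → fromℕ (suc N) - ½ ≤ seq x k) → Eventually λ k → H (suc N) - fromℕ 2 ≤ seq ℓ k) ×
    (∀ N → (Eventually λ k → seq x k ≤ fromℕ (suc N)) → Eventually λ k → seq ℓ k ≤ H N + 1ℚ)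
  log-exists x 2≤x = go (bounded-by-ℕ x)
    where
    go : (∃ λ b → Eventually λ k → ∣ seq x k ∣ ≤ fromℕ b) → _
    go (b , x≤b) = log , isLog , log>0 , s≥⅛ , s-harmonic-lower , s-harmonic-upper
      where open Log x 2≤x b x≤b

-- Passing from `L` and integers to log x and real x.

module LogarithmComparison where
  open import Defs as D hiding (_+_; _*_; -_; _-_; _≤_; _<_; _^_; ∣_∣)
  open import Data.Nat as ℕ using (ℕ; zero; suc; z≤n; s≤s)
  import Data.Nat.Properties as ℕₚ
  open import Data.Nat.Coprimality using (Coprime)
  open import Data.Nat.Divisibility using (_∣_; ∣1⇒≡1; 0∣⇒≡0; ∣-trans)
  open import Data.Nat.Primality using (Prime; prime?; euclidsLemma)
  open import Data.Integer using (+_) renaming (_-_ to _-ᶻ_)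
  open import Data.Rational as ℚ using (ℚ; 0ℚ; 1ℚ; ½; _+_; _*_; -_; _-_; _≤_; _<_; ∣_∣)
  open import Data.Rational.Properties hiding (≃-sym)
  open import Data.Rational.Solver using (module +-*-Solver)
  open import Data.Product using (_×_; _,_; proj₁; proj₂)
  open import Data.Sum using (inj₁; inj₂)
  open import Relation.Nullary using (Dec; yes; no; ¬_)
  open import Relation.Nullary.Negation using (contradiction)
  open import Relation.Binary.PropositionalEquality using (_≡_; refl; sym; trans; cong; cong₂; subst)
  open Rationals
  open Harmonic
  open Growth
  open Weights
  open BanachAlgebras
  open Operators using (prime⇒2≤; primeDivisor; prime∤)
  open MeanValues
  open ComplexAlgebra
  open Logarithm
  open +-*-Solver using (solve; _:=_; _:+_; _:*_; _:-_; :-_; con)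
  open ≤-Reasoning
  private
    module A = BanachAlgebra ℂ-algebra
    module AL = BanachAlgebra-lemmas ℂ-algebra
    module EP = EulerProducts ℂ-algebra

  prime∣^ : ∀ {p q} → Prime p → Prime q → ∀ α → q ∣ p ℕ.^ α → q ≡ p
  prime∣^ {p} {q} pr-p pr-q zero q∣1 = contradiction (subst (2 ℕ.≤_) (∣1⇒≡1 q∣1) (prime⇒2≤ pr-q)) λ { (s≤s ()) }
  prime∣^ {p} {q} pr-p pr-q (suc α) q∣ with q ℕ.≟ p
  ... | yes q≡p = q≡p
  ... | no  q≢p with euclidsLemma p (p ℕ.^ α) pr-q q∣
  ...   | inj₁ q∣p = contradiction q∣p (prime∤ pr-p pr-q q≢p)
  ...   | inj₂ q∣^ = prime∣^ pr-p pr-q α q∣^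

  prime-power-coprime : ∀ {p} → Prime p → ∀ α n → ¬ (p ∣ suc n) → Coprime (p ℕ.^ α) (suc n)
  prime-power-coprime pr α n p∤n {zero}        (_ , 0∣n) = contradiction (0∣⇒≡0 0∣n) λ ()
  prime-power-coprime pr α n p∤n {suc zero}    _ = refl
  prime-power-coprime pr α n p∤n {suc (suc d)} (d∣^ , d∣n) =
    let q , pr-q , q∣d , _ = primeDivisor (2 ℕ.+ d) (s≤s (s≤s z≤n))
    in contradiction (subst (_∣ suc n) (prime∣^ pr pr-q α (∣-trans q∣d d∣^)) (∣-trans q∣d d∣n)) p∤n

  ⟶⇒⟶ᶜ : ∀ {a z} → a A.⟶ z → a ⟶ᶜ z
  ⟶⇒⟶ᶜ {a} {z} a⟶z ε (ε₀ , ε₀>0 , K , ε≥ε₀) =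
    let N , hN = a⟶z (ε₀ * ½ * ½) (half>0 (half>0 ε₀>0))
    -- A strict inequality needs a margin: half of ε₀ bounds the norm, as limit accuracy plus
    -- approximation error, and the other half is the margin.
    in N , λ n N≤n → ε₀ * ½ , half>0 ε₀>0 ,
      eventually (λ k (h , K≤k) → bound n k h (ε≥ε₀ k K≤k)) (both (hN n N≤n (ε₀ * ½ * ½) (half>0 (half>0 ε₀>0))) (K , λ _ h → h))
    where
    bound : ∀ n k → norm (a n -ᶜ z) k ≤ ε₀ * ½ * ½ + ε₀ * ½ * ½ → 0ℚ + ε₀ ≤ seq ε k → seq (∣ a n -ᶜ z ∣ᶜ) k + ε₀ * ½ ≤ seq ε k
    bound n k h hε = begin
      seq (∣ a n -ᶜ z ∣ᶜ) k + ε₀ * ½          ≤⟨ +-monoˡ-≤ (ε₀ * ½) (≤-trans (∣∣ᶜ≤norm (a n -ᶜ z) k) h) ⟩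
      ε₀ * ½ * ½ + ε₀ * ½ * ½ + ε₀ * ½        ≡⟨ trans (cong (_+ ε₀ * ½) (halves (ε₀ * ½))) (halves ε₀) ⟩
      ε₀                                      ≡⟨ sym (+-identityˡ ε₀) ⟩
      0ℚ + ε₀                                 ≤⟨ hε ⟩
      seq ε k                                 ∎

  ≡⇒≃ᶜ : ∀ (z w : ℂ) → z ≡ w → z ≃ᶜ w
  ≡⇒≃ᶜ z w refl = ≃ᶜ-refl {z}

  +ᶜ-congˡ : ∀ (z x y : ℂ) → x ≃ᶜ y → z +ᶜ x ≃ᶜ z +ᶜ y
  +ᶜ-congˡ z x y (h , k) = +-cong {re z} {re z} {re x} {re y} (≃-refl {re z}) h , +-cong {im z} {im z} {im x} {im y} (≃-refl {im z}) k

  *ᶜ-congˡ : ∀ (z x y : ℂ) → x ≃ᶜ y → z *ᶜ x ≃ᶜ z *ᶜ y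
  *ᶜ-congˡ z x y h = *ᶜ-cong {z} {z} {x} {y} (≃ᶜ-refl {z}) h

  ∑ᶜ≈sum : ∀ {a b : ℕ → ℂ} → (∀ i → a i ≃ᶜ b i) → ∀ n → ∑ᶜ a n A.≈ AL.sum b n
  ∑ᶜ≈sum {a} {b} h = EP.sum-unique {∑ᶜ a} {b} (≃ᶜ-refl {0ℂ}) (λ n → +ᶜ-congˡ (∑ᶜ a n) (a n) (b n) (h n))

  ^ᶜ≈^ : ∀ z n → z ^ᶜ n A.≈ z AL.^ n
  ^ᶜ≈^ z = EP.^-unique {z ^ᶜ_} {z} (≃ᶜ-refl {1ℂ}) (λ n → ≃ᶜ-refl {z *ᶜ z ^ᶜ n})

  extendᶜ : ∀ {n} → Dec (Prime n) → (∀ p → Prime p → ℂ) → ℂ → ℂ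
  extendᶜ {n} (yes pr) F z = z *ᶜ F n pr
  extendᶜ     (no _)   F z = z

  primeProduct-suc : ∀ F n → primeProduct F (suc n) ≡ extendᶜ (prime? (suc n)) F (primeProduct F n)
  primeProduct-suc F n with prime? (suc n)
  ... | yes pr = refl
  ... | no  _  = refl

  extendᶜ-cong : ∀ {n} F z (d d′ : Dec (Prime n)) → d ≡ d′ → extendᶜ d F z ≡ extendᶜ d′ F z
  extendᶜ-cong F z d d′ refl = refl

  primeProduct-prime : ∀ F n pr → prime? (suc n) ≡ yes pr → primeProduct F (suc n) ≡ primeProduct F n *ᶜ F (suc n) pr
  primeProduct-prime F n pr eq = trans {i = primeProduct F (suc n)} {j = extendᶜ (prime? (suc n)) F (primeProduct F n)} {k = extendᶜ (yes pr) F (primeProduct F n)}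
    (primeProduct-suc F n) (extendᶜ-cong F (primeProduct F n) (prime? (suc n)) (yes pr) eq)

  primeProduct-composite : ∀ F n ¬pr → prime? (suc n) ≡ no ¬pr → primeProduct F (suc n) ≡ primeProduct F n
  primeProduct-composite F n ¬pr eq = trans {i = primeProduct F (suc n)} {j = extendᶜ (prime? (suc n)) F (primeProduct F n)} {k = extendᶜ (no ¬pr) F (primeProduct F n)}
    (primeProduct-suc F n) (extendᶜ-cong F (primeProduct F n) (prime? (suc n)) (no ¬pr) eq)

  primeProduct≈ : ∀ {F F′ : ∀ p → Prime p → ℂ} → (∀ p pr → F p pr ≃ᶜ F′ p pr) → ∀ n → primeProduct F n A.≈ EP.primeProducts F′ n
  primeProduct≈ {F} {F′} h = EP.primeProducts-unique {primeProduct F} {F′} (≃ᶜ-refl {1ℂ})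
    (λ n pr eq → ≃ᶜ-trans {primeProduct F (suc n)} {primeProduct F n *ᶜ F (suc n) pr} {primeProduct F n *ᶜ F′ (suc n) pr}
      (≡⇒≃ᶜ (primeProduct F (suc n)) (primeProduct F n *ᶜ F (suc n) pr) (primeProduct-prime F n pr eq))
      (*ᶜ-congˡ (primeProduct F n) (F (suc n) pr) (F′ (suc n) pr) (h (suc n) pr)))
    (λ n ¬pr eq → ≡⇒≃ᶜ (primeProduct F (suc n)) (primeProduct F n) (primeProduct-composite F n ¬pr eq))

  module _ (j n : ℕ) (X l : ℚ) where
    private
      N = 2 ℕ.+ n
      M = fromℕ N
      x = L N ^ j * Λ N

      0≤x : 0ℚ ≤ x
      0≤x = 0≤* (0≤L^ N j) (0≤Λ N)

      W≡ : W j N ≡ M * x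
      W≡ = *-assoc M (L N ^ j) (Λ N)

      L≤2M : L N ≤ fromℕ 2 * M
      L≤2M = ≤-trans (L-≤ N) (≤-by (M - 1ℚ) (0≤difference (1≤fromℕ (suc n))) (solve 1 (λ m → con 1ℚ :+ m :+ (m :- con 1ℚ) := con (fromℕ 2) :* m) refl M))

    -- Lets the error term absorb additive constants, such as the 1 that comes with every eventual
    -- norm bound.
    1≤2W : 1ℚ ≤ fromℕ 2 * W j N
    1≤2W = begin
      1ℚ                            ≡⟨ sym (L*Λ N) ⟩
      L N * Λ N                     ≤⟨ *-monoʳ (0≤Λ N) L≤2M ⟩
      fromℕ 2 * M * Λ N             ≡⟨ solve 2 (λ m a → con (fromℕ 2) :* m :* a := con (fromℕ 2) :* (m :* con 1ℚ :* a)) refl M (Λ N) ⟩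
      fromℕ 2 * (M * 1ℚ * Λ N)      ≤⟨ *-monoˡ (0≤fromℕ 2) (*-monoʳ (0≤Λ N) (*-monoˡ (0≤fromℕ N) (1≤^ (1≤L N) j))) ⟩
      fromℕ 2 * W j N               ∎

    module _ (N≤X : M - ½ ≤ X) (X≤N+1 : X ≤ fromℕ (suc N)) (l-lower : H N - fromℕ 2 ≤ l) (l-upper : l ≤ H N + 1ℚ) (⅛≤l : recip 8 ≤ l) where

      l≤L : l ≤ L N
      l≤L = ≤-trans l-upper (≤-reflexive (+-comm (H N) 1ℚ))

      0≤l : 0ℚ ≤ l
      0≤l = ≤-trans (0≤recip 8) ⅛≤l

      -- The harmonic bound gives L ≤ l + 3, and 3 = 24/8 ≤ 24 l. The bound 1/8 ≤ l is needed
      -- because H - 2 may be negative for small x.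
      L≤25l : L N ≤ fromℕ 25 * l
      L≤25l = begin
        1ℚ + H N                                  ≡⟨ solve 1 (λ h → con 1ℚ :+ h := h :- con (fromℕ 2) :+ con (fromℕ 24) :* con (recip 8)) refl (H N) ⟩
        H N - fromℕ 2 + fromℕ 24 * recip 8        ≤⟨ +-mono-≤ l-lower (*-monoˡ (0≤fromℕ 24) ⅛≤l) ⟩
        l + fromℕ 24 * l                          ≡⟨ solve 1 (λ l → l :+ con (fromℕ 24) :* l := con (fromℕ 25) :* l) refl l ⟩
        fromℕ 25 * l                              ∎

      -- 3 j comes from exchanging the logarithms, which differ by at most 3; the 2 comes from
      -- exchanging X for N, which costs one L^j ≤ 2 W.
      main-difference : ∣ G j N - X * l ^ j ∣ ≤ fromℕ (3 ℕ.* j ℕ.+ 2) * W j N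
      main-difference = begin
        ∣ M * L N ^ j - X * l ^ j ∣                            ≡⟨ cong ∣_∣ (solve 4 (λ m a x b → m :* a :- x :* b := m :* (a :- b) :+ (m :- x) :* b) refl M (L N ^ j) X (l ^ j)) ⟩
        ∣ M * (L N ^ j - l ^ j) + (M - X) * l ^ j ∣            ≤⟨ ∣p+q∣≤∣p∣+∣q∣ (M * (L N ^ j - l ^ j)) ((M - X) * l ^ j) ⟩
        ∣ M * (L N ^ j - l ^ j) ∣ + ∣ (M - X) * l ^ j ∣        ≤⟨ +-mono-≤ first second ⟩
        fromℕ (3 ℕ.* j) * (M * x) + fromℕ 2 * (M * x)          ≡⟨ trans (sym (*-distribʳ-+ (M * x) (fromℕ (3 ℕ.* j)) (fromℕ 2))) (cong₂ _*_ (sym (fromℕ-+ (3 ℕ.* j) 2)) (sym W≡)) ⟩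
        fromℕ (3 ℕ.* j ℕ.+ 2) * W j N                          ∎
        where
        first : ∣ M * (L N ^ j - l ^ j) ∣ ≤ fromℕ (3 ℕ.* j) * (M * x)
        first = begin
          ∣ M * (L N ^ j - l ^ j) ∣                ≡⟨ 0≤p⇒∣p∣≡p (0≤* (0≤fromℕ N) (0≤difference (^-mono 0≤l l≤L j))) ⟩
          M * (L N ^ j - l ^ j)                    ≤⟨ *-monoˡ (0≤fromℕ N) (^-difference-Λ N j 0≤l l≤L ≤-refl) ⟩
          M * (fromℕ j * x * (L N - l))            ≤⟨ *-monoˡ (0≤fromℕ N) (*-monoˡ (0≤* (0≤fromℕ j) 0≤x) L-l≤3) ⟩
          M * (fromℕ j * x * fromℕ 3)              ≡⟨ solve 3 (λ m j x → m :* (j :* x :* con (fromℕ 3)) := con (fromℕ 3) :* j :* (m :* x)) refl M (fromℕ j) x ⟩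
          fromℕ 3 * fromℕ j * (M * x)              ≡⟨ cong (_* (M * x)) (sym (fromℕ-* 3 j)) ⟩
          fromℕ (3 ℕ.* j) * (M * x)                ∎
          where
          L-l≤3 : L N - l ≤ fromℕ 3
          L-l≤3 = ≤-trans (+-monoʳ-≤ (L N) (neg-antimono-≤ l-lower)) (≤-reflexive (solve 1 (λ h → con 1ℚ :+ h :- (h :- con (fromℕ 2)) := con (fromℕ 3)) refl (H N)))
        second : ∣ (M - X) * l ^ j ∣ ≤ fromℕ 2 * (M * x)
        second = begin
          ∣ (M - X) * l ^ j ∣          ≡⟨ trans (∣p*q∣≡∣p∣*∣q∣ (M - X) (l ^ j)) (cong (∣ M - X ∣ *_) (0≤p⇒∣p∣≡p (0≤^ 0≤l j))) ⟩
          ∣ M - X ∣ * l ^ j            ≤⟨ *-mono (0≤∣p∣ (M - X)) (0≤^ 0≤l j) M-X (^-mono 0≤l l≤L j) ⟩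
          1ℚ * L N ^ j                 ≡⟨ trans (*-identityˡ (L N ^ j)) (trans (sym (*-identityʳ (L N ^ j))) (cong (L N ^ j *_) (sym (L*Λ N)))) ⟩
          L N ^ j * (L N * Λ N)        ≡⟨ solve 3 (λ p l a → p :* (l :* a) := l :* (p :* a)) refl (L N ^ j) (L N) (Λ N) ⟩
          L N * x                      ≤⟨ *-monoʳ 0≤x L≤2M ⟩
          fromℕ 2 * M * x              ≡⟨ *-assoc (fromℕ 2) M x ⟩
          fromℕ 2 * (M * x)            ∎
          where
          M-X : ∣ M - X ∣ ≤ 1ℚ
          M-X = ∣-∣≤ (≤-trans (≤-reflexive (solve 1 (λ m → m := m :- con ½ :+ con ½) refl M)) (≤-trans (+-monoˡ-≤ ½ N≤X) (+-monoʳ-≤ X (≤-by ½ 0≤½ refl))))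
            (≤-trans X≤N+1 (≤-reflexive (trans (fromℕ-suc N) (+-comm 1ℚ M))))

      M≤2X : M ≤ fromℕ 2 * X
      M≤2X = ≤-trans (≤-by (M - 1ℚ) (0≤difference (1≤fromℕ (suc n))) (solve 1 (λ m → m :+ (m :- con 1ℚ) := con (fromℕ 2) :* (m :- con ½)) refl M)) (*-monoˡ (0≤fromℕ 2) N≤X)

      0≤X : 0ℚ ≤ X
      0≤X = ≤-trans (≤-by {0ℚ} (M - 1ℚ + ½) (0≤+ (0≤difference (1≤fromℕ (suc n))) 0≤½) (solve 1 (λ m → con 0ℚ :+ (m :- con 1ℚ :+ con ½) := m :- con ½) refl M)) N≤X

  -- ζ stands for (log x)^(k - 2), where k = j + 1.
  W-upper : ∀ j n X l ζ → fromℕ (2 ℕ.+ n) ≤ fromℕ 2 * X → 0ℚ ≤ X → 0ℚ ≤ l → L (2 ℕ.+ n) ≤ fromℕ 25 * l →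
    L (2 ℕ.+ n) ^ j * Λ (2 ℕ.+ n) ≤ fromℕ 25 ^ j * ζ → W j (2 ℕ.+ n) ≤ fromℕ 2 * fromℕ 25 ^ j * (X * ζ)
  W-upper j n X l ζ M≤2X 0≤X 0≤l L≤25l h = begin
    W j N                                  ≡⟨ *-assoc (fromℕ N) (L N ^ j) (Λ N) ⟩
    fromℕ N * (L N ^ j * Λ N)              ≤⟨ *-mono (0≤fromℕ N) (0≤* (0≤L^ N j) (0≤Λ N)) M≤2X h ⟩
    fromℕ 2 * X * (fromℕ 25 ^ j * ζ)       ≡⟨ solve 4 (λ t x p z → t :* x :* (p :* z) := t :* p :* (x :* z)) refl (fromℕ 2) X (fromℕ 25 ^ j) ζ ⟩
    fromℕ 2 * fromℕ 25 ^ j * (X * ζ)       ∎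
    where N = 2 ℕ.+ n

  -- `inv` reads ℓ at the shifted index N + k; this is at least k, so an eventual bound still
  -- applies.
  inv-lower : ∀ ℓ (ℓ>0 : 0ℝ D.< ℓ) {c} (c>0 : 0ℚ < c) → Eventually (λ k → seq ℓ k ≤ c) → Eventually λ k → reciprocal c>0 ≤ seq (inv ℓ ℓ>0) k
  inv-lower ℓ (ε , ε>0 , N , h) c>0 (M , hM) = M , λ k M≤k → reciprocal-anti
    (<-≤-trans ε>0 (≤-trans (≤-reflexive (sym (+-identityˡ ε))) (h (N ℕ.+ k) (ℕₚ.m≤m+n N k)))) c>0 (hM (N ℕ.+ k) (ℕₚ.≤-trans M≤k (ℕₚ.m≤n+m k N)))

  norm-split : ∀ S C g y k → norm (S -ᶜ C *ᶜ ℝ⇒ℂ y) k ≤ norm (S -ᶜ C *ᶜ ℚ⇒ℂ g) k + norm C k * ∣ g - seq y k ∣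
  norm-split S C g y k = ≤-trans (≤-reflexive (cong₂ (λ p q → ∣ p ∣ + ∣ q ∣)
      (solve 5 (λ s c d g y → s :- (c :* y :- d :* con 0ℚ) := (s :- (c :* g :- d :* con 0ℚ)) :+ (c :* (g :- y) :- d :* (con 0ℚ :- con 0ℚ))) refl (seq (re S) k) (seq (re C) k) (seq (im C) k) g (seq y k))
      (solve 5 (λ s c d g y → s :- (c :* con 0ℚ :+ d :* y) := (s :- (c :* con 0ℚ :+ d :* g)) :+ (c :* (con 0ℚ :- con 0ℚ) :+ d :* (g :- y))) refl (seq (im S) k) (seq (re C) k) (seq (im C) k) g (seq y k))))
    (≤-trans (norm-+ (S -ᶜ C *ᶜ ℚ⇒ℂ g) (C *ᶜ (ℚ⇒ℂ g -ᶜ ℝ⇒ℂ y)) k) (+-monoʳ-≤ (norm (S -ᶜ C *ᶜ ℚ⇒ℂ g) k)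
      (≤-trans (norm-* C (ℚ⇒ℂ g -ᶜ ℝ⇒ℂ y) k) (≤-reflexive (cong (norm C k *_) (+-identityʳ ∣ g - seq y k ∣))))))

  -- The exponent k - 2 is -1 for j = 0, where an upper bound for ℓ is used, and j - 1 ≥ 0
  -- otherwise, where a lower bound is used.
  zeta-lower : ∀ j N ℓ (ℓ>0 : 0ℝ D.< ℓ) → Eventually (λ k → 0ℚ ≤ seq ℓ k × seq ℓ k ≤ L N × L N ≤ fromℕ 25 * seq ℓ k) →
    Eventually λ k → L N ^ j * Λ N ≤ fromℕ 25 ^ j * seq (zpow ℓ ℓ>0 (+ suc j -ᶻ + 2)) k
  zeta-lower zero N ℓ ℓ>0 h = eventually
    (λ k Λ≤ → *-monoˡ 0≤1 (≤-trans Λ≤ (≤-reflexive (sym (*-identityʳ (seq (inv ℓ ℓ>0) k))))))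
    (inv-lower ℓ ℓ>0 (0<L N) (eventually (λ k p → proj₁ (proj₂ p)) h))
  zeta-lower (suc i) N ℓ ℓ>0 h = eventually (λ k (0≤l , l≤L , L≤25l) → bound k 0≤l L≤25l) h
    where
    bound : ∀ k → 0ℚ ≤ seq ℓ k → L N ≤ fromℕ 25 * seq ℓ k → L N ^ suc i * Λ N ≤ fromℕ 25 ^ suc i * seq (ℓ D.^ i) k
    bound k 0≤l L≤25l = begin
      L N ^ suc i * Λ N                      ≡⟨ L^suc*Λ N i ⟩
      L N ^ i                                ≤⟨ ^-mono (0≤L N) L≤25l i ⟩
      (fromℕ 25 * seq ℓ k) ^ i               ≡⟨ ^-distrib-* (fromℕ 25) (seq ℓ k) i ⟩
      fromℕ 25 ^ i * seq ℓ k ^ i             ≤⟨ *-monoʳ (0≤^ 0≤l i) (≤-trans (≤-reflexive (sym (*-identityˡ (fromℕ 25 ^ i)))) (*-monoʳ {fromℕ 25 ^ i} {1ℚ} {fromℕ 25} (0≤^ (0≤fromℕ 25) i) (1≤fromℕ 24))) ⟩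
      fromℕ 25 ^ suc i * seq ℓ k ^ i         ≡⟨ cong (fromℕ 25 ^ suc i *_) (sym (seq-^ ℓ i k)) ⟩
      fromℕ 25 ^ suc i * seq (ℓ D.^ i) k     ∎

  module _ (j : ℕ) (A₀ B : ℚ) (0≤A₀ : 0ℚ ≤ A₀) (0≤B : 0ℚ ≤ B) where

    private
      A₁ = A₀ + fromℕ 2 + B * fromℕ (3 ℕ.* j ℕ.+ 2)

      0≤A₁ : 0ℚ ≤ A₁
      0≤A₁ = 0≤+ (0≤+ 0≤A₀ (0≤fromℕ 2)) (0≤* 0≤B (0≤fromℕ (3 ℕ.* j ℕ.+ 2)))

    -- In `A₁`, A₀ is the error in terms of `L`, 2 absorbs an additive 1, and B (3 j + 2) is the
    -- change of the main term with |C_f| ≤ B. The factor 2 · 25^j converts `W` into x (log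
    -- x)^(k-2).
    errorConstant : ℚ
    errorConstant = A₁ * (fromℕ 2 * fromℕ 25 ^ j)

    error-bound : ∀ n X l ζ s c g → fromℕ (2 ℕ.+ n) - ½ ≤ X → X ≤ fromℕ (3 ℕ.+ n) → H (2 ℕ.+ n) - fromℕ 2 ≤ l → l ≤ H (2 ℕ.+ n) + 1ℚ → recip 8 ≤ l →
      L (2 ℕ.+ n) ^ j * Λ (2 ℕ.+ n) ≤ fromℕ 25 ^ j * ζ → s ≤ A₀ * W j (2 ℕ.+ n) + 1ℚ → c ≤ B → g ≡ ∣ G j (2 ℕ.+ n) - X * l ^ j ∣ →
      s + c * g ≤ errorConstant * (X * ζ)
    error-bound n X l ζ s c g N≤X X≤N+1 l-lower l-upper ⅛≤l hζ hs hc refl = begin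
      s + c * ∣ G j N - X * l ^ j ∣               ≤⟨ +-mono-≤ (≤-trans hs (+-monoʳ-≤ (A₀ * w) (1≤2W j n X l))) (*-monoʳ (0≤∣p∣ (G j N - X * l ^ j)) hc) ⟩
      A₀ * w + fromℕ 2 * w + B * ∣ G j N - X * l ^ j ∣ ≤⟨ +-monoʳ-≤ (A₀ * w + fromℕ 2 * w) (*-monoˡ 0≤B (main-difference j n X l N≤X X≤N+1 l-lower l-upper ⅛≤l)) ⟩
      A₀ * w + fromℕ 2 * w + B * (m * w)          ≡⟨ solve 4 (λ a b m w → a :* w :+ con (fromℕ 2) :* w :+ b :* (m :* w) := (a :+ con (fromℕ 2) :+ b :* m) :* w) refl A₀ B m w ⟩
      A₁ * w                                      ≤⟨ *-monoˡ 0≤A₁ (W-upper j n X l ζ (M≤2X j n X l N≤X X≤N+1 l-lower l-upper ⅛≤l) (0≤X j n X l N≤X X≤N+1 l-lower l-upper ⅛≤l)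
                                                       (≤-trans (0≤recip 8) ⅛≤l) (L≤25l j n X l N≤X X≤N+1 l-lower l-upper ⅛≤l) hζ) ⟩
      A₁ * (fromℕ 2 * fromℕ 25 ^ j * (X * ζ))     ≡⟨ sym (*-assoc A₁ (fromℕ 2 * fromℕ 25 ^ j) (X * ζ)) ⟩
      errorConstant * (X * ζ)                     ∎
      where
      N = 2 ℕ.+ n
      w = W j N
      m = fromℕ (3 ℕ.* j ℕ.+ 2)

    module _ (S C : ℂ) (n : ℕ) (S-asymptotic : Eventually λ k → norm (S -ᶜ C *ᶜ ℚ⇒ℂ (G j (2 ℕ.+ n))) k ≤ A₀ * W j (2 ℕ.+ n) + 1ℚ)
      (C≤B : Eventually λ k → norm C k ≤ B) (x ℓ : ℝ) (ℓ>0 : 0ℝ D.< ℓ)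
      (N≤x : Eventually λ k → fromℕ (2 ℕ.+ n) - ½ ≤ seq x k) (x≤N+1 : Eventually λ k → seq x k ≤ fromℕ (3 ℕ.+ n))
      (ℓ-lower : Eventually λ k → H (2 ℕ.+ n) - fromℕ 2 ≤ seq ℓ k) (ℓ-upper : Eventually λ k → seq ℓ k ≤ H (2 ℕ.+ n) + 1ℚ)
      (⅛≤ℓ : Eventually λ k → recip 8 ≤ seq ℓ k) where

      private
        N = 2 ℕ.+ n

        ζ : ℝ
        ζ = zpow ℓ ℓ>0 (+ suc j -ᶻ + 2)

        sizes : Eventually λ k → 0ℚ ≤ seq ℓ k × seq ℓ k ≤ L N × L N ≤ fromℕ 25 * seq ℓ k
        sizes = eventually (λ k ((((a , b) , c) , d) , e) → ≤-trans (0≤recip 8) e , ≤-trans d (≤-reflexive (+-comm (H N) 1ℚ)) , L≤25l j n (seq x k) (seq ℓ k) a b c d e)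
          (both (both (both (both N≤x x≤N+1) ℓ-lower) ℓ-upper) ⅛≤ℓ)

      asymptotic-bound : ∣ S -ᶜ C *ᶜ ℝ⇒ℂ (x D.* ℓ D.^ j) ∣ᶜ D.≤ ℚ⇒ℝ errorConstant D.* (x D.* ζ)
      asymptotic-bound ε ε>0 = eventually (λ k (((((((a , b) , c) , d) , e) , hζ) , hs) , hc) → ≤-trans
          (≤-trans (∣∣ᶜ≤norm (S -ᶜ C *ᶜ ℝ⇒ℂ (x D.* ℓ D.^ j)) k) (≤-trans (norm-split S C (G j N) (x D.* ℓ D.^ j) k)
            (error-bound n (seq x k) (seq ℓ k) (seq ζ k) (norm (S -ᶜ C *ᶜ ℚ⇒ℂ (G j N)) k) (norm C k) (∣ G j N - seq x k * seq (ℓ D.^ j) k ∣) a b c d e hζ hs hc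
              (cong (λ t → ∣ G j N - seq x k * t ∣) (seq-^ ℓ j k)))))
          (p≤p+q (<⇒≤ ε>0)))
        (both (both (both (both (both (both (both N≤x x≤N+1) ℓ-lower) ℓ-upper) ⅛≤ℓ) (zeta-lower j N ℓ ℓ>0 sizes)) S-asymptotic) C≤B)

-- Translation of the hypotheses and the conclusion.

module MeanValueTheorem where
  open import Defs as D hiding (_+_; _*_; -_; _-_; _≤_; _<_; _^_; ∣_∣)
  open import Data.Nat as ℕ using (ℕ; zero; suc; z≤n; s≤s; _!)
  import Data.Nat.Properties as ℕₚ
  open import Data.Nat.Properties using (_!≢0)
  open import Data.Nat.Divisibility using (_∣_)
  open import Data.Nat.Primality using (Prime; prime⇒nonZero)
  open import Data.Integer using (+_) renaming (_-_ to _-ᶻ_)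
  open import Data.Rational as ℚ using (ℚ; 0ℚ; 1ℚ; ½; _+_; _*_; -_; _-_; _≤_; _<_; ∣_∣; _/_)
  open import Data.Rational.Properties hiding (≃-sym)
  open import Data.Rational.Solver using (module +-*-Solver)
  open import Data.Product using (Σ; ∃; _×_; _,_; proj₁; proj₂)
  open import Data.Empty using (⊥)
  open import Relation.Nullary using (¬_)
  open import Relation.Binary.PropositionalEquality using (_≡_; refl; sym; cong; subst; subst₂)
  open Rationals
  open Harmonic
  open Growth
  open Weights
  open BanachAlgebras
  open MeanValues
  open ComplexAlgebra
  open Logarithm
  open LogarithmComparison
  open +-*-Solver using (solve; _:=_; _:+_; _:*_; _:-_; :-_; con)
  open ≤-Reasoning
  private
    module A = BanachAlgebra ℂ-algebra
    module AL = BanachAlgebra-lemmas ℂ-algebra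
    module EP = EulerProducts ℂ-algebra
    module MV = MeanValue ℂ-algebra

  Growth : (ℕ → ℂ) → Set
  Growth f = ∃ λ K → 0ℝ D.< K × (∀ p α → Prime p → 2 ℕ.≤ α → ∃ λ v → IsPower (ℕ⇒ℝ α) K v × ∣ f (p ℕ.^ α) ∣ᶜ D.≤ v)

  prime-power-bound : ∀ {f j} → Multiplicative f → (∀ p → Prime p → f p ≃ᶜ ℕ⇒ℂ (suc j)) → Growth f →
    ∃ λ C → ∀ p α → Prime p → f (p ℕ.^ α) ⊑ C * ρ ^ α
  prime-power-bound {f} {j} mult f-prime (K , K>0 , growth) = combine (power-bound {K} K>0)
    where
    module _ (l : ℕ) (power : ∀ α v → 2 ℕ.≤ α → IsPower (ℕ⇒ℝ α) K v → Eventually λ k → seq v k ≤ fromℕ (suc α) ^ l + 1ℚ)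
      (C₁ : ℚ) (0≤C₁ : 0ℚ ≤ C₁) (C₁-bound : ∀ α → fromℕ (suc α) ^ l ≤ C₁ * ρ ^ α) where
      C : ℚ
      -- The three summands serve α ≥ 2, α = 1 and α = 0.
      C = fromℕ 8 * C₁ + fromℕ (suc j) + 1ℚ
      0≤8C₁ : 0ℚ ≤ fromℕ 8 * C₁
      0≤8C₁ = 0≤* (0≤fromℕ 8) 0≤C₁
      1≤C : 1ℚ ≤ C * 1ℚ
      1≤C = ≤-trans (p≤q+p (0≤+ 0≤8C₁ (0≤fromℕ (suc j)))) (≤-reflexive (sym (*-identityʳ C)))
      j≤C : fromℕ (suc j) + 0ℚ ≤ C * (ρ * 1ℚ)
      j≤C = ≤-by ((fromℕ 8 * C₁ + 1ℚ) * ρ + fromℕ (suc j) * ½) (0≤+ (0≤* (0≤+ 0≤8C₁ 0≤1) (nonNegative⁻¹ ρ)) (0≤* (0≤fromℕ (suc j)) 0≤½))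
        (solve 2 (λ c j → j :+ con 0ℚ :+ ((c :+ con 1ℚ) :* con ρ :+ j :* con ½) := (c :+ j :+ con 1ℚ) :* (con ρ :* con 1ℚ)) refl (fromℕ 8 * C₁) (fromℕ (suc j)))
      large : ∀ α {r v ε} → 0ℚ < ε → r ≤ v + 1ℚ → v ≤ fromℕ (suc α) ^ l + 1ℚ → (r + 1ℚ) + (r + 1ℚ) ≤ C * ρ ^ α + ε
      large α {r} {v} {ε} ε>0 hr hv = begin
        (r + 1ℚ) + (r + 1ℚ)             ≤⟨ +-mono-≤ half half ⟩
        fromℕ 4 * P + fromℕ 4 * P       ≡⟨ solve 1 (λ p → con (fromℕ 4) :* p :+ con (fromℕ 4) :* p := con (fromℕ 8) :* p) refl P ⟩
        fromℕ 8 * P                     ≤⟨ *-monoˡ (0≤fromℕ 8) (C₁-bound α) ⟩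
        fromℕ 8 * (C₁ * ρ ^ α)          ≡⟨ sym (*-assoc (fromℕ 8) C₁ (ρ ^ α)) ⟩
        fromℕ 8 * C₁ * ρ ^ α            ≤⟨ *-monoʳ (0≤ρ^ α) (≤-trans (p≤p+q {fromℕ 8 * C₁} (0≤fromℕ (suc j))) (p≤p+q 0≤1)) ⟩
        C * ρ ^ α                       ≤⟨ p≤p+q (<⇒≤ ε>0) ⟩
        C * ρ ^ α + ε                   ∎
        where
        P = fromℕ (suc α) ^ l
        1≤P : 1ℚ ≤ P
        1≤P = 1≤^ (1≤fromℕ α) l
        -- One of the two components: r + 1 ≤ P + 3 ≤ 4 P. Two of them give the 8 in C.
        half : r + 1ℚ ≤ fromℕ 4 * P
        half = begin
          r + 1ℚ                        ≤⟨ +-monoˡ-≤ 1ℚ (≤-trans hr (+-monoˡ-≤ 1ℚ hv)) ⟩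
          P + 1ℚ + 1ℚ + 1ℚ              ≤⟨ +-mono-≤ (+-mono-≤ (+-monoʳ-≤ P 1≤P) 1≤P) 1≤P ⟩
          P + P + P + P                 ≡⟨ solve 1 (λ p → p :+ p :+ p :+ p := con (fromℕ 4) :* p) refl P ⟩
          fromℕ 4 * P                   ∎
      bound : ∀ p α → Prime p → f (p ℕ.^ α) ⊑ C * ρ ^ α
      bound p zero pr = ⊑-resp {1ℂ} {f 1} {C * 1ℚ} (≃ᶜ-sym {f 1} {1ℂ} (Multiplicative.at-1 mult)) λ ε ε>0 → always λ n → ≤-trans 1≤C (p≤p+q (<⇒≤ ε>0))
      bound p (suc zero) pr = subst (λ q → f q ⊑ C * ρ ^ 1) (sym (ℕₚ.*-identityʳ p))
        (⊑-resp {ℕ⇒ℂ (suc j)} {f p} {C * ρ ^ 1} (≃ᶜ-sym {f p} {ℕ⇒ℂ (suc j)} (f-prime p pr)) λ ε ε>0 → always λ n →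
          ≤-trans (≤-trans (≤-reflexive (cong (_+ 0ℚ) (0≤p⇒∣p∣≡p (0≤fromℕ (suc j))))) j≤C) (p≤p+q (<⇒≤ ε>0)))
      bound p α@(suc (suc α-2)) pr ε ε>0 = go (growth p α pr (s≤s (s≤s z≤n)))
        where
        go : (∃ λ v → IsPower (ℕ⇒ℝ α) K v × ∣ f (p ℕ.^ α) ∣ᶜ D.≤ v) → Eventually λ n → norm (f (p ℕ.^ α)) n ≤ C * ρ ^ α + ε
        go (v , v-power , f≤v) = eventually (λ n ((a , b) , c) → ≤-trans a (large α ε>0 b c))
          (both (both (norm≤∣∣ᶜ (f (p ℕ.^ α)) 1ℚ 0<1) (f≤v 1ℚ 0<1)) (power α v (s≤s (s≤s z≤n)) v-power))
    combine : (∃ λ l → ∀ α v → 2 ℕ.≤ α → IsPower (ℕ⇒ℝ α) K v → Eventually λ k → seq v k ≤ fromℕ (suc α) ^ l + 1ℚ) →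
      ∃ λ C → ∀ p α → Prime p → f (p ℕ.^ α) ⊑ C * ρ ^ α
    combine (l , power) = let C₁ , 0≤C₁ , h = polynomial≤exponential l in C l power C₁ 0≤C₁ h , bound l power C₁ 0≤C₁ h

  norm-asymptotic : ∀ (S C : ℂ) g b → (S A.- C A.* ℚ⇒ℂ g) ⊑ b → Eventually λ k → norm (S -ᶜ C *ᶜ ℚ⇒ℂ g) k ≤ b + 1ℚ
  norm-asymptotic S C g b h = h 1ℚ 0<1

  floor≥2 : ∀ N x → ℕ⇒ℝ 2 D.≤ x → IsFloor N x → 2 ℕ.≤ N
  floor≥2 N x 2≤x (_ , ε , ε>0 , M , x<N+1) = ℕₚ.≮⇒≥ λ N<2 →
    let K , hK = 2≤x (ε * ½) (half>0 ε>0)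
        k = K ℕ.⊔ M
    in impossible N N<2 (seq x k) (hK k (ℕₚ.m≤m⊔n K M)) (x<N+1 k (ℕₚ.m≤n⊔m K M))
    where
    ε/2<ε : ε * ½ < ε
    ε/2<ε = subst₂ _<_ (+-identityʳ (ε * ½)) (halves ε) (+-monoʳ-< (ε * ½) (half>0 ε>0))
    impossible : ∀ N → N ℕ.< 2 → ∀ X → fromℕ 2 ≤ X + ε * ½ → X + ε ≤ fromℕ (suc N) → ⊥
    impossible N N<2 X h₁ h₂ = <-irrefl refl (<-≤-trans (+-monoʳ-< X ε/2<ε) (≤-trans h₂ (≤-trans (fromℕ-mono N<2) h₁)))

  ℚ⇒ℂ*-cong : ∀ {p q} z → p ≡ q → ℚ⇒ℂ p *ᶜ z ≃ᶜ ℚ⇒ℂ q *ᶜ z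
  ℚ⇒ℂ*-cong {p} z refl = ≃ᶜ-refl {ℚ⇒ℂ p *ᶜ z}

  *ℚ⇒ℂ-cong : ∀ {p q} z → p ≡ q → z *ᶜ ℚ⇒ℂ p ≃ᶜ z *ᶜ ℚ⇒ℂ q
  *ℚ⇒ℂ-cong {p} z refl = ≃ᶜ-refl {z *ᶜ ℚ⇒ℂ p}

  ℚ⇒ℂ^-cong : ∀ {p q} n z → p ≡ q → ℚ⇒ℂ p ^ᶜ n *ᶜ z ≃ᶜ ℚ⇒ℂ q ^ᶜ n *ᶜ z
  ℚ⇒ℂ^-cong {p} n z refl = ≃ᶜ-refl {ℚ⇒ℂ p ^ᶜ n *ᶜ z}

  localTerm≃ : ∀ f p pr α → localTerm f p pr α ≃ᶜ f (p ℕ.^ α) A.* A.ι (recip (p ℕ.^ α))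
  localTerm≃ f p pr α = *ℚ⇒ℂ-cong (f (p ℕ.^ α)) (recip-/ (p ℕ.^ α) {{ℕₚ.m^n≢0 p α {{prime⇒nonZero pr}}}})

  localSums≃ : ∀ f p pr n → ∑ᶜ (localTerm f p pr) n A.≈ EP.dirichlet (λ α → f (p ℕ.^ α)) p n
  localSums≃ f p pr = EP.dirichlet-unique {∑ᶜ (localTerm f p pr)} {λ α → f (p ℕ.^ α)} {p} (≃ᶜ-refl {0ℂ})
    (λ n → +ᶜ-congˡ (∑ᶜ (localTerm f p pr) n) (localTerm f p pr n) (f (p ℕ.^ n) A.* A.ι (recip (p ℕ.^ n))) (localTerm≃ f p pr n))

  module _ (j : ℕ) (f : ℕ → ℂ) (localSum : ∀ p → Prime p → ℂ) where

    eulerFactor≃ : ∀ p pr → eulerFactor f (suc j) localSum p pr A.≈ EP.eulerFactor (suc j) localSum p pr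
    eulerFactor≃ p pr = EP.eulerFactor-unique (suc j) localSum p pr {ℚ⇒ℂ (1ℚ - recip p) ^ᶜ suc j} {eulerFactor f (suc j) localSum p pr}
      (^ᶜ≈^ (ℚ⇒ℂ (1ℚ - recip p)) (suc j))
      (ℚ⇒ℂ^-cong (suc j) (localSum p pr) (cong (λ t → 1ℚ - t) (recip-/ p {{prime⇒nonZero pr}})))

    module _ (sums : ∀ p pr → EP.dirichlet (λ α → f (p ℕ.^ α)) p A.⟶ localSum p pr)
      (product : ℂ) (product-converges : EP.primeProducts (EP.eulerFactor (suc j) localSum) A.⟶ product) where

      C : ℂ
      C = ℚ⇒ℂ (recip (j !)) *ᶜ product

      localSum-hasSum : ∀ p pr → HasSumᶜ (localTerm f p pr) (localSum p pr)
      localSum-hasSum p pr = ⟶⇒⟶ᶜ {∑ᶜ (localTerm f p pr)} {localSum p pr}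
        (EP.⟶-replace {∑ᶜ (localTerm f p pr)} {EP.dirichlet (λ α → f (p ℕ.^ α)) p} {localSum p pr} (localSums≃ f p pr) (sums p pr))

      product-hasLimit : primeProduct (eulerFactor f (suc j) localSum) ⟶ᶜ product
      product-hasLimit = ⟶⇒⟶ᶜ {primeProduct (eulerFactor f (suc j) localSum)} {product}
        (EP.⟶-replace {primeProduct (eulerFactor f (suc j) localSum)} {EP.primeProducts (EP.eulerFactor (suc j) localSum)} {product}
          (primeProduct≈ {eulerFactor f (suc j) localSum} {EP.eulerFactor (suc j) localSum} eulerFactor≃) product-converges)

      C≃ : C ≃ᶜ ℚ⇒ℂ ((+ 1 / j !) {{j !≢0}}) *ᶜ product
      C≃ = ℚ⇒ℂ*-cong product (sym (recip-/ (j !) {{j !≢0}}))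

      isLeadingConstant : IsLeadingConstant f (suc j) C
      isLeadingConstant = localSum , localSum-hasSum , product , product-hasLimit , C≃

      module _ (A₀ : ℚ) (0≤A₀ : 0ℚ ≤ A₀)
        (mean-value : ∀ N → (AL.sum (λ i → f (suc i)) N A.- C A.* ℚ⇒ℂ (G j N)) ⊑ A₀ * W j N) where

        summatory-asymptotic : ∀ N → Eventually λ k → norm (summatory f N -ᶜ C *ᶜ ℚ⇒ℂ (G j N)) k ≤ A₀ * W j N + 1ℚ
        summatory-asymptotic N = norm-asymptotic (summatory f N) C (G j N) (A₀ * W j N)
          (EP.⊑-replace {summatory f N} {AL.sum (λ i → f (suc i)) N} {C A.* ℚ⇒ℂ (G j N)} {A₀ * W j N}
            (∑ᶜ≈sum {λ i → f (suc i)} {λ i → f (suc i)} (λ i → ≃ᶜ-refl {f (suc i)}) N) (mean-value N))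

        module _ (B : ℚ) (0≤B : 0ℚ ≤ B) (C≤B : Eventually λ k → norm C k ≤ B) where

          private
            A₁ = ℚ⇒ℝ (errorConstant j A₀ B 0≤A₀ 0≤B)

          error-term : ∀ x ℓ (ℓ>0 : 0ℝ D.< ℓ) → (Eventually λ k → recip 8 ≤ seq ℓ k) →
            (∀ N → (Eventually λ k → fromℕ (suc N) - ½ ≤ seq x k) → Eventually λ k → H (suc N) - fromℕ 2 ≤ seq ℓ k) →
            (∀ N → (Eventually λ k → seq x k ≤ fromℕ (suc N)) → Eventually λ k → seq ℓ k ≤ H N + 1ℚ) →
            ∀ N → 2 ℕ.≤ N → IsFloor N x →
            ∣ summatory f N -ᶜ C *ᶜ ℝ⇒ℂ (x D.* ℓ D.^ j) ∣ᶜ D.≤ A₁ D.* (x D.* zpow ℓ ℓ>0 (+ suc j -ᶻ + 2))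
          error-term x ℓ ℓ>0 ⅛≤ℓ ℓ-lower ℓ-upper (suc zero) (s≤s ()) _
          error-term x ℓ ℓ>0 ⅛≤ℓ ℓ-lower ℓ-upper (suc (suc n)) _ (N≤x , ε , ε>0 , x<N+1) = asymptotic-bound j A₀ B 0≤A₀ 0≤B (summatory f (2 ℕ.+ n)) C n
            (summatory-asymptotic (2 ℕ.+ n)) C≤B x ℓ ℓ>0 lower upper (ℓ-lower (suc n) lower) (ℓ-upper (2 ℕ.+ n) upper) ⅛≤ℓ
            where
            lower : Eventually λ k → fromℕ (2 ℕ.+ n) - ½ ≤ seq x k
            lower = eventually (λ k h → ≤-trans (+-monoˡ-≤ (- ½) h) (≤-reflexive (solve 1 (λ a → a :+ con ½ :- con ½ := a) refl (seq x k)))) (N≤x ½ (positive⁻¹ ½))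
            upper : Eventually λ k → seq x k ≤ fromℕ (3 ℕ.+ n)
            upper = eventually (λ k h → ≤-trans (p≤p+q (<⇒≤ ε>0)) h) x<N+1

          error-terms : ∀ x → ℕ⇒ℝ 2 D.≤ x → ∃ λ ℓ → IsLog x ℓ × Σ (0ℝ D.< ℓ) λ ℓ>0 → ∀ N → IsFloor N x →
            ∣ summatory f N -ᶜ C *ᶜ ℝ⇒ℂ (x D.* ℓ D.^ j) ∣ᶜ D.≤ A₁ D.* (x D.* zpow ℓ ℓ>0 (+ suc j -ᶻ + 2))
          error-terms x 2≤x =
            let ℓ , log-ℓ , ℓ>0 , ⅛≤ℓ , ℓ-lower , ℓ-upper = log-exists x 2≤x
            in ℓ , log-ℓ , ℓ>0 , λ N floor → error-term x ℓ ℓ>0 ⅛≤ℓ ℓ-lower ℓ-upper N (floor≥2 N x 2≤x floor) floor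

  mean-value-theorem : ∀ j f → Multiplicative f → (∀ p → Prime p → f p ≃ᶜ ℕ⇒ℂ (suc j)) → Growth f →
    ∃ λ C → IsLeadingConstant f (suc j) C × (∃ λ A → ∀ x → ℕ⇒ℝ 2 D.≤ x → ∃ λ ℓ → IsLog x ℓ × Σ (0ℝ D.< ℓ) λ ℓ>0 → ∀ N → IsFloor N x →
      ∣ summatory f N -ᶜ C *ᶜ ℝ⇒ℂ (x D.* ℓ D.^ j) ∣ᶜ D.≤ A D.* (x D.* zpow ℓ ℓ>0 (+ suc j -ᶻ + 2)))
  mean-value-theorem j f mult f-prime growth = go (prime-power-bound {f} {j} mult f-prime growth)
    where
    open Multiplicative mult
    f-* : ∀ p α n → Prime p → ¬ (p ∣ suc n) → f (p ℕ.^ α ℕ.* suc n) ≃ᶜ f (p ℕ.^ α) *ᶜ f (suc n)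
    f-* p α n pr p∤n = at-* (p ℕ.^ α) (suc n) {{ℕₚ.m^n≢0 p α {{prime⇒nonZero pr}}}} (prime-power-coprime pr α n p∤n)
    Goal : Set
    Goal = ∃ λ C → IsLeadingConstant f (suc j) C × (∃ λ A → ∀ x → ℕ⇒ℝ 2 D.≤ x → ∃ λ ℓ → IsLog x ℓ × Σ (0ℝ D.< ℓ) λ ℓ>0 → ∀ N → IsFloor N x →
      ∣ summatory f N -ᶜ C *ᶜ ℝ⇒ℂ (x D.* ℓ D.^ j) ∣ᶜ D.≤ A D.* (x D.* zpow ℓ ℓ>0 (+ suc j -ᶻ + 2)))
    assemble : ∀ localSum → (∀ p pr → EP.dirichlet (λ α → f (p ℕ.^ α)) p A.⟶ localSum p pr) →
      ∀ product → EP.primeProducts (EP.eulerFactor (suc j) localSum) A.⟶ product →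
      (∃ λ A₀ → 0ℚ ≤ A₀ × ∀ N → (AL.sum (λ i → f (suc i)) N A.- ℚ⇒ℂ (recip (j !)) A.* product A.* ℚ⇒ℂ (G j N)) ⊑ A₀ * W j N) →
      (∃ λ b → (ℚ⇒ℂ (recip (j !)) *ᶜ product) ⊑ b) → Goal
    assemble localSum sums product product-converges (A₀ , 0≤A₀ , mean-value) (b , C⊑b) =
      C j f localSum sums product product-converges ,
      isLeadingConstant j f localSum sums product product-converges ,
      -- A norm bound b holds for the approximations only up to some positive ε; here ε = 1.
      ℚ⇒ℝ (errorConstant j A₀ (b + 1ℚ) 0≤A₀ (0≤+ (⊑⇒0≤ {ℚ⇒ℂ (recip (j !)) *ᶜ product} {b} C⊑b) 0≤1)) ,
      error-terms j f localSum sums product product-converges A₀ 0≤A₀ mean-value (b + 1ℚ)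
        (0≤+ (⊑⇒0≤ {ℚ⇒ℂ (recip (j !)) *ᶜ product} {b} C⊑b) 0≤1) (C⊑b 1ℚ 0<1)
    go : (∃ λ C₁ → ∀ p α → Prime p → f (p ℕ.^ α) ⊑ C₁ * ρ ^ α) → Goal
    go (C₁ , f-bound) = assemble
      (MV.localSum j f at-1 f-* f-prime C₁ f-bound) (MV.localSum-converges j f at-1 f-* f-prime C₁ f-bound)
      (proj₁ (MV.product-converges j f at-1 f-* f-prime C₁ f-bound)) (proj₂ (MV.product-converges j f at-1 f-* f-prime C₁ f-bound))
      (MV.mean-value j f at-1 f-* f-prime C₁ f-bound) (⊑-bounded (ℚ⇒ℂ (recip (j !)) *ᶜ proj₁ (MV.product-converges j f at-1 f-* f-prime C₁ f-bound)))

open import Defs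
open import Data.Nat using (ℕ; NonZero; _∸_)
import Data.Nat as ℕ
open import Data.Nat.Primality using (Prime)
open import Data.Integer using (+_) renaming (_-_ to _-ᶻ_)
open import Data.Product using (Σ; ∃; _×_)
open MeanValueTheorem

theorem1 :
    (k : ℕ) → .{{_ : NonZero k}} → (f : ℕ → ℂ) →
    Multiplicative f →
    (∀ p → Prime p → f p ≃ᶜ ℕ⇒ℂ k) →
    (∃ λ K → 0ℝ < K ×
      (∀ p α → Prime p → 2 ℕ.≤ α →
        ∃ λ v → IsPower (ℕ⇒ℝ α) K v × ∣ f (p ℕ.^ α) ∣ᶜ ≤ v)) →
    ∃ λ C → IsLeadingConstant f k C ×
      (∃ λ A → ∀ x → ℕ⇒ℝ 2 ≤ x →
        ∃ λ ℓ → IsLog x ℓ × Σ (0ℝ < ℓ) λ ℓ>0 →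
          ∀ N → IsFloor N x →
            ∣ summatory f N -ᶜ C *ᶜ ℝ⇒ℂ (x * ℓ ^ (k ∸ 1)) ∣ᶜ
              ≤ A * (x * zpow ℓ ℓ>0 (+ k -ᶻ + 2)))
theorem1 ℕ.zero {{k≢0}} f mult f-prime growth = ⊥-elim (NonZero.nonZero k≢0)
  where open import Data.Empty.Irrelevant using (⊥-elim)
theorem1 (ℕ.suc j) f mult f-prime growth = mean-value-theorem j f mult f-prime growth
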